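{- Let $P$ be a $d$-dimensional lattice polytope in a lattice $N$ with Ehrhart $\delta$-vector $(\delta_0,\ldots,\delta_d)$. If the boundary $\partial P$ admits a regular unimodular lattice triangulation, then for $i = 0, \ldots, \lfloor d/2 \rfloor - 1$, \[ \delta_{i + 1} \geq \delta_{d - i} \] and \[ \delta_{0} + \cdots + \delta_{i + 1} \leq \delta_{d} + \cdots + \delta_{d - i} + \binom{\delta_{1} - \delta_{d} + i + 1}{i + 1}. \]
   Context: For a lattice polytope $P$ of dimension $d$ in a lattice $N$, let $f_P(m)$ be the number of lattice points of $mP$; one writes $\sum_{m\ge 0} f_P(m)t^m = (\delta_0 + \delta_1 t + \cdots + \delta_d t^d)/(1-t)^{d+1}$, and $(\delta_0,\ldots,\delta_d)$ is the Ehrhart $\delta$-vector of $P$. A lattice triangulation $\mathcal{T}$ of $\partial P$ is a triangulation of $\partial P$ into simplices whose vertices are lattice points. It is regular if, after translating $P$ by an element of $N \otimes \mathbb{Q}$ so that the origin lies in its interior, the complete simplicial fan $\Sigma$ formed by the cones over the faces of $\mathcal{T}$ is the fan over the faces of some rational polytope (equivalently, the toric variety of $\Sigma$ is projective). It is unimodular if for every non-empty face $F$ of $\mathcal{T}$, the cone over $F \times \{1\}$ in $(N \times \mathbb{Z})\otimes\mathbb{R}$ is non-singular, i.e. generated by part of a basis of the lattice $N\times\mathbb{Z}$. -}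

module Defs where

open import Data.Nat as ℕ using (ℕ; zero; suc)
open import Data.Nat.Combinatorics using (_C_)
open import Data.Integer as ℤ using (ℤ; +_; -[1+_])
open import Data.Rational as ℚ using (ℚ; 0ℚ; 1ℚ)
open import Data.Vec as V using (Vec; []; _∷_)
open import Data.List as L using (List; []; _∷_; length; upTo)
open import Data.List.Membership.Propositional using (_∈_)
open import Data.List.Relation.Unary.All using (All)
open import Data.List.Relation.Unary.Unique.Propositional using (Unique)
open import Data.List.Relation.Binary.Sublist.Propositional using (_⊆_)
open import Data.Product using (Σ; ∃; ∃-syntax; _×_; _,_)
open import Relation.Binary.PropositionalEquality using (_≡_)
open import Relation.Nullary using (¬_)
open import Function.Bundles using (_⇔_)

-- Points.  The lattice N is ℤ^d; N ⊗ ℚ is ℚ^d.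

Pt : ℕ → Set
Pt d = Vec ℤ d

QPt : ℕ → Set
QPt d = Vec ℚ d

toQ : {d : ℕ} → Pt d → QPt d
toQ = V.map (λ z → z ℚ./ 1)

0Q : {d : ℕ} → QPt d
0Q {d} = V.replicate d 0ℚ

_+ᵥ_ : {d : ℕ} → QPt d → QPt d → QPt d
_+ᵥ_ = V.zipWith ℚ._+_

_-ᵥ_ : {d : ℕ} → QPt d → QPt d → QPt d
_-ᵥ_ = V.zipWith ℚ._-_

_·ᵥ_ : {d : ℕ} → ℚ → QPt d → QPt d
t ·ᵥ x = V.map (t ℚ.*_) x

dot : {d : ℕ} → QPt d → QPt d → ℚ
dot a x = V.foldr _ ℚ._+_ 0ℚ (V.zipWith ℚ._*_ a x)

scaleℤ : {d : ℕ} → ℕ → Pt d → Pt d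
scaleℤ m = V.map ((+ m) ℤ.*_)

lincomb : {d : ℕ} → List ℚ → List (QPt d) → QPt d
lincomb (c ∷ cs) (v ∷ vs) = (c ·ᵥ v) +ᵥ lincomb cs vs
lincomb _ _ = 0Q

sumQ : List ℚ → ℚ
sumQ = L.foldr ℚ._+_ 0ℚ

InConv : {d : ℕ} → List (QPt d) → QPt d → Set
InConv S x = ∃[ cs ] ∃[ vs ]
  (length cs ≡ length vs) × All (_∈ S) vs × All (0ℚ ℚ.≤_) cs
  × (sumQ cs ≡ 1ℚ) × (lincomb cs vs ≡ x)

AffInd : {d : ℕ} → List (QPt d) → Set
AffInd S = (cs : List ℚ) → length cs ≡ length S →
  sumQ cs ≡ 0ℚ → lincomb cs S ≡ 0Q → All (_≡ 0ℚ) cs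

-- lattice polytope P = conv(V), V a finite list of lattice points
LPoly : ℕ → Set
LPoly d = List (Pt d)

QV : {d : ℕ} → LPoly d → List (QPt d)
QV P = L.map toQ P

_∈P_ : {d : ℕ} → QPt d → LPoly d → Set
x ∈P P = InConv (QV P) x

FullDim : {d : ℕ} → LPoly d → Set
FullDim {d} P = ∃[ S ] (S ⊆ P) × (length S ≡ suc d) × AffInd (L.map toQ S)

_∈∂_ : {d : ℕ} → QPt d → LPoly d → Set
x ∈∂ P = (x ∈P P) × ∃[ a ] (¬ (a ≡ 0Q)) × All (λ v → dot a v ℚ.≤ dot a x) (QV P)

-- Lattice triangulations of ∂P.
-- A triangulation is given by a list of simplices (vertex lists of
-- lattice points); its faces are the non-empty sublists of these.

Simplex : ℕ → Set
Simplex d = List (Pt d)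

IsFace : {d : ℕ} → List (Simplex d) → Simplex d → Set
IsFace T F = ¬ (F ≡ []) × ∃[ σ ] (σ ∈ T) × (F ⊆ σ)

LatticeTriangulationOfBoundary : {d : ℕ} → LPoly d → List (Simplex d) → Set
LatticeTriangulationOfBoundary P T =
  All (λ σ → AffInd (L.map toQ σ)) T
  × All (λ σ → ∀ x → InConv (L.map toQ σ) x → x ∈∂ P) T
  × (∀ x → x ∈∂ P → ∃[ σ ] (σ ∈ T) × InConv (L.map toQ σ) x)
  × (∀ σ τ → σ ∈ T → τ ∈ T → ∀ x →
       InConv (L.map toQ σ) x → InConv (L.map toQ τ) x →
       ∃[ F ] (F ⊆ σ) × All (_∈ τ) F × InConv (L.map toQ F) x)

lincombℤ : {n : ℕ} → List ℤ → List (Vec ℤ n) → Vec ℤ n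
lincombℤ {n} (c ∷ cs) (v ∷ vs) = V.zipWith ℤ._+_ (V.map (c ℤ.*_) v) (lincombℤ cs vs)
lincombℤ {n} _ _ = V.replicate n (+ 0)

IsBasis : {n : ℕ} → List (Vec ℤ n) → Set
IsBasis {n} bs =
  (∀ z → ∃[ cs ] (length cs ≡ length bs) × (lincombℤ cs bs ≡ z))
  × (∀ cs → length cs ≡ length bs → lincombℤ cs bs ≡ V.replicate n (+ 0)
       → All (_≡ + 0) cs)

PartOfBasis : {n : ℕ} → List (Vec ℤ n) → Set
PartOfBasis vs = ∃[ ws ] IsBasis (vs L.++ ws)

lift1 : {d : ℕ} → Pt d → Vec ℤ (suc d)
lift1 v = v V.∷ʳ (+ 1)

-- for every non-empty face F, the cone over F × {1} is non-singular
Unimodular : {d : ℕ} → List (Simplex d) → Set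
Unimodular T = ∀ F → IsFace T F → PartOfBasis (L.map lift1 F)

InConeT : {d : ℕ} → QPt d → Simplex d → QPt d → Set
InConeT q F y = ∃[ μ ] (length μ ≡ length F) × All (0ℚ ℚ.≤_) μ
  × (lincomb μ (L.map (λ v → toQ v -ᵥ q) F) ≡ y)

-- (a , b) cuts out a non-empty proper face G = Q ∩ {a·x = b} of the
-- rational polytope Q = conv(Qv)
FaceOfQ : {d : ℕ} → List (QPt d) → QPt d → ℚ → Set
FaceOfQ Qv a b = ¬ (a ≡ 0Q) × All (λ v → dot a v ℚ.≤ b) Qv
  × ∃[ x ] InConv Qv x × (dot a x ≡ b)

InConeQ : {d : ℕ} → List (QPt d) → QPt d → ℚ → QPt d → Set
InConeQ Qv a b y = ∃[ t ] ∃[ x ] (0ℚ ℚ.≤ t) × InConv Qv x × (dot a x ≡ b)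
  × (t ·ᵥ x ≡ y)

Regular : {d : ℕ} → LPoly d → List (Simplex d) → Set
Regular P T = ∃[ q ] (q ∈P P) × ¬ (q ∈∂ P) × ∃[ Qv ]
  ((∀ F → IsFace T F → ∃[ a ] ∃[ b ] FaceOfQ Qv a b
       × (∀ y → InConeT q F y ⇔ InConeQ Qv a b y))
  × (∀ a b → FaceOfQ Qv a b → ∃[ F ] IsFace T F
       × (∀ y → InConeT q F y ⇔ InConeQ Qv a b y)))

sumTo : ℕ → (ℕ → ℤ) → ℤ
sumTo n f = L.foldr ℤ._+_ (+ 0) (L.map f (upTo (suc n)))

-- Σ f(m) t^m = (δ_0 + … + δ_d t^d)/(1-t)^{d+1}, coefficientwise:
-- f(m) = Σ_{i=0}^{d} δ_i · C(m - i + d, d)   (the term is 0 when i > m).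
-- f(m) = #(mP ∩ N) is given relationally: any duplicate-free list
-- enumerating exactly the lattice points of mP has that length.
IsDeltaVector : {d : ℕ} → LPoly d → (ℕ → ℤ) → Set
IsDeltaVector {d} P δ = ∀ (m : ℕ) (Lp : List (Pt d)) → Unique Lp →
  (∀ x → (x ∈ Lp) ⇔ InConv (L.map (λ v → toQ (scaleℤ m v)) P) (toQ x)) →
  + (length Lp) ≡ sumTo d (λ i → δ i ℤ.* + ((m ℕ.+ d ℕ.∸ i) C d))

binomℤ : ℤ → ℕ → ℤ
binomℤ (+ n) k = + (n C k)
binomℤ -[1+ n ] k = ((ℤ.- (+ 1)) ℤ.^ k) ℤ.* + ((n ℕ.+ k) C k)

{-# OPTIONS --safe #-}
-- Seen from an interior point q, the boundary triangulation spans a complete unimodular fan.  A generic direction c makes its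
-- maximal cones half-open, so that they partition the space; counting lattice points in them for c and for -c gives Ehrhart
-- reciprocity in the form δ_{i+1} - δ_{d-i} = h_{i+1} - h_i, where h is the h-vector of the triangulation.  By regularity there
-- is a strictly convex support function, so sweeping along c shells the triangulation in both directions.  The inequalities for h
-- hold in the Stanley–Reisner ring modulo generic parameters in characteristic 2: there the degree map E satisfies differential
-- identities that make it anisotropic, so a generic linear form is injective below the middle degree.
module Submission where

open import Defs
open import Level using (0ℓ)
open import Algebra.Bundles using (CommutativeRing)
import Algebra.Solver.Ring.NaturalCoefficients.Default as SemiringSolver
import Algebra.Properties.CommutativeSemigroup as CSG
import Algebra.Properties.Ring as RingProps
open import Data.Nat as ℕ using (ℕ; zero; suc; _∸_; _/_)
import Data.Nat.Properties as ℕP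
open ℕP using (suc-injective)
import Data.Nat.Solver
open import Data.Nat.Combinatorics using (_C_; k>n⇒nCk≡0; nCn≡1; nCk+nC[k+1]≡[n+1]C[k+1])
open import Data.Integer as ℤ using (ℤ; +_; -[1+_])
import Data.Integer.Properties as ℤP
open import Data.Rational as ℚ using (ℚ; 0ℚ; 1ℚ)
import Data.Rational.Properties as ℚP
open import Data.Bool using (Bool; true; false)
import Data.Bool.Properties as BoolP
open import Data.Empty using (⊥; ⊥-elim)
open import Data.Fin as F using (Fin)
import Data.Fin.Properties as FP
open import Data.Vec as V using (Vec)
import Data.Vec.Properties as VP
open VP using (lookup∘tabulate; lookup-map; lookup-zipWith; lookup-replicate)
open import Data.Product using (Σ; ∃-syntax; _×_; _,_; proj₁; proj₂)
open import Data.Sum as Sum using (_⊎_; inj₁; inj₂)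
open import Data.List as L using (List; []; _∷_; _++_; length; map; filter; upTo; allFin)
import Data.List.Properties as LP
open LP using (length-map; length-++)
open import Data.List.Membership.Propositional as L∈ using (_∈_; _∉_)
import Data.List.Membership.DecPropositional as DecMembership
open import Data.List.Membership.Propositional.Properties using (∈-map⁺; ∈-map⁻; ∈-++⁺ˡ; ∈-++⁺ʳ; ∈-++⁻; ∈-filter⁺; ∈-filter⁻; ∈-lookup; ∈-concat⁺′; ∈-concat⁻′; ∈-upTo⁺; ∈-upTo⁻; ∈-allFin)
open import Data.List.Relation.Unary.Any as Any using (here; there)
import Data.List.Relation.Unary.Any.Properties as AnyP
open import Data.List.Relation.Unary.All as All using (All; []; _∷_)
import Data.List.Relation.Unary.All.Properties as AllP
open import Data.List.Relation.Unary.AllPairs using ([]; _∷_)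
open import Data.List.Relation.Unary.Unique.Propositional using (Unique)
import Data.List.Relation.Unary.Unique.Propositional.Properties as UP
open import Data.List.Relation.Binary.Sublist.Propositional as SL using (_⊆_; []; _∷_; _∷ʳ_)
open import Data.List.Relation.Binary.Permutation.Propositional as Perm using (_↭_; ↭-sym; ↭-reflexive; ↭-trans; ↭-refl; prep; swap)
import Data.List.Relation.Binary.Permutation.Propositional.Properties as PermP
open PermP using (∈-resp-↭; ↭-length)
open import Algebra.Structures using (IsCommutativeRing)
open import Data.Maybe using (Maybe; just; nothing)
import Data.Maybe.Properties as MaybeP
open import Data.Nat.ListAction using () renaming (sum to sumℕ)
open import Data.List.Relation.Binary.Pointwise using (Pointwise; []; _∷_; Pointwise-length)
import Data.Integer.DivMod as ℤDM
open import Data.Integer.Tactic.RingSolver using (solve-∀)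
import Data.Rational.Unnormalised as ℚᵘ
import Data.Rational.Unnormalised.Properties as ℚᵘP
import Data.Nat.DivMod as ℕDM
open import Function.Bundles using (_⇔_; Equivalence; mk⇔)
open import Function.Base using (_∘_; id; case_of_)
open import Relation.Binary.Definitions as Tri using (DecidableEquality)
import Relation.Binary.PropositionalEquality as PE
open PE using (_≡_; _≢_)
import Relation.Binary.Reasoning.Setoid as SetoidReasoning
open import Relation.Nullary using (¬_; Dec; yes; no; contradiction)
open import Relation.Nullary.Decidable as Dec using (¬?)

-- The point q is rational but in general not a lattice point, so a lifted facet and the lifted apex
-- need not span a unimodular cone. Its lattice points are therefore cut into levels by the
-- coordinate transversal to the facet. In each level they form a translate of the monoid of
-- d-tuples of natural numbers, which contributes t^e / (1 - t)^d. The lowest heights e are periodic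
-- under translation by the apex and are reversed when level and direction change sign; reciprocity
-- is a statement about these numbers. No quotient ring is formed. A class is given by its values at
-- the facets, and to vanish means to pair to zero under a functional E, a localisation formula
-- along an auxiliary vertex z. Denominators are cleared once, so the scalars stay in a polynomial
-- ring over the field with two elements. Characteristic 2 enters because derivations treat squares
-- as constants: if a generic linear form kills u, derivatives in its coefficients lead to E (u² x)
-- = 0, and derivatives in the parameters then produce the square of E (u x′).

module ≡ where
  open PE public hiding (sym; trans; cong; cong₂; subst; subst₂)

  sym : {A : Set} {x y : A} → x ≡ y → y ≡ x
  sym = PE.sym

  trans : {A : Set} {x y z : A} → x ≡ y → y ≡ z → x ≡ z
  trans = PE.trans

  cong : {A B : Set} (f : A → B) {x y : A} → x ≡ y → f x ≡ f y
  cong = PE.cong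

  cong₂ : {A B D : Set} (f : A → B → D) {x y : A} {u v : B} → x ≡ y → u ≡ v → f x u ≡ f y v
  cong₂ = PE.cong₂

  subst : {A : Set} (P : A → Set) {x y : A} → x ≡ y → P x → P y
  subst = PE.subst

  subst₂ : {A B : Set} (P : A → B → Set) {x y : A} {u v : B} → x ≡ y → u ≡ v → P x u → P y v
  subst₂ = PE.subst₂

module ℕS = Data.Nat.Solver.+-*-Solver

-- Picking an entry from a list, and sums in commutative rings

picks : {A : Set} → List A → List (A × List A)
picks [] = []
picks (x ∷ xs) = (x , xs) ∷ map (λ p → proj₁ p , x ∷ proj₂ p) (picks xs)

picks-↭ : {A : Set} {s : A} {r xs : List A} → (s , r) ∈ picks xs → s ∷ r ↭ xs
picks-↭ {xs = x ∷ xs} (here ≡.refl) = ↭-refl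
picks-↭ {xs = x ∷ xs} (there m) with ∈-map⁻ _ m
... | (s , r) , m′ , ≡.refl = ↭-trans (swap s x ↭-refl) (prep x (picks-↭ m′))

∈⇒picks : {A : Set} {s : A} {xs : List A} → s ∈ xs → ∃[ r ] (s , r) ∈ picks xs
∈⇒picks (here ≡.refl) = _ , here ≡.refl
∈⇒picks (there m) with ∈⇒picks m
... | r , m′ = _ , there (∈-map⁺ _ m′)

∈⇒↭ : {A : Set} {s : A} {xs : List A} → s ∈ xs → ∃[ r ] s ∷ r ↭ xs
∈⇒↭ m = _ , picks-↭ (proj₂ (∈⇒picks m))

unique-resp-↭ : {A : Set} {xs ys : List A} → xs ↭ ys → Unique xs → Unique ys
unique-resp-↭ Perm.refl u = u
unique-resp-↭ (prep x p) (x∉ ∷ u) = PermP.All-resp-↭ p x∉ ∷ unique-resp-↭ p u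
unique-resp-↭ (swap x y p) ((x≢y ∷ x∉) ∷ y∉ ∷ u) =
  ((λ e → x≢y (≡.sym e)) ∷ PermP.All-resp-↭ p y∉) ∷ PermP.All-resp-↭ p x∉ ∷ unique-resp-↭ p u
unique-resp-↭ (Perm.trans p q) u = unique-resp-↭ q (unique-resp-↭ p u)

unique-head : {A : Set} {x : A} {xs : List A} → Unique (x ∷ xs) → x ∉ xs
unique-head (x∉ ∷ _) m = All.lookup x∉ m ≡.refl

module RingIdentities (R : CommutativeRing 0ℓ 0ℓ) where
  open CommutativeRing R
  open SemiringSolver commutativeSemiring using (solve; _:+_; _:*_; _:=_)

  collect-leibniz : ∀ f g p h q r → f * g + p + (f * h + (q + r)) ≈ (p + q) + (f * (g + h) + r)
  collect-leibniz = solve 6 (λ f g p h q r → f :* g :+ p :+ (f :* h :+ (q :+ r)) := (p :+ q) :+ (f :* (g :+ h) :+ r)) refl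

  square-+ : ∀ x y → (x + y) * (x + y) ≈ x * x + y * y + (x * y + x * y)
  square-+ = solve 2 (λ x y → (x :+ y) :* (x :+ y) := x :* x :+ y :* y :+ (x :* y :+ x :* y)) refl

  leibniz : ∀ t p y x q → t * (p * y + x * q) ≈ t * p * y + x * (t * q)
  leibniz = solve 5 (λ t p y x q → t :* (p :* y :+ x :* q) := t :* p :* y :+ x :* (t :* q)) refl

  x[yz]w≈xz[yw] : ∀ x y z w → x * (y * z) * w ≈ x * z * (y * w)
  x[yz]w≈xz[yw] = solve 4 (λ x y z w → x :* (y :* z) :* w := x :* z :* (y :* w)) refl

  a+px+p[x+y]≈a+py+2px : ∀ a p x y → a + p * x + p * (x + y) ≈ a + p * y + (p * x + p * x)
  a+px+p[x+y]≈a+py+2px = solve 4 (λ a p x y → a :+ p :* x :+ p :* (x :+ y) := a :+ p :* y :+ (p :* x :+ p :* x)) refl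

  xy[xz]≈xx[yz] : ∀ x y z → x * y * (x * z) ≈ x * x * (y * z)
  xy[xz]≈xx[yz] = solve 3 (λ x y z → x :* y :* (x :* z) := x :* x :* (y :* z)) refl

  xx[yyz]≈xy[xy]z : ∀ x y z → x * x * (y * y * z) ≈ x * y * (x * y) * z
  xx[yyz]≈xy[xy]z = solve 3 (λ x y z → x :* x :* (y :* y :* z) := x :* y :* (x :* y) :* z) refl

  st[a+b]≈t[sa]+s[tb] : ∀ s t a b → s * t * (a + b) ≈ t * (s * a) + s * (t * b)
  st[a+b]≈t[sa]+s[tb] = solve 4 (λ s t a b → s :* t :* (a :+ b) := t :* (s :* a) :+ s :* (t :* b)) refl

  t[ae]+s[be]≈[ta+sb]e : ∀ t a e s b → t * (a * e) + s * (b * e) ≈ (t * a + s * b) * e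
  t[ae]+s[be]≈[ta+sb]e = solve 5 (λ t a e s b → t :* (a :* e) :+ s :* (b :* e) := (t :* a :+ s :* b) :* e) refl

  xyzz≈zz[xy] : ∀ x y z → x * y * z * z ≈ z * z * (x * y)
  xyzz≈zz[xy] = solve 3 (λ x y z → x :* y :* z :* z := z :* z :* (x :* y)) refl

  xx[yyz]≈z[yx[yx]] : ∀ x y z → x * x * (y * y * z) ≈ z * (y * x * (y * x))
  xx[yyz]≈z[yx[yx]] = solve 3 (λ x y z → x :* x :* (y :* y :* z) := z :* (y :* x :* (y :* x))) refl

  x[y[zw]]≈y[xzw] : ∀ x y z w → x * (y * (z * w)) ≈ y * (x * z * w)
  x[y[zw]]≈y[xzw] = solve 4 (λ x y z w → x :* (y :* (z :* w)) := y :* (x :* z :* w)) refl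

  xy[zw]≈xz[yw] : ∀ x y z w → x * y * (z * w) ≈ x * z * (y * w)
  xy[zw]≈xz[yw] = solve 4 (λ x y z w → x :* y :* (z :* w) := x :* z :* (y :* w)) refl

  x[y[zw][y[zw]]]≈yz[yz][x[ww]] : ∀ x y z w → x * (y * (z * w) * (y * (z * w))) ≈ y * z * (y * z) * (x * (w * w))
  x[y[zw][y[zw]]]≈yz[yz][x[ww]] = solve 4 (λ x y z w → x :* (y :* (z :* w) :* (y :* (z :* w))) := y :* z :* (y :* z) :* (x :* (w :* w))) refl

  xy[xy][zw]≈zx[x[yyw]] : ∀ x y z w → x * y * (x * y) * (z * w) ≈ z * x * (x * (y * y * w))
  xy[xy][zw]≈zx[x[yyw]] = solve 4 (λ x y z w → x :* y :* (x :* y) :* (z :* w) := z :* x :* (x :* (y :* y :* w))) refl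

  xx[yz]≈yx[xz] : ∀ x y z → x * x * (y * z) ≈ y * x * (x * z)
  xx[yz]≈yx[xz] = solve 3 (λ x y z → x :* x :* (y :* z) := y :* x :* (x :* z)) refl

module RingSums (R : CommutativeRing 0ℓ 0ℓ) where
  open CommutativeRing R
  open SetoidReasoning setoid
  open CSG +-commutativeSemigroup using (interchange; x∙yz≈y∙xz) public

  x*yz≈y*xz : ∀ x y z → x * (y * z) ≈ y * (x * z)
  x*yz≈y*xz = CSG.x∙yz≈y∙xz *-commutativeSemigroup

  sumL : {I : Set} → (I → Carrier) → List I → Carrier
  sumL f [] = 0#
  sumL f (x ∷ xs) = f x + sumL f xs

  prodL : {I : Set} → (I → Carrier) → List I → Carrier
  prodL f [] = 1#
  prodL f (x ∷ xs) = f x * prodL f xs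

  module _ {I : Set} where
    sum-cong-∈ : {f g : I → Carrier} (xs : List I) → (∀ {x} → x ∈ xs → f x ≈ g x) → sumL f xs ≈ sumL g xs
    sum-cong-∈ [] h = refl
    sum-cong-∈ (x ∷ xs) h = +-cong (h (here ≡.refl)) (sum-cong-∈ xs (h ∘ there))

    sum-cong : {f g : I → Carrier} (xs : List I) → (∀ x → f x ≈ g x) → sumL f xs ≈ sumL g xs
    sum-cong xs h = sum-cong-∈ xs (λ {x} _ → h x)

    sum-zero-∈ : {f : I → Carrier} (xs : List I) → (∀ {x} → x ∈ xs → f x ≈ 0#) → sumL f xs ≈ 0#
    sum-zero-∈ [] h = refl
    sum-zero-∈ (x ∷ xs) h = trans (+-cong (h (here ≡.refl)) (sum-zero-∈ xs (h ∘ there))) (+-identityˡ 0#)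

    sum-zero : {f : I → Carrier} (xs : List I) → (∀ x → f x ≈ 0#) → sumL f xs ≈ 0#
    sum-zero xs h = sum-zero-∈ xs (λ {x} _ → h x)

    sum-+ : (f g : I → Carrier) (xs : List I) → sumL (λ x → f x + g x) xs ≈ sumL f xs + sumL g xs
    sum-+ f g [] = sym (+-identityˡ 0#)
    sum-+ f g (x ∷ xs) = trans (+-congˡ (sum-+ f g xs)) (interchange _ _ _ _)

    sum-*ˡ : (c : Carrier) (f : I → Carrier) (xs : List I) → c * sumL f xs ≈ sumL (λ x → c * f x) xs
    sum-*ˡ c f [] = zeroʳ c
    sum-*ˡ c f (x ∷ xs) = trans (distribˡ c _ _) (+-congˡ (sum-*ˡ c f xs))

    sum-*ʳ : (f : I → Carrier) (c : Carrier) (xs : List I) → sumL f xs * c ≈ sumL (λ x → f x * c) xs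
    sum-*ʳ f c [] = zeroˡ c
    sum-*ʳ f c (x ∷ xs) = trans (distribʳ c _ _) (+-congˡ (sum-*ʳ f c xs))

    sum-++ : (f : I → Carrier) (xs ys : List I) → sumL f (xs ++ ys) ≈ sumL f xs + sumL f ys
    sum-++ f [] ys = sym (+-identityˡ _)
    sum-++ f (x ∷ xs) ys = trans (+-congˡ (sum-++ f xs ys)) (sym (+-assoc _ _ _))

    sum-↭ : (f : I → Carrier) {xs ys : List I} → xs ↭ ys → sumL f xs ≈ sumL f ys
    sum-↭ f Perm.refl = refl
    sum-↭ f (prep x p) = +-congˡ (sum-↭ f p)
    sum-↭ f (swap x y p) = trans (+-congˡ (+-congˡ (sum-↭ f p))) (x∙yz≈y∙xz _ _ _)
    sum-↭ f (Perm.trans p p′) = trans (sum-↭ f p) (sum-↭ f p′)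

    sum-single : {f : I → Carrier} {xs : List I} {y : I} → Unique xs → y ∈ xs →
      (∀ {x} → x ∈ xs → x ≢ y → f x ≈ 0#) → sumL f xs ≈ f y
    sum-single {xs = x ∷ xs} (x∉ ∷ u) (here ≡.refl) h =
      trans (+-congˡ (sum-zero-∈ xs (λ m → h (there m) (λ { ≡.refl → All.lookup x∉ m ≡.refl })))) (+-identityʳ _)
    sum-single {xs = x ∷ xs} (x∉ ∷ u) (there m) h =
      trans (+-congʳ (h (here ≡.refl) (λ { ≡.refl → All.lookup x∉ m ≡.refl })))
        (trans (+-identityˡ _) (sum-single u m (h ∘ there)))

    sum-pair : {f : I → Carrier} {xs : List I} {y y′ : I} → Unique xs → y ∈ xs → y′ ∈ xs → y ≢ y′ →
      (∀ {x} → x ∈ xs → x ≢ y → x ≢ y′ → f x ≈ 0#) → sumL f xs ≈ f y + f y′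
    sum-pair {f} {xs} {y} {y′} u m m′ ne h with ∈⇒↭ m
    ... | r , p with unique-resp-↭ (↭-sym p) u
    ... | y∉ ∷ ur = trans (sum-↭ f (↭-sym p)) (+-congˡ (sum-single ur y′∈r
          (λ {x} n → h (∈-resp-↭ p (there n)) (λ { ≡.refl → All.lookup y∉ n ≡.refl }))))
      where
      y′∈r : y′ ∈ r
      y′∈r with ∈-resp-↭ (↭-sym p) m′
      ... | here e = contradiction (≡.sym e) ne
      ... | there n = n

    prod-++ : (f : I → Carrier) (xs ys : List I) → prodL f (xs ++ ys) ≈ prodL f xs * prodL f ys
    prod-++ f [] ys = sym (*-identityˡ _)
    prod-++ f (x ∷ xs) ys = trans (*-congˡ (prod-++ f xs ys)) (sym (*-assoc _ _ _))

    prod-↭ : (f : I → Carrier) {xs ys : List I} → xs ↭ ys → prodL f xs ≈ prodL f ys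
    prod-↭ f Perm.refl = refl
    prod-↭ f (prep x p) = *-congˡ (prod-↭ f p)
    prod-↭ f (swap x y p) = trans (*-congˡ (*-congˡ (prod-↭ f p))) (x*yz≈y*xz _ _ _)
    prod-↭ f (Perm.trans p p′) = trans (prod-↭ f p) (prod-↭ f p′)

    prod-zero : {f : I → Carrier} {xs : List I} {y : I} → y ∈ xs → f y ≈ 0# → prodL f xs ≈ 0#
    prod-zero (here ≡.refl) h = trans (*-congʳ h) (zeroˡ _)
    prod-zero (there m) h = trans (*-congˡ (prod-zero m h)) (zeroʳ _)

  module _ {I J : Set} where
    sum-map : (f : J → Carrier) (g : I → J) (xs : List I) → sumL f (map g xs) ≈ sumL (f ∘ g) xs
    sum-map f g [] = refl
    sum-map f g (x ∷ xs) = +-congˡ (sum-map f g xs)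

    sum-swap : (f : I → J → Carrier) (xs : List I) (ys : List J) →
      sumL (λ x → sumL (f x) ys) xs ≈ sumL (λ y → sumL (λ x → f x y) xs) ys
    sum-swap f [] ys = sym (sum-zero ys (λ _ → refl))
    sum-swap f (x ∷ xs) ys = trans (+-congˡ (sum-swap f xs ys)) (sym (sum-+ _ _ ys))

  -- Laplace expansions and Plücker relations are sums of this shape: a chosen column together with
  -- the columns that remain.
  Σpicks : {I : Set} → (I → List I → Carrier) → List I → Carrier
  Σpicks f xs = sumL (λ p → f (proj₁ p) (proj₂ p)) (picks xs)

  module _ {I : Set} where
    Σpicks-∷ : (f : I → List I → Carrier) (x : I) (xs : List I) →
      Σpicks f (x ∷ xs) ≈ f x xs + Σpicks (λ s r → f s (x ∷ r)) xs
    Σpicks-∷ f x xs = +-congˡ (sum-map _ _ (picks xs))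

    Σpicks-const : (f : I → Carrier) (xs : List I) → sumL f xs ≈ Σpicks (λ s _ → f s) xs
    Σpicks-const f [] = refl
    Σpicks-const f (x ∷ xs) = trans (+-congˡ (Σpicks-const f xs)) (sym (Σpicks-∷ (λ s _ → f s) x xs))

    Σpicks-cong : {f g : I → List I → Carrier} (xs : List I) →
      (∀ s r → s ∷ r ↭ xs → f s r ≈ g s r) → Σpicks f xs ≈ Σpicks g xs
    Σpicks-cong xs h = sum-cong-∈ (picks xs) (λ m → h _ _ (picks-↭ m))

    Σpicks-↭ : {f : I → List I → Carrier} → (∀ s {r r′} → r ↭ r′ → f s r ≈ f s r′) →
      {xs ys : List I} → xs ↭ ys → Σpicks f xs ≈ Σpicks f ys
    Σpicks-↭ h Perm.refl = refl
    Σpicks-↭ {f} h {_ ∷ xs} {_ ∷ ys} (prep x p) = begin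
      Σpicks f (x ∷ xs) ≈⟨ Σpicks-∷ f x xs ⟩
      f x xs + Σpicks (λ s r → f s (x ∷ r)) xs
        ≈⟨ +-cong (h x p) (Σpicks-↭ (λ s q → h s (prep x q)) p) ⟩
      f x ys + Σpicks (λ s r → f s (x ∷ r)) ys ≈⟨ Σpicks-∷ f x ys ⟨
      Σpicks f (x ∷ ys) ∎
    Σpicks-↭ {f} h {_ ∷ _ ∷ xs} {_ ∷ _ ∷ ys} (swap x y p) = begin
      Σpicks f (x ∷ y ∷ xs) ≈⟨ trans (Σpicks-∷ f x _) (+-congˡ (Σpicks-∷ _ y xs)) ⟩
      f x (y ∷ xs) + (f y (x ∷ xs) + Σpicks (λ s r → f s (x ∷ y ∷ r)) xs)
        ≈⟨ x∙yz≈y∙xz _ _ _ ⟩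
      f y (x ∷ xs) + (f x (y ∷ xs) + Σpicks (λ s r → f s (x ∷ y ∷ r)) xs)
        ≈⟨ +-cong (h y (prep x p)) (+-cong (h x (prep y p))
             (trans (Σpicks-cong xs (λ s r _ → h s (swap x y ↭-refl)))
                    (Σpicks-↭ (λ s q → h s (prep y (prep x q))) p))) ⟩
      f y (x ∷ ys) + (f x (y ∷ ys) + Σpicks (λ s r → f s (y ∷ x ∷ r)) ys)
        ≈⟨ trans (Σpicks-∷ f y _) (+-congˡ (Σpicks-∷ _ x ys)) ⟨
      Σpicks f (y ∷ x ∷ ys) ∎
    Σpicks-↭ h (Perm.trans p p′) = trans (Σpicks-↭ h p) (Σpicks-↭ h p′)

    Σpicks-zero : {f : I → List I → Carrier} (xs : List I) →
      (∀ s r → s ∷ r ↭ xs → f s r ≈ 0#) → Σpicks f xs ≈ 0#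
    Σpicks-zero xs h = sum-zero-∈ (picks xs) (λ m → h _ _ (picks-↭ m))

    -- The entry `x` is the first pick, the second pick, or left over.
    Σpicks-expand : (k : I → I → List I → Carrier) (x : I) (xs : List I) → Σpicks (λ c r → Σpicks (k c) r) (x ∷ xs) ≈
      Σpicks (k x) xs + (Σpicks (λ c → k c x) xs + Σpicks (λ c r → Σpicks (λ c′ r′ → k c c′ (x ∷ r′)) r) xs)
    Σpicks-expand k x xs = trans (Σpicks-∷ (λ c r → Σpicks (k c) r) x xs)
      (+-congˡ (trans (Σpicks-cong xs (λ c r _ → Σpicks-∷ (k c) x r)) (sum-+ _ _ (picks xs))))

    -- An ordered pair of positions can be picked in either order and leaves the same remainder.
    Σpicks-swap : (g : I → I → List I → Carrier) (xs : List I) →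
      Σpicks (λ c r → Σpicks (g c) r) xs ≈ Σpicks (λ c r → Σpicks (λ c′ → g c′ c) r) xs
    Σpicks-swap g [] = refl
    Σpicks-swap g (x ∷ xs) = begin
      Σpicks (λ c r → Σpicks (g c) r) (x ∷ xs)
        ≈⟨ Σpicks-expand g x xs ⟩
      Σpicks (g x) xs + (Σpicks (λ c → g c x) xs + Σpicks (λ c r → Σpicks (λ c′ r′ → g c c′ (x ∷ r′)) r) xs)
        ≈⟨ trans (x∙yz≈y∙xz _ _ _) (+-congˡ (+-congˡ (Σpicks-swap (λ c c′ r → g c c′ (x ∷ r)) xs))) ⟩
      Σpicks (λ c → g c x) xs + (Σpicks (g x) xs + Σpicks (λ c r → Σpicks (λ c′ r′ → g c′ c (x ∷ r′)) r) xs)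
        ≈⟨ Σpicks-expand (λ c c′ → g c′ c) x xs ⟨
      Σpicks (λ c r → Σpicks (λ c′ → g c′ c) r) (x ∷ xs) ∎

-- Integral domains and linear algebra without division

record IntegralDomain : Set₁ where
  field
    cring : CommutativeRing 0ℓ 0ℓ
  open CommutativeRing cring public
  field
    zero? : ∀ x → Dec (x ≈ 0#)
    integral : ∀ {x y} → x * y ≈ 0# → x ≈ 0# ⊎ y ≈ 0#
    1≉0 : ¬ (1# ≈ 0#)

  cancelˡ : ∀ {x y} → ¬ (x ≈ 0#) → x * y ≈ 0# → y ≈ 0#
  cancelˡ p e with integral e
  ... | inj₁ z = contradiction z p
  ... | inj₂ z = z

  *-≉0 : ∀ {x y} → ¬ (x ≈ 0#) → ¬ (y ≈ 0#) → ¬ (x * y ≈ 0#)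
  *-≉0 p q e = q (cancelˡ p e)

  square≈0 : ∀ {x} → x * x ≈ 0# → x ≈ 0#
  square≈0 e with integral e
  ... | inj₁ z = z
  ... | inj₂ z = z

module Kernel (D : IntegralDomain) where
  open IntegralDomain D
  open RingSums cring
  open SetoidReasoning setoid
  open RingProps ring using (-‿distribˡ-*; -‿distribʳ-*)

  sumF : ∀ {n} → (Fin n → Carrier) → Carrier
  sumF f = sumL f (allFin _)

  private
    sumF-remove : ∀ {n} (f : Fin (suc n) → Carrier) (p : Fin (suc n)) → sumF f ≈ f p + sumF (f ∘ F.punchIn p)
    sumF-remove {n} f p = trans (tab f) (trans (go n f p) (+-congˡ (sym (tab (f ∘ F.punchIn p)))))
      where
      s : ∀ {n} → (Fin n → Carrier) → Carrier
      s {zero} f = 0#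
      s {suc n} f = f F.zero + s (f ∘ F.suc)
      tab′ : ∀ n {m} (g : Fin n → Fin m) (f : Fin m → Carrier) → sumL f (L.tabulate g) ≈ s (f ∘ g)
      tab′ zero g f = refl
      tab′ (suc n) g f = +-congˡ (tab′ n (g ∘ F.suc) f)
      tab : ∀ {n} (f : Fin n → Carrier) → sumF f ≈ s f
      tab {n} f = tab′ n id f
      go : ∀ n (f : Fin (suc n) → Carrier) p → s f ≈ f p + s (f ∘ F.punchIn p)
      go n f F.zero = refl
      go (suc n) f (F.suc p) = trans (+-congˡ (go n (f ∘ F.suc) p)) (x∙yz≈y∙xz _ _ _)

  -- Fraction-free Gaussian elimination. Over ℤ, over ordered fields and over the polynomial ring it
  -- takes the place of comparing dimensions.
  kernel : ∀ {n} (cols : List (Fin n → Carrier)) → length cols ℕ.< n →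
    ∃[ y ] (∃[ j ] ¬ (y j ≈ 0#)) × All (λ c → sumF (λ j → y j * c j) ≈ 0#) cols
  kernel cols = go (length cols) cols ≡.refl
    where
    go : ∀ m {n} (cols : List (Fin n → Carrier)) → length cols ≡ m → m ℕ.< n →
      ∃[ y ] (∃[ j ] ¬ (y j ≈ 0#)) × All (λ c → sumF (λ j → y j * c j) ≈ 0#) cols
    go zero {suc n} [] _ _ = (λ _ → 1#) , (F.zero , 1≉0) , []
    go (suc m) {suc n} (c ∷ cols) eq (ℕ.s≤s lt) with FP.all? (λ j → zero? (c j))
    ... | yes c≈0 with go m cols (suc-injective eq) (ℕP.m<n⇒m<1+n lt)
    ...   | y , nz , ok = y , nz , sum-zero (allFin (suc n)) (λ j → trans (*-congˡ (c≈0 j)) (zeroʳ _)) ∷ ok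
    go (suc m) {suc n} (c ∷ cols) eq (ℕ.s≤s lt) | no ¬all with FP.¬∀⟶∃¬ _ _ (λ j → zero? (c j)) ¬all
    ... | p , cp≉0 with go m (map elim cols) (≡.trans (length-map _ cols) (suc-injective eq)) lt
      where
      elim : (Fin (suc n) → Carrier) → Fin n → Carrier
      elim g k = c p * g (F.punchIn p k) + - (g p) * c (F.punchIn p k)
    ... | y′ , (j , nz) , ok = y , (F.punchIn p j , nz′) , on-c ∷ All.map on-col (AllP.map⁻ ok)
      where
      y₀ : Carrier
      y₀ = - sumF (λ k → y′ k * c (F.punchIn p k))
      y : Fin (suc n) → Carrier
      y i with p F.≟ i
      ... | yes _ = y₀
      ... | no p≢i = c p * y′ (F.punchOut p≢i)
      y-p : y p ≈ y₀
      y-p with p F.≟ p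
      ... | yes _ = refl
      ... | no ne = contradiction ≡.refl ne
      y-in : ∀ k → y (F.punchIn p k) ≈ c p * y′ k
      y-in k with p F.≟ F.punchIn p k
      ... | yes e = contradiction (≡.sym e) (FP.punchInᵢ≢i p k)
      ... | no ne = *-congˡ (reflexive (≡.cong y′ (≡.trans (FP.punchOut-cong p ≡.refl) (FP.punchOut-punchIn p))))
      nz′ : ¬ (y (F.punchIn p j) ≈ 0#)
      nz′ e = *-≉0 cp≉0 nz (trans (sym (y-in j)) e)
      split : ∀ g → sumF (λ i → y i * g i) ≈ y₀ * g p + sumF (λ k → c p * y′ k * g (F.punchIn p k))
      split g = trans (sumF-remove _ p) (+-cong (*-congʳ y-p) (sum-cong (allFin n) (λ k → *-congʳ (y-in k))))
      on-c : sumF (λ i → y i * c i) ≈ 0#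
      on-c = begin
        sumF (λ i → y i * c i) ≈⟨ split c ⟩
        y₀ * c p + sumF (λ k → c p * y′ k * c (F.punchIn p k))
          ≈⟨ +-cong (*-comm _ _) (trans (sum-cong (allFin n) (λ k → *-assoc _ _ _)) (sym (sum-*ˡ (c p) _ (allFin n)))) ⟩
        c p * y₀ + c p * sumF (λ k → y′ k * c (F.punchIn p k)) ≈⟨ distribˡ _ _ _ ⟨
        c p * (y₀ + sumF (λ k → y′ k * c (F.punchIn p k))) ≈⟨ *-congˡ (-‿inverseˡ _) ⟩
        c p * 0# ≈⟨ zeroʳ _ ⟩
        0# ∎
      on-col : ∀ {g} → sumF (λ k → y′ k * (c p * g (F.punchIn p k) + - (g p) * c (F.punchIn p k))) ≈ 0# →
        sumF (λ i → y i * g i) ≈ 0#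
      on-col {g} e = begin
        sumF (λ i → y i * g i) ≈⟨ split g ⟩
        y₀ * g p + sumF (λ k → c p * y′ k * g (F.punchIn p k)) ≈⟨ +-comm _ _ ⟩
        sumF (λ k → c p * y′ k * g (F.punchIn p k)) + y₀ * g p
          ≈⟨ +-cong (sum-cong (allFin n) (λ k → trans (*-congʳ (*-comm _ _)) (*-assoc _ _ _))) y₀-g ⟩
        sumF (λ k → y′ k * (c p * g (F.punchIn p k))) + sumF (λ k → y′ k * (- (g p) * c (F.punchIn p k)))
          ≈⟨ sum-+ _ _ (allFin n) ⟨
        sumF (λ k → y′ k * (c p * g (F.punchIn p k)) + y′ k * (- (g p) * c (F.punchIn p k)))
          ≈⟨ sum-cong (allFin n) (λ k → sym (distribˡ _ _ _)) ⟩
        sumF (λ k → y′ k * (c p * g (F.punchIn p k) + - (g p) * c (F.punchIn p k))) ≈⟨ e ⟩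
        0# ∎
        where
        y₀-g : y₀ * g p ≈ sumF (λ k → y′ k * (- (g p) * c (F.punchIn p k)))
        y₀-g = begin
          - sumF (λ k → y′ k * c (F.punchIn p k)) * g p ≈⟨ -‿distribˡ-* _ _ ⟨
          - (sumF (λ k → y′ k * c (F.punchIn p k)) * g p) ≈⟨ -‿distribʳ-* _ _ ⟩
          sumF (λ k → y′ k * c (F.punchIn p k)) * - g p ≈⟨ sum-*ʳ _ _ (allFin n) ⟩
          sumF (λ k → y′ k * c (F.punchIn p k) * - g p)
            ≈⟨ sum-cong (allFin n) (λ k → trans (*-assoc _ _ _) (*-congˡ (*-comm _ _))) ⟩
          sumF (λ k → y′ k * (- (g p) * c (F.punchIn p k))) ∎

-- Derivations and polynomial rings over the field with two elements

record Derivation (R : CommutativeRing 0ℓ 0ℓ) : Set where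
  open CommutativeRing R
  field
    der : Carrier → Carrier
    der-cong : ∀ {x y} → x ≈ y → der x ≈ der y
    der-+ : ∀ x y → der (x + y) ≈ der x + der y
    der-* : ∀ x y → der (x * y) ≈ der x * y + x * der y

  der-0 : der 0# ≈ 0#
  der-0 = begin
    der 0# ≈⟨ +-identityʳ _ ⟨
    der 0# + 0# ≈⟨ +-congˡ (-‿inverseʳ (der 0#)) ⟨
    der 0# + (der 0# - der 0#) ≈⟨ +-assoc _ _ _ ⟨
    der 0# + der 0# - der 0# ≈⟨ +-congʳ (trans (sym (der-+ 0# 0#)) (der-cong (+-identityˡ 0#))) ⟩
    der 0# - der 0# ≈⟨ -‿inverseʳ _ ⟩
    0# ∎
    where open SetoidReasoning setoid

-- Polynomials over a ring are coefficient lists, compared coefficientwise.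
module Polynomials (D : IntegralDomain) where
  open IntegralDomain D
  open SetoidReasoning setoid
  open CSG +-commutativeSemigroup using (interchange)

  Seq : Set
  Seq = ℕ → Carrier

  conv : Seq → Seq → Seq
  conv F G zero = F 0 * G 0
  conv F G (suc n) = F 0 * G (suc n) + conv (F ∘ suc) G n

  conv-cong : ∀ {F F′ G G′} → (∀ n → F n ≈ F′ n) → (∀ n → G n ≈ G′ n) → ∀ n → conv F G n ≈ conv F′ G′ n
  conv-cong p q zero = *-cong (p 0) (q 0)
  conv-cong p q (suc n) = +-cong (*-cong (p 0) (q (suc n))) (conv-cong (p ∘ suc) q n)

  conv-+ʳ : ∀ F G H n → conv F (λ k → G k + H k) n ≈ conv F G n + conv F H n
  conv-+ʳ F G H zero = distribˡ _ _ _
  conv-+ʳ F G H (suc n) = trans (+-cong (distribˡ _ _ _) (conv-+ʳ (F ∘ suc) G H n)) (interchange _ _ _ _)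

  conv-suc : ∀ F G n → conv F G (suc n) ≈ conv F (G ∘ suc) n + F (suc n) * G 0
  conv-suc F G zero = refl
  conv-suc F G (suc n) = trans (+-congˡ (conv-suc (F ∘ suc) G n)) (sym (+-assoc _ _ _))

  conv-comm : ∀ F G n → conv F G n ≈ conv G F n
  conv-comm F G zero = *-comm _ _
  conv-comm F G (suc n) = begin
    F 0 * G (suc n) + conv (F ∘ suc) G n ≈⟨ +-comm _ _ ⟩
    conv (F ∘ suc) G n + F 0 * G (suc n) ≈⟨ +-cong (conv-comm (F ∘ suc) G n) (*-comm _ _) ⟩
    conv G (F ∘ suc) n + G (suc n) * F 0 ≈⟨ conv-suc G F n ⟨
    conv G F (suc n) ∎

  conv-+ˡ : ∀ F G H n → conv (λ k → F k + G k) H n ≈ conv F H n + conv G H n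
  conv-+ˡ F G H n = trans (conv-comm _ H n) (trans (conv-+ʳ H F G n) (+-cong (conv-comm H F n) (conv-comm H G n)))

  conv-scaleˡ : ∀ a F G n → conv (λ k → a * F k) G n ≈ a * conv F G n
  conv-scaleˡ a F G zero = *-assoc _ _ _
  conv-scaleˡ a F G (suc n) = trans (+-cong (*-assoc _ _ _) (conv-scaleˡ a (F ∘ suc) G n)) (sym (distribˡ _ _ _))

  conv-zeroˡ : ∀ G n → conv (λ _ → 0#) G n ≈ 0#
  conv-zeroˡ G zero = zeroˡ _
  conv-zeroˡ G (suc n) = trans (+-cong (zeroˡ _) (conv-zeroˡ G n)) (+-identityˡ _)

  conv-assoc : ∀ F G H n → conv (conv F G) H n ≈ conv F (conv G H) n
  conv-assoc F G H zero = *-assoc _ _ _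
  conv-assoc F G H (suc n) = begin
    F 0 * G 0 * H (suc n) + conv (λ k → F 0 * G (suc k) + conv (F ∘ suc) G k) H n
      ≈⟨ +-cong (*-assoc _ _ _) (trans (conv-+ˡ _ _ H n) (+-cong (conv-scaleˡ (F 0) (G ∘ suc) H n) (conv-assoc (F ∘ suc) G H n))) ⟩
    F 0 * (G 0 * H (suc n)) + (F 0 * conv (G ∘ suc) H n + conv (F ∘ suc) (conv G H) n)
      ≈⟨ +-assoc _ _ _ ⟨
    F 0 * (G 0 * H (suc n)) + F 0 * conv (G ∘ suc) H n + conv (F ∘ suc) (conv G H) n
      ≈⟨ +-congʳ (distribˡ _ _ _) ⟨
    F 0 * conv G H (suc n) + conv (F ∘ suc) (conv G H) n ∎

  shift : Seq → Seq
  shift F zero = 0#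
  shift F (suc n) = F n

  conv-shift : ∀ F G n → conv (shift F) G (suc n) ≈ conv F G n
  conv-shift F G n = trans (+-congʳ (zeroˡ _)) (+-identityˡ _)

  -- The coefficient `(n + 1) F (n + 1)`, obtained from the product rule for `F 0 + z F′` so that no
  -- integer multiples have to be defined.
  deriv : Seq → Seq
  deriv F zero = F 1
  deriv F (suc n) = F (suc (suc n)) + deriv (F ∘ suc) n

  deriv-cong : ∀ {F G} → (∀ n → F n ≈ G n) → ∀ n → deriv F n ≈ deriv G n
  deriv-cong p zero = p 1
  deriv-cong p (suc n) = +-cong (p _) (deriv-cong (p ∘ suc) n)

  deriv-+ : ∀ F G n → deriv (λ k → F k + G k) n ≈ deriv F n + deriv G n
  deriv-+ F G zero = refl
  deriv-+ F G (suc n) = trans (+-congˡ (deriv-+ (F ∘ suc) (G ∘ suc) n)) (interchange _ _ _ _)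

  deriv-scale : ∀ a F n → deriv (λ k → a * F k) n ≈ a * deriv F n
  deriv-scale a F zero = refl
  deriv-scale a F (suc n) = trans (+-congˡ (deriv-scale a (F ∘ suc) n)) (sym (distribˡ _ _ _))

  deriv-conv : ∀ F G n → deriv (conv F G) n ≈ conv (deriv F) G n + conv F (deriv G) n
  deriv-conv F G zero = +-comm _ _
  deriv-conv F G (suc n) = begin
    F 0 * G (2 ℕ.+ n) + conv F′ G (suc n) + deriv (λ k → F 0 * G (suc k) + conv F′ G k) n
      ≈⟨ +-congˡ (trans (deriv-+ _ _ n) (+-cong (deriv-scale (F 0) (G ∘ suc) n) (deriv-conv F′ G n))) ⟩
    F 0 * G (2 ℕ.+ n) + conv F′ G (suc n) + (F 0 * deriv (G ∘ suc) n + (conv (deriv F′) G n + conv F′ (deriv G) n))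
      ≈⟨ RingIdentities.collect-leibniz cring _ _ _ _ _ _ ⟩
    (conv F′ G (suc n) + conv (deriv F′) G n) + (F 0 * (G (2 ℕ.+ n) + deriv (G ∘ suc) n) + conv F′ (deriv G) n)
      ≈⟨ +-congʳ (+-congˡ (conv-shift (deriv F′) G n)) ⟨
    (conv F′ G (suc n) + conv (shift (deriv F′)) G (suc n)) + conv F (deriv G) (suc n)
      ≈⟨ +-congʳ (conv-+ˡ F′ (shift (deriv F′)) G (suc n)) ⟨
    conv (λ k → F′ k + shift (deriv F′) k) G (suc n) + conv F (deriv G) (suc n)
      ≈⟨ +-congʳ (conv-cong unshift (λ _ → refl) (suc n)) ⟩
    conv (deriv F) G (suc n) + conv F (deriv G) (suc n) ∎
    where
    F′ : Seq
    F′ = F ∘ suc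
    unshift : ∀ k → F′ k + shift (deriv F′) k ≈ deriv F k
    unshift zero = +-identityʳ _
    unshift (suc k) = refl

  coef : List Carrier → Seq
  coef [] n = 0#
  coef (a ∷ f) zero = a
  coef (a ∷ f) (suc n) = coef f n

  record _≈ₚ_ (f g : List Carrier) : Set where
    constructor coefs
    field at : ∀ n → coef f n ≈ coef g n
  open _≈ₚ_

  _+ₚ_ _*ₚ_ : List Carrier → List Carrier → List Carrier
  [] +ₚ g = g
  (a ∷ f) +ₚ [] = a ∷ f
  (a ∷ f) +ₚ (b ∷ g) = (a + b) ∷ (f +ₚ g)
  [] *ₚ g = []
  (a ∷ f) *ₚ g = map (a *_) g +ₚ (0# ∷ (f *ₚ g))

  coef-+ : ∀ f g n → coef (f +ₚ g) n ≈ coef f n + coef g n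
  coef-+ [] g n = sym (+-identityˡ _)
  coef-+ (a ∷ f) [] n = sym (+-identityʳ _)
  coef-+ (a ∷ f) (b ∷ g) zero = refl
  coef-+ (a ∷ f) (b ∷ g) (suc n) = coef-+ f g n

  coef-map : (h : Carrier → Carrier) → h 0# ≈ 0# → ∀ f n → coef (map h f) n ≈ h (coef f n)
  coef-map h z [] n = sym z
  coef-map h z (a ∷ f) zero = refl
  coef-map h z (a ∷ f) (suc n) = coef-map h z f n

  coef-* : ∀ f g n → coef (f *ₚ g) n ≈ conv (coef f) (coef g) n
  coef-* [] g n = sym (conv-zeroˡ (coef g) n)
  coef-* (a ∷ f) g zero = trans (coef-+ (map (a *_) g) _ 0) (trans (+-identityʳ _) (coef-map _ (zeroʳ a) g 0))
  coef-* (a ∷ f) g (suc n) = trans (coef-+ (map (a *_) g) _ (suc n)) (+-cong (coef-map _ (zeroʳ a) g (suc n)) (coef-* f g n))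

  coef-neg : ∀ f n → coef (map (-_) f) n ≈ - coef f n
  coef-neg = coef-map -_ (RingProps.-0#≈0# ring)

  polyRing : CommutativeRing 0ℓ 0ℓ
  polyRing = record
    { Carrier = List Carrier ; _≈_ = _≈ₚ_ ; _+_ = _+ₚ_ ; _*_ = _*ₚ_ ; -_ = map (-_) ; 0# = [] ; 1# = 1# ∷ []
    ; isCommutativeRing = record
      { isRing = record
        { +-isAbelianGroup = record
          { isGroup = record
            { isMonoid = record
              { isSemigroup = record
                { isMagma = record
                  { isEquivalence = record
                    { refl = coefs (λ _ → refl)
                    ; sym = λ p → coefs (λ n → sym (at p n))
                    ; trans = λ p q → coefs (λ n → trans (at p n) (at q n)) }
                  ; ∙-cong = λ {f} {f′} {g} {g′} p q → coefs (λ n →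
                      trans (coef-+ f g n) (trans (+-cong (at p n) (at q n)) (sym (coef-+ f′ g′ n)))) }
                ; assoc = λ f g h → coefs (λ n → trans (trans (coef-+ (f +ₚ g) h n) (+-congʳ (coef-+ f g n)))
                    (trans (+-assoc _ _ _) (sym (trans (coef-+ f (g +ₚ h) n) (+-congˡ (coef-+ g h n)))))) }
              ; identity = (λ f → coefs (λ _ → refl)) , (λ f → coefs (λ n → trans (coef-+ f [] n) (+-identityʳ _))) }
            ; inverse = (λ f → coefs (λ n → trans (coef-+ (map (-_) f) f n) (trans (+-congʳ (coef-neg f n)) (-‿inverseˡ _))))
                      , (λ f → coefs (λ n → trans (coef-+ f (map (-_) f) n) (trans (+-congˡ (coef-neg f n)) (-‿inverseʳ _))))
            ; ⁻¹-cong = λ {f} {g} p → coefs (λ n → trans (coef-neg f n) (trans (-‿cong (at p n)) (sym (coef-neg g n)))) }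
          ; comm = λ f g → coefs (λ n → trans (coef-+ f g n) (trans (+-comm _ _) (sym (coef-+ g f n)))) }
        ; *-cong = λ {f} {f′} {g} {g′} p q → coefs (λ n →
            trans (coef-* f g n) (trans (conv-cong (at p) (at q) n) (sym (coef-* f′ g′ n))))
        ; *-assoc = λ f g h → coefs (λ n → trans (trans (coef-* (f *ₚ g) h n) (conv-cong (coef-* f g) (λ _ → refl) n))
            (trans (conv-assoc (coef f) (coef g) (coef h) n) (sym (trans (coef-* f (g *ₚ h) n) (conv-cong (λ _ → refl) (coef-* g h) n)))))
        ; *-identity = *ₚ-identityˡ , (λ f → coefs (λ n → trans (*ₚ-comm f _ n) (at (*ₚ-identityˡ f) n)))
        ; distrib = *ₚ-distribˡ , (λ f g h → coefs (λ n → trans (*ₚ-comm (g +ₚ h) f n) (trans (at (*ₚ-distribˡ f g h) n)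
            (trans (coef-+ (f *ₚ g) _ n) (trans (+-cong (*ₚ-comm f g n) (*ₚ-comm f h n)) (sym (coef-+ (g *ₚ f) _ n))))))) }
      ; *-comm = λ f g → coefs (*ₚ-comm f g) } }
    where
    *ₚ-comm : ∀ f g n → coef (f *ₚ g) n ≈ coef (g *ₚ f) n
    *ₚ-comm f g n = trans (coef-* f g n) (trans (conv-comm (coef f) (coef g) n) (sym (coef-* g f n)))
    *ₚ-identityˡ : ∀ f → ((1# ∷ []) *ₚ f) ≈ₚ f
    *ₚ-identityˡ f = coefs λ
      { zero → trans (coef-+ (map (1# *_) f) (0# ∷ []) 0) (trans (+-identityʳ _) (trans (coef-map _ (zeroʳ _) f 0) (*-identityˡ _)))
      ; (suc n) → trans (coef-+ (map (1# *_) f) (0# ∷ []) (suc n)) (trans (+-identityʳ _) (trans (coef-map _ (zeroʳ _) f (suc n)) (*-identityˡ _))) }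
    *ₚ-distribˡ : ∀ f g h → (f *ₚ (g +ₚ h)) ≈ₚ ((f *ₚ g) +ₚ (f *ₚ h))
    *ₚ-distribˡ f g h = coefs (λ n → trans (coef-* f (g +ₚ h) n) (trans (conv-cong (λ _ → refl) (coef-+ g h) n)
      (trans (conv-+ʳ (coef f) (coef g) (coef h) n) (sym (trans (coef-+ (f *ₚ g) _ n) (+-cong (coef-* f g n) (coef-* f h n)))))))

  -- The lowest coefficient of `G` is cancelled against `F 0`; once it is zero, the same hypotheses
  -- hold for `G` shifted by one place.
  conv-integral : ∀ F → ¬ (F 0 ≈ 0#) → ∀ G → (∀ n → conv F G n ≈ 0#) → ∀ n → G n ≈ 0#
  conv-integral F F₀ G e zero = cancelˡ F₀ (e 0)
  conv-integral F F₀ G e (suc n) = conv-integral F F₀ (G ∘ suc) e′ n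
    where
    G₀ : G 0 ≈ 0#
    G₀ = cancelˡ F₀ (e 0)
    e′ : ∀ k → conv F (G ∘ suc) k ≈ 0#
    e′ k = begin
      conv F (G ∘ suc) k ≈⟨ +-identityʳ _ ⟨
      conv F (G ∘ suc) k + 0# ≈⟨ +-congˡ (trans (*-congˡ G₀) (zeroʳ _)) ⟨
      conv F (G ∘ suc) k + F (suc k) * G 0 ≈⟨ conv-suc F G k ⟨
      conv F G (suc k) ≈⟨ e (suc k) ⟩
      0# ∎

  polyDomain : IntegralDomain
  polyDomain = record
    { cring = polyRing
    ; zero? = zeroₚ?
    ; integral = λ {f} {g} e → int f g (λ n → trans (sym (coef-* f g n)) (at e n))
    ; 1≉0 = λ e → 1≉0 (at e 0) }
    where
    zeroₚ? : ∀ f → Dec (f ≈ₚ [])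
    zeroₚ? [] = yes (coefs (λ _ → refl))
    zeroₚ? (a ∷ f) with zero? a | zeroₚ? f
    ... | no a≉0 | _ = no (λ e → a≉0 (at e 0))
    ... | yes _ | no f≉0 = no (λ e → f≉0 (coefs (at e ∘ suc)))
    ... | yes a≈0 | yes f≈0 = yes (coefs λ { zero → a≈0 ; (suc n) → at f≈0 n })
    int : ∀ f g → (∀ n → conv (coef f) (coef g) n ≈ 0#) → f ≈ₚ [] ⊎ g ≈ₚ []
    int [] g e = inj₁ (coefs (λ _ → refl))
    int (a ∷ f) g e with zero? a
    ... | no a≉0 = inj₂ (coefs (conv-integral (coef (a ∷ f)) a≉0 (coef g) e))
    ... | yes a≈0 with int f g (λ n → trans (sym (trans (+-congʳ (trans (*-congʳ a≈0) (zeroˡ _))) (+-identityˡ _))) (e (suc n)))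
    ...   | inj₂ z = inj₂ z
    ...   | inj₁ z = inj₁ (coefs λ { zero → a≈0 ; (suc n) → at z n })

  d/dz : List Carrier → List Carrier
  d/dz [] = []
  d/dz (a ∷ f) = f +ₚ (0# ∷ d/dz f)

  coef-d/dz : ∀ f n → coef (d/dz f) n ≈ deriv (coef f) n
  coef-d/dz [] n = sym (zeros n)
    where
    zeros : ∀ n → deriv (λ _ → 0#) n ≈ 0#
    zeros zero = refl
    zeros (suc n) = trans (+-identityˡ _) (zeros n)
  coef-d/dz (a ∷ f) zero = trans (coef-+ f _ 0) (+-identityʳ _)
  coef-d/dz (a ∷ f) (suc n) = trans (coef-+ f _ (suc n)) (+-congˡ (coef-d/dz f n))

  ∂z : Derivation polyRing
  ∂z = record
    { der = d/dz
    ; der-cong = λ {f} {g} p → coefs (λ n → trans (coef-d/dz f n) (trans (deriv-cong (at p) n) (sym (coef-d/dz g n))))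
    ; der-+ = λ f g → coefs (λ n → trans (trans (coef-d/dz (f +ₚ g) n) (trans (deriv-cong (coef-+ f g) n) (deriv-+ (coef f) (coef g) n)))
        (sym (trans (coef-+ (d/dz f) (d/dz g) n) (+-cong (coef-d/dz f n) (coef-d/dz g n)))))
    ; der-* = λ f g → coefs (λ n → trans (trans (coef-d/dz (f *ₚ g) n) (trans (deriv-cong (coef-* f g) n) (deriv-conv (coef f) (coef g) n)))
        (sym (trans (coef-+ (d/dz f *ₚ g) (f *ₚ d/dz g) n) (+-cong (trans (coef-* (d/dz f) g n) (conv-cong (coef-d/dz f) (λ _ → refl) n))
          (trans (coef-* f (d/dz g) n) (conv-cong (λ _ → refl) (coef-d/dz g) n)))))) }

  module Coefficientwise (δ : Derivation cring) where
    open Derivation δ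

    der-conv : ∀ F G n → der (conv F G n) ≈ conv (der ∘ F) G n + conv F (der ∘ G) n
    der-conv F G zero = der-* _ _
    der-conv F G (suc n) = trans (trans (der-+ _ _) (+-cong (der-* _ _) (der-conv (F ∘ suc) G n))) (interchange _ _ _ _)

    coef-der : ∀ f n → coef (map der f) n ≈ der (coef f n)
    coef-der = coef-map der der-0

    lift : Derivation polyRing
    lift = record
      { der = map der
      ; der-cong = λ {f} {g} p → coefs (λ n → trans (coef-der f n) (trans (der-cong (at p n)) (sym (coef-der g n))))
      ; der-+ = λ f g → coefs (λ n → trans (trans (coef-der (f +ₚ g) n) (trans (der-cong (coef-+ f g n)) (der-+ _ _)))
          (sym (trans (coef-+ (map der f) (map der g) n) (+-cong (coef-der f n) (coef-der g n)))))
      ; der-* = λ f g → coefs (λ n → trans (trans (coef-der (f *ₚ g) n) (trans (der-cong (coef-* f g n)) (der-conv (coef f) (coef g) n)))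
          (sym (trans (coef-+ (map der f *ₚ g) (f *ₚ map der g) n) (+-cong (trans (coef-* (map der f) g n) (conv-cong (coef-der f) (λ _ → refl) n))
            (trans (coef-* f (map der g) n) (conv-cong (λ _ → refl) (coef-der g) n)))))) }

-- Partial derivatives and their values on the variables are all that the argument asks of a
-- polynomial ring; even the non-vanishing of determinants is proved by differentiating.
record GenericDomain (Ix : Set) : Set₁ where
  field
    domain : IntegralDomain
  open IntegralDomain domain public
  field
    char2 : ∀ x → x + x ≈ 0#
    var : Ix → Carrier
    ∂ : Ix → Derivation cring
    ∂-same : ∀ i → Derivation.der (∂ i) (var i) ≈ 1#
    ∂-other : ∀ {i j} → i ≢ j → Derivation.der (∂ i) (var j) ≈ 0#

𝔽₂ : IntegralDomain
𝔽₂ = record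
  { cring = BoolP.xor-∧-commutativeRing
  ; zero? = λ x → x BoolP.≟ false
  ; integral = λ { {false} _ → inj₁ ≡.refl ; {true} e → inj₂ e }
  ; 1≉0 = λ () }

𝔽₂[_] : ∀ n → GenericDomain (Fin n)
𝔽₂[ zero ] = record
  { domain = 𝔽₂ ; char2 = λ { false → ≡.refl ; true → ≡.refl }
  ; var = λ () ; ∂ = λ () ; ∂-same = λ () ; ∂-other = λ { {()} } }
𝔽₂[ suc n ] = record
  { domain = polyDomain
  ; char2 = λ f → coefs (λ k → trans (coef-+ f f k) (char2 _))
  ; var = λ { F.zero → 0# ∷ 1# ∷ [] ; (F.suc i) → var i ∷ [] }
  ; ∂ = λ { F.zero → ∂z ; (F.suc i) → Coefficientwise.lift (∂ i) }
  ; ∂-same = λ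
      { F.zero → coefs (λ { zero → +-identityʳ 1# ; (suc zero) → refl ; (suc (suc _)) → refl })
      ; (F.suc i) → coefs (λ { zero → ∂-same i ; (suc _) → refl }) }
  ; ∂-other = λ
      { {F.zero} {F.zero} ne → contradiction ≡.refl ne
      ; {F.zero} {F.suc j} ne → coefs (λ { zero → refl ; (suc _) → refl })
      ; {F.suc i} {F.zero} ne → coefs (λ { zero → Derivation.der-0 (∂ i) ; (suc zero) → der-1 i ; (suc (suc _)) → refl })
      ; {F.suc i} {F.suc j} ne → coefs (λ { zero → ∂-other (λ { ≡.refl → ne ≡.refl }) ; (suc _) → refl }) } }
  where
  open GenericDomain 𝔽₂[ n ]
  open Polynomials domain
  der-1 : ∀ i → Derivation.der (∂ i) 1# ≈ 0#
  der-1 i = trans (der-cong (sym (*-identityˡ 1#))) (trans (der-* 1# 1#) (trans (+-cong (*-identityʳ _) (*-identityˡ _)) (char2 _)))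
    where open Derivation (∂ i)

reindex : {Ix Jx : Set} (f : Jx → Ix) → (∀ {i j} → f i ≡ f j → i ≡ j) → GenericDomain Ix → GenericDomain Jx
reindex f inj G = record
  { domain = domain ; char2 = char2 ; var = var ∘ f ; ∂ = ∂ ∘ f ; ∂-same = ∂-same ∘ f
  ; ∂-other = λ ne → ∂-other (λ e → ne (inj e)) }
  where open GenericDomain G

module Char2 {Ix : Set} (G : GenericDomain Ix) where
  open GenericDomain G
  open RingSums cring
  open SetoidReasoning setoid

  cancel : ∀ {x y} → x ≈ y → x + y ≈ 0#
  cancel p = trans (+-congʳ p) (char2 _)

  +≈0⇒≈ : ∀ {x y} → x + y ≈ 0# → x ≈ y
  +≈0⇒≈ {x} {y} e = begin
    x ≈⟨ +-identityʳ x ⟨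
    x + 0# ≈⟨ +-congˡ (char2 y) ⟨
    x + (y + y) ≈⟨ +-assoc x y y ⟨
    x + y + y ≈⟨ +-congʳ e ⟩
    0# + y ≈⟨ +-identityˡ y ⟩
    y ∎

  -- Frobenius. It turns the square of a degree into a sum of squares over the facets.
  square-sum : ∀ {I : Set} (f : I → Carrier) xs → sumL f xs * sumL f xs ≈ sumL (λ x → f x * f x) xs
  square-sum f [] = zeroˡ 0#
  square-sum f (x ∷ xs) = begin
    (f x + s) * (f x + s)
      ≈⟨ RingIdentities.square-+ cring (f x) s ⟩
    f x * f x + s * s + (f x * s + f x * s) ≈⟨ trans (+-congˡ (char2 _)) (+-identityʳ _) ⟩
    f x * f x + s * s ≈⟨ +-congˡ (square-sum f xs) ⟩
    f x * f x + sumL (λ x → f x * f x) xs ∎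
    where
    s : Carrier
    s = sumL f xs

  -- The terms for (c, c′) and (c′, c) cancel, and there is no diagonal because the two picks are at
  -- different positions.
  Σpicks²-zero : {I : Set} (g : I → I → List I → Carrier) → (∀ c c′ r → g c c′ r ≈ g c′ c r) →
    ∀ xs → Σpicks (λ c r → Σpicks (g c) r) xs ≈ 0#
  Σpicks²-zero g h [] = refl
  Σpicks²-zero g h (x ∷ xs) = begin
    Σpicks (λ c r → Σpicks (g c) r) (x ∷ xs) ≈⟨ Σpicks-expand g x xs ⟩
    Σpicks (g x) xs + (Σpicks (λ c → g c x) xs + Σpicks (λ c r → Σpicks (λ c′ r′ → g c c′ (x ∷ r′)) r) xs)
      ≈⟨ +-congˡ (trans (+-congˡ (Σpicks²-zero _ (λ c c′ r → h c c′ (x ∷ r)) xs)) (+-identityʳ _)) ⟩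
    Σpicks (g x) xs + Σpicks (λ c → g c x) xs ≈⟨ cancel (Σpicks-cong xs (λ c r _ → h x c r)) ⟩
    0# ∎

  module DerivationProperties (δ : Derivation cring) where
    open Derivation δ public

    der-1 : der 1# ≈ 0#
    der-1 = trans (der-cong (sym (*-identityˡ 1#))) (trans (der-* 1# 1#) (cancel (trans (*-identityʳ _) (sym (*-identityˡ _)))))

    der-sum : {I : Set} (f : I → Carrier) (xs : List I) → der (sumL f xs) ≈ sumL (der ∘ f) xs
    der-sum f [] = der-0
    der-sum f (x ∷ xs) = trans (der-+ _ _) (+-congˡ (der-sum f xs))

    -- Squares are constants for every derivation in characteristic 2. This carries unknown
    -- coefficients through all the differentiations below, once they occur squared.
    der-square-* : ∀ x y → der (x * x * y) ≈ x * x * der y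
    der-square-* x y = begin
      der (x * x * y) ≈⟨ der-* _ _ ⟩
      der (x * x) * y + x * x * der y ≈⟨ +-congʳ (trans (*-congʳ (trans (der-* x x) (cancel (*-comm _ _)))) (zeroˡ y)) ⟩
      0# + x * x * der y ≈⟨ +-identityˡ _ ⟩
      x * x * der y ∎

    der-const-* : ∀ {c} → der c ≈ 0# → ∀ x → der (c * x) ≈ c * der x
    der-const-* z x = trans (der-* _ _) (trans (+-congʳ (trans (*-congʳ z) (zeroˡ _))) (+-identityˡ _))

    der-*-const : ∀ {c} x → der c ≈ 0# → der (x * c) ≈ der x * c
    der-*-const x z = trans (der-* _ _) (trans (+-congˡ (trans (*-congˡ z) (zeroʳ _))) (+-identityʳ _))

    der-*-zero : ∀ {x y} → der x ≈ 0# → der y ≈ 0# → der (x * y) ≈ 0#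
    der-*-zero p q = trans (der-const-* p _) (trans (*-congˡ q) (zeroʳ _))

    der-prod-zero : {I : Set} {f : I → Carrier} (xs : List I) → (∀ {x} → x ∈ xs → der (f x) ≈ 0#) → der (prodL f xs) ≈ 0#
    der-prod-zero [] h = der-1
    der-prod-zero (x ∷ xs) h = der-*-zero (h (here ≡.refl)) (der-prod-zero xs (h ∘ there))

    der-prod : {I : Set} (f : I → Carrier) (xs : List I) → der (prodL f xs) ≈ Σpicks (λ s r → der (f s) * prodL f r) xs
    der-prod f [] = der-1
    der-prod f (x ∷ xs) = begin
      der (f x * prodL f xs) ≈⟨ der-* _ _ ⟩
      der (f x) * prodL f xs + f x * der (prodL f xs) ≈⟨ +-congˡ (*-congˡ (der-prod f xs)) ⟩
      der (f x) * prodL f xs + f x * Σpicks (λ s r → der (f s) * prodL f r) xs ≈⟨ +-congˡ (sum-*ˡ (f x) _ (picks xs)) ⟩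
      der (f x) * prodL f xs + Σpicks (λ s r → f x * (der (f s) * prodL f r)) xs
        ≈⟨ +-congˡ (Σpicks-cong xs (λ s r _ → x*yz≈y*xz _ _ _)) ⟩
      der (f x) * prodL f xs + Σpicks (λ s r → der (f s) * prodL f (x ∷ r)) xs ≈⟨ Σpicks-∷ _ x xs ⟨
      Σpicks (λ s r → der (f s) * prodL f r) (x ∷ xs) ∎

-- Determinants of generic matrices

-- In characteristic 2 the determinant is the permanent, so no signs appear.
module Determinants {Row V : Set} (G : GenericDomain (Row × V)) where
  open GenericDomain G
  open RingSums cring
  open Char2 G
  open SetoidReasoning setoid

  θ : Row → V → Carrier
  θ r v = var (r , v)

  det : List Row → List V → Carrier
  det [] [] = 1#
  det [] (_ ∷ _) = 0#
  det (r ∷ rs) cs = Σpicks (λ c rest → θ r c * det rs rest) cs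

  det-↭ : ∀ rs {cs cs′} → cs ↭ cs′ → det rs cs ≈ det rs cs′
  det-↭ [] Perm.refl = refl
  det-↭ [] (prep x p) = refl
  det-↭ [] (swap x y p) = refl
  det-↭ [] (Perm.trans p q) = trans (det-↭ [] p) (det-↭ [] q)
  det-↭ (r ∷ rs) p = Σpicks-↭ (λ s q → *-congˡ (det-↭ rs q)) p

  det-twice : ∀ rs x cs → det rs (x ∷ x ∷ cs) ≈ 0#
  det-twice [] x cs = refl
  det-twice (r ∷ rs) x cs = begin
    det (r ∷ rs) (x ∷ x ∷ cs) ≈⟨ trans (Σpicks-∷ _ x (x ∷ cs)) (+-congˡ (Σpicks-∷ _ x cs)) ⟩
    a + (a + Σpicks (λ c rest → θ r c * det rs (x ∷ x ∷ rest)) cs)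
      ≈⟨ +-congˡ (trans (+-congˡ (Σpicks-zero cs (λ c rest _ → trans (*-congˡ (det-twice rs x rest)) (zeroʳ _)))) (+-identityʳ _)) ⟩
    a + a ≈⟨ char2 a ⟩
    0# ∎
    where
    a : Carrier
    a = θ r x * det rs (x ∷ cs)

  det-repeated : ∀ rs {x cs} → x ∈ cs → det rs (x ∷ cs) ≈ 0#
  det-repeated rs {x} m with ∈⇒↭ m
  ... | r , p = trans (det-↭ rs (prep x (↭-sym p))) (det-twice rs x r)

  -- If the equal rows are adjacent, the summand is symmetric in the two columns picked for them.
  -- Otherwise the second row is interchanged with the first, and the smaller determinants vanish by
  -- induction.
  det-row-repeated : ∀ {r rs} → r ∈ rs → ∀ cs → det (r ∷ rs) cs ≈ 0#
  det-row-repeated {r} {_ ∷ rs} (here ≡.refl) cs =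
    trans (Σpicks-cong cs (λ c R _ → sum-*ˡ (θ r c) _ (picks R)))
      (Σpicks²-zero _ (λ c c′ R → x*yz≈y*xz _ _ _) cs)
  det-row-repeated {r} {r′ ∷ rs} (there m) cs = begin
    det (r ∷ r′ ∷ rs) cs ≈⟨ Σpicks-cong cs (λ c R _ → sum-*ˡ (θ r c) _ (picks R)) ⟩
    Σpicks (λ c R → Σpicks (λ c′ R′ → θ r c * (θ r′ c′ * det rs R′)) R) cs ≈⟨ Σpicks-swap _ cs ⟩
    Σpicks (λ c R → Σpicks (λ c′ R′ → θ r c′ * (θ r′ c * det rs R′)) R) cs
      ≈⟨ Σpicks-cong cs (λ c R _ → trans (Σpicks-cong R (λ c′ R′ _ → x*yz≈y*xz _ _ _)) (sym (sum-*ˡ _ _ (picks R)))) ⟩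
    Σpicks (λ c R → θ r′ c * det (r ∷ rs) R) cs
      ≈⟨ Σpicks-zero cs (λ c R _ → trans (*-congˡ (det-row-repeated m R)) (zeroʳ _)) ⟩
    0# ∎

  det-expand-column : ∀ rs s cs → det rs (s ∷ cs) ≈ Σpicks (λ r rs′ → θ r s * det rs′ cs) rs
  det-expand-column [] s cs = refl
  det-expand-column (r ∷ rs) s cs = begin
    det (r ∷ rs) (s ∷ cs) ≈⟨ Σpicks-∷ _ s cs ⟩
    θ r s * det rs cs + Σpicks (λ c R → θ r c * det rs (s ∷ R)) cs
      ≈⟨ +-congˡ (Σpicks-cong cs (λ c R _ → trans (*-congˡ (det-expand-column rs s R)) (sum-*ˡ _ _ (picks rs)))) ⟩
    θ r s * det rs cs + Σpicks (λ c R → Σpicks (λ r′ rs′ → θ r c * (θ r′ s * det rs′ R)) rs) cs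
      ≈⟨ +-congˡ (sum-swap _ (picks cs) (picks rs)) ⟩
    θ r s * det rs cs + Σpicks (λ r′ rs′ → Σpicks (λ c R → θ r c * (θ r′ s * det rs′ R)) cs) rs
      ≈⟨ +-congˡ (Σpicks-cong rs (λ r′ rs′ _ → trans (Σpicks-cong cs (λ c R _ → x*yz≈y*xz _ _ _)) (sym (sum-*ˡ _ _ (picks cs))))) ⟩
    θ r s * det rs cs + Σpicks (λ r′ rs′ → θ r′ s * det (r ∷ rs′) cs) rs ≈⟨ Σpicks-∷ _ r rs ⟨
    Σpicks (λ r′ rs′ → θ r′ s * det rs′ cs) (r ∷ rs) ∎

  -- Expanding the first factor along the column `s` leaves, for each row `r`, the expansion of a
  -- determinant on `hs` in which the row `r` occurs twice.
  plücker : ∀ rs cs hs → Σpicks (λ s R → det rs (s ∷ cs) * det rs R) hs ≈ 0#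
  plücker rs cs hs = begin
    Σpicks (λ s R → det rs (s ∷ cs) * det rs R) hs
      ≈⟨ Σpicks-cong hs (λ s R _ → trans (*-congʳ (det-expand-column rs s cs)) (sum-*ʳ _ _ (picks rs))) ⟩
    Σpicks (λ s R → Σpicks (λ r rs′ → θ r s * det rs′ cs * det rs R) rs) hs ≈⟨ sum-swap _ (picks hs) (picks rs) ⟩
    Σpicks (λ r rs′ → Σpicks (λ s R → θ r s * det rs′ cs * det rs R) hs) rs
      ≈⟨ Σpicks-zero rs (λ r rs′ p → trans (Σpicks-cong hs (λ s R _ → move _ _ _)) (trans (sym (sum-*ˡ _ _ (picks hs)))
           (trans (*-congˡ (det-row-repeated (∈-resp-↭ p (here ≡.refl)) hs)) (zeroʳ _)))) ⟩
    0# ∎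
    where
    move : ∀ a b c → a * b * c ≈ b * (a * c)
    move a b c = trans (*-congʳ (*-comm a b)) (*-assoc b a c)

  module _ (δ : Derivation cring) where
    open DerivationProperties δ

    der-det-zero : ∀ rs cs → (∀ {r v} → r ∈ rs → v ∈ cs → der (θ r v) ≈ 0#) → der (det rs cs) ≈ 0#
    der-det-zero [] [] h = der-1
    der-det-zero [] (_ ∷ _) h = der-0
    der-det-zero (r ∷ rs) cs h = trans (der-sum _ (picks cs)) (Σpicks-zero cs (λ c R p →
      der-*-zero (h (here ≡.refl) (∈-resp-↭ p (here ≡.refl)))
        (der-det-zero rs R (λ m m′ → h (there m) (∈-resp-↭ p (there m′))))))

  -- The derivative in the variable at the first row and first column is the complementary minor,
  -- which is non-zero by induction.
  det≉0 : ∀ {rs cs} → Unique rs → Unique cs → length rs ≡ length cs → ¬ (det rs cs ≈ 0#)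
  det≉0 {[]} {[]} _ _ _ = 1≉0
  det≉0 {r ∷ rs} {c ∷ cs} (r∉ ∷ ur) (c∉ ∷ uc) eq z = det≉0 ur uc (suc-injective eq) (begin
    det rs cs ≈⟨ trans (*-congʳ (∂-same (r , c))) (*-identityˡ _) ⟨
    der (θ r c) * det rs cs ≈⟨ der-*-const _ (const cs) ⟨
    der (θ r c * det rs cs) ≈⟨ +-identityʳ _ ⟨
    der (θ r c * det rs cs) + 0# ≈⟨ +-congˡ (trans (der-sum _ (picks cs)) (Σpicks-zero cs (λ s R p → der-*-zero
         (∂-other (λ e → All.lookup c∉ (∈-resp-↭ p (here ≡.refl)) (≡.cong proj₂ e))) (const (c ∷ R))))) ⟨
    der (θ r c * det rs cs) + der (Σpicks (λ s R → θ r s * det rs (c ∷ R)) cs) ≈⟨ der-+ _ _ ⟨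
    der (θ r c * det rs cs + Σpicks (λ s R → θ r s * det rs (c ∷ R)) cs) ≈⟨ der-cong (Σpicks-∷ _ c cs) ⟨
    der (det (r ∷ rs) (c ∷ cs)) ≈⟨ trans (der-cong z) der-0 ⟩
    0# ∎)
    where
    open DerivationProperties (∂ (r , c))
    const : ∀ xs → der (det rs xs) ≈ 0#
    const xs = der-det-zero (∂ (r , c)) rs xs (λ m _ → ∂-other (λ e → All.lookup r∉ m (≡.cong proj₁ e)))

  -- The derivation replacing column a by column w, that is Σᵣ θ r w · ∂/∂θ(r , a).
  module ColumnMove (rows : List Row) (uniq : Unique rows) (w a : V) where
    move : Derivation cring
    move = record
      { der = λ x → sumL (λ r → θ r w * d r x) rows
      ; der-cong = λ p → sum-cong rows (λ r → *-congˡ (Derivation.der-cong (∂ (r , a)) p))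
      ; der-+ = λ x y → trans (sum-cong rows (λ r → trans (*-congˡ (Derivation.der-+ (∂ (r , a)) x y)) (distribˡ _ _ _))) (sum-+ _ _ rows)
      ; der-* = λ x y → trans (sum-cong rows (λ r → trans (*-congˡ (Derivation.der-* (∂ (r , a)) x y)) (RingIdentities.leibniz cring _ _ _ _ _)))
          (trans (sum-+ _ _ rows) (+-cong (sym (sum-*ʳ _ y rows)) (sym (sum-*ˡ x _ rows)))) }
      where
      d : Row → Carrier → Carrier
      d r = Derivation.der (∂ (r , a))

    open DerivationProperties move public

    move-θ : ∀ {r} → r ∈ rows → der (θ r a) ≈ θ r w
    move-θ {r} m = trans (sum-single uniq m (λ {r′} _ ne → trans (*-congˡ (∂-other (λ e → ne (≡.cong proj₁ e)))) (zeroʳ _)))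
      (trans (*-congˡ (∂-same (r , a))) (*-identityʳ _))

    move-other : ∀ {r v} → v ≢ a → der (θ r v) ≈ 0#
    move-other ne = sum-zero rows (λ r′ → trans (*-congˡ (∂-other (λ e → ne (≡.sym (≡.cong proj₂ e))))) (zeroʳ _))

    move-det-∉ : ∀ rs {cs} → a ∉ cs → der (det rs cs) ≈ 0#
    move-det-∉ rs {cs} a∉ = der-det-zero move rs cs (λ _ m → move-other (λ { ≡.refl → a∉ m }))

    move-det : ∀ rs {cs} → (∀ {r} → r ∈ rs → r ∈ rows) → a ∉ cs → der (det rs (a ∷ cs)) ≈ det rs (w ∷ cs)
    move-det rs {cs} sub a∉ = begin
      der (det rs (a ∷ cs)) ≈⟨ trans (der-cong (det-expand-column rs a cs)) (der-sum _ (picks rs)) ⟩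
      Σpicks (λ r rs′ → der (θ r a * det rs′ cs)) rs
        ≈⟨ Σpicks-cong rs (λ r rs′ p → trans (der-*-const _ (move-det-∉ rs′ a∉)) (*-congʳ (move-θ (sub (∈-resp-↭ p (here ≡.refl)))))) ⟩
      Σpicks (λ r rs′ → θ r w * det rs′ cs) rs ≈⟨ det-expand-column rs w cs ⟨
      det rs (w ∷ cs) ∎

-- The differential identity for products of maximal minors

data Even : ℕ → Set where
  even-0 : Even 0
  even-2+ : ∀ {n} → Even n → Even (2 ℕ.+ n)

even-double : ∀ n → Even (n ℕ.+ n)
even-double zero = even-0
even-double (suc n) rewrite ℕP.+-suc n n = even-2+ (even-double n)

picks-length : {A : Set} (xs : List A) → length (picks xs) ≡ length xs
picks-length [] = ≡.refl
picks-length (x ∷ xs) = ≡.cong suc (≡.trans (length-map _ (picks xs)) (picks-length xs))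

unique-extend : {A : Set} (xs : List A) {ys : List A} → Unique xs → (∀ {x} → x ∈ xs → x ∈ ys) → ∃[ zs ] xs ++ zs ↭ ys
unique-extend [] {ys} u h = ys , ↭-refl
unique-extend (x ∷ xs) (x∉ ∷ u) h with ∈⇒↭ (h (here ≡.refl))
... | r , p with unique-extend xs u (λ {y} m → back y m (∈-resp-↭ (↭-sym p) (h (there m))))
  where
  back : ∀ y → y ∈ xs → y ∈ x ∷ r → y ∈ r
  back y m (here ≡.refl) = contradiction ≡.refl (All.lookup x∉ m)
  back y m (there n) = n
... | zs , q = zs , ↭-trans (prep x q) p

module Splittings (R : CommutativeRing 0ℓ 0ℓ) {V : Set} where
  open CommutativeRing R
  open RingSums R
  open SetoidReasoning setoid

  Σsplit : List V → ℕ → (List V → List V → Carrier) → Carrier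
  Σsplit U zero h = h [] U
  Σsplit [] (suc k) h = 0#
  Σsplit (x ∷ U) (suc k) h = Σsplit U (suc k) (λ B B′ → h B (x ∷ B′)) + Σsplit U k (λ B B′ → h (x ∷ B) B′)

  split-cong : ∀ U k {h h′} → (∀ B B′ → B ++ B′ ↭ U → length B ≡ k → h B B′ ≈ h′ B B′) → Σsplit U k h ≈ Σsplit U k h′
  split-cong U zero e = e [] U ↭-refl ≡.refl
  split-cong [] (suc k) e = refl
  split-cong (x ∷ U) (suc k) e = +-cong
    (split-cong U (suc k) (λ B B′ p l → e B (x ∷ B′) (↭-trans (PermP.shift x B B′) (prep x p)) l))
    (split-cong U k (λ B B′ p l → e (x ∷ B) B′ (prep x p) (≡.cong suc l)))

  split-+ : ∀ U k f g → Σsplit U k (λ B B′ → f B B′ + g B B′) ≈ Σsplit U k f + Σsplit U k g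
  split-+ U zero f g = refl
  split-+ [] (suc k) f g = sym (+-identityˡ 0#)
  split-+ (x ∷ U) (suc k) f g = trans (+-cong (split-+ U (suc k) _ _) (split-+ U k _ _)) (interchange _ _ _ _)

  split-*ˡ : ∀ U k c f → c * Σsplit U k f ≈ Σsplit U k (λ B B′ → c * f B B′)
  split-*ˡ U zero c f = refl
  split-*ˡ [] (suc k) c f = zeroʳ c
  split-*ˡ (x ∷ U) (suc k) c f = trans (distribˡ _ _ _) (+-cong (split-*ˡ U (suc k) c _) (split-*ˡ U k c _))

  split-over : ∀ U j h → Σsplit U (suc (length U ℕ.+ j)) h ≈ 0#
  split-over [] j h = refl
  split-over (x ∷ U) j h = trans (+-cong (trans (reflexive (≡.cong (λ n → Σsplit U (suc n) (λ B B′ → h B (x ∷ B′))) (≡.sym (ℕP.+-suc (length U) j)))) (split-over U (suc j) _)) (split-over U j _)) (+-identityˡ _)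

  split-all : ∀ U h → Σsplit U (length U) h ≈ h U []
  split-all [] h = refl
  split-all (x ∷ U) h = trans (+-cong (trans (reflexive (≡.cong (λ n → Σsplit U (suc n) _) (≡.sym (ℕP.+-identityʳ (length U))))) (split-over U 0 _)) (split-all U _)) (+-identityˡ _)

  -- Both sides choose `k` entries and one further entry `s`. This works because `g` depends only on
  -- `s` and on what is left after both choices.
  split-exchange : ∀ U k (g : V → List V → Carrier) →
    Σsplit U (suc k) (λ B B′ → sumL (λ s → g s B′) B) ≈ Σsplit U k (λ B B′ → Σpicks g B′)
  split-exchange [] zero g = refl
  split-exchange [] (suc k) g = refl
  split-exchange (x ∷ U) zero g = begin
    Σsplit U 1 (λ B B′ → sumL (λ s → g s (x ∷ B′)) B) + (g x U + 0#)
      ≈⟨ +-cong (split-exchange U 0 (λ s r → g s (x ∷ r))) (+-identityʳ _) ⟩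
    Σpicks (λ s r → g s (x ∷ r)) U + g x U ≈⟨ +-comm _ _ ⟩
    g x U + Σpicks (λ s r → g s (x ∷ r)) U ≈⟨ Σpicks-∷ g x U ⟨
    Σpicks g (x ∷ U) ∎
  split-exchange (x ∷ U) (suc k) g = begin
    Σsplit U (2 ℕ.+ k) (λ B B′ → sumL (λ s → g s (x ∷ B′)) B) + Σsplit U (suc k) (λ B B′ → g x B′ + sumL (λ s → g s B′) B)
      ≈⟨ +-cong (split-exchange U (suc k) (λ s r → g s (x ∷ r))) (trans (split-+ U (suc k) _ _) (+-congˡ (split-exchange U k g))) ⟩
    Σsplit U (suc k) (λ B B′ → Σpicks (λ s r → g s (x ∷ r)) B′) + (Σsplit U (suc k) (λ B B′ → g x B′) + Σsplit U k (λ B B′ → Σpicks g B′))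
      ≈⟨ +-assoc _ _ _ ⟨
    Σsplit U (suc k) (λ B B′ → Σpicks (λ s r → g s (x ∷ r)) B′) + Σsplit U (suc k) (λ B B′ → g x B′) + Σsplit U k (λ B B′ → Σpicks g B′)
      ≈⟨ +-congʳ (trans (+-comm _ _) (sym (split-+ U (suc k) _ _))) ⟩
    Σsplit U (suc k) (λ B B′ → g x B′ + Σpicks (λ s r → g s (x ∷ r)) B′) + Σsplit U k (λ B B′ → Σpicks g B′)
      ≈⟨ +-congʳ (split-cong U (suc k) (λ B B′ _ _ → Σpicks-∷ g x B′)) ⟨
    Σsplit U (suc k) (λ B B′ → Σpicks g (x ∷ B′)) + Σsplit U k (λ B B′ → Σpicks g B′) ∎

  -- The entry `s` is taken out before the splitting instead of from the complement afterwards.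
  split-picks : ∀ U k (g : V → List V → Carrier) →
    Σsplit U k (λ B B′ → Σpicks g B′) ≈ Σpicks (λ s U′ → Σsplit U′ k (λ B r → g s r)) U
  split-picks U zero g = refl
  split-picks [] (suc k) g = refl
  split-picks (x ∷ U) (suc k) g = begin
    Σsplit U (suc k) (λ B B′ → Σpicks g (x ∷ B′)) + Σsplit U k (λ B B′ → Σpicks g B′)
      ≈⟨ +-cong (trans (split-cong U (suc k) (λ B B′ _ _ → Σpicks-∷ g x B′)) (split-+ U (suc k) _ _)) (split-picks U k g) ⟩
    Σsplit U (suc k) (λ B B′ → g x B′) + Σsplit U (suc k) (λ B B′ → Σpicks (λ s r → g s (x ∷ r)) B′) + Σpicks (λ s U′ → Σsplit U′ k (λ B r → g s r)) U
      ≈⟨ trans (+-assoc _ _ _) (+-congˡ (+-congʳ (split-picks U (suc k) (λ s r → g s (x ∷ r))))) ⟩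
    Σsplit U (suc k) (λ B B′ → g x B′) + (Σpicks (λ s U′ → Σsplit U′ (suc k) (λ B r → g s (x ∷ r))) U + Σpicks (λ s U′ → Σsplit U′ k (λ B r → g s r)) U)
      ≈⟨ +-congˡ (sum-+ _ _ (picks U)) ⟨
    Σsplit U (suc k) (λ B B′ → g x B′) + Σpicks (λ s U′ → Σsplit (x ∷ U′) (suc k) (λ B r → g s r)) U
      ≈⟨ Σpicks-∷ _ x U ⟨
    Σpicks (λ s U′ → Σsplit U′ (suc k) (λ B r → g s r)) (x ∷ U) ∎

-- The differential identity behind anisotropy: iterated column moves turn a product of maximal minors into one minor times squares.
module MinorProducts {Row V : Set} (_≟_ : DecidableEquality V) (G : GenericDomain (Row × V))
                     (rows : List Row) (uniq : Unique rows) where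
  open GenericDomain G
  open RingSums cring
  open Char2 G
  open Determinants G
  open Splittings cring {V}
  open SetoidReasoning setoid
  open ColumnMove rows uniq using (move)

  br : List V → Carrier
  br = det rows

  br-↭ : ∀ {cs cs′} → cs ↭ cs′ → br cs ≈ br cs′
  br-↭ = det-↭ rows

  moves : List (V × V) → Carrier → Carrier
  moves [] x = x
  moves ((w , a) ∷ qs) x = moves qs (Derivation.der (move w a) x)

  moves-cong : ∀ qs {x y} → x ≈ y → moves qs x ≈ moves qs y
  moves-cong [] e = e
  moves-cong ((w , a) ∷ qs) e = moves-cong qs (Derivation.der-cong (move w a) e)

  moves-0 : ∀ qs → moves qs 0# ≈ 0#
  moves-0 [] = refl
  moves-0 ((w , a) ∷ qs) = trans (moves-cong qs (Derivation.der-0 (move w a))) (moves-0 qs)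

  moves-+ : ∀ qs x y → moves qs (x + y) ≈ moves qs x + moves qs y
  moves-+ [] x y = refl
  moves-+ ((w , a) ∷ qs) x y = trans (moves-cong qs (Derivation.der-+ (move w a) x y)) (moves-+ qs _ _)

  moves-square-* : ∀ qs x y → moves qs (x * x * y) ≈ x * x * moves qs y
  moves-square-* [] x y = refl
  moves-square-* ((w , a) ∷ qs) x y = trans (moves-cong qs (DerivationProperties.der-square-* (move w a) x y)) (moves-square-* qs x _)

  moves-sum : ∀ qs {I : Set} (f : I → Carrier) xs → moves qs (sumL f xs) ≈ sumL (λ x → moves qs (f x)) xs
  moves-sum qs f [] = moves-0 qs
  moves-sum qs f (x ∷ xs) = trans (moves-+ qs _ _) (+-congˡ (moves-sum qs f xs))

  -- A certificate that no variable of column `a` is involved. It is built from the ring operations,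
  -- so that closure under moves is a structural induction and no support of a polynomial has to be
  -- defined.
  data FreeOf (a : V) : Carrier → Set where
    generator : ∀ {r v} → r ∈ rows → v ≢ a → FreeOf a (θ r v)
    free-0 : FreeOf a 0#
    free-1 : FreeOf a 1#
    free-+ : ∀ {x y} → FreeOf a x → FreeOf a y → FreeOf a (x + y)
    free-* : ∀ {x y} → FreeOf a x → FreeOf a y → FreeOf a (x * y)
    free-≈ : ∀ {x y} → x ≈ y → FreeOf a x → FreeOf a y

  free-sum : ∀ {a} {I : Set} {f : I → Carrier} xs → (∀ {x} → x ∈ xs → FreeOf a (f x)) → FreeOf a (sumL f xs)
  free-sum [] h = free-0
  free-sum (x ∷ xs) h = free-+ (h (here ≡.refl)) (free-sum xs (h ∘ there))

  free-prod : ∀ {a} {I : Set} {f : I → Carrier} xs → (∀ {x} → x ∈ xs → FreeOf a (f x)) → FreeOf a (prodL f xs)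
  free-prod [] h = free-1
  free-prod (x ∷ xs) h = free-* (h (here ≡.refl)) (free-prod xs (h ∘ there))

  free-det : ∀ {a} rs {cs} → (∀ {r} → r ∈ rs → r ∈ rows) → a ∉ cs → FreeOf a (det rs cs)
  free-det [] {[]} h a∉ = free-1
  free-det [] {_ ∷ _} h a∉ = free-0
  free-det (r ∷ rs) {cs} h a∉ = free-sum (picks cs) (λ {p} m → let q = picks-↭ m in
    free-* (generator (h (here ≡.refl)) (λ { ≡.refl → a∉ (∈-resp-↭ q (here ≡.refl)) }))
           (free-det rs (h ∘ there) (λ m′ → a∉ (∈-resp-↭ q (there m′)))))

  free-move : ∀ {a w a′ x} → w ≢ a → FreeOf a x → FreeOf a (Derivation.der (move w a′) x)
  free-move {a} {w} {a′} ne = go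
    where
    open ColumnMove rows uniq w a′ hiding (move)
    go : ∀ {x} → FreeOf a x → FreeOf a (der x)
    go (generator {r} {v} m _) with v ≟ a′
    ... | yes ≡.refl = free-≈ (sym (move-θ m)) (generator m ne)
    ... | no v≢a′ = free-≈ (sym (move-other v≢a′)) free-0
    go free-0 = free-≈ (sym der-0) free-0
    go free-1 = free-≈ (sym der-1) free-0
    go (free-+ p q) = free-≈ (sym (der-+ _ _)) (free-+ (go p) (go q))
    go (free-* p q) = free-≈ (sym (der-* _ _)) (free-+ (free-* (go p) q) (free-* p (go q)))
    go (free-≈ e p) = free-≈ (der-cong e) (go p)

  move-free : ∀ {a w x} → FreeOf a x → Derivation.der (move w a) x ≈ 0#
  move-free {a} {w} = go
    where
    open ColumnMove rows uniq w a hiding (move)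
    go : ∀ {x} → FreeOf a x → der x ≈ 0#
    go (generator m ne) = move-other ne
    go free-0 = der-0
    go free-1 = der-1
    go (free-+ p q) = trans (der-+ _ _) (trans (+-cong (go p) (go q)) (+-identityˡ _))
    go (free-* p q) = der-*-zero (go p) (go q)
    go (free-≈ e p) = trans (der-cong (sym e)) (go p)

  -- Until the turn of column `a` comes, no move brings this column in, since it is not among the
  -- replacing columns; then its own move kills everything.
  moves-free : ∀ {a} qs {x} → a ∈ map proj₂ qs → a ∉ map proj₁ qs → FreeOf a x → moves qs x ≈ 0#
  moves-free ((w , a) ∷ qs) (here ≡.refl) a∉ fr = trans (moves-cong qs (move-free fr)) (moves-0 qs)
  moves-free ((w , a′) ∷ qs) (there m) a∉ fr = moves-free qs m (a∉ ∘ there) (free-move (λ e → a∉ (here (≡.sym e))) fr)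

  -- In the application `C` is a facet with the vertex `z` added, so that by Cramer's rule `X` lists
  -- the coefficients of the linear relation among its columns.
  module Circuit (C : List V) (uC : Unique C) (X : V → Carrier)
                 (X-minor : ∀ {s r} → s ∷ r ↭ C → X s ≈ br r)
                 (X≉0 : ∀ {s} → s ∈ C → ¬ (X s ≈ 0#)) where

    P : List V → Carrier
    P = prodL X

    unique-↭ : ∀ {xs} → xs ↭ C → Unique xs
    unique-↭ p = unique-resp-↭ (↭-sym p) uC

    head∉ : ∀ {x xs} → x ∷ xs ↭ C → x ∉ xs
    head∉ p m with unique-↭ p
    ... | x∉ ∷ _ = All.lookup x∉ m ≡.refl

    module _ (w a : V) where
      open ColumnMove rows uniq w a hiding (move)

      move-X : ∀ {s R} → a ∷ s ∷ R ↭ C → der (X s) ≈ br (w ∷ R)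
      move-X {s} {R} p = trans (der-cong (X-minor (↭-trans (swap s a ↭-refl) p)))
        (move-det rows id (λ m → head∉ p (there m)))

      move-Xa : ∀ {R} → a ∷ R ↭ C → der (X a) ≈ 0#
      move-Xa p = trans (der-cong (X-minor p)) (move-det-∉ rows (head∉ p))

      -- The Plücker relation on `w ∷ B ++ K`: the derivative of `X s` is the minor in which `w` has
      -- replaced `a`, and the terms with `s` in `K` vanish because such an `s` already occurs in
      -- `Gs`.
      exchange : ∀ B K Gs → a ∷ B ++ K ↭ C → (∀ {k} → k ∈ K → k ∈ Gs) →
        sumL (λ s → der (X s) * br (s ∷ Gs)) B ≈ X a * br (w ∷ Gs)
      exchange B K Gs p sub = +≈0⇒≈ (begin
        sumL (λ s → der (X s) * br (s ∷ Gs)) B + X a * br (w ∷ Gs)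
          ≈⟨ +-cong toPicks (trans (*-congʳ (X-minor p)) (*-comm _ _)) ⟩
        Σpicks (λ s R → br (s ∷ Gs) * br (w ∷ R)) (B ++ K) + br (w ∷ Gs) * br (B ++ K) ≈⟨ +-comm _ _ ⟩
        br (w ∷ Gs) * br (B ++ K) + Σpicks (λ s R → br (s ∷ Gs) * br (w ∷ R)) (B ++ K)
          ≈⟨ Σpicks-∷ (λ s R → br (s ∷ Gs) * br R) w (B ++ K) ⟨
        Σpicks (λ s R → br (s ∷ Gs) * br R) (w ∷ B ++ K) ≈⟨ plücker rows Gs (w ∷ B ++ K) ⟩
        0# ∎)
        where
        term : ∀ s R → s ∷ R ↭ B ++ K → der (X s) * br (s ∷ Gs) ≈ br (s ∷ Gs) * br (w ∷ R)
        term s R q = trans (*-congʳ (move-X (↭-trans (prep a q) p))) (*-comm _ _)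
        toPicks : sumL (λ s → der (X s) * br (s ∷ Gs)) B ≈ Σpicks (λ s R → br (s ∷ Gs) * br (w ∷ R)) (B ++ K)
        toPicks = begin
          sumL (λ s → der (X s) * br (s ∷ Gs)) B ≈⟨ +-identityʳ _ ⟨
          sumL (λ s → der (X s) * br (s ∷ Gs)) B + 0#
            ≈⟨ +-congˡ (sum-zero-∈ K (λ m → trans (*-congˡ (det-repeated rows (sub m))) (zeroʳ _))) ⟨
          sumL (λ s → der (X s) * br (s ∷ Gs)) B + sumL (λ s → der (X s) * br (s ∷ Gs)) K ≈⟨ sum-++ _ B K ⟨
          sumL (λ s → der (X s) * br (s ∷ Gs)) (B ++ K) ≈⟨ Σpicks-const _ (B ++ K) ⟩
          Σpicks (λ s _ → der (X s) * br (s ∷ Gs)) (B ++ K) ≈⟨ Σpicks-cong (B ++ K) term ⟩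
          Σpicks (λ s R → br (s ∷ Gs) * br (w ∷ R)) (B ++ K) ∎

    -- These sums interpolate between a product of minors and a single minor: for `k = 0` only
    -- `P U * br (U ++ E)` remains, for `k = length U` only `br E`.
    N : List V → ℕ → List V → Carrier
    N U k E = Σsplit U k (λ B B′ → P B′ * br (B′ ++ E))

    N-↭ : ∀ U k {E E′} → E ↭ E′ → N U k E ≈ N U k E′
    N-↭ U k p = split-cong U k (λ B B′ _ _ → *-congˡ (br-↭ (PermP.++⁺ˡ B′ p)))

    private
      sum-even : ∀ {I : Set} c (xs : List I) → Even (length xs) → sumL (λ _ → c) xs ≈ 0#
      sum-even c [] e = refl
      sum-even c (x ∷ y ∷ xs) (even-2+ e) = trans (sym (+-assoc _ _ _)) (trans (+-cong (char2 c) (sum-even c xs e)) (+-identityˡ _))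

      singleton : ∀ {f : Carrier} (B : List V) → length B ≡ 1 → f ≈ sumL (λ _ → f) B
      singleton (x ∷ []) _ = sym (+-identityʳ _)

    -- Without pairs, `br (r ++ K)` is the missing factor `X s`, so every summand equals `P U`, and
    -- an even number of equal summands cancels. Otherwise multiplication by `X a` allows an
    -- exchange of `a` against an entry `s` of `B`; then `s` and `a` join `K`, and `U` and `ps` both
    -- become shorter by one, which preserves the parity.
    N-vanish : ∀ ps U K → map proj₂ ps ++ U ++ K ↭ C → Even (length U ℕ.+ length ps) →
      N U (suc (length ps)) (map proj₁ ps ++ map proj₂ ps ++ K) ≈ 0#
    N-vanish [] U K p ev = begin
      N U 1 K ≈⟨ split-cong U 1 (λ B B′ _ l → singleton B l) ⟩
      Σsplit U 1 (λ B B′ → sumL (λ s → P B′ * br (B′ ++ K)) B) ≈⟨ split-exchange U 0 (λ s r → P r * br (r ++ K)) ⟩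
      Σpicks (λ s r → P r * br (r ++ K)) U
        ≈⟨ Σpicks-cong U (λ s r q → trans (*-congˡ (sym (X-minor (↭-trans (PermP.++⁺ʳ K q) p)))) (trans (*-comm _ _) (prod-↭ X q))) ⟩
      Σpicks (λ _ _ → P U) U
        ≈⟨ sum-even (P U) (picks U) (≡.subst Even (≡.trans (ℕP.+-identityʳ _) (≡.sym (picks-length U))) ev) ⟩
      0# ∎
    N-vanish ((w , a) ∷ ps) U K p ev = cancelˡ (X≉0 (∈-resp-↭ p (here ≡.refl))) (begin
      X a * N U (2 ℕ.+ k) (w ∷ ws ++ a ∷ as ++ K) ≈⟨ split-*ˡ U (2 ℕ.+ k) _ _ ⟩
      Σsplit U (2 ℕ.+ k) (λ B B′ → X a * (P B′ * br (B′ ++ w ∷ ws ++ a ∷ as ++ K))) ≈⟨ split-cong U (2 ℕ.+ k) (λ B B′ q _ → rewriteTerm B B′ q) ⟩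
      Σsplit U (2 ℕ.+ k) (λ B B′ → sumL (λ s → g s B′) B) ≈⟨ split-exchange U (suc k) g ⟩
      Σsplit U (suc k) (λ B B′ → Σpicks g B′) ≈⟨ split-picks U (suc k) g ⟩
      Σpicks (λ s U′ → Σsplit U′ (suc k) (λ B r → g s r)) U ≈⟨ Σpicks-zero U vanish ⟩
      0# ∎)
      where
      ws as : List V
      ws = map proj₁ ps
      as = map proj₂ ps
      k : ℕ
      k = length ps
      Z : V → Carrier
      Z s = Derivation.der (move w a) (X s)
      g : V → List V → Carrier
      g s r = P r * (Z s * br (s ∷ r ++ ws ++ a ∷ as ++ K))
      rewriteTerm : ∀ B B′ → B ++ B′ ↭ U → X a * (P B′ * br (B′ ++ w ∷ ws ++ a ∷ as ++ K)) ≈ sumL (λ s → g s B′) B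
      rewriteTerm B B′ q = begin
        X a * (P B′ * br (B′ ++ w ∷ ws ++ a ∷ as ++ K)) ≈⟨ x*yz≈y*xz _ _ _ ⟩
        P B′ * (X a * br (B′ ++ w ∷ ws ++ a ∷ as ++ K)) ≈⟨ *-congˡ (*-congˡ (br-↭ (PermP.shift w B′ _))) ⟩
        P B′ * (X a * br (w ∷ B′ ++ ws ++ a ∷ as ++ K)) ≈⟨ *-congˡ (exchange w a B (B′ ++ as ++ K) _ perm sub) ⟨
        P B′ * sumL (λ s → Z s * br (s ∷ B′ ++ ws ++ a ∷ as ++ K)) B ≈⟨ sum-*ˡ _ _ B ⟩
        sumL (λ s → g s B′) B ∎
        where
        perm : a ∷ B ++ B′ ++ as ++ K ↭ C
        perm = ↭-trans (prep a (↭-trans (↭-reflexive (≡.sym (LP.++-assoc B B′ (as ++ K)))) (↭-trans (PermP.++⁺ʳ (as ++ K) q)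
          (↭-trans (↭-reflexive (≡.sym (LP.++-assoc U as K))) (↭-trans (PermP.++⁺ʳ K (PermP.++-comm U as)) (↭-reflexive (LP.++-assoc as U K))))))) p
        sub : ∀ {v} → v ∈ B′ ++ as ++ K → v ∈ B′ ++ ws ++ a ∷ as ++ K
        sub m with ∈-++⁻ B′ m
        ... | inj₁ x = ∈-++⁺ˡ x
        ... | inj₂ y = ∈-++⁺ʳ B′ (∈-++⁺ʳ ws (there y))
      vanish : ∀ s U′ → s ∷ U′ ↭ U → Σsplit U′ (suc k) (λ B r → g s r) ≈ 0#
      vanish s U′ q = begin
        Σsplit U′ (suc k) (λ B r → g s r)
          ≈⟨ split-cong U′ (suc k) (λ B r _ _ → trans (x*yz≈y*xz _ _ _) (*-congˡ (*-congˡ (br-↭ (perm r))))) ⟩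
        Σsplit U′ (suc k) (λ B r → Z s * (P r * br (r ++ ws ++ as ++ s ∷ a ∷ K))) ≈⟨ split-*ˡ U′ (suc k) _ _ ⟨
        Z s * N U′ (suc k) (ws ++ as ++ s ∷ a ∷ K) ≈⟨ *-congˡ (N-vanish ps U′ (s ∷ a ∷ K) perm₂ ev′) ⟩
        Z s * 0# ≈⟨ zeroʳ _ ⟩
        0# ∎
        where
        perm : ∀ r → s ∷ r ++ ws ++ a ∷ as ++ K ↭ r ++ ws ++ as ++ s ∷ a ∷ K
        perm r = ↭-trans (↭-sym (PermP.shift s r _)) (PermP.++⁺ˡ r (↭-trans (↭-sym (PermP.shift s ws _)) (PermP.++⁺ˡ ws
          (↭-trans (prep s (↭-sym (PermP.shift a as K))) (↭-sym (PermP.shift s as (a ∷ K)))))))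
        perm₂ : as ++ U′ ++ s ∷ a ∷ K ↭ C
        perm₂ = ↭-trans (PermP.++⁺ˡ as (↭-trans (PermP.shift s U′ (a ∷ K)) (↭-trans (prep s (PermP.shift a U′ K))
          (↭-trans (swap s a ↭-refl) (prep a (PermP.++⁺ʳ K q)))))) (↭-trans (PermP.shift a as (U ++ K)) p)
        ev′ : Even (length U′ ℕ.+ k)
        ev′ with ≡.subst (λ n → Even (n ℕ.+ suc k)) (≡.sym (↭-length q)) ev
        ... | e rewrite ℕP.+-suc (length U′) k with e
        ... | even-2+ e′ = e′

    -- One move carries one interpolating sum to the next. The splittings of `a ∷ U` are sorted by
    -- the side on which `a` lies. The exchange relation involves `z ∷ B` rather than `B`, and the
    -- terms caused by `z` vanish together by parity.
    module Step (w a z : V) (ps : List (V × V)) (U K : List V)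
                (perm : z ∷ map proj₂ ps ++ (a ∷ U) ++ K ↭ C) (a∉ws : a ∉ map proj₁ ps)
                (ev : Even (length (a ∷ U) ℕ.+ length ps)) where
      open ColumnMove rows uniq w a hiding (move)

      ws as E : List V
      ws = map proj₁ ps
      as = map proj₂ ps
      E = ws ++ as ++ K

      Z : V → Carrier
      Z s = der (X s)

      Q : List V → Carrier
      Q = Σpicks (λ s r → Z s * P r)

      der-split : ∀ W k h → der (Σsplit W k h) ≈ Σsplit W k (λ B B′ → der (h B B′))
      der-split W zero h = refl
      der-split [] (suc k) h = der-0
      der-split (x ∷ W) (suc k) h = trans (der-+ _ _) (+-cong (der-split W (suc k) _) (der-split W k _))

      perm-a : a ∷ z ∷ as ++ U ++ K ↭ C
      perm-a = ↭-trans (swap a z ↭-refl) (↭-trans (prep z (↭-sym (PermP.shift a as (U ++ K)))) perm)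

      a∉E : a ∉ E
      a∉E m with ∈-++⁻ ws m
      ... | inj₁ x = a∉ws x
      ... | inj₂ y with ∈-++⁻ as y
      ...   | inj₁ x = head∉ perm-a (there (∈-++⁺ˡ x))
      ...   | inj₂ x = head∉ perm-a (there (∈-++⁺ʳ as (∈-++⁺ʳ U x)))

      a∉B′ : ∀ B B′ → B ++ B′ ↭ U → a ∉ B′ ++ E
      a∉B′ B B′ q m with ∈-++⁻ B′ m
      ... | inj₁ x = head∉ perm-a (there (∈-++⁺ʳ as (∈-++⁺ˡ (∈-resp-↭ q (∈-++⁺ʳ B x)))))
      ... | inj₂ x = a∉E x

      perm-B : ∀ B B′ → B ++ B′ ↭ U → a ∷ (z ∷ B) ++ (B′ ++ as ++ K) ↭ C
      perm-B B B′ q = ↭-trans (prep a (prep z (↭-trans (↭-reflexive (≡.sym (LP.++-assoc B B′ (as ++ K)))) (↭-trans (PermP.++⁺ʳ (as ++ K) q)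
          (↭-trans (↭-reflexive (≡.sym (LP.++-assoc U as K))) (↭-trans (PermP.++⁺ʳ K (PermP.++-comm U as)) (↭-reflexive (LP.++-assoc as U K)))))))) perm-a

      sub : ∀ B′ {v} → v ∈ B′ ++ as ++ K → v ∈ B′ ++ E
      sub B′ m with ∈-++⁻ B′ m
      ... | inj₁ x = ∈-++⁺ˡ x
      ... | inj₂ y = ∈-++⁺ʳ B′ (∈-++⁺ʳ ws y)

      exchange-z : ∀ B B′ Gs → B ++ B′ ↭ U → (∀ {v} → v ∈ B′ ++ as ++ K → v ∈ Gs) →
        sumL (λ s → Z s * br (s ∷ Gs)) B ≈ X a * br (w ∷ Gs) + Z z * br (z ∷ Gs)
      exchange-z B B′ Gs q h = begin
        sB ≈⟨ trans (sym (+-identityʳ _)) (+-congˡ (sym (char2 (Z z * br (z ∷ Gs))))) ⟩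
        sB + (Z z * br (z ∷ Gs) + Z z * br (z ∷ Gs)) ≈⟨ trans (sym (+-assoc _ _ _)) (+-congʳ (+-comm _ _)) ⟩
        Z z * br (z ∷ Gs) + sB + Z z * br (z ∷ Gs) ≈⟨ +-congʳ (exchange w a (z ∷ B) (B′ ++ as ++ K) Gs (perm-B B B′ q) h) ⟩
        X a * br (w ∷ Gs) + Z z * br (z ∷ Gs) ∎
        where
        sB : Carrier
        sB = sumL (λ s → Z s * br (s ∷ Gs)) B

      S⁻ : ℕ → Carrier
      S⁻ zero = 0#
      S⁻ (suc k) = N U k E

      N-split : ∀ k → N (a ∷ U) k E ≈ Σsplit U k (λ B B′ → P (a ∷ B′) * br (a ∷ B′ ++ E)) + S⁻ k
      N-split zero = sym (+-identityʳ _)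
      N-split (suc k) = refl

      W : List V → Carrier
      W Gs = X a * br (w ∷ Gs) + Z z * br (z ∷ Gs)

      der-S⁻ : ∀ k → der (S⁻ k) ≈ Σsplit U k (λ B B′ → P B′ * W (B′ ++ E))
      der-S⁻ k = trans (go k) (split-cong U k (λ B B′ q _ → trans (trans (sum-cong B (λ s → trans (*-congʳ (*-comm _ _)) (*-assoc _ _ _)))
          (sym (sum-*ˡ (P B′) _ B))) (*-congˡ (exchange-z B B′ (B′ ++ E) q (sub B′)))))
        where
        go : ∀ k → der (S⁻ k) ≈ Σsplit U k (λ B B′ → sumL (λ s → Z s * P B′ * br (s ∷ B′ ++ E)) B)
        go zero = der-0
        go (suc k) = begin
          der (N U k E) ≈⟨ der-split U k _ ⟩
          Σsplit U k (λ B B′ → der (P B′ * br (B′ ++ E)))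
            ≈⟨ split-cong U k (λ B B′ q _ → trans (der-*-const (P B′) (move-det-∉ rows (a∉B′ B B′ q))) (*-congʳ (der-prod X B′))) ⟩
          Σsplit U k (λ B B′ → Q B′ * br (B′ ++ E))
            ≈⟨ split-cong U k (λ B B′ _ _ → trans (sum-*ʳ _ _ (picks B′)) (Σpicks-cong B′ (λ s r q → *-congˡ (br-↭ (PermP.++⁺ʳ E (↭-sym q)))))) ⟩
          Σsplit U k (λ B B′ → Σpicks (λ s r → Z s * P r * br (s ∷ r ++ E)) B′) ≈⟨ split-exchange U k _ ⟨
          Σsplit U (suc k) (λ B B′ → sumL (λ s → Z s * P B′ * br (s ∷ B′ ++ E)) B) ∎

      der-first : ∀ B B′ → B ++ B′ ↭ U → der (P (a ∷ B′) * br (a ∷ B′ ++ E)) ≈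
        X a * Q B′ * br (a ∷ B′ ++ E) + P B′ * (X a * br (w ∷ B′ ++ E))
      der-first B B′ q = begin
        der (X a * P B′ * br (a ∷ B′ ++ E)) ≈⟨ der-* _ _ ⟩
        der (X a * P B′) * br (a ∷ B′ ++ E) + X a * P B′ * der (br (a ∷ B′ ++ E))
          ≈⟨ +-cong (*-congʳ (trans (der-const-* (move-Xa w a perm-a) _) (*-congˡ (der-prod X B′))))
                    (trans (*-congˡ (move-det rows id (a∉B′ B B′ q))) (trans (*-congʳ (*-comm _ _)) (*-assoc _ _ _))) ⟩
        X a * Q B′ * br (a ∷ B′ ++ E) + P B′ * (X a * br (w ∷ B′ ++ E)) ∎

      expand-Q : ∀ k → Σsplit U k (λ B B′ → X a * Q B′ * br (a ∷ B′ ++ E)) ≈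
        Σsplit U (suc k) (λ B B′ → X a * P B′ * W (a ∷ B′ ++ E))
      expand-Q k = begin
        Σsplit U k (λ B B′ → X a * Q B′ * br (a ∷ B′ ++ E))
          ≈⟨ split-cong U k (λ B B′ _ _ → trans (*-congʳ (sum-*ˡ (X a) _ (picks B′))) (trans (sum-*ʳ _ _ (picks B′))
               (Σpicks-cong B′ (λ s r q → *-congˡ (br-↭ (↭-trans (prep a (PermP.++⁺ʳ E (↭-sym q))) (swap a s ↭-refl))))))) ⟩
        Σsplit U k (λ B B′ → Σpicks (λ s r → X a * (Z s * P r) * br (s ∷ a ∷ r ++ E)) B′) ≈⟨ split-exchange U k _ ⟨
        Σsplit U (suc k) (λ B B′ → sumL (λ s → X a * (Z s * P B′) * br (s ∷ a ∷ B′ ++ E)) B)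
          ≈⟨ split-cong U (suc k) (λ B B′ q _ → trans (trans (sum-cong B (λ s → RingIdentities.x[yz]w≈xz[yw] cring _ _ _ _)) (sym (sum-*ˡ (X a * P B′) _ B)))
               (*-congˡ (exchange-z B B′ (a ∷ B′ ++ E) q (there ∘ sub B′)))) ⟩
        Σsplit U (suc k) (λ B B′ → X a * P B′ * W (a ∷ B′ ++ E)) ∎

      step : ∀ {k} → k ≡ length ps →
        der (N (a ∷ U) k E) ≈ X a * X a * N U (suc k) (w ∷ ws ++ a ∷ as ++ K)
      step {k} ≡.refl = begin
        der (N (a ∷ U) k E) ≈⟨ trans (der-cong (N-split k)) (der-+ _ _) ⟩
        der (Σsplit U k (λ B B′ → P (a ∷ B′) * br (a ∷ B′ ++ E))) + der (S⁻ k)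
          ≈⟨ +-cong (trans (der-split U k _) (split-cong U k (λ B B′ q _ → der-first B B′ q))) (der-S⁻ k) ⟩
        Σsplit U k (λ B B′ → X a * Q B′ * br (a ∷ B′ ++ E) + P B′ * (X a * br (w ∷ B′ ++ E))) + Σsplit U k (λ B B′ → P B′ * W (B′ ++ E))
          -- The terms with `br (w ∷ B′ ++ E)` arise from both halves and cancel.
          ≈⟨ trans (sym (split-+ U k _ _)) (trans (split-cong U k (λ B B′ _ _ → drop _ _ _ _)) (split-+ U k _ _)) ⟩
        Σsplit U k (λ B B′ → X a * Q B′ * br (a ∷ B′ ++ E)) + Σsplit U k (λ B B′ → P B′ * (Z z * br (z ∷ B′ ++ E)))
          ≈⟨ +-congʳ (trans (expand-Q k) (trans (split-cong U (suc k) (λ B B′ _ _ → distribˡ _ _ _)) (split-+ U (suc k) _ _))) ⟩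
        Σsplit U (suc k) (λ B B′ → X a * P B′ * (X a * br (w ∷ a ∷ B′ ++ E))) + Σsplit U (suc k) (λ B B′ → X a * P B′ * (Z z * br (z ∷ a ∷ B′ ++ E)))
          + Σsplit U k (λ B B′ → P B′ * (Z z * br (z ∷ B′ ++ E))) ≈⟨ +-assoc _ _ _ ⟩
        Σsplit U (suc k) (λ B B′ → X a * P B′ * (X a * br (w ∷ a ∷ B′ ++ E))) + (Σsplit U (suc k) (λ B B′ → X a * P B′ * (Z z * br (z ∷ a ∷ B′ ++ E)))
          + Σsplit U k (λ B B′ → P B′ * (Z z * br (z ∷ B′ ++ E)))) ≈⟨ trans (+-cong main rest) (+-identityʳ _) ⟩
        X a * X a * N U (suc k) (w ∷ ws ++ a ∷ as ++ K) ∎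
        where
        drop : ∀ A p x y → A + p * x + p * (x + y) ≈ A + p * y
        drop A p x y = begin
          A + p * x + p * (x + y) ≈⟨ RingIdentities.a+px+p[x+y]≈a+py+2px cring A p x y ⟩
          A + p * y + (p * x + p * x) ≈⟨ trans (+-congˡ (char2 _)) (+-identityʳ _) ⟩
          A + p * y ∎
        main : Σsplit U (suc k) (λ B B′ → X a * P B′ * (X a * br (w ∷ a ∷ B′ ++ E))) ≈ X a * X a * N U (suc k) (w ∷ ws ++ a ∷ as ++ K)
        main = trans (split-cong U (suc k) (λ B B′ _ _ → trans
            (RingIdentities.xy[xz]≈xx[yz] cring _ _ _) (*-congˡ (*-congˡ (br-↭ (pm B′))))))
          (sym (split-*ˡ U (suc k) _ _))
          where
          pm : ∀ B′ → w ∷ a ∷ B′ ++ E ↭ B′ ++ w ∷ ws ++ a ∷ as ++ K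
          pm B′ = ↭-trans (prep w (↭-sym (PermP.shift a B′ E))) (↭-trans (↭-sym (PermP.shift w B′ (a ∷ E)))
            (PermP.++⁺ˡ B′ (prep w (↭-sym (PermP.shift a ws (as ++ K))))))
        -- These are the two halves, with `a` in the complement and with `a` in the chosen part, of
        -- one sum over splittings of `a ∷ U`; that sum is zero by `N-vanish`.
        rest : Σsplit U (suc k) (λ B B′ → X a * P B′ * (Z z * br (z ∷ a ∷ B′ ++ E))) + Σsplit U k (λ B B′ → P B′ * (Z z * br (z ∷ B′ ++ E))) ≈ 0#
        rest = begin
          _ ≈⟨ +-cong (trans (split-cong U (suc k) (λ B B′ _ _ → trans (x*yz≈y*xz _ _ _)
                 (*-congˡ (*-congˡ (br-↭ (↭-sym (PermP.shift z (a ∷ B′) E))))))) (sym (split-*ˡ U (suc k) (Z z) _)))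
               (trans (split-cong U k (λ B B′ _ _ → trans (x*yz≈y*xz _ _ _)
                 (*-congˡ (*-congˡ (br-↭ (↭-sym (PermP.shift z B′ E))))))) (sym (split-*ˡ U k (Z z) _))) ⟩
          Z z * Σsplit U (suc k) (λ B B′ → P (a ∷ B′) * br (a ∷ B′ ++ z ∷ E)) + Z z * N U k (z ∷ E) ≈⟨ distribˡ _ _ _ ⟨
          Z z * N (a ∷ U) (suc k) (z ∷ E) ≈⟨ *-congˡ (trans (N-↭ (a ∷ U) (suc k) (↭-sym (↭-trans (PermP.++⁺ˡ ws (PermP.shift z as K)) (PermP.shift z ws (as ++ K)))))
               (N-vanish ps (a ∷ U) (z ∷ K) pm ev)) ⟩
          Z z * 0# ≈⟨ zeroʳ _ ⟩
          0# ∎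
          where
          pm : as ++ (a ∷ U) ++ z ∷ K ↭ C
          pm = ↭-trans (↭-trans (PermP.++⁺ˡ as (PermP.shift z (a ∷ U) K)) (PermP.shift z as ((a ∷ U) ++ K))) perm

    -- The invariant of the iteration: the pairs `ps` have been moved, the pairs `qs` are still to
    -- come. At the end `bs` has exactly as many entries as the splitting must choose, so the sum
    -- collapses to one minor.
    moves-N : ∀ z qs ps bs K → z ∷ map proj₂ ps ++ (map proj₂ qs ++ bs) ++ K ↭ C →
      length bs ≡ length qs ℕ.+ length ps →
      (∀ {a} → a ∈ map proj₂ qs → a ∉ map proj₁ ps × a ∉ map proj₁ qs) →
      moves qs (N (map proj₂ qs ++ bs) (length ps) (map proj₁ ps ++ map proj₂ ps ++ K)) ≈
        P (map proj₂ qs) * P (map proj₂ qs) * br (map proj₁ qs ++ map proj₁ ps ++ map proj₂ qs ++ map proj₂ ps ++ K)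
    moves-N z [] ps bs K perm len fresh = begin
      N bs (length ps) E ≈⟨ reflexive (≡.cong (λ n → N bs n E) (≡.sym len)) ⟩
      N bs (length bs) E ≈⟨ split-all bs _ ⟩
      1# * br E ≈⟨ *-congʳ (*-identityˡ 1#) ⟨
      1# * 1# * br E ∎
      where
      E : List V
      E = map proj₁ ps ++ map proj₂ ps ++ K
    moves-N z ((w , a) ∷ qs) ps bs K perm len fresh = begin
      moves qs (Derivation.der (move w a) (N (a ∷ aq ++ bs) (length ps) (wp ++ ap ++ K)))
        ≈⟨ moves-cong qs (Step.step w a z ps (aq ++ bs) K perm (proj₁ (fresh (here ≡.refl))) ev ≡.refl) ⟩
      moves qs (X a * X a * N (aq ++ bs) (suc (length ps)) (w ∷ wp ++ a ∷ ap ++ K)) ≈⟨ moves-square-* qs (X a) _ ⟩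
      X a * X a * moves qs (N (aq ++ bs) (suc (length ps)) (w ∷ wp ++ a ∷ ap ++ K))
        ≈⟨ *-congˡ (moves-N z qs ((w , a) ∷ ps) bs K (↭-trans (prep z (↭-sym (PermP.shift a ap _))) perm)
             (≡.trans len (≡.sym (ℕP.+-suc (length qs) (length ps)))) fresh′) ⟩
      X a * X a * (P aq * P aq * br (wq ++ w ∷ wp ++ aq ++ a ∷ ap ++ K))
        ≈⟨ RingIdentities.xx[yyz]≈xy[xy]z cring _ _ _ ⟩
      P (a ∷ aq) * P (a ∷ aq) * br (wq ++ w ∷ wp ++ aq ++ a ∷ ap ++ K)
        ≈⟨ *-congˡ (br-↭ (↭-trans (PermP.shift w wq _) (prep w (PermP.++⁺ˡ wq (PermP.++⁺ˡ wp (PermP.shift a aq _)))))) ⟩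
      P (a ∷ aq) * P (a ∷ aq) * br (w ∷ wq ++ wp ++ a ∷ aq ++ ap ++ K) ∎
      where
      aq wq ap wp : List V
      aq = map proj₂ qs
      wq = map proj₁ qs
      ap = map proj₂ ps
      wp = map proj₁ ps
      ev : Even (length (a ∷ aq ++ bs) ℕ.+ length ps)
      ev = ≡.subst Even (≡.sym eq) (even-double (suc (length qs ℕ.+ length ps)))
        where
        eq : suc (length (aq ++ bs)) ℕ.+ length ps ≡ suc (length qs ℕ.+ length ps) ℕ.+ suc (length qs ℕ.+ length ps)
        eq = ≡.trans (≡.cong (λ n → suc n ℕ.+ length ps) (≡.trans (length-++ aq) (≡.cong₂ ℕ._+_ (length-map proj₂ qs) len)))
          (ℕS.solve 2 (λ m n → ℕS.con 1 ℕS.:+ (m ℕS.:+ (ℕS.con 1 ℕS.:+ (m ℕS.:+ n))) ℕS.:+ n ℕS.:= ℕS.con 1 ℕS.:+ (m ℕS.:+ n) ℕS.:+ (ℕS.con 1 ℕS.:+ (m ℕS.:+ n))) ≡.refl (length qs) (length ps))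
      fresh′ : ∀ {v} → v ∈ aq → v ∉ w ∷ wp × v ∉ wq
      fresh′ m = (λ { (here e) → proj₂ (fresh (there m)) (here e) ; (there n) → proj₁ (fresh (there m)) n }) , (λ n → proj₂ (fresh (there m)) (there n))

    -- Since `X z` is the minor of all remaining vertices, the product on the left is the
    -- interpolating sum with nothing chosen, and the iteration can start.
    moves-circuit : ∀ z qs bs K → z ∷ map proj₂ qs ++ bs ++ K ↭ C → length bs ≡ length qs →
      (∀ {a} → a ∈ map proj₂ qs → a ∉ map proj₁ qs) →
      moves qs (X z * P (map proj₂ qs ++ bs)) ≈
        P (map proj₂ qs) * P (map proj₂ qs) * br (map proj₁ qs ++ map proj₂ qs ++ K)
    moves-circuit z qs bs K perm len fresh = trans
      (moves-cong qs (trans (*-comm _ _) (*-congˡ (X-minor perm′))))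
      (moves-N z qs [] bs K perm′ (≡.trans len (≡.sym (ℕP.+-identityʳ _))) (λ m → (λ ()) , fresh m))
      where
      perm′ : z ∷ (map proj₂ qs ++ bs) ++ K ↭ C
      perm′ = ↭-trans (prep z (↭-reflexive (LP.++-assoc (map proj₂ qs) bs K))) perm

-- Shellable spheres

_⊑_ : {A : Set} → List A → List A → Set
xs ⊑ ys = ∀ {v} → v ∈ xs → v ∈ ys

-- R σ is the restriction of the facet σ in a shelling (in order of decreasing ω) whose reverse,
-- with restrictions S σ, is a shelling too.
record ShellableSphere (d : ℕ) {V : Set} (vs : List V) (Fs : List (List V)) : Set where
  field
    R S : List V → List V
    ω : List V → ℕ
    bound : ℕ
    Fs-unique : Unique Fs
    facet-unique : ∀ {σ} → σ ∈ Fs → Unique σ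
    facet-length : ∀ {σ} → σ ∈ Fs → length σ ≡ d
    facet-vs : ∀ {σ} → σ ∈ Fs → σ ⊑ vs
    R++S : ∀ {σ} → σ ∈ Fs → R σ ++ S σ ↭ σ
    ω-bound : ∀ {σ} → σ ∈ Fs → ω σ ℕ.< bound
    order-R : ∀ {σ τ} → σ ∈ Fs → τ ∈ Fs → R σ ⊑ τ → σ ≡ τ ⊎ ω τ ℕ.< ω σ
    order-S : ∀ {σ τ} → σ ∈ Fs → τ ∈ Fs → S σ ⊑ τ → σ ≡ τ ⊎ ω σ ℕ.< ω τ
    cover-R : ∀ {σ} A → σ ∈ Fs → A ⊑ σ → ∃[ τ ] τ ∈ Fs × R τ ⊑ A × A ⊑ τ
    cover-S : ∀ {σ} A → σ ∈ Fs → A ⊑ σ → ∃[ τ ] τ ∈ Fs × S τ ⊑ A × A ⊑ τ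

  R⊑ : ∀ {σ} → σ ∈ Fs → R σ ⊑ σ
  R⊑ m n = ∈-resp-↭ (R++S m) (∈-++⁺ˡ n)

  S⊑ : ∀ {σ} → σ ∈ Fs → S σ ⊑ σ
  S⊑ {σ} m n = ∈-resp-↭ (R++S m) (∈-++⁺ʳ (R σ) n)

  R-or-S : ∀ {σ v} → σ ∈ Fs → v ∈ σ → v ∈ R σ ⊎ v ∈ S σ
  R-or-S {σ} m n = ∈-++⁻ (R σ) (∈-resp-↭ (↭-sym (R++S m)) n)

  RS-unique : ∀ {σ} → σ ∈ Fs → Unique (R σ ++ S σ)
  RS-unique m = unique-resp-↭ (↭-sym (R++S m)) (facet-unique m)

  R-S-disjoint : ∀ {σ v} → σ ∈ Fs → v ∈ R σ → v ∉ S σ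
  R-S-disjoint {σ} m = go (R σ) (RS-unique m)
    where
    go : ∀ as {bs v} → Unique (as ++ bs) → v ∈ as → v ∉ bs
    go (a ∷ as) (a∉ ∷ u) (here ≡.refl) n = All.lookup a∉ (∈-++⁺ʳ as n) ≡.refl
    go (a ∷ as) (a∉ ∷ u) (there m) n = go as u m n

  level : ℕ → List (List V)
  level k = filter (λ σ → length (R σ) ℕ.≟ k) Fs

  -- The h-vector, in its shelling form.
  h : ℕ → ℕ
  h k = length (level k)

  ∈-level : ∀ {k σ} → σ ∈ level k → σ ∈ Fs × length (R σ) ≡ k
  ∈-level {k} = ∈-filter⁻ (λ σ → length (R σ) ℕ.≟ k)

-- The Stanley-Reisner ring modulo generic parameters, seen through its degree map

unique-++ˡ : {A : Set} (xs : List A) {ys : List A} → Unique (xs ++ ys) → Unique xs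
unique-++ˡ [] u = []
unique-++ˡ (x ∷ xs) (x∉ ∷ u) = AllP.++⁻ˡ xs x∉ ∷ unique-++ˡ xs u

unique-++ʳ : {A : Set} (xs : List A) {ys : List A} → Unique (xs ++ ys) → Unique ys
unique-++ʳ [] u = u
unique-++ʳ (x ∷ xs) (_ ∷ u) = unique-++ʳ xs u

lookup-injective : {A : Set} {xs : List A} → Unique xs → ∀ i j → L.lookup xs i ≡ L.lookup xs j → i ≡ j
lookup-injective (_ ∷ _) F.zero F.zero _ = ≡.refl
lookup-injective (x∉ ∷ _) F.zero (F.suc j) e = contradiction e (All.lookup x∉ (∈-lookup j))
lookup-injective (x∉ ∷ _) (F.suc i) F.zero e = contradiction (≡.sym e) (All.lookup x∉ (∈-lookup i))
lookup-injective (_ ∷ u) (F.suc i) (F.suc j) e = ≡.cong F.suc (lookup-injective u i j e)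

-- Multisets, each listed in one order only: a generator that has been passed over does not return.
monos : {A : Set} → List A → ℕ → List (List A)
monos gs zero = [] ∷ []
monos [] (suc k) = []
monos (g ∷ gs) (suc k) = map (g ∷_) (monos (g ∷ gs) k) ++ monos gs (suc k)

monos-length : {A : Set} (gs : List A) (k : ℕ) → length (monos gs (suc k)) ≡ (length gs ℕ.+ k) C suc k
monos-length [] k = ≡.sym (k>n⇒nCk≡0 (ℕP.n<1+n k))
monos-length (g ∷ gs) k = ≡.trans (length-++ (map (g ∷_) (monos (g ∷ gs) k)))
  (≡.trans (≡.cong₂ ℕ._+_ (≡.trans (length-map _ (monos (g ∷ gs) k)) (first k)) (monos-length gs k)) (nCk+nC[k+1]≡[n+1]C[k+1] (length gs ℕ.+ k) k))
  where
  first : ∀ k → length (monos (g ∷ gs) k) ≡ (length gs ℕ.+ k) C k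
  first zero = ≡.refl
  first (suc k) = ≡.trans (monos-length (g ∷ gs) k) (≡.cong (_C suc k) (≡.sym (ℕP.+-suc (length gs) k)))

monos-insert : {A : Set} {g : A} (gs : List A) (k : ℕ) {J : List A} → g ∈ gs → J ∈ monos gs k → ∃[ J′ ] J′ ∈ monos gs (suc k) × J′ ↭ g ∷ J
monos-insert (g ∷ gs) k (here ≡.refl) m = _ , ∈-++⁺ˡ (∈-map⁺ (g ∷_) m) , ↭-refl
monos-insert (g₀ ∷ gs) zero (there n) (here ≡.refl) with monos-insert gs zero n (here ≡.refl)
... | J′ , m′ , p = J′ , ∈-++⁺ʳ (map (g₀ ∷_) (monos (g₀ ∷ gs) zero)) m′ , p
monos-insert {g = g} (g₀ ∷ gs) (suc k) (there n) m with ∈-++⁻ (map (g₀ ∷_) (monos (g₀ ∷ gs) k)) m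
... | inj₂ m₂ with monos-insert gs (suc k) n m₂
...   | J′ , m′ , p = J′ , ∈-++⁺ʳ (map (g₀ ∷_) (monos (g₀ ∷ gs) (suc k))) m′ , p
monos-insert {g = g} (g₀ ∷ gs) (suc k) (there n) m | inj₁ m₁ with ∈-map⁻ (g₀ ∷_) m₁
... | J₁ , m₃ , ≡.refl with monos-insert (g₀ ∷ gs) k (there n) m₃
... | J′ , m′ , p = g₀ ∷ J′ , ∈-++⁺ˡ (∈-map⁺ (g₀ ∷_) m′) , ↭-trans (prep g₀ p) (swap g₀ g ↭-refl)

-- The list `rows` holds the linear forms of a generic system of parameters, and the extra row `ρ`
-- holds the coefficients of the linear form that plays the part of a Lefschetz element. The vertex
-- `z` outside the complex has a generic column of its own; it is the direction along which the
-- degree map is localised.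
record StanleyReisnerData : Set₁ where
  constructor stanley-reisner-data
  field
    Row V : Set
    _≟_ : DecidableEquality V
    G : GenericDomain (Row × V)
    rows : List Row
    uniq : Unique rows
    ρ : Row
    ρ∉rows : ρ ∉ rows
    z : V
    vs : List V
    uvs : Unique (z ∷ vs)
    d′ : ℕ
    rows-length : length rows ≡ suc d′
    Fs : List (List V)
    Δ : ShellableSphere (suc d′) vs Fs

module StanleyReisner (𝒮 : StanleyReisnerData) where
  open StanleyReisnerData 𝒮
  open GenericDomain G
  open RingSums cring
  open Char2 G
  open Determinants G
  open MinorProducts _≟_ G rows uniq
  open Kernel domain using (sumF; kernel)
  open ShellableSphere Δ
  open SetoidReasoning setoid
  open DecMembership _≟_ using (_∈?_)

  z∉vs : z ∉ vs
  z∉vs = unique-head uvs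

  z∉facet : ∀ {σ} → σ ∈ Fs → z ∉ σ
  z∉facet m n = z∉vs (facet-vs m n)

  cone-unique : ∀ {σ} → σ ∈ Fs → Unique (z ∷ σ)
  cone-unique m = All.tabulate (λ n → λ { ≡.refl → z∉facet m n }) ∷ facet-unique m

  br≉0 : ∀ {cs} → Unique cs → length cs ≡ suc d′ → ¬ (br cs ≈ 0#)
  br≉0 u l = det≉0 uniq u (≡.trans rows-length (≡.sym l))

  -- By Cramer's rule the values on `z ∷ σ` are the coefficients of the linear relation among its d
  -- + 1 columns. They are the coordinates of the point at which polynomials are evaluated on the
  -- facet σ; each parameter, extended by its entry at `z`, vanishes there.
  X : List V → V → Carrier
  X σ v with v ∈? (z ∷ σ)
  ... | yes m = br (proj₁ (∈⇒picks m))
  ... | no _ = 0#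

  X-out : ∀ {σ v} → v ∉ z ∷ σ → X σ v ≈ 0#
  X-out {σ} {v} v∉ with v ∈? (z ∷ σ)
  ... | yes m = contradiction m v∉
  ... | no _ = refl

  X-minor : ∀ {σ s r} → s ∷ r ↭ z ∷ σ → X σ s ≈ br r
  X-minor {σ} {s} p with s ∈? (z ∷ σ)
  ... | yes m = br-↭ (PermP.drop-∷ (↭-trans (picks-↭ (proj₂ (∈⇒picks m))) (↭-sym p)))
  ... | no s∉ = contradiction (∈-resp-↭ p (here ≡.refl)) s∉

  X≉0 : ∀ {σ s} → σ ∈ Fs → s ∈ z ∷ σ → ¬ (X σ s ≈ 0#)
  X≉0 {σ} {s} m n e with ∈⇒↭ n
  ... | r , p with unique-resp-↭ (↭-sym p) (cone-unique m)
  ... | _ ∷ ur = br≉0 ur (suc-injective (≡.trans (↭-length p) (≡.cong suc (facet-length m)))) (trans (sym (X-minor p)) e)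

  -- The monomial with vertex list J, as a vector indexed by the facets.
  x : List V → List V → Carrier
  x J σ = prodL (X σ) J

  pr : List V → Carrier
  pr σ = x (z ∷ σ) σ

  prod≉0 : ∀ {I : Set} {f : I → Carrier} xs → (∀ {i} → i ∈ xs → ¬ (f i ≈ 0#)) → ¬ (prodL f xs ≈ 0#)
  prod≉0 [] h = 1≉0
  prod≉0 (i ∷ xs) h = *-≉0 (h (here ≡.refl)) (prod≉0 xs (h ∘ there))

  Π : Carrier
  Π = prodL pr Fs

  Π≉0 : ¬ (Π ≈ 0#)
  Π≉0 = prod≉0 Fs (λ {σ} m → prod≉0 (z ∷ σ) (X≉0 m))

  -- The quotient of `Π` by `pr σ`, formed by leaving out a factor; the value 0 off `Fs` is a
  -- default.
  cof : List V → Carrier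
  cof σ with DecMembership._∈?_ (LP.≡-dec _≟_) σ Fs
  ... | yes m = prodL pr (proj₁ (∈⇒picks m))
  ... | no _ = 0#

  pr-cof : ∀ {σ} → σ ∈ Fs → pr σ * cof σ ≈ Π
  pr-cof {σ} n with DecMembership._∈?_ (LP.≡-dec _≟_) σ Fs
  ... | yes m = prod-↭ pr (picks-↭ (proj₂ (∈⇒picks m)))
  ... | no σ∉ = contradiction n σ∉

  cof≉0 : ∀ {σ} → σ ∈ Fs → ¬ (cof σ ≈ 0#)
  cof≉0 m e = Π≉0 (trans (sym (pr-cof m)) (trans (*-congˡ e) (zeroʳ _)))

  -- The degree map: E f is Π times the sum over the facets σ of f σ / pr σ.
  E : (List V → Carrier) → Carrier
  E f = sumL (λ σ → cof σ * f σ) Fs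

  E-cong : ∀ {f g} → (∀ {σ} → σ ∈ Fs → f σ ≈ g σ) → E f ≈ E g
  E-cong p = sum-cong-∈ Fs (λ m → *-congˡ (p m))

  E-+ : ∀ f g → E (λ σ → f σ + g σ) ≈ E f + E g
  E-+ f g = trans (sum-cong Fs (λ σ → distribˡ _ _ _)) (sum-+ _ _ Fs)

  E-* : ∀ c f → E (λ σ → c * f σ) ≈ c * E f
  E-* c f = trans (sum-cong Fs (λ σ → x*yz≈y*xz _ _ _)) (sym (sum-*ˡ c _ Fs))

  E-sum : ∀ {I : Set} (f : I → List V → Carrier) is → E (λ σ → sumL (λ i → f i σ) is) ≈ sumL (λ i → E (f i)) is
  E-sum f is = trans (sum-cong Fs (λ σ → sum-*ˡ (cof σ) _ is)) (sum-swap _ Fs is)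

  E-lin : ∀ {I : Set} (c : I → Carrier) (f : I → List V → Carrier) is →
    E (λ σ → sumL (λ i → c i * f i σ) is) ≈ sumL (λ i → c i * E (f i)) is
  E-lin c f is = trans (E-sum (λ i σ → c i * f i σ) is) (sum-cong is (λ i → E-* (c i) (f i)))

  E-zero : ∀ {f} → (∀ {σ} → σ ∈ Fs → f σ ≈ 0#) → E f ≈ 0#
  E-zero p = sum-zero-∈ Fs (λ m → trans (*-congˡ (p m)) (zeroʳ _))

  E-↭ : ∀ {J J′} → J ↭ J′ → E (x J) ≈ E (x J′)
  E-↭ p = E-cong (λ {σ} _ → prod-↭ (X σ) p)

  x-out : ∀ {σ v J} → v ∈ J → v ∉ σ → v ≢ z → x J σ ≈ 0#
  x-out m v∉ ne = prod-zero m (X-out (λ { (here e) → ne e ; (there n) → v∉ n }))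

  ⊑? : ∀ J σ → Dec (J ⊑ σ)
  ⊑? J σ with All.all? (_∈? σ) J
  ... | yes a = yes (All.lookup a)
  ... | no ¬a = no (λ s → ¬a (All.tabulate s))

  x-⋢ : ∀ {J σ} → J ⊑ vs → ¬ (J ⊑ σ) → x J σ ≈ 0#
  x-⋢ {J} {σ} sub ¬s with AllP.¬All⇒Any¬ (_∈? σ) J (λ a → ¬s (All.lookup a))
  ... | any with L∈.find any
  ... | v , m , v∉ = x-out m v∉ (λ { ≡.refl → z∉vs (sub m) })

  E-prefix-⋢ : ∀ J K → J ⊑ vs → (∀ {σ} → σ ∈ Fs → ¬ (J ⊑ σ)) → E (x (J ++ K)) ≈ 0#
  E-prefix-⋢ J K sub h = E-zero (λ {σ} m → trans (prod-++ (X σ) J K) (trans (*-congʳ (x-⋢ sub (h m))) (zeroˡ _)))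

  inFacet? : ∀ J → (∃[ σ ] σ ∈ Fs × J ⊑ σ) ⊎ (∀ {σ} → σ ∈ Fs → ¬ (J ⊑ σ))
  inFacet? J with Any.any? (⊑? J) Fs
  ... | yes any = inj₁ (let σ , m , s = L∈.find any in σ , m , s)
  ... | no none = inj₂ (λ m s → none (L∈.lose {P = J ⊑_} m s))

  -- Off `z ∷ τ` the values `X τ u` vanish, and on it this is the Plücker relation. By Laplace
  -- expansion the coefficients `br (u ∷ cs)` combine the rows, so this is a parameter extended to
  -- `z`; the choice of `cs` decides which vertices drop out of it.
  linear-relation : ∀ cs {τ} → τ ∈ Fs → sumL (λ u → br (u ∷ cs) * X τ u) (z ∷ vs) ≈ 0#
  linear-relation cs {τ} m with unique-extend (z ∷ τ) (cone-unique m) (λ { (here e) → here e ; (there n) → there (facet-vs m n) })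
  ... | rest , p = begin
    sumL T (z ∷ vs) ≈⟨ trans (sum-↭ T (↭-sym p)) (sum-++ T (z ∷ τ) rest) ⟩
    sumL T (z ∷ τ) + sumL T rest ≈⟨ +-cong on-cone off-cone ⟩
    0# + 0# ≈⟨ +-identityˡ _ ⟩
    0# ∎
    where
    T : V → Carrier
    T u = br (u ∷ cs) * X τ u
    on-cone : sumL T (z ∷ τ) ≈ 0#
    on-cone = trans (Σpicks-const T (z ∷ τ)) (trans (Σpicks-cong (z ∷ τ) (λ s r q → *-congˡ (X-minor q))) (plücker rows cs (z ∷ τ)))
    disjoint : ∀ as {bs v} → Unique (as ++ bs) → v ∈ bs → v ∉ as
    disjoint (a ∷ as) (a∉ ∷ u) n (here ≡.refl) = All.lookup a∉ (∈-++⁺ʳ as n) ≡.refl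
    disjoint (a ∷ as) (a∉ ∷ u) n (there k) = disjoint as u n k
    off-cone : sumL T rest ≈ 0#
    off-cone = sum-zero-∈ rest (λ n → trans (*-congˡ (X-out (disjoint (z ∷ τ) (unique-resp-↭ (↭-sym p) uvs) n))) (zeroʳ _))

  linear-relation-E : ∀ cs K → sumL (λ u → br (u ∷ cs) * E (x (u ∷ K))) (z ∷ vs) ≈ 0#
  linear-relation-E cs K = trans (sym (E-lin (λ u → br (u ∷ cs)) (λ u → x (u ∷ K)) (z ∷ vs)))
    (E-zero (λ {τ} m → trans (sum-cong (z ∷ vs) (λ u → sym (*-assoc _ _ _)))
      (trans (sym (sum-*ʳ _ (x K τ) (z ∷ vs))) (trans (*-congʳ (linear-relation cs m)) (zeroˡ _)))))

  module _ {A : List V} (A-unique : Unique A) (A⊑vs : A ⊑ vs) (A-length : length A ≡ d′) where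
    private
      A⊂ : ∀ {σ} → σ ∈ Fs → A ⊑ σ → ∃[ a ] A ++ a ∷ [] ↭ σ
      A⊂ {σ} m s with unique-extend A A-unique s
      ... | [] , p = contradiction (≡.trans (≡.sym (↭-length p)) (≡.trans (≡.cong length (LP.++-identityʳ A)) A-length)) (λ e → ℕP.1+n≢n (≡.trans (≡.sym (facet-length m)) e))
      ... | a ∷ [] , p = a , p
      ... | a ∷ b ∷ zs , p = contradiction (≡.trans (≡.sym (facet-length m)) (≡.trans (≡.sym (↭-length p)) (≡.trans (length-++ A) (≡.cong (ℕ._+ suc (suc (length zs))) A-length))))
            (λ e → ℕP.m≢1+m+n (suc d′) (≡.trans e (≡.trans (ℕP.+-suc d′ _) (≡.cong suc (ℕP.+-suc d′ _)))))

      zA-unique : Unique (z ∷ A)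
      zA-unique = All.tabulate (λ n → λ { ≡.refl → z∉vs (A⊑vs n) }) ∷ A-unique

    -- Exactly two facets contain the ridge `A`: one whose restriction lies in `A`, and one for
    -- which this holds in the reverse shelling. After multiplication by the minor of `z ∷ A` each
    -- contributes `Π`, and the two contributions cancel in characteristic 2.
    E-ridge : E (x (z ∷ A)) ≈ 0#
    E-ridge with inFacet? A
    ... | inj₂ none = trans (E-↭ (↭-sym (PermP.++-comm A (z ∷ [])))) (E-prefix-⋢ A (z ∷ []) A⊑vs none)
    ... | inj₁ (σ , m , s) with cover-R A m s | cover-S A m s
    ... | τ , mτ , Rτ , sτ | τ′ , mτ′ , Sτ′ , sτ′ = cancelˡ (br≉0 zA-unique (≡.cong suc A-length)) (begin
      br (z ∷ A) * E (x (z ∷ A)) ≈⟨ sum-*ˡ _ _ Fs ⟩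
      sumL (λ σ → br (z ∷ A) * (cof σ * x (z ∷ A) σ)) Fs
        ≈⟨ sum-pair Fs-unique mτ mτ′ τ≢τ′ (λ {σ} n n₁ n₂ → trans (*-congˡ (trans (*-congˡ (trans (*-congˡ (x-⋢ A⊑vs (λ s → Sum.[ n₁ , n₂ ] (two n s)))) (zeroʳ _))) (zeroʳ _))) (zeroʳ _)) ⟩
      br (z ∷ A) * (cof τ * x (z ∷ A) τ) + br (z ∷ A) * (cof τ′ * x (z ∷ A) τ′) ≈⟨ +-cong (value mτ sτ) (value mτ′ sτ′) ⟩
      Π + Π ≈⟨ char2 Π ⟩
      0# ∎)
      where
      τ≢τ′ : τ ≢ τ′
      τ≢τ′ ≡.refl with A⊂ mτ sτ
      ... | a , p with R-or-S mτ (∈-resp-↭ p (∈-++⁺ʳ A (here ≡.refl))) | unique-resp-↭ (↭-trans (↭-sym p) (PermP.++-comm A (a ∷ []))) (facet-unique mτ)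
      ... | inj₁ r | a∉ ∷ _ = All.lookup a∉ (Rτ r) ≡.refl
      ... | inj₂ r | a∉ ∷ _ = All.lookup a∉ (Sτ′ r) ≡.refl
      -- The vertex of σ outside `A` decides. If it lies in `S σ`, then `R σ ⊑ A`, so σ and τ
      -- contain each other's restrictions and must agree. If it lies in `R σ`, the reverse shelling
      -- gives the same for σ and τ′.
      two : ∀ {σ} → σ ∈ Fs → A ⊑ σ → σ ≡ τ ⊎ σ ≡ τ′
      two {σ} n s with A⊂ n s
      ... | a , p with R-or-S n (∈-resp-↭ p (∈-++⁺ʳ A (here ≡.refl)))
      ... | inj₂ a∈S = inj₁ (go (order-R n mτ (λ m → sτ (Rσ m))) (order-R mτ n (λ m → s (Rτ m))))
        where
        Rσ : R σ ⊑ A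
        Rσ {v} m with ∈-++⁻ A (∈-resp-↭ (↭-sym p) (R⊑ n m))
        ... | inj₁ k = k
        ... | inj₂ (here ≡.refl) = contradiction a∈S (R-S-disjoint n m)
        go : σ ≡ τ ⊎ ω τ ℕ.< ω σ → τ ≡ σ ⊎ ω σ ℕ.< ω τ → σ ≡ τ
        go (inj₁ e) _ = e
        go (inj₂ _) (inj₁ e) = ≡.sym e
        go (inj₂ l) (inj₂ l′) = contradiction l′ (ℕP.<-asym l)
      ... | inj₁ a∈R = inj₂ (go (order-S n mτ′ (λ m → sτ′ (Sσ m))) (order-S mτ′ n (λ m → s (Sτ′ m))))
        where
        Sσ : S σ ⊑ A
        Sσ {v} m with ∈-++⁻ A (∈-resp-↭ (↭-sym p) (S⊑ n m))
        ... | inj₁ k = k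
        ... | inj₂ (here ≡.refl) = contradiction m (R-S-disjoint n a∈R)
        go : σ ≡ τ′ ⊎ ω σ ℕ.< ω τ′ → τ′ ≡ σ ⊎ ω τ′ ℕ.< ω σ → σ ≡ τ′
        go (inj₁ e) _ = e
        go (inj₂ _) (inj₁ e) = ≡.sym e
        go (inj₂ l) (inj₂ l′) = contradiction l′ (ℕP.<-asym l)
      value : ∀ {σ} → σ ∈ Fs → A ⊑ σ → br (z ∷ A) * (cof σ * x (z ∷ A) σ) ≈ Π
      value {σ} n s with A⊂ n s
      ... | a , p = begin
        br (z ∷ A) * (cof σ * x (z ∷ A) σ) ≈⟨ *-congʳ (X-minor q) ⟨
        X σ a * (cof σ * x (z ∷ A) σ) ≈⟨ trans (x*yz≈y*xz _ _ _) (*-comm _ _) ⟩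
        x (a ∷ z ∷ A) σ * cof σ ≈⟨ *-congʳ (prod-↭ (X σ) q) ⟩
        pr σ * cof σ ≈⟨ pr-cof n ⟩
        Π ∎
        where
        q : a ∷ z ∷ A ↭ z ∷ σ
        q = ↭-trans (swap a z ↭-refl) (prep z (↭-trans (PermP.++-comm (a ∷ []) A) p))

  -- x_z lies in the ideal killed by E: rewrite repeated vertices until the monomial is squarefree.
  E-z-repeated : ∀ A B → Unique A → A ⊑ vs → B ⊑ A → length A ℕ.+ length B ≡ d′ → E (x (z ∷ A ++ B)) ≈ 0#
  E-z-repeated A [] u sub _ l = trans (E-↭ (prep z (↭-reflexive (LP.++-identityʳ A)))) (E-ridge u sub (≡.trans (≡.sym (ℕP.+-identityʳ _)) l))
  E-z-repeated A (b ∷ B) u sub B⊑ l with inFacet? A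
  ... | inj₂ none = trans (E-↭ (↭-sym (PermP.shift z A (b ∷ B)))) (E-prefix-⋢ A (z ∷ b ∷ B) sub none)
  ... | inj₁ (σ , m , s) with unique-extend A u s | ∈⇒↭ (B⊑ (here ≡.refl))
  ... | [] , p | _ = contradiction (≡.trans (≡.sym (facet-length m)) (≡.trans (≡.sym (↭-length p)) (≡.cong length (LP.++-identityʳ A))))
        (λ e → ℕP.m≢1+m+n (length A) (≡.trans (≡.sym e) (≡.cong suc (≡.trans (≡.sym l) ≡.refl))))
  ... | j ∷ zs , p | r , q = cancelˡ (br≉0 bG-unique bG-length) (begin
    br (b ∷ Gs) * E (x (z ∷ A ++ b ∷ B)) ≈⟨ *-congˡ (E-↭ (PermP.shift b (z ∷ A) B)) ⟩
    br (b ∷ Gs) * E (x (b ∷ z ∷ A ++ B)) ≈⟨ sum-single {f = T} uvs (there (sub (B⊑ (here ≡.refl)))) others ⟨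
    sumL T (z ∷ vs) ≈⟨ linear-relation-E Gs (z ∷ A ++ B) ⟩
    0# ∎)
    where
    -- The vertex `z` takes the place of `j`. The linear form then involves neither `z` nor a vertex
    -- of `A` other than `b`, so every remaining monomial has a larger squarefree part.
    Gs : List V
    Gs = z ∷ r ++ zs
    T : V → Carrier
    T u = br (u ∷ Gs) * E (x (u ∷ z ∷ A ++ B))
    bG-↭ : b ∷ Gs ↭ z ∷ A ++ zs
    bG-↭ = ↭-trans (swap b z ↭-refl) (prep z (PermP.++⁺ʳ zs q))
    Azs : j ∷ A ++ zs ↭ σ
    Azs = ↭-trans (↭-sym (PermP.shift j A zs)) p
    bG-unique : Unique (b ∷ Gs)
    bG-unique with unique-resp-↭ (↭-trans (prep z (↭-sym Azs)) (swap z j ↭-refl)) (cone-unique m)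
    ... | _ ∷ w = unique-resp-↭ (↭-sym bG-↭) w
    bG-length : length (b ∷ Gs) ≡ suc d′
    bG-length = ≡.trans (↭-length bG-↭) (≡.trans (↭-length Azs) (facet-length m))
    others : ∀ {v} → v ∈ z ∷ vs → v ≢ b → T v ≈ 0#
    others {v} (here ≡.refl) _ = trans (*-congʳ (det-repeated rows (here ≡.refl))) (zeroˡ _)
    others {v} (there v∈) ne with v ∈? Gs
    ... | yes k = trans (*-congʳ (det-repeated rows k)) (zeroˡ _)
    ... | no v∉ = trans (*-congˡ (trans (E-↭ {v ∷ z ∷ A ++ B} (swap v z ↭-refl)) (E-z-repeated (v ∷ A) B (All.tabulate (λ n → λ { ≡.refl → v∉A n }) ∷ u)
        (λ { (here ≡.refl) → v∈ ; (there n) → sub n }) (λ n → there (B⊑ (there n))) (≡.trans (≡.sym (ℕP.+-suc _ _)) l)))) (zeroʳ _)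
      where
      v∉A : v ∉ A
      v∉A n with ∈-resp-↭ (↭-sym q) n
      ... | here e = ne e
      ... | there k = v∉ (there (∈-++⁺ˡ k))

  squarefree-part : ∀ J → ∃[ A ] ∃[ B ] Unique A × B ⊑ A × A ++ B ↭ J
  squarefree-part [] = [] , [] , [] , (λ ()) , ↭-refl
  squarefree-part (v ∷ J) with squarefree-part J
  ... | A , B , u , s , p with v ∈? A
  ... | yes m = A , v ∷ B , u , (λ { (here ≡.refl) → m ; (there n) → s n }) , ↭-trans (PermP.shift v A B) (prep v p)
  ... | no v∉ = v ∷ A , B , All.tabulate (λ n → λ { ≡.refl → v∉ n }) ∷ u , (λ n → there (s n)) , prep v p

  E-z : ∀ J → J ⊑ vs → length J ≡ d′ → E (x (z ∷ J)) ≈ 0#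
  E-z J sub l with squarefree-part J
  ... | A , B , u , s , p = trans (E-↭ (prep z (↭-sym p)))
    (E-z-repeated A B u (λ n → sub (∈-resp-↭ p (∈-++⁺ˡ n))) s (≡.trans (≡.sym (length-++ A)) (≡.trans (↭-length p) l)))

  Ok : ℕ → List V → Set
  Ok e M = M ⊑ vs × length M ≡ e

  -- φ is, up to a nonzero factor and as a functional on the monomials of degree e,
  -- a linear combination of the generators.
  record Red {n : ℕ} (gen : Fin n → List V) (e : ℕ) (φ : List V → Carrier) : Set where
    field
      scale : Carrier
      scale≉0 : ¬ (scale ≈ 0#)
      coeff : Fin n → Carrier
      reduce : ∀ {M} → Ok e M → scale * φ M ≈ sumF (λ l → coeff l * E (x (gen l ++ M)))
  open Red

  module _ {n : ℕ} {gen : Fin n → List V} {e : ℕ} where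
    private
      fins : List (Fin n)
      fins = allFin n

    red-cong : ∀ {φ ψ} → (∀ {M} → Ok e M → φ M ≈ ψ M) → Red gen e φ → Red gen e ψ
    red-cong p r = record { scale = scale r ; scale≉0 = scale≉0 r ; coeff = coeff r
      ; reduce = λ ok → trans (*-congˡ (sym (p ok))) (reduce r ok) }

    red-0 : Red gen e (λ _ → 0#)
    red-0 = record { scale = 1# ; scale≉0 = 1≉0 ; coeff = λ _ → 0#
      ; reduce = λ _ → trans (zeroʳ _) (sym (sum-zero fins (λ _ → zeroˡ _))) }

    red-+ : ∀ {φ ψ} → Red gen e φ → Red gen e ψ → Red gen e (λ M → φ M + ψ M)
    red-+ {φ} {ψ} r r′ = record
      { scale = scale r * scale r′ ; scale≉0 = *-≉0 (scale≉0 r) (scale≉0 r′)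
      ; coeff = λ l → scale r′ * coeff r l + scale r * coeff r′ l
      ; reduce = λ {M} ok → begin
          scale r * scale r′ * (φ M + ψ M)
            ≈⟨ RingIdentities.st[a+b]≈t[sa]+s[tb] cring _ _ _ _ ⟩
          scale r′ * (scale r * φ M) + scale r * (scale r′ * ψ M)
            ≈⟨ +-cong (*-congˡ (reduce r ok)) (*-congˡ (reduce r′ ok)) ⟩
          scale r′ * sumF (λ l → coeff r l * E (x (gen l ++ M))) + scale r * sumF (λ l → coeff r′ l * E (x (gen l ++ M)))
            ≈⟨ +-cong (sum-*ˡ _ _ fins) (sum-*ˡ _ _ fins) ⟩
          sumF (λ l → scale r′ * (coeff r l * E (x (gen l ++ M)))) + sumF (λ l → scale r * (coeff r′ l * E (x (gen l ++ M))))
            ≈⟨ sum-+ _ _ fins ⟨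
          sumF (λ l → scale r′ * (coeff r l * E (x (gen l ++ M))) + scale r * (coeff r′ l * E (x (gen l ++ M))))
            ≈⟨ sum-cong fins (λ l → RingIdentities.t[ae]+s[be]≈[ta+sb]e cring _ _ _ _ _) ⟩
          sumF (λ l → (scale r′ * coeff r l + scale r * coeff r′ l) * E (x (gen l ++ M))) ∎ }

    red-* : ∀ c {φ} → Red gen e φ → Red gen e (λ M → c * φ M)
    red-* c {φ} r = record { scale = scale r ; scale≉0 = scale≉0 r ; coeff = λ l → c * coeff r l
      ; reduce = λ {M} ok → trans (x*yz≈y*xz _ _ _) (trans (*-congˡ (reduce r ok))
          (trans (sum-*ˡ c _ fins) (sum-cong fins (λ l → sym (*-assoc _ _ _))))) }

    red-cancel : ∀ {t φ} → ¬ (t ≈ 0#) → Red gen e (λ M → t * φ M) → Red gen e φ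
    red-cancel {t} nz r = record { scale = scale r * t ; scale≉0 = *-≉0 (scale≉0 r) nz ; coeff = coeff r
      ; reduce = λ ok → trans (*-assoc _ _ _) (reduce r ok) }

    red-sum : ∀ {I : Set} (φ : I → List V → Carrier) is → (∀ {i} → i ∈ is → Red gen e (φ i)) →
      Red gen e (λ M → sumL (λ i → φ i M) is)
    red-sum φ [] h = red-0
    red-sum φ (i ∷ is) h = red-+ (h (here ≡.refl)) (red-sum φ is (h ∘ there))

    red-gen : ∀ l → Red gen e (λ M → E (x (gen l ++ M)))
    red-gen l = record { scale = 1# ; scale≉0 = 1≉0 ; coeff = δ
      ; reduce = λ {M} _ → sym (trans (sum-single {f = λ i → δ i * E (x (gen i ++ M))} (UP.allFin⁺ n) (∈-allFin l)
          (λ {i} _ ne → trans (*-congʳ (δ-≢ ne)) (zeroˡ _))) (*-congʳ δ-≡)) }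
      where
      δ : Fin n → Carrier
      δ i with i F.≟ l
      ... | yes _ = 1#
      ... | no _ = 0#
      δ-≡ : δ l ≈ 1#
      δ-≡ with l F.≟ l
      ... | yes _ = refl
      ... | no ne = contradiction ≡.refl ne
      δ-≢ : ∀ {i} → i ≢ l → δ i ≈ 0#
      δ-≢ {i} ne with i F.≟ l
      ... | yes e = contradiction e ne
      ... | no _ = refl

  red-∈ : ∀ {gs : List (List V)} {e J J′} → J ∈ gs → J ↭ J′ → Red (L.lookup gs) e (λ M → E (x (J′ ++ M)))
  red-∈ {gs} m p = red-cong (λ {M} _ → E-↭ (PermP.++⁺ʳ M (↭-trans (↭-reflexive (≡.sym (AnyP.lookup-index m))) p))) (red-gen (Any.index m))

  Dependency : ∀ {n} → ℕ → (Fin n → List V → Carrier) → Set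
  Dependency {n} e φ = Σ (Fin n → Carrier) λ u → (∃[ j ] ¬ (u j ≈ 0#)) × (∀ {M} → Ok e M → sumF (λ j → u j * φ j M) ≈ 0#)

  -- Each reduced functional is a vector of coefficients in the `m` generators, so a kernel vector
  -- exists; the factors `scale` are put back into it and cannot turn a non-zero entry into zero.
  dependency : ∀ {m n e} {gen : Fin m → List V} (φ : Fin n → List V → Carrier) → m ℕ.< n → (∀ j → Red gen e (φ j)) →
    Dependency e φ
  dependency {m} {n} {e} {gen} φ lt red
    with kernel (map (λ l j → coeff (red j) l) (allFin m)) (≡.subst (ℕ._< n) (≡.sym (≡.trans (length-map _ (allFin m)) (LP.length-tabulate id))) lt)
  ... | y , (j , nz) , ker = (λ j → y j * scale (red j)) , (j , *-≉0 nz (scale≉0 (red j))) , λ {M} ok → begin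
      sumF (λ j → y j * scale (red j) * φ j M)
        ≈⟨ sum-cong (allFin n) (λ j → trans (*-assoc _ _ _) (*-congˡ (reduce (red j) ok))) ⟩
      sumF (λ j → y j * sumF (λ l → coeff (red j) l * E (x (gen l ++ M))))
        ≈⟨ sum-cong (allFin n) (λ j → trans (sum-*ˡ _ _ (allFin m)) (sum-cong (allFin m) (λ l → sym (*-assoc _ _ _)))) ⟩
      sumF (λ j → sumF (λ l → y j * coeff (red j) l * E (x (gen l ++ M)))) ≈⟨ sum-swap _ (allFin n) (allFin m) ⟩
      sumF (λ l → sumF (λ j → y j * coeff (red j) l * E (x (gen l ++ M))))
        ≈⟨ sum-zero (allFin m) (λ l → trans (sym (sum-*ʳ _ _ (allFin n))) (trans (*-congʳ (All.lookup (AllP.map⁻ ker) (∈-allFin l))) (zeroˡ _))) ⟩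
      0# ∎

  restr : ∀ k → Fin (h k) → List V
  restr k j = R (L.lookup (level k) j)

  module _ {k e : ℕ} (k+e : k ℕ.+ e ≡ suc d′) where

    private
      Reduced : List V → Set
      Reduced J = Red (restr k) e (λ M → E (x (J ++ M)))

    -- Induction along the shelling. A vertex `v` of `J` beyond `R σ` is exchanged for vertices
    -- outside σ, by a linear form in which no other vertex of σ occurs. The facet that covers a new
    -- monomial contains `R σ` and is different from σ, so its `ω` is smaller.
    span-facet : ∀ n {σ} → σ ∈ Fs → ω σ ℕ.< n → ∀ J → Ok k J → R σ ⊑ J → J ⊑ σ → Reduced J
    span-facet (suc n) {σ} m lt J (J⊑ , lJ) R⊑J J⊑σ with unique-extend (R σ) (unique-++ˡ (R σ) (RS-unique m)) R⊑J
    ... | [] , p = red-cong (λ {M} _ → E-↭ (PermP.++⁺ʳ M (↭-trans (↭-reflexive (≡.trans (≡.cong R (≡.sym (AnyP.lookup-index σ∈))) (≡.sym (LP.++-identityʳ (R σ))))) p)))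
                     (red-gen (Any.index σ∈))
      where
      σ∈ : σ ∈ level k
      σ∈ = ∈-filter⁺ (λ σ → length (R σ) ℕ.≟ k) m (≡.trans (≡.cong length (≡.sym (LP.++-identityʳ (R σ)))) (≡.trans (↭-length p) lJ))
    ... | v ∷ m″ , p with ∈⇒↭ (J⊑σ (∈-resp-↭ p (∈-++⁺ʳ (R σ) (here ≡.refl)))) | ∈⇒↭ {xs = z ∷ vs} (there (J⊑ (∈-resp-↭ p (∈-++⁺ʳ (R σ) (here ≡.refl)))))
    ... | Gs , pσ | rest , pvs = red-cancel (br≉0 (unique-resp-↭ (↭-sym pσ) (facet-unique m)) (≡.trans (↭-length pσ) (facet-length m)))
        (red-cong (λ {M} ok → trans (sym (isolate M ok)) (*-congˡ (E-↭ (PermP.++⁺ʳ M vJ′)))) (red-sum (λ u M → br (u ∷ Gs) * E (x (u ∷ J′ ++ M))) rest each))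
      where
      J′ : List V
      J′ = R σ ++ m″
      vJ′ : v ∷ J′ ↭ J
      vJ′ = ↭-trans (↭-sym (PermP.shift v (R σ) m″)) p
      J′⊑ : J′ ⊑ J
      J′⊑ n = ∈-resp-↭ vJ′ (there n)
      isolate : ∀ M → Ok e M → br (v ∷ Gs) * E (x (v ∷ J′ ++ M)) ≈ sumL (λ u → br (u ∷ Gs) * E (x (u ∷ J′ ++ M))) rest
      isolate M _ = +≈0⇒≈ (trans (sum-↭ (λ u → br (u ∷ Gs) * E (x (u ∷ J′ ++ M))) pvs) (linear-relation-E Gs (J′ ++ M)))
      v∉rest : v ∉ rest
      v∉rest = unique-head (unique-resp-↭ (↭-sym pvs) uvs)
      each : ∀ {u} → u ∈ rest → Red (restr k) e (λ M → br (u ∷ Gs) * E (x (u ∷ J′ ++ M)))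
      each {u} u∈ with u ∈? Gs
      ... | yes n = red-cong (λ _ → sym (trans (*-congʳ (det-repeated rows n)) (zeroˡ _))) red-0
      ... | no u∉ with ∈-resp-↭ pvs (there u∈)
      -- The term of `z` vanishes, because `J′ ++ M` has exactly the degree required by `E-z`.
      ... | here ≡.refl = red-cong (λ {M} ok → sym (trans (*-congˡ (E-z (J′ ++ M) (λ n → Sum.[ (λ a → J⊑ (J′⊑ a)) , proj₁ ok ] (∈-++⁻ J′ n)) (len M ok))) (zeroʳ _))) red-0
        where
        len : ∀ M → Ok e M → length (J′ ++ M) ≡ d′
        len M (_ , lM) = suc-injective (≡.trans (≡.cong suc (length-++ J′)) (≡.trans (≡.cong₂ ℕ._+_ (≡.trans (↭-length vJ′) lJ) lM) k+e))
      ... | there u∈vs with inFacet? (u ∷ J′)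
      ... | inj₂ none = red-cong (λ {M} _ → sym (trans (*-congˡ (E-prefix-⋢ (u ∷ J′) M (λ { (here ≡.refl) → u∈vs ; (there n) → J⊑ (J′⊑ n) }) none)) (zeroʳ _))) red-0
      ... | inj₁ (σ₁ , m₁ , s₁) with cover-R (u ∷ J′) m₁ s₁
      ... | τ , mτ , Rτ , sτ with order-R m mτ (λ n → sτ (there (∈-++⁺ˡ n)))
      ... | inj₁ ≡.refl with ∈-resp-↭ (↭-sym pσ) (sτ (here ≡.refl))
      ...   | here ≡.refl = contradiction u∈ v∉rest
      ...   | there n = contradiction n u∉
      each {u} u∈ | no u∉ | there u∈vs | inj₁ _ | τ , mτ , Rτ , sτ | inj₂ ωτ<ωσ =
        red-* (br (u ∷ Gs)) (span-facet n mτ (ℕP.<-≤-trans ωτ<ωσ (ℕP.≤-pred lt)) (u ∷ J′)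
          ((λ { (here ≡.refl) → u∈vs ; (there n) → J⊑ (J′⊑ n) }) , ≡.trans (↭-length vJ′) lJ) Rτ sτ)

    span : ∀ J → Ok k J → Reduced J
    span J ok with inFacet? J
    ... | inj₂ none = red-cong (λ {M} _ → sym (E-prefix-⋢ J M (proj₁ ok) none)) red-0
    ... | inj₁ (σ , m , s) with cover-R J m s
    ... | τ , mτ , Rτ , sτ = span-facet (suc (ω τ)) mτ ℕP.≤-refl J ok Rτ sτ

  -- The matrix E (x (R σ ++ S τ)) is triangular with nonzero diagonal.
  independent : ∀ {k} (u : Fin (h k) → Carrier) →
    (∀ i → sumF (λ j → u j * E (x (restr k j ++ S (L.lookup (level k) i)))) ≈ 0#) → ∀ i → u i ≈ 0#
  independent {k} u eqs i = go bound i (ℕP.m∸n≤m bound (ω (facet i)))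
    where
    facet : Fin (h k) → List V
    facet = L.lookup (level k)
    facet∈ : ∀ j → facet j ∈ Fs
    facet∈ j = proj₁ (∈-level (∈-lookup {xs = level k} j))
    facet-injective : ∀ {i j} → facet i ≡ facet j → i ≡ j
    facet-injective = lookup-injective (UP.filter⁺ (λ σ → length (R σ) ℕ.≟ k) Fs-unique) _ _
    diagonal : ∀ i → ¬ (E (x (R (facet i) ++ S (facet i))) ≈ 0#)
    diagonal i e = *-≉0 (cof≉0 (facet∈ i)) (prod≉0 _ (λ n → X≉0 (facet∈ i) (there (∈-resp-↭ (R++S (facet∈ i)) n))))
      (trans (sym (sum-single {f = λ σ → cof σ * x (R (facet i) ++ S (facet i)) σ} Fs-unique (facet∈ i) (λ {τ} m ne → trans (*-congˡ (x-⋢ (λ n → facet-vs (facet∈ i) (∈-resp-↭ (R++S (facet∈ i)) n))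
        (λ s → ne (same m s)))) (zeroʳ _)))) e)
      where
      same : ∀ {τ} → τ ∈ Fs → (R (facet i) ++ S (facet i)) ⊑ τ → τ ≡ facet i
      same m s with order-R (facet∈ i) m (λ n → s (∈-++⁺ˡ n)) | order-S (facet∈ i) m (λ n → s (∈-++⁺ʳ (R (facet i)) n))
      ... | inj₁ e | _ = ≡.sym e
      ... | inj₂ _ | inj₁ e = ≡.sym e
      ... | inj₂ l | inj₂ l′ = contradiction l′ (ℕP.<-asym l)
    -- A facet that contains both parts lies, in the order by `ω`, between the facet `i` from below
    -- and the facet `j` from above.
    zero-or-above : ∀ i j → j ≢ i → E (x (R (facet j) ++ S (facet i))) ≈ 0# ⊎ ω (facet i) ℕ.< ω (facet j)
    zero-or-above i j ne with inFacet? (R (facet j) ++ S (facet i))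
    ... | inj₂ none = inj₁ (E-zero (λ m → x-⋢ (λ n → Sum.[ (λ a → facet-vs (facet∈ j) (R⊑ (facet∈ j) a)) , (λ a → facet-vs (facet∈ i) (S⊑ (facet∈ i) a)) ] (∈-++⁻ (R (facet j)) n)) (none m)))
    ... | inj₁ (τ , m , s) with order-R (facet∈ j) m (λ n → s (∈-++⁺ˡ n)) | order-S (facet∈ i) m (λ n → s (∈-++⁺ʳ (R (facet j)) n))
    ... | inj₁ e | inj₁ e′ = contradiction (facet-injective (≡.trans e (≡.sym e′))) ne
    ... | inj₁ ≡.refl | inj₂ l = inj₂ l
    ... | inj₂ l | inj₁ ≡.refl = inj₂ l
    ... | inj₂ l | inj₂ l′ = inj₂ (ℕP.<-trans l′ l)
    go : ∀ n i → bound ∸ ω (facet i) ℕ.≤ n → u i ≈ 0#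
    go zero i le = contradiction (ω-bound (facet∈ i)) (ℕP.≤⇒≯ (ℕP.m∸n≡0⇒m≤n (ℕP.n≤0⇒n≡0 le)))
    go (suc n) i le = cancelˡ (diagonal i) (trans (*-comm _ _) (trans (sym (sum-single {f = λ j → u j * E (x (restr k j ++ S (facet i)))}
        (UP.allFin⁺ (h k)) (∈-allFin i) others)) (eqs i)))
      where
      others : ∀ {j} → j ∈ allFin (h k) → j ≢ i → u j * E (x (restr k j ++ S (facet i))) ≈ 0#
      others {j} _ ne with zero-or-above i j ne
      ... | inj₁ e = trans (*-congˡ e) (zeroʳ _)
      ... | inj₂ l = trans (*-congʳ (go n j (ℕP.≤-pred (ℕP.<-≤-trans (ℕP.∸-monoʳ-< l (ℕP.<⇒≤ (ω-bound (facet∈ j)))) le)))) (zeroˡ _)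

  -- If τ contains `as` and `ms`, the square of `x ms τ` is constant for the moves, and the circuit
  -- identity applies to the rest. Otherwise both sides vanish: either `x ms τ` is zero, or some
  -- column of `as` is absent from τ and its move kills the left side.
  moves-facet : ∀ {τ} → τ ∈ Fs → ∀ qs ms → let ws = map proj₁ qs ; as = map proj₂ qs in
    Unique (as ++ ms) → (as ++ ms) ⊑ vs → length ms ℕ.+ (length qs ℕ.+ length qs) ≡ suc d′ → (∀ {a} → a ∈ as → a ∉ ws) →
    moves qs (pr τ * x ms τ) ≈ br (ws ++ as ++ ms) * (x (as ++ ms) τ * x (as ++ ms) τ)
  moves-facet {τ} mτ qs ms u sub len fresh with ⊑? (map proj₂ qs ++ ms) τ
  ... | yes s with unique-extend (map proj₂ qs ++ ms) u s
  ... | bs , p = begin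
    moves qs (pr τ * x ms τ) ≈⟨ moves-cong qs (trans (*-congʳ split) (RingIdentities.xyzz≈zz[xy] cring _ _ _)) ⟩
    moves qs (x ms τ * x ms τ * (X τ z * x (as ++ bs) τ)) ≈⟨ moves-square-* qs _ _ ⟩
    x ms τ * x ms τ * moves qs (X τ z * x (as ++ bs) τ)
      ≈⟨ *-congˡ (Circuit.moves-circuit (z ∷ τ) (cone-unique mτ) (X τ) X-minor (X≉0 mτ) z qs bs ms perm bs-length fresh) ⟩
    x ms τ * x ms τ * (x as τ * x as τ * br (ws ++ as ++ ms))
      ≈⟨ RingIdentities.xx[yyz]≈z[yx[yx]] cring _ _ _ ⟩
    br (ws ++ as ++ ms) * (x as τ * x ms τ * (x as τ * x ms τ)) ≈⟨ *-congˡ (*-cong (prod-++ (X τ) as ms) (prod-++ (X τ) as ms)) ⟨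
    br (ws ++ as ++ ms) * (x (as ++ ms) τ * x (as ++ ms) τ) ∎
    where
    ws as : List V
    ws = map proj₁ qs
    as = map proj₂ qs
    perm : z ∷ as ++ bs ++ ms ↭ z ∷ τ
    perm = prep z (↭-trans (PermP.++⁺ˡ as (PermP.++-comm bs ms)) (↭-trans (↭-reflexive (≡.sym (LP.++-assoc as ms bs))) p))
    split : pr τ ≈ X τ z * x (as ++ bs) τ * x ms τ
    split = trans (sym (prod-↭ (X τ) perm)) (trans (*-congˡ (trans (reflexive (≡.cong (λ l → x l τ) (≡.sym (LP.++-assoc as bs ms)))) (prod-++ (X τ) (as ++ bs) ms))) (sym (*-assoc _ _ _)))
    bs-length : length bs ≡ length qs
    bs-length = ℕP.+-cancelˡ-≡ (length qs ℕ.+ length ms) _ _ (≡.trans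
      (≡.trans (≡.sym (≡.trans (length-++ (as ++ ms)) (≡.cong (ℕ._+ length bs) (≡.trans (length-++ as) (≡.cong (ℕ._+ length ms) (length-map proj₂ qs))))))
        (≡.trans (↭-length p) (facet-length mτ)))
      (≡.trans (≡.sym len) (ℕS.solve 2 (λ q m → m ℕS.:+ (q ℕS.:+ q) ℕS.:= q ℕS.:+ m ℕS.:+ q) ≡.refl (length qs) (length ms))))
  moves-facet {τ} mτ qs ms u sub len fresh | no ¬s = trans lhs (sym (trans (*-congˡ (trans (*-congˡ (x-⋢ sub ¬s)) (zeroʳ _))) (zeroʳ _)))
    where
    as : List V
    as = map proj₂ qs
    lhs : moves qs (pr τ * x ms τ) ≈ 0#
    lhs with ⊑? ms τ
    ... | no ¬m = trans (moves-cong qs (trans (*-congˡ (x-⋢ (λ n → sub (∈-++⁺ʳ as n)) ¬m)) (zeroʳ _))) (moves-0 qs)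
    ... | yes ms⊑ with AllP.¬All⇒Any¬ (_∈? τ) as (λ al → ¬s (λ n → Sum.[ All.lookup al , ms⊑ ] (∈-++⁻ as n)))
    ... | any with L∈.find any
    ... | a , a∈ , a∉τ = moves-free qs a∈ (fresh a∈) (free-* (free-prod (z ∷ τ) free) (free-prod ms (λ n → free (there (ms⊑ n)))))
      where
      a∉ : a ∉ z ∷ τ
      a∉ (here ≡.refl) = z∉vs (sub (∈-++⁺ˡ a∈))
      a∉ (there n) = a∉τ n
      free : ∀ {v} → v ∈ z ∷ τ → FreeOf a (X τ v)
      free n with ∈⇒↭ n
      ... | r , q = free-≈ (sym (X-minor q)) (free-det rows id (λ m → a∉ (∈-resp-↭ q (there m))))

  -- A class of degree `k` with coefficients `c` in the spanning monomials, evaluated at the facets.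
  comb : ∀ {k} → (Fin (h k) → Carrier) → List V → Carrier
  comb {k} c σ = sumF (λ j → c j * x (restr k j) σ)

  E-comb : ∀ {k} (c : Fin (h k) → Carrier) (g : List V → Carrier) M →
    sumF (λ j → c j * E (λ σ → g σ * x (restr k j ++ M) σ)) ≈ E (λ σ → g σ * (comb c σ * x M σ))
  E-comb {k} c g M = trans (sym (E-lin c _ (allFin (h k)))) (E-cong (λ {σ} _ → begin
    sumF (λ j → c j * (g σ * x (restr k j ++ M) σ))
      ≈⟨ sum-cong (allFin (h k)) (λ j → trans (*-congˡ (*-congˡ (prod-++ (X σ) (restr k j) M)))
           (RingIdentities.x[y[zw]]≈y[xzw] cring _ _ _ _)) ⟩
    sumF (λ j → g σ * (c j * x (restr k j) σ * x M σ)) ≈⟨ sum-*ˡ (g σ) _ (allFin (h k)) ⟨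
    g σ * sumF (λ j → c j * x (restr k j) σ * x M σ) ≈⟨ *-congˡ (sum-*ʳ _ (x M σ) (allFin (h k))) ⟨
    g σ * (comb c σ * x M σ) ∎))

  -- The generic linear form. Its coefficients are the variables of row `ρ`, on which neither the
  -- points `X` nor the factors `cof` depend.
  ℓ : List V → Carrier
  ℓ σ = sumL (λ v → θ ρ v * X σ v) vs

  E-ℓ : ∀ K → E (λ σ → ℓ σ * x K σ) ≈ sumL (λ v → θ ρ v * E (x (v ∷ K))) vs
  E-ℓ K = trans (E-cong (λ {σ} _ → trans (sum-*ʳ _ (x K σ) vs) (sum-cong vs (λ v → *-assoc _ _ _)))) (E-lin (θ ρ) (λ v → x (v ∷ K)) vs)

  module _ (w : V) (w∈ : w ∈ vs) where
    open DerivationProperties (∂ (ρ , w))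

    private
      der-br : ∀ cs → der (br cs) ≈ 0#
      der-br cs = der-det-zero (∂ (ρ , w)) rows cs (λ m _ → ∂-other (λ { ≡.refl → ρ∉rows m }))

      der-X : ∀ σ v → der (X σ v) ≈ 0#
      der-X σ v with v ∈? (z ∷ σ)
      ... | yes m = der-br _
      ... | no _ = der-0

      der-x : ∀ J σ → der (x J σ) ≈ 0#
      der-x J σ = der-prod-zero J (λ {v} _ → der-X σ v)

      der-cof : ∀ σ → der (cof σ) ≈ 0#
      der-cof σ with DecMembership._∈?_ (LP.≡-dec _≟_) σ Fs
      ... | yes m = der-prod-zero (proj₁ (∈⇒picks m)) (λ {τ} _ → der-x (z ∷ τ) τ)
      ... | no _ = der-0

      der-ℓ : ∀ σ → der (ℓ σ) ≈ X σ w
      der-ℓ σ = begin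
        der (ℓ σ) ≈⟨ trans (der-sum _ vs) (sum-cong vs (λ v → der-*-const _ (der-X σ v))) ⟩
        sumL (λ v → der (θ ρ v) * X σ v) vs
          ≈⟨ sum-single (unique-++ʳ (z ∷ []) uvs) w∈ (λ _ ne → trans (*-congʳ (∂-other (λ e → ne (≡.sym (≡.cong proj₂ e))))) (zeroˡ _)) ⟩
        der (θ ρ w) * X σ w ≈⟨ trans (*-congʳ (∂-same (ρ , w))) (*-identityˡ _) ⟩
        X σ w ∎

      der-comb : ∀ {k} (u : Fin (h k) → Carrier) σ → der (comb u σ) ≈ comb (der ∘ u) σ
      der-comb {k} u σ = trans (der-sum _ (allFin (h k))) (sum-cong (allFin (h k)) (λ j → der-*-const _ (der-x (restr k j) σ)))

    -- Differentiate E (ℓ u x^M) = 0 in the coefficient of x_w in ℓ, and multiply by u.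
    E-ℓ-comb⇒E-comb² : ∀ {k e} (u : Fin (h k) → Carrier) →
      (∀ {M} → Ok (k ℕ.+ e) M → E (λ σ → ℓ σ * (comb u σ * x M σ)) ≈ 0#) →
      ∀ {M} → Ok e M → E (λ σ → X σ w * comb u σ * (comb u σ * x M σ)) ≈ 0#
    E-ℓ-comb⇒E-comb² {k} {e} u hyp {M} (M⊑ , lM) = begin
      E (λ σ → X σ w * comb u σ * (comb u σ * x M σ)) ≈⟨ E-comb u _ M ⟨
      sumF (λ j → u j * E (λ σ → X σ w * comb u σ * x (restr k j ++ M) σ)) ≈⟨ sum-cong fins (λ j → *-congˡ (+≈0⇒≈ (derived j))) ⟩
      sumF (λ j → u j * E (λ σ → ℓ σ * u′ σ * x (restr k j ++ M) σ)) ≈⟨ E-comb u _ M ⟩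
      -- The factors are regrouped so that `ℓ` stands next to `u` again and `u′` supplies the test
      -- monomials; then the hypothesis applies a second time.
      E (λ σ → ℓ σ * u′ σ * (comb u σ * x M σ)) ≈⟨ E-cong (λ {σ} _ → RingIdentities.xy[zw]≈xz[yw] cring _ _ _ _) ⟩
      E (λ σ → ℓ σ * comb u σ * (u′ σ * x M σ)) ≈⟨ E-comb (der ∘ u) _ M ⟨
      sumF (λ j → der (u j) * E (λ σ → ℓ σ * comb u σ * x (restr k j ++ M) σ))
        ≈⟨ sum-zero fins (λ j → trans (*-congˡ (trans (E-cong (λ _ → *-assoc _ _ _)) (hyp (ok j)))) (zeroʳ _)) ⟩
      0# ∎
      where
      fins : List (Fin (h k))
      fins = allFin (h k)
      u′ : List V → Carrier
      u′ = comb (der ∘ u)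
      ok : ∀ j → Ok (k ℕ.+ e) (restr k j ++ M)
      ok j with ∈-level (∈-lookup {xs = level k} j)
      ... | m , l = (λ n → Sum.[ (λ a → facet-vs m (R⊑ m a)) , M⊑ ] (∈-++⁻ (restr k j) n)) , ≡.trans (length-++ (restr k j)) (≡.cong₂ ℕ._+_ l lM)
      derived : ∀ j → E (λ σ → X σ w * comb u σ * x (restr k j ++ M) σ) + E (λ σ → ℓ σ * u′ σ * x (restr k j ++ M) σ) ≈ 0#
      derived j = begin
        E (λ σ → X σ w * comb u σ * K σ) + E (λ σ → ℓ σ * u′ σ * K σ) ≈⟨ E-+ _ _ ⟨
        E (λ σ → X σ w * comb u σ * K σ + ℓ σ * u′ σ * K σ) ≈⟨ E-cong (λ {σ} _ → sym (pointwise σ)) ⟩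
        E (λ σ → der (ℓ σ * (comb u σ * K σ))) ≈⟨ sum-cong Fs (λ σ → sym (der-const-* (der-cof σ) _)) ⟩
        sumL (λ σ → der (cof σ * (ℓ σ * (comb u σ * K σ)))) Fs ≈⟨ der-sum _ Fs ⟨
        der (E (λ σ → ℓ σ * (comb u σ * K σ))) ≈⟨ trans (der-cong (hyp (ok j))) der-0 ⟩
        0# ∎
        where
        K : List V → Carrier
        K = x (restr k j ++ M)
        pointwise : ∀ σ → der (ℓ σ * (comb u σ * K σ)) ≈ X σ w * comb u σ * K σ + ℓ σ * u′ σ * K σ
        pointwise σ = trans (der-* _ _) (+-cong (trans (*-congʳ (der-ℓ σ)) (sym (*-assoc _ _ _)))
          (trans (*-congˡ (trans (der-*-const _ (der-x (restr k j ++ M) σ)) (*-congʳ (der-comb u σ)))) (sym (*-assoc _ _ _))))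

  private
    zip-map : ∀ (as bs : List V) → length as ≡ length bs → map proj₁ (L.zip as bs) ≡ as × map proj₂ (L.zip as bs) ≡ bs × length (L.zip as bs) ≡ length as
    zip-map [] [] _ = ≡.refl , ≡.refl , ≡.refl
    zip-map (a ∷ as) (b ∷ bs) e with zip-map as bs (suc-injective e)
    ... | p , q , l = ≡.cong (a ∷_) p , ≡.cong (b ∷_) q , ≡.cong suc l

  -- Anisotropy. `S σ` is divided into `as`, of the size of `R σ`, and the rest `ms`. Replacing the
  -- columns `as` by `R σ` turns `Π` times the degree of u² x^ms into the minor of σ times the
  -- square of the degree of u x^S: squares pass through the moves, and Frobenius collects the
  -- squares over the facets.
  E-comb²⇒E-comb : ∀ {k e} → k ℕ.+ (k ℕ.+ suc e) ≡ suc d′ → (u : Fin (h k) → Carrier) →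
    (∀ {M} → Ok (suc e) M → E (λ σ → comb u σ * comb u σ * x M σ) ≈ 0#) →
    ∀ {σ} → σ ∈ level k → E (λ τ → comb u τ * x (S σ) τ) ≈ 0#
  E-comb²⇒E-comb {k} {e} keq u hyp {σ} σ∈ = go (zip-map (R σ) as (≡.trans lR (≡.sym las)))
    where
    mσ : σ ∈ Fs
    mσ = proj₁ (∈-level σ∈)
    lR : length (R σ) ≡ k
    lR = proj₂ (∈-level {k} σ∈)
    lS : length (S σ) ≡ k ℕ.+ suc e
    lS = ℕP.+-cancelˡ-≡ k _ _ (≡.trans (≡.sym (≡.trans (length-++ (R σ)) (≡.cong (ℕ._+ length (S σ)) lR))) (≡.trans (≡.trans (↭-length (R++S mσ)) (facet-length mσ)) (≡.sym keq)))
    as ms : List V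
    as = L.take k (S σ)
    ms = L.drop k (S σ)
    as++ms : as ++ ms ≡ S σ
    as++ms = LP.take++drop≡id k (S σ)
    las : length as ≡ k
    las = ≡.trans (LP.length-take k (S σ)) (≡.trans (≡.cong (k ℕ.⊓_) lS) (ℕP.m≤n⇒m⊓n≡m (ℕP.m≤m+n k (suc e))))
    lms : length ms ≡ suc e
    lms = ≡.trans (LP.length-drop k (S σ)) (≡.trans (≡.cong (_∸ k) lS) (ℕP.m+n∸m≡n k (suc e)))
    S⊑vs : S σ ⊑ vs
    S⊑vs n = facet-vs mσ (S⊑ mσ n)
    go : map proj₁ (L.zip (R σ) as) ≡ R σ × map proj₂ (L.zip (R σ) as) ≡ as × length (L.zip (R σ) as) ≡ length (R σ) → E (λ τ → comb u τ * x (S σ) τ) ≈ 0#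
    go (ws≡ , as≡ , l) = square≈0 (cancelˡ (br≉0 (unique-resp-↭ (↭-sym (R++S mσ)) (facet-unique mσ)) (≡.trans (↭-length (R++S mσ)) (facet-length mσ))) (begin
      br (R σ ++ S σ) * (E Y * E Y) ≈⟨ *-congˡ (square-sum _ Fs) ⟩
      br (R σ ++ S σ) * sumL (λ τ → cof τ * Y τ * (cof τ * Y τ)) Fs ≈⟨ sum-*ˡ _ _ Fs ⟩
      sumL (λ τ → br (R σ ++ S σ) * (cof τ * Y τ * (cof τ * Y τ))) Fs
        ≈⟨ sum-cong Fs (λ τ → RingIdentities.x[y[zw][y[zw]]]≈yz[yz][x[ww]] cring _ _ _ _) ⟩
      sumL (λ τ → cof τ * comb u τ * (cof τ * comb u τ) * (br (R σ ++ S σ) * (x (S σ) τ * x (S σ) τ))) Fs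
        ≈⟨ sum-cong-∈ Fs (λ m → sym (trans (moves-square-* qs _ _) (*-congˡ (facet-identity m)))) ⟩
      sumL (λ τ → moves qs (cof τ * comb u τ * (cof τ * comb u τ) * (pr τ * x ms τ))) Fs ≈⟨ moves-sum qs _ Fs ⟨
      moves qs (sumL (λ τ → cof τ * comb u τ * (cof τ * comb u τ) * (pr τ * x ms τ)) Fs)
        ≈⟨ moves-cong qs (sum-cong-∈ Fs (λ {τ} m → trans (RingIdentities.xy[xy][zw]≈zx[x[yyw]] cring _ _ _ _) (*-congʳ (pr-cof m)))) ⟩
      moves qs (sumL (λ τ → Π * (cof τ * (comb u τ * comb u τ * x ms τ))) Fs)
        ≈⟨ moves-cong qs (trans (sym (sum-*ˡ Π _ Fs)) (trans (*-congˡ (hyp ((λ n → S⊑vs (≡.subst (_ ∈_) as++ms (∈-++⁺ʳ as n))) , lms))) (zeroʳ _))) ⟩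
      moves qs 0# ≈⟨ moves-0 qs ⟩
      0# ∎))
      where
      qs : List (V × V)
      qs = L.zip (R σ) as
      Y : List V → Carrier
      Y τ = comb u τ * x (S σ) τ
      S≡ : map proj₂ qs ++ ms ≡ S σ
      S≡ = ≡.trans (≡.cong (_++ ms) as≡) as++ms
      facet-identity : ∀ {τ} → τ ∈ Fs → moves qs (pr τ * x ms τ) ≈ br (R σ ++ S σ) * (x (S σ) τ * x (S σ) τ)
      facet-identity {τ} m = trans (moves-facet m qs ms (≡.subst Unique (≡.sym S≡) (unique-++ʳ (R σ) (RS-unique mσ))) (λ n → S⊑vs (≡.subst (_ ∈_) S≡ n)) len
          (λ a∈ a∈ws → R-S-disjoint mσ (≡.subst (_ ∈_) ws≡ a∈ws) (≡.subst (_ ∈_) S≡ (∈-++⁺ˡ a∈))))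
        (reflexive (≡.cong₂ (λ r s → br (r ++ s) * (x s τ * x s τ)) ws≡ S≡))
        where
        len : length ms ℕ.+ (length qs ℕ.+ length qs) ≡ suc d′
        len = ≡.trans (≡.cong₂ (λ a b → a ℕ.+ (b ℕ.+ b)) lms (≡.trans l lR)) (≡.trans (ℕS.solve 2 (λ a b → a ℕS.:+ (b ℕS.:+ b) ℕS.:= b ℕS.:+ (b ℕS.:+ a)) ≡.refl (suc e) k) keq)

  -- If `h (suc k)` were smaller, the products of `ℓ` with the monomials of level `k` would be
  -- dependent, so some non-zero `u` would be annihilated by `ℓ`. Differentiation gives that u²
  -- pairs to zero, anisotropy that `u` does, and `independent` that `u` is zero. The degree `suc e`
  -- guarantees a vertex `w` in every test monomial for the differentiation.
  h-increasing : ∀ {k e} → k ℕ.+ (k ℕ.+ suc e) ≡ suc d′ → h k ℕ.≤ h (suc k)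
  h-increasing {k} {e} keq = ℕP.≮⇒≥ absurd
    where
    φ : Fin (h k) → List V → Carrier
    φ j M = sumL (λ v → θ ρ v * E (x (v ∷ restr k j ++ M))) vs
    facet : ∀ j → restr k j ⊑ vs × length (restr k j) ≡ k
    facet j with ∈-level (∈-lookup {xs = level k} j)
    ... | m , l = (λ n → facet-vs m (R⊑ m n)) , l
    reduced : ∀ j → Red (restr (suc k)) (k ℕ.+ e) (φ j)
    reduced j = red-sum (λ v M → θ ρ v * E (x (v ∷ restr k j ++ M))) vs (λ {v} v∈ → red-* (θ ρ v) (span (≡.trans (≡.trans (≡.sym (ℕP.+-suc k (k ℕ.+ e))) (≡.cong (k ℕ.+_) (≡.sym (ℕP.+-suc k e)))) keq)
      (v ∷ restr k j) ((λ { (here ≡.refl) → v∈ ; (there n) → proj₁ (facet j) n }) , ≡.cong suc (proj₂ (facet j)))))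
    absurd : ¬ (h (suc k) ℕ.< h k)
    absurd lt = contra (dependency {m = h (suc k)} {n = h k} {e = k ℕ.+ e} {gen = restr (suc k)} φ lt reduced)
     where
     contra : Dependency (k ℕ.+ e) φ → ⊥
     contra (u , (j , nz) , rel) = nz (independent u eqs j)
      where
      step₁ : ∀ {M} → Ok (k ℕ.+ e) M → E (λ σ → ℓ σ * (comb u σ * x M σ)) ≈ 0#
      step₁ {M} ok = trans (sym (E-comb u ℓ M)) (trans (sum-cong (allFin (h k)) (λ j → *-congˡ (E-ℓ (restr k j ++ M)))) (rel ok))
      step₂ : ∀ {M} → Ok (suc e) M → E (λ σ → comb u σ * comb u σ * x M σ) ≈ 0#
      step₂ {w ∷ M} (sub , l) = trans (E-cong (λ {σ} _ → RingIdentities.xx[yz]≈yx[xz] cring _ _ _))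
        (E-ℓ-comb⇒E-comb² w (sub (here ≡.refl)) u step₁ ((λ n → sub (there n)) , suc-injective l))
      eqs : ∀ i → sumF (λ j → u j * E (x (restr k j ++ S (L.lookup (level k) i)))) ≈ 0#
      eqs i = trans (sum-cong (allFin (h k)) (λ j → *-congˡ (E-cong (λ _ → sym (*-identityˡ _)))))
        (trans (E-comb u (λ _ → 1#) _) (trans (E-cong (λ _ → *-identityˡ _)) (E-comb²⇒E-comb keq u step₂ (∈-lookup i))))

  -- The restrictions of level 1 are single vertices and span degree 1. The vertices of a monomial
  -- are replaced by them one after the other.
  span-monos : ∀ k e → k ℕ.+ e ≡ suc d′ → ∀ J → Ok k J →
    Red (L.lookup (monos (L.concat (map R (level 1))) k)) e (λ M → E (x (J ++ M)))
  span-monos zero e keq [] _ = red-∈ (here ≡.refl) ↭-refl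
  span-monos (suc k) e keq (v ∷ J) (sub , lJ) = red-cancel (scale≉0 r₁) (red-cong (λ {M} ok → sym (reduce r₁ (ok₁ M ok)))
      (red-sum (λ l M → coeff r₁ l * E (x (restr 1 l ++ J ++ M))) (allFin (h 1)) (λ {l} _ → red-* (coeff r₁ l) (insert l))))
    where
    gv : List V
    gv = L.concat (map R (level 1))
    r₁ : Red (restr 1) (k ℕ.+ e) (λ M → E (x (v ∷ M)))
    r₁ = span keq (v ∷ []) ((λ { (here ≡.refl) → sub (here ≡.refl) }) , ≡.refl)
    ok₁ : ∀ M → Ok e M → Ok (k ℕ.+ e) (J ++ M)
    ok₁ M (s , l) = (λ n → Sum.[ (λ a → sub (there a)) , s ] (∈-++⁻ J n)) , ≡.trans (length-++ J) (≡.cong₂ ℕ._+_ (suc-injective lJ) l)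
    insert : ∀ l → Red (L.lookup (monos gv (suc k))) e (λ M → E (x (restr 1 l ++ J ++ M)))
    insert l with restr 1 l in eq | ∈-level {1} (∈-lookup {xs = level 1} l)
    ... | R₁ | m , len with R₁ | len
    ... | g ∷ [] | _ = red-cancel (scale≉0 r₂) (red-cong (λ {M} ok → trans (sym (reduce r₂ (ok₂ ok))) (*-congˡ (E-↭ (PermP.shift g J M))))
          (red-sum (λ i M → coeff r₂ i * E (x (L.lookup (monos gv k) i ++ g ∷ M))) (allFin _) (λ {i} _ → red-* (coeff r₂ i) (last i))))
      where
      g∈gv : g ∈ gv
      g∈gv = ∈-concat⁺′ (≡.subst (g ∈_) (≡.sym eq) (here ≡.refl)) (∈-map⁺ R (∈-lookup {xs = level 1} l))
      r₂ : Red (L.lookup (monos gv k)) (suc e) (λ M → E (x (J ++ M)))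
      r₂ = span-monos k (suc e) (≡.trans (ℕP.+-suc k e) keq) J ((λ n → sub (there n)) , suc-injective lJ)
      ok₂ : ∀ {M} → Ok e M → Ok (suc e) (g ∷ M)
      ok₂ (s , l) = (λ { (here ≡.refl) → facet-vs m (R⊑ m (≡.subst (g ∈_) (≡.sym eq) (here ≡.refl))) ; (there n) → s n }) , ≡.cong suc l
      last : ∀ i → Red (L.lookup (monos gv (suc k))) e (λ M → E (x (L.lookup (monos gv k) i ++ g ∷ M)))
      last i with monos-insert gv k g∈gv (∈-lookup {xs = monos gv k} i)
      ... | J′ , m′ , p = red-cong (λ {M} _ → E-↭ (↭-sym (PermP.shift g (L.lookup (monos gv k) i) M))) (red-∈ m′ p)

  -- The independent monomials of level `suc k` cannot outnumber the monomials of that degree in the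
  -- `h 1` vertices that span degree 1.
  h-upper : ∀ {k e} → suc k ℕ.+ e ≡ suc d′ → h (suc k) ℕ.≤ (h 1 ℕ.+ k) C suc k
  h-upper {k} {e} keq = ≡.subst (h (suc k) ℕ.≤_) (≡.trans (monos-length gv k) (≡.cong (λ n → (n ℕ.+ k) C suc k) gv-length)) (ℕP.≮⇒≥ absurd)
    where
    gv : List V
    gv = L.concat (map R (level 1))
    gv-length : length gv ≡ h 1
    gv-length = go (level 1) (λ m → proj₂ (∈-level {1} m))
      where
      go : ∀ Ls → (∀ {σ} → σ ∈ Ls → length (R σ) ≡ 1) → length (L.concat (map R Ls)) ≡ length Ls
      go [] _ = ≡.refl
      go (σ ∷ Ls) f = ≡.trans (length-++ (R σ)) (≡.cong₂ ℕ._+_ (f (here ≡.refl)) (go Ls (f ∘ there)))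
    reduced : ∀ j → Red (L.lookup (monos gv (suc k))) e (λ M → E (x (restr (suc k) j ++ M)))
    reduced j with ∈-level (∈-lookup {xs = level (suc k)} j)
    ... | m , l = span-monos (suc k) e keq (restr (suc k) j) ((λ n → facet-vs m (R⊑ m n)) , l)
    φ : Fin (h (suc k)) → List V → Carrier
    φ j M = E (x (restr (suc k) j ++ M))
    absurd : ¬ (length (monos gv (suc k)) ℕ.< h (suc k))
    absurd lt = contra (dependency {m = length (monos gv (suc k))} {n = h (suc k)} {e = e} {gen = L.lookup (monos gv (suc k))} φ lt reduced)
     where
     contra : Dependency e φ → ⊥
     contra (u , (j , nz) , rel) = nz (independent u (λ i → rel (ok i)) j)
      where
      ok : ∀ i → Ok e (S (L.lookup (level (suc k)) i))
      ok i with ∈-level (∈-lookup {xs = level (suc k)} i)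
      ... | m , l = (λ n → facet-vs m (S⊑ m n)) , ℕP.+-cancelˡ-≡ (suc k) _ _ (≡.trans (≡.cong (ℕ._+ length (S (L.lookup (level (suc k)) i))) (≡.sym l)) (≡.trans (≡.sym (length-++ (R (L.lookup (level (suc k)) i)))) (≡.trans (↭-length (R++S m)) (≡.trans (facet-length m) (≡.sym keq)))))

-- Ordered fields

module ListKernel (D : IntegralDomain) {A : Set} (_≟_ : DecidableEquality A) where
  open IntegralDomain D
  open RingSums cring
  open DecMembership _≟_ using (_∈?_)

  kernel-list : (xs : List A) → Unique xs → (cols : List (A → Carrier)) → length cols ℕ.< length xs →
    ∃[ c ] (∃[ a ] a ∈ xs × ¬ (c a ≈ 0#)) × All (λ g → sumL (λ a → c a * g a) xs ≈ 0#) cols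
  kernel-list xs u cols lt = transport (Kernel.kernel D (map (λ g j → g (L.lookup xs j)) cols) (≡.subst (ℕ._< length xs) (≡.sym (length-map _ cols)) lt))
    where
    module Transport (y : Fin (length xs) → Carrier) where
      c : A → Carrier
      c a with a ∈? xs
      ... | yes m = y (Any.index m)
      ... | no _ = 0#
      c-lookup : ∀ j → c (L.lookup xs j) ≈ y j
      c-lookup j with L.lookup xs j ∈? xs
      ... | yes m = reflexive (≡.cong y (lookup-injective u _ _ (≡.sym (AnyP.lookup-index m))))
      ... | no ∉xs = contradiction (∈-lookup j) ∉xs
      lookups : map (L.lookup xs) (allFin (length xs)) ≡ xs
      lookups = ≡.trans (LP.map-tabulate id (L.lookup xs)) (LP.tabulate-lookup xs)
      transfer : ∀ {g : A → Carrier} → Kernel.sumF D (λ j → y j * g (L.lookup xs j)) ≈ 0# → sumL (λ a → c a * g a) xs ≈ 0#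
      transfer {g} e = ≡.subst (λ l → sumL (λ a → c a * g a) l ≈ 0#) lookups
        (trans (sum-map (λ a → c a * g a) (L.lookup xs) (allFin (length xs))) (trans (sum-cong (allFin (length xs)) (λ j → *-congʳ (c-lookup j))) e))
    transport : ∃[ y ] (∃[ j ] ¬ (y j ≈ 0#)) × All (λ c → Kernel.sumF D (λ j → y j * c j) ≈ 0#) (map (λ g j → g (L.lookup xs j)) cols) →
      ∃[ c ] (∃[ a ] a ∈ xs × ¬ (c a ≈ 0#)) × All (λ g → sumL (λ a → c a * g a) xs ≈ 0#) cols
    transport (y , (j , nz) , ker) = c , (L.lookup xs j , ∈-lookup j , λ e → nz (trans (sym (c-lookup j)) e)) , All.map transfer (AllP.map⁻ ker)
      where open Transport y

record OrderedField : Set₁ where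
  infixl 6 _+_
  infixl 7 _*_
  infix 8 -_
  infix 4 _≤_ _<_
  field
    𝔽 : Set
    _+_ _*_ : 𝔽 → 𝔽 → 𝔽
    -_ : 𝔽 → 𝔽
    0# 1# : 𝔽
    isCommutativeRing : IsCommutativeRing _≡_ _+_ _*_ -_ 0# 1#
    _<_ _≤_ : 𝔽 → 𝔽 → Set
    <-cmp : Tri.Trichotomous _≡_ _<_
    <-trans : ∀ {p q r} → p < q → q < r → p < r
    ≤⇒≯ : ∀ {p q} → p ≤ q → ¬ (q < p)
    ≮⇒≥ : ∀ {p q} → ¬ (p < q) → q ≤ p
    +-monoˡ-< : ∀ r {p q} → p < q → p + r < q + r
    *-0< : ∀ {p q} → 0# < p → 0# < q → 0# < p * q
    0<1 : 0# < 1#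
    1/′ : ∀ {p} → p ≢ 0# → ∃[ r ] p * r ≡ 1#

  cring : CommutativeRing 0ℓ 0ℓ
  cring = record { isCommutativeRing = isCommutativeRing }

module FieldProperties (O : OrderedField) where
  open OrderedField O public using (𝔽; _<_; _≤_; <-cmp; <-trans; ≤⇒≯; ≮⇒≥; +-monoˡ-<; *-0<; 0<1; 1/′; cring)
  open CommutativeRing cring public using (_+_; _*_; -_; _-_; 0#; 1#; +-assoc; +-comm; +-identityˡ; +-identityʳ; *-assoc; *-comm; *-identityˡ; *-identityʳ; distribˡ; distribʳ; zeroˡ; zeroʳ; -‿inverseˡ; -‿inverseʳ)
  open RingProps (CommutativeRing.ring cring) public using () renaming (-‿distribˡ-* to neg-distribˡ-*; -‿distribʳ-* to neg-distribʳ-*; -‿involutive to neg-involutive; -0#≈0# to -0≡0)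
  open RingProps (CommutativeRing.ring cring) using (-‿+-comm)
  open RingSums cring public
  open ≡

  neg-distrib-+ : ∀ p q → - (p + q) ≡ - p + - q
  neg-distrib-+ p q = sym (-‿+-comm p q)

  <-irrefl : ∀ {p q} → p ≡ q → ¬ (p < q)
  <-irrefl {p} refl lt with <-cmp p p
  ... | Tri.tri< _ ne _ = ne refl
  ... | Tri.tri≈ nl _ _ = nl lt
  ... | Tri.tri> nl _ _ = nl lt

  ≤-refl : ∀ {p} → p ≤ p
  ≤-refl = ≮⇒≥ (<-irrefl refl)

  ≤-reflexive : ∀ {p q} → p ≡ q → p ≤ q
  ≤-reflexive refl = ≤-refl

  <⇒≤ : ∀ {p q} → p < q → p ≤ q
  <⇒≤ lt = ≮⇒≥ (λ gt → <-irrefl refl (<-trans lt gt))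

  ≤-cases : ∀ {p q} → p ≤ q → p < q ⊎ p ≡ q
  ≤-cases {p} {q} le with <-cmp p q
  ... | Tri.tri< lt _ _ = inj₁ lt
  ... | Tri.tri≈ _ e _ = inj₂ e
  ... | Tri.tri> _ _ gt = contradiction gt (≤⇒≯ le)

  ≤-<-trans : ∀ {p q r} → p ≤ q → q < r → p < r
  ≤-<-trans le lt with ≤-cases le
  ... | inj₁ l = <-trans l lt
  ... | inj₂ refl = lt

  <-≤-trans : ∀ {p q r} → p < q → q ≤ r → p < r
  <-≤-trans lt le with ≤-cases le
  ... | inj₁ l = <-trans lt l
  ... | inj₂ refl = lt

  ≤-trans : ∀ {p q r} → p ≤ q → q ≤ r → p ≤ r
  ≤-trans a b with ≤-cases a
  ... | inj₁ l = <⇒≤ (<-≤-trans l b)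
  ... | inj₂ refl = b

  ≤-antisym : ∀ {p q} → p ≤ q → q ≤ p → p ≡ q
  ≤-antisym a b with ≤-cases a
  ... | inj₁ l = contradiction l (≤⇒≯ b)
  ... | inj₂ e = e

  _≤?_ : ∀ p q → Dec (p ≤ q)
  p ≤? q with <-cmp p q
  ... | Tri.tri< lt _ _ = yes (<⇒≤ lt)
  ... | Tri.tri≈ _ e _ = yes (≤-reflexive e)
  ... | Tri.tri> _ _ gt = no (λ le → ≤⇒≯ le gt)

  _<?_ : ∀ p q → Dec (p < q)
  p <? q with <-cmp p q
  ... | Tri.tri< lt _ _ = yes lt
  ... | Tri.tri≈ nl _ _ = no nl
  ... | Tri.tri> nl _ _ = no nl

  _≟ᶠ_ : (p q : 𝔽) → Dec (p ≡ q)
  p ≟ᶠ q with <-cmp p q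
  ... | Tri.tri< _ ne _ = no ne
  ... | Tri.tri≈ _ e _ = yes e
  ... | Tri.tri> _ ne _ = no ne

  ≰⇒> : ∀ {p q} → ¬ (p ≤ q) → q < p
  ≰⇒> {p} {q} n with q <? p
  ... | yes lt = lt
  ... | no nl = contradiction (≮⇒≥ nl) n

  ≤∧≢⇒< : ∀ {p q} → p ≤ q → p ≢ q → p < q
  ≤∧≢⇒< le ne with ≤-cases le
  ... | inj₁ l = l
  ... | inj₂ e = contradiction e ne

  0<⇒≢0 : ∀ {p} → 0# < p → p ≢ 0#
  0<⇒≢0 lt e = <-irrefl (sym e) lt

  +-monoˡ-≤ : ∀ r {p q} → p ≤ q → p + r ≤ q + r
  +-monoˡ-≤ r le with ≤-cases le
  ... | inj₁ l = <⇒≤ (+-monoˡ-< r l)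
  ... | inj₂ refl = ≤-refl

  *-0≤ : ∀ {p q} → 0# ≤ p → 0# ≤ q → 0# ≤ p * q
  *-0≤ {p} {q} a b with ≤-cases a | ≤-cases b
  ... | inj₁ l | inj₁ l′ = <⇒≤ (*-0< l l′)
  ... | inj₂ refl | _ = ≤-reflexive (sym (zeroˡ q))
  ... | inj₁ _ | inj₂ refl = ≤-reflexive (sym (zeroʳ p))

  +-0≤ : ∀ {p q} → 0# ≤ p → 0# ≤ q → 0# ≤ p + q
  +-0≤ {p} {q} a b = ≤-trans b (subst (_≤ p + q) (+-identityˡ q) (+-monoˡ-≤ q a))

  +-0< : ∀ {p q} → 0# < p → 0# ≤ q → 0# < p + q
  +-0< {p} {q} a b = ≤-<-trans b (subst (_< p + q) (+-identityˡ q) (+-monoˡ-< q a))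

  cancel-+ : ∀ p q → q - p + p ≡ q
  cancel-+ p q = trans (+-assoc q (- p) p) (trans (cong (_+_ q) (-‿inverseˡ p)) (+-identityʳ q))

  ≤⇒0≤- : ∀ {p q} → p ≤ q → 0# ≤ q - p
  ≤⇒0≤- {p} {q} le = subst (_≤ q - p) (-‿inverseʳ p) (+-monoˡ-≤ (- p) le)

  <⇒0<- : ∀ {p q} → p < q → 0# < q - p
  <⇒0<- {p} {q} lt = subst (_< q - p) (-‿inverseʳ p) (+-monoˡ-< (- p) lt)

  0≤-⇒≤ : ∀ {p q} → 0# ≤ q - p → p ≤ q
  0≤-⇒≤ {p} {q} le = subst₂ _≤_ (+-identityˡ p) (cancel-+ p q) (+-monoˡ-≤ p le)

  0<-⇒< : ∀ {p q} → 0# < q - p → p < q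
  0<-⇒< {p} {q} lt = subst₂ _<_ (+-identityˡ p) (cancel-+ p q) (+-monoˡ-< p lt)

  -≡0⇒≡ : ∀ {p q} → q - p ≡ 0# → q ≡ p
  -≡0⇒≡ {p} {q} e = trans (sym (cancel-+ p q)) (trans (cong (_+ p) e) (+-identityˡ p))

  neg-0< : ∀ {p} → p < 0# → 0# < - p
  neg-0< {p} lt = subst (0# <_) (+-identityˡ (- p)) (<⇒0<- lt)

  neg-<0 : ∀ {p} → 0# < p → - p < 0#
  neg-<0 {p} lt = 0<-⇒< (subst (0# <_) (sym (trans (+-identityˡ _) (neg-involutive p))) lt)

  *-distribˡ-- : ∀ r p q → r * (q - p) ≡ r * q - r * p
  *-distribˡ-- r p q = trans (distribˡ r q (- p)) (cong (_+_ (r * q)) (sym (neg-distribʳ-* r p)))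

  *-monoˡ-≤ : ∀ {r p q} → 0# ≤ r → p ≤ q → r * p ≤ r * q
  *-monoˡ-≤ {r} {p} {q} a le = 0≤-⇒≤ (subst (0# ≤_) (*-distribˡ-- r p q) (*-0≤ a (≤⇒0≤- le)))

  *-monoˡ-< : ∀ {r p q} → 0# < r → p < q → r * p < r * q
  *-monoˡ-< {r} {p} {q} a lt = 0<-⇒< (subst (0# <_) (*-distribˡ-- r p q) (*-0< a (<⇒0<- lt)))

  1/⁺ : ∀ {p} → 0# < p → ∃[ r ] 0# < r × p * r ≡ 1#
  1/⁺ {p} lt with 1/′ (0<⇒≢0 lt)
  ... | r , e = r , ≰⇒> (λ r≤0 → ≤⇒≯ (subst₂ _≤_ e (zeroʳ p) (*-monoˡ-≤ (<⇒≤ lt) r≤0)) 0<1) , e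

  domain : IntegralDomain
  domain = record
    { cring = cring ; zero? = λ p → p ≟ᶠ 0# ; integral = int ; 1≉0 = 0<⇒≢0 0<1 }
    where
    int : ∀ {p q} → p * q ≡ 0# → p ≡ 0# ⊎ q ≡ 0#
    int {p} {q} e with p ≟ᶠ 0#
    ... | yes z = inj₁ z
    ... | no ne with 1/′ ne
    ... | r , pr = inj₂ (trans (sym (*-identityˡ q)) (trans (cong (_* q) (trans (sym pr) (*-comm p r))) (trans (*-assoc r p q) (trans (cong (r *_) e) (zeroʳ r)))))

  module _ {I : Set} where
    sum-0≤ : ∀ {f : I → 𝔽} xs → (∀ {x} → x ∈ xs → 0# ≤ f x) → 0# ≤ sumL f xs
    sum-0≤ [] h = ≤-refl
    sum-0≤ (x ∷ xs) h = +-0≤ (h (here refl)) (sum-0≤ xs (h ∘ there))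

    sum-0< : ∀ {f : I → 𝔽} {y} xs → y ∈ xs → (∀ {x} → x ∈ xs → 0# ≤ f x) → 0# < f y → 0# < sumL f xs
    sum-0< (x ∷ xs) (here refl) h lt = +-0< lt (sum-0≤ xs (h ∘ there))
    sum-0< {f} (x ∷ xs) (there m) h lt = subst (0# <_) (+-comm (sumL f xs) (f x)) (+-0< (sum-0< xs m (h ∘ there) lt) (h (here refl)))

    sum-neg : ∀ (f : I → 𝔽) xs → sumL (λ x → - f x) xs ≡ - sumL f xs
    sum-neg f [] = sym -0≡0
    sum-neg f (x ∷ xs) = trans (cong (_+_ (- f x)) (sum-neg f xs)) (sym (neg-distrib-+ (f x) (sumL f xs)))

    sum-- : ∀ (f g : I → 𝔽) xs → sumL (λ x → f x - g x) xs ≡ sumL f xs - sumL g xs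
    sum-- f g xs = trans (sum-+ f (λ x → - g x) xs) (cong (_+_ (sumL f xs)) (sum-neg g xs))

  -- "P ε for all sufficiently small ε > 0"
  Ev : (𝔽 → Set) → Set
  Ev P = ∃[ ε₀ ] 0# < ε₀ × (∀ {ε} → 0# < ε → ε ≤ ε₀ → P ε)

  ev-∧ : ∀ {P Q} → Ev P → Ev Q → Ev (λ ε → P ε × Q ε)
  ev-∧ (a , a>0 , p) (b , b>0 , q) with a ≤? b
  ... | yes a≤b = a , a>0 , λ lt le → p lt le , q lt (≤-trans le a≤b)
  ... | no a≰b = b , b>0 , λ lt le → p lt (≤-trans le (<⇒≤ (≰⇒> a≰b))) , q lt le

  ev-map : ∀ {P Q : 𝔽 → Set} → (∀ {ε} → 0# < ε → P ε → Q ε) → Ev P → Ev Q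
  ev-map f (a , a>0 , p) = a , a>0 , λ lt le → f lt (p lt le)

  ev-const : ∀ {P : 𝔽 → Set} → (∀ {ε} → 0# < ε → P ε) → Ev P
  ev-const h = 1# , 0<1 , λ lt _ → h lt

  ev-∀ : ∀ {I : Set} {P : I → 𝔽 → Set} xs → (∀ {x} → x ∈ xs → Ev (P x)) → Ev (λ ε → ∀ {x} → x ∈ xs → P x ε)
  ev-∀ [] h = ev-const (λ _ ())
  ev-∀ (x ∷ xs) h = ev-map (λ { _ (p , q) (here refl) → p ; _ (p , q) (there m) → q m }) (ev-∧ (h (here refl)) (ev-∀ xs (h ∘ there)))

  ev-witness : ∀ {P} → Ev P → ∃[ ε ] 0# < ε × P ε
  ev-witness (a , a>0 , p) = a , a>0 , p a>0 ≤-refl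

  above : ∀ p → ∃[ q ] p < q × 0# < q
  above p with p <? 0#
  ... | yes lt = 1# , <-trans lt 0<1 , 0<1
  ... | no nl = p + 1# , subst₂ _<_ (+-identityˡ p) (+-comm 1# p) (+-monoˡ-< p 0<1) , subst (0# <_) (+-comm 1# p) (+-0< 0<1 (≮⇒≥ nl))

  -- With a positive γ above `- β`, every ε up to α / γ will do.
  ev-pos : ∀ {α} β → 0# < α → Ev (λ ε → 0# < α + ε * β)
  ev-pos {α} β α>0 with above (- β)
  ... | γ , β<γ , γ>0 with 1/⁺ γ>0
  ... | r , r>0 , e = α * r , *-0< α>0 r>0 , λ {ε} ε>0 le →
      subst (0# <_) (cong (_+_ α) (neg-involutive (ε * β))) (<⇒0<- (subst (_< α) (sym (neg-distribʳ-* ε β)) (strict ε>0 le)))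
    where
    strict : ∀ {ε} → 0# < ε → ε ≤ α * r → ε * - β < α
    strict {ε} ε>0 le = <-≤-trans (*-monoˡ-< ε>0 β<γ) (subst₂ _≤_ (*-comm γ ε) eq (*-monoˡ-≤ (<⇒≤ γ>0) le))
      where
      eq : γ * (α * r) ≡ α
      eq = trans (cong (γ *_) (*-comm α r)) (trans (sym (*-assoc γ r α)) (trans (cong (_* α) e) (*-identityˡ α)))

  ev-neg : ∀ {α} β → α < 0# → Ev (λ ε → α + ε * β < 0#)
  ev-neg {α} β α<0 = ev-map (λ {ε} _ lt → subst (_< 0#) (eq ε) (neg-<0 lt)) (ev-pos (- β) (neg-0< α<0))
    where
    eq : ∀ ε → - (- α + ε * - β) ≡ α + ε * β
    eq ε = trans (neg-distrib-+ (- α) (ε * - β)) (cong₂ _+_ (neg-involutive α) (trans (neg-distribʳ-* ε (- β)) (cong (ε *_) (neg-involutive β))))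

  ev-≢0 : ∀ {α β} → α ≢ 0# ⊎ β ≢ 0# → Ev (λ ε → α + ε * β ≢ 0#)
  ev-≢0 {α} {β} h with <-cmp α 0#
  ... | Tri.tri< lt _ _ = ev-map (λ _ l e → <-irrefl e l) (ev-neg β lt)
  ... | Tri.tri> _ _ gt = ev-map (λ _ l → 0<⇒≢0 l) (ev-pos β gt)
  ... | Tri.tri≈ _ refl _ with h
  ...   | inj₁ ne = contradiction refl ne
  ...   | inj₂ ne = ev-const (λ {ε} lt e → Sum.[ 0<⇒≢0 lt , ne ] (IntegralDomain.integral domain (trans (sym (+-identityˡ (ε * β))) e)))

  sum-≡0 : ∀ {I : Set} {f : I → 𝔽} xs → (∀ {x} → x ∈ xs → 0# ≤ f x) → sumL f xs ≡ 0# → ∀ {x} → x ∈ xs → f x ≡ 0#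
  sum-≡0 {f = f} xs h e {x} m with f x ≟ᶠ 0#
  ... | yes z = z
  ... | no ne = contradiction e (0<⇒≢0 (sum-0< xs m h (≤∧≢⇒< (h m) (λ z → ne (sym z)))))

-- Complete simplicial fans and half-open cones

module Vectors (O : OrderedField) (d : ℕ) where
  open ≡
  open FieldProperties O

  Vector : Set
  Vector = Fin d → 𝔽

  _·_ : Vector → Vector → 𝔽
  a · y = sumL (λ i → a i * y i) (allFin d)

  ·-cong : ∀ a {x y : Vector} → (∀ i → x i ≡ y i) → a · x ≡ a · y
  ·-cong a e = sum-cong (allFin d) (λ i → cong (a i *_) (e i))

  ·-ε : ∀ a (x y : Vector) ε → a · (λ i → x i + ε * y i) ≡ a · x + ε * (a · y)
  ·-ε a x y ε = trans (sum-cong (allFin d) (λ i → trans (distribˡ (a i) (x i) (ε * y i)) (cong (_+_ (a i * x i)) (x∙yz (a i) ε (y i)))))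
    (trans (sum-+ _ _ (allFin d)) (cong (_+_ (a · x)) (sym (sum-*ˡ ε _ (allFin d)))))
    where
    x∙yz : ∀ a b c → a * (b * c) ≡ b * (a * c)
    x∙yz a b c = trans (sym (*-assoc a b c)) (trans (cong (_* c) (*-comm a b)) (*-assoc b a c))

  module Combinations {V : Set} (pos : V → Vector) where
    comb : (V → 𝔽) → List V → Vector
    comb μ σ i = sumL (λ v → μ v * pos v i) σ

    comb-cong : ∀ {μ ν} σ → (∀ {v} → v ∈ σ → μ v ≡ ν v) → ∀ i → comb μ σ i ≡ comb ν σ i
    comb-cong σ e i = sum-cong-∈ σ (λ m → cong (_* pos _ i) (e m))

    comb-ε : ∀ μ ν ε σ i → comb (λ v → μ v + ε * ν v) σ i ≡ comb μ σ i + ε * comb ν σ i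
    comb-ε μ ν ε σ i = trans (sum-cong σ (λ v → trans (distribʳ (pos v i) (μ v) (ε * ν v)) (cong (_+_ (μ v * pos v i)) (*-assoc ε (ν v) (pos v i)))))
      (trans (sum-+ _ _ σ) (cong (_+_ (comb μ σ i)) (sym (sum-*ˡ ε _ σ))))

    ·-comb : ∀ a μ σ → a · comb μ σ ≡ sumL (λ v → μ v * (a · pos v)) σ
    ·-comb a μ σ = trans (sum-cong (allFin d) (λ i → sum-*ˡ (a i) _ σ)) (trans (sum-swap _ (allFin d) σ)
      (sum-cong σ (λ v → trans (sum-cong (allFin d) (λ i → trans (sym (*-assoc (a i) (μ v) _)) (trans (cong (_* pos v i) (*-comm (a i) (μ v))) (*-assoc (μ v) (a i) _))))
        (sym (sum-*ˡ (μ v) _ (allFin d))))))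

-- The field `proper` says through coordinates that cones meet in common faces: a vector in two
-- cones has the same coefficients in both, and zero off the common rays. For a single cone it
-- already contains linear independence.
record Fan (O : OrderedField) (d : ℕ) {V : Set} (vs : List V) (K : List (List V)) (pos : V → Vectors.Vector O d) : Set where
  open FieldProperties O using (_≤_; 0#)
  open Vectors O d
  open Combinations pos
  field
    K-unique : Unique K
    cone-unique : ∀ {σ} → σ ∈ K → Unique σ
    cone-vs : ∀ {σ} → σ ∈ K → σ ⊑ vs
    cone-ext : ∀ {σ τ} → σ ∈ K → τ ∈ K → σ ⊑ τ → τ ⊑ σ → σ ≡ τ
    complete : ∀ (y : Vector) → ∃[ σ ] σ ∈ K × ∃[ μ ] (∀ {v} → v ∈ σ → 0# ≤ μ v) × (∀ i → y i ≡ comb μ σ i)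
    proper : ∀ {σ τ} → σ ∈ K → τ ∈ K → ∀ μ ν → (∀ {v} → v ∈ σ → 0# ≤ μ v) → (∀ {v} → v ∈ τ → 0# ≤ ν v) →
      (∀ i → comb μ σ i ≡ comb ν τ i) → ∀ {v} → v ∈ σ → (v ∈ τ × μ v ≡ ν v) ⊎ (v ∉ τ × μ v ≡ 0#)

record FanData : Set₁ where
  constructor fan-data
  field
    O : OrderedField
    d : ℕ
    V : Set
    _≟_ : DecidableEquality V
    vs : List V
    K : List (List V)
    pos : V → Vectors.Vector O d
    fan : Fan O d vs K pos

module FanGeometry (ℱ : FanData) where
  open FanData ℱ
  open Fan fan
  open ≡
  open FieldProperties O
  open Vectors O d
  open Combinations pos
  open DecMembership (LP.≡-dec _≟_) using (_∈?_)

  comb-- : ∀ μ ν σ i → comb (λ v → μ v - ν v) σ i ≡ comb μ σ i - comb ν σ i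
  comb-- μ ν σ i = trans (sum-cong σ (λ v → trans (distribʳ (pos v i) (μ v) (- ν v)) (cong (_+_ (μ v * pos v i)) (sym (neg-distribˡ-* (ν v) (pos v i))))))
    (sum-- (λ v → μ v * pos v i) (λ v → ν v * pos v i) σ)

  -- The positive and the negative part of a linear relation are two non-negative representations of
  -- one vector in the same cone, and `proper` identifies them.
  lin-indep : ∀ {σ} → σ ∈ K → ∀ c → (∀ i → comb c σ i ≡ 0#) → ∀ {v} → v ∈ σ → c v ≡ 0#
  lin-indep {σ} m c e {v} v∈ = conclude (proper m m c⁺ c⁻ (λ {v} _ → c⁺≥0 v) (λ {v} _ → c⁻≥0 v) eq v∈)
    where
    c⁺ c⁻ : V → 𝔽
    c⁺ v with 0# ≤? c v
    ... | yes _ = c v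
    ... | no _ = 0#
    c⁻ v with 0# ≤? c v
    ... | yes _ = 0#
    ... | no _ = - c v
    c⁺≥0 : ∀ v → 0# ≤ c⁺ v
    c⁺≥0 v with 0# ≤? c v
    ... | yes p = p
    ... | no _ = ≤-refl
    c⁻≥0 : ∀ v → 0# ≤ c⁻ v
    c⁻≥0 v with 0# ≤? c v
    ... | yes _ = ≤-refl
    ... | no np = <⇒≤ (neg-0< (≰⇒> np))
    c⁺-c⁻ : ∀ v → c⁺ v - c⁻ v ≡ c v
    c⁺-c⁻ v with 0# ≤? c v
    ... | yes _ = trans (cong (_+_ (c v)) -0≡0) (+-identityʳ (c v))
    ... | no _ = trans (+-identityˡ _) (neg-involutive (c v))
    eq : ∀ i → comb c⁺ σ i ≡ comb c⁻ σ i
    eq i = -≡0⇒≡ (trans (sym (comb-- c⁺ c⁻ σ i)) (trans (comb-cong σ (λ {v} _ → c⁺-c⁻ v) i) (e i)))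
    conclude : (v ∈ σ × c⁺ v ≡ c⁻ v) ⊎ (v ∉ σ × c⁺ v ≡ 0#) → c v ≡ 0#
    conclude (inj₂ (v∉ , _)) = contradiction v∈ v∉
    conclude (inj₁ (_ , same)) = trans (sym (c⁺-c⁻ v)) (trans (cong (_- c⁻ v) same) (-‿inverseʳ (c⁻ v)))

  coord-unique : ∀ {σ} → σ ∈ K → ∀ {μ ν} → (∀ i → comb μ σ i ≡ comb ν σ i) → ∀ {v} → v ∈ σ → μ v ≡ ν v
  coord-unique {σ} m {μ} {ν} e {v} v∈ = -≡0⇒≡ (lin-indep m (λ v → μ v - ν v)
      (λ i → trans (comb-- μ ν σ i) (trans (cong (_- comb ν σ i) (e i)) (-‿inverseʳ (comb ν σ i)))) v∈)

  length≤d : ∀ {σ} → σ ∈ K → length σ ℕ.≤ d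
  length≤d {σ} m = ℕP.≮⇒≥ λ lt → absurd (ListKernel.kernel-list domain _≟_ σ (cone-unique m) (map (λ i v → pos v i) (allFin d))
      (subst (ℕ._< length σ) (sym (trans (length-map _ (allFin d)) (LP.length-tabulate id))) lt))
    where
    absurd : ∃[ c ] (∃[ a ] a ∈ σ × ¬ (c a ≡ 0#)) × All (λ g → sumL (λ a → c a * g a) σ ≡ 0#) (map (λ i v → pos v i) (allFin d)) → ⊥
    absurd (c , (v , v∈ , nz) , ker) = nz (lin-indep m c (λ i → All.lookup (AllP.map⁻ ker) (∈-allFin i)) v∈)

  Fs : List (List V)
  Fs = filter (λ σ → length σ ℕ.≟ d) K

  facet∈K : ∀ {σ} → σ ∈ Fs → σ ∈ K
  facet∈K m = proj₁ (∈-filter⁻ (λ σ → length σ ℕ.≟ d) m)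

  facet-length : ∀ {σ} → σ ∈ Fs → length σ ≡ d
  facet-length m = proj₂ (∈-filter⁻ (λ σ → length σ ℕ.≟ d) {xs = K} m)

  -- The d + 1 vectors consisting of `y` and the rays of σ are dependent. The coefficient of `y`,
  -- represented by `nothing`, is non-zero because σ is independent.
  coord-exists : ∀ {σ} → σ ∈ Fs → ∀ (y : Vector) → ∃[ μ ] (∀ i → y i ≡ comb μ σ i)
  coord-exists {σ} m y = solve (ListKernel.kernel-list domain (MaybeP.≡-dec _≟_) (nothing ∷ map just σ) unique (map vec (allFin d))
      (subst₂ ℕ._<_ (sym (trans (length-map _ (allFin d)) (LP.length-tabulate id))) (cong suc (sym (trans (length-map just σ) (facet-length m)))) ℕP.≤-refl))
    where
    vec : Fin d → Maybe V → 𝔽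
    vec i nothing = y i
    vec i (just v) = pos v i
    unique : Unique (nothing ∷ map just σ)
    unique = AllP.map⁺ (All.tabulate (λ _ ())) ∷ UP.map⁺ (λ { refl → refl }) (cone-unique (facet∈K m))
    solve : ∃[ c ] (∃[ a ] a ∈ nothing ∷ map just σ × ¬ (c a ≡ 0#)) × All (λ g → sumL (λ a → c a * g a) (nothing ∷ map just σ) ≡ 0#) (map vec (allFin d)) →
      ∃[ μ ] (∀ i → y i ≡ comb μ σ i)
    solve (c , (a , a∈ , nz) , ker) with c nothing ≟ᶠ 0#
    ... | yes z = contradiction (go a∈) nz
      where
      go : a ∈ nothing ∷ map just σ → c a ≡ 0#
      go (here refl) = z
      go (there n) with ∈-map⁻ just n
      ... | v , v∈ , refl = lin-indep (facet∈K m) (c ∘ just) (λ i → trans (sym (sum-map (λ a → c a * vec i a) just σ)) (trans (sym (+-identityˡ _))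
              (trans (cong (_+ sumL (λ a → c a * vec i a) (map just σ)) (sym (trans (cong (_* y i) z) (zeroˡ (y i))))) (All.lookup (AllP.map⁻ ker) (∈-allFin i))))) v∈
    ... | no ne with 1/′ ne
    ... | r , e = (λ v → - r * c (just v)) , λ i → eq i
      where
      eq : ∀ i → y i ≡ comb (λ v → - r * c (just v)) σ i
      eq i = trans (trans (sym (*-identityˡ (y i))) (trans (cong (_* y i) (trans (sym e) (*-comm _ r))) (*-assoc r _ (y i))))
        (trans (cong (r *_) neg) (trans (sym (trans (sym (neg-distribˡ-* r s)) (neg-distribʳ-* r s)))
          (trans (sum-*ˡ (- r) _ σ) (sum-cong σ (λ v → sym (*-assoc (- r) _ _))))))
        where
        s : 𝔽
        s = sumL (λ v → c (just v) * pos v i) σ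
        neg : c nothing * y i ≡ - s
        neg = trans (-≡0⇒≡ (trans (cong (_+_ (c nothing * y i)) (neg-involutive s)) (trans (cong (_+_ (c nothing * y i)) (sym (sum-map (λ a → c a * vec i a) just σ))) (All.lookup (AllP.map⁻ ker) (∈-allFin i))))) refl

  -- Coordinates of y in the basis σ (junk value 0 if σ is not a facet).
  co : List V → Vector → V → 𝔽
  co σ y v with σ ∈? Fs
  ... | yes m = proj₁ (coord-exists m y) v
  ... | no _ = 0#

  co-spec : ∀ {σ} → σ ∈ Fs → ∀ y i → y i ≡ comb (co σ y) σ i
  co-spec {σ} m y i with σ ∈? Fs
  ... | yes m′ = proj₂ (coord-exists m′ y) i
  ... | no σ∉ = contradiction m σ∉

  co-unique : ∀ {σ y μ} → σ ∈ Fs → (∀ i → y i ≡ comb μ σ i) → ∀ {v} → v ∈ σ → co σ y v ≡ μ v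
  co-unique {σ} {y} m e = coord-unique (facet∈K m) (λ i → trans (sym (co-spec m y i)) (e i))

  co-ε : ∀ {σ} → σ ∈ Fs → ∀ y c ε {v} → v ∈ σ → co σ (λ i → y i + ε * c i) v ≡ co σ y v + ε * co σ c v
  co-ε {σ} m y c ε = co-unique m (λ i → trans (cong₂ (λ a b → a + ε * b) (co-spec m y i) (co-spec m c i)) (sym (comb-ε (co σ y) (co σ c) ε σ i)))

  normal-exists : ∀ F → length F ℕ.< d → ∃[ ψ ] (∃[ j ] ψ j ≢ 0#) × (∀ {v} → v ∈ F → ψ · pos v ≡ 0#)
  normal-exists F lt = use (Kernel.kernel domain (map pos F) (subst (ℕ._< d) (sym (length-map pos F)) lt))
    where
    use : ∃[ y ] (∃[ j ] ¬ (y j ≡ 0#)) × All (λ c → y · c ≡ 0#) (map pos F) → ∃[ ψ ] (∃[ j ] ψ j ≢ 0#) × (∀ {v} → v ∈ F → ψ · pos v ≡ 0#)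
    use (ψ , nz , ker) = ψ , nz , λ m → All.lookup (AllP.map⁻ ker) m

  Normal : Set
  Normal = ∃[ F ] ∃[ ψ ] (∃[ j ] ψ j ≢ 0#) × (∀ {v : V} → v ∈ F → ψ · pos v ≡ 0#)

  normals : List (List V) → List Normal
  normals [] = []
  normals (F ∷ Gs) with length F ℕ.<? d
  ... | yes lt = (F , normal-exists F lt) ∷ normals Gs
  ... | no _ = normals Gs

  normals-∈ : ∀ {F} Gs → F ∈ Gs → length F ℕ.< d → ∃[ ν ] ν ∈ normals Gs × proj₁ ν ≡ F
  normals-∈ (F ∷ Gs) m lt with length F ℕ.<? d
  normals-∈ (F ∷ Gs) (here refl) lt | yes lt′ = _ , here refl , refl
  normals-∈ (F ∷ Gs) (there m) lt | yes lt′ = let ν , n , e = normals-∈ Gs m lt in ν , there n , e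
  normals-∈ (F ∷ Gs) (here refl) lt | no ¬lt = contradiction lt ¬lt
  normals-∈ (F ∷ Gs) (there m) lt | no ¬lt = normals-∈ Gs m lt

  -- A generic direction has to avoid two kinds of subspaces: spans of lower-dimensional cones, so
  -- that a perturbed vector lands in a full cone, and spans of a cone without one ray, so that no
  -- coordinate of the direction vanishes.
  faces : List (List V)
  faces = K ++ L.concat (map (λ σ → map proj₂ (picks σ)) K)

  Generic : Vector → Set
  Generic c = ∀ {ν} → ν ∈ normals faces → proj₁ (proj₂ ν) · c ≢ 0#

  -- A direction that is good for the other normals is moved slightly along a unit vector on which
  -- the first normal does not vanish.
  generic-exists : ∀ (νs : List Normal) → ∃[ c ] (∀ {ν} → ν ∈ νs → proj₁ (proj₂ ν) · c ≢ 0#)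
  generic-exists [] = (λ _ → 0#) , λ ()
  generic-exists ((F , ψ , (j , ψj≢0) , ψ-F) ∷ νs) with generic-exists νs
  ... | c , ok with ev-witness (ev-∧ (ev-≢0 {ψ · c} {ψ · unit} (inj₂ (λ e → ψj≢0 (trans (sym (ψ·unit ψ)) e)))) (ev-∀ {P = λ ν ε → proj₁ (proj₂ ν) · c + ε * (proj₁ (proj₂ ν) · unit) ≢ 0#} νs (λ m → ev-≢0 (inj₁ (ok m)))))
    where
    unit : Vector
    unit i with i F.≟ j
    ... | yes _ = 1#
    ... | no _ = 0#
    ψ·unit : ∀ ψ → ψ · unit ≡ ψ j
    ψ·unit ψ = trans (sum-single {f = λ i → ψ i * unit i} (UP.allFin⁺ d) (∈-allFin j) (λ {i} _ ne → trans (cong (ψ i *_) (other i ne)) (zeroʳ (ψ i)))) (trans (cong (ψ j *_) same) (*-identityʳ (ψ j)))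
      where
      other : ∀ i → i ≢ j → unit i ≡ 0#
      other i ne with i F.≟ j
      ... | yes e = contradiction e ne
      ... | no _ = refl
      same : unit j ≡ 1#
      same with j F.≟ j
      ... | yes _ = refl
      ... | no ne = contradiction refl ne
  ... | ε , _ , head , tail = _ , λ { (here refl) e → head (trans (sym (·-ε ψ c _ ε)) e) ; {ν} (there m) e → tail m (trans (sym (·-ε (proj₁ (proj₂ ν)) c _ ε)) e) }

  -- y lies in the part of the cone over σ that is entered when y is moved in direction c.
  HalfOpen : Vector → List V → Vector → Set
  HalfOpen c σ y = ∀ {v} → v ∈ σ → 0# < co σ y v ⊎ (co σ y v ≡ 0# × 0# < co σ c v)

  half-open⇒0≤ : ∀ {c σ y} → HalfOpen c σ y → ∀ {v} → v ∈ σ → 0# ≤ co σ y v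
  half-open⇒0≤ ho m with ho m
  ... | inj₁ lt = <⇒≤ lt
  ... | inj₂ (e , _) = ≤-reflexive (sym e)

  co-generic : ∀ {c} → Generic c → ∀ {σ} → σ ∈ Fs → ∀ {v} → v ∈ σ → co σ c v ≢ 0#
  co-generic {c} gen {σ} m {v} v∈ z with ∈⇒picks v∈
  ... | r , p∈ with normals-∈ faces (∈-++⁺ʳ K (∈-concat⁺′ (∈-map⁺ proj₂ p∈) (∈-map⁺ (λ σ → map proj₂ (picks σ)) (facet∈K m))))
                     (subst (length r ℕ.<_) (trans (↭-length (picks-↭ p∈)) (facet-length m)) ℕP.≤-refl)
  ... | (_ , ψ , nz , ker) , ν∈ , refl = gen ν∈ (trans (·-cong ψ (co-spec m c)) (trans (·-comb ψ (co σ c) σ)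
        (trans (sum-↭ (λ v → co σ c v * (ψ · pos v)) (↭-sym (picks-↭ p∈))) (trans (cong₂ _+_ (trans (cong (_* (ψ · pos v)) z) (zeroˡ _)) (sum-zero-∈ r (λ n → trans (cong (co σ c _ *_) (ker n)) (zeroʳ (co σ c _)))))
          (+-identityˡ 0#)))))

  -- For small ε the vector `y + ε c` lies in no lower-dimensional cone, and negative coordinates of
  -- `y` stay negative. The full cone that contains it is the required one.
  half-open-exists : ∀ {c} → Generic c → ∀ y → ∃[ σ ] σ ∈ Fs × HalfOpen c σ y
  half-open-exists {c} gen y with ev-witness (ev-∧
      (ev-∀ {P = λ ν ε → proj₁ (proj₂ ν) · y + ε * (proj₁ (proj₂ ν) · c) ≢ 0#} (normals faces) (λ m → ev-≢0 (inj₂ (gen m))))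
      (ev-∀ {P = λ σ ε → ∀ {v} → v ∈ σ → co σ y v < 0# → co σ y v + ε * co σ c v < 0#} Fs (λ {σ} _ → ev-∀ {P = λ v ε → co σ y v < 0# → co σ y v + ε * co σ c v < 0#} σ (λ {v} _ → negative σ v))))
    where
    negative : ∀ σ v → Ev (λ ε → co σ y v < 0# → co σ y v + ε * co σ c v < 0#)
    negative σ v with co σ y v <? 0#
    ... | yes lt = ev-map (λ _ l _ → l) (ev-neg (co σ c v) lt)
    ... | no ¬lt = ev-const (λ _ lt → contradiction lt ¬lt)
  ... | ε , ε>0 , avoid , keep with complete (λ i → y i + ε * c i)
  ... | σ , m , μ , μ≥0 , e with length σ ℕ.<? d
  ... | yes lt with normals-∈ faces (∈-++⁺ˡ m) lt
  ...   | (_ , ψ , nz , ker) , ν∈ , refl = contradiction (trans (sym (·-ε ψ y c ε)) (trans (·-cong ψ e) (trans (·-comb ψ μ σ)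
            (sum-zero-∈ σ (λ n → trans (cong (μ _ *_) (ker n)) (zeroʳ (μ _))))))) (avoid ν∈)
  half-open-exists {c} gen y | ε , ε>0 , avoid , keep | σ , m , μ , μ≥0 , e | no ¬lt = σ , mF , ho
    where
    mF : σ ∈ Fs
    mF = ∈-filter⁺ (λ σ → length σ ℕ.≟ d) m (ℕP.≤-antisym (length≤d m) (ℕP.≮⇒≥ ¬lt))
    value : ∀ {v} → v ∈ σ → 0# ≤ co σ y v + ε * co σ c v
    value v∈ = subst (0# ≤_) (trans (sym (co-unique mF e v∈)) (co-ε mF y c ε v∈)) (μ≥0 v∈)
    ho : HalfOpen c σ y
    ho {v} v∈ with <-cmp (co σ y v) 0#
    ... | Tri.tri< lt _ _ = contradiction (≤-<-trans (value v∈) (keep mF v∈ lt)) (<-irrefl refl)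
    ... | Tri.tri> _ _ gt = inj₁ gt
    ... | Tri.tri≈ _ z _ with <-cmp (co σ c v) 0#
    ...   | Tri.tri> _ _ gt = inj₂ (z , gt)
    ...   | Tri.tri≈ _ zc _ = contradiction zc (co-generic gen mF v∈)
    ...   | Tri.tri< lt _ _ = contradiction (≤-<-trans (value v∈) (subst (_< 0#) (sym (trans (cong (_+ ε * co σ c v) z) (+-identityˡ _)))
                (subst (ε * co σ c v <_) (zeroʳ ε) (*-monoˡ-< ε>0 lt)))) (<-irrefl refl)

  -- For small ε the vector `y + ε c` is interior to both cones, and `proper` then finds the rays of
  -- each among those of the other.
  half-open-unique : ∀ {c σ τ y} → σ ∈ Fs → τ ∈ Fs → HalfOpen c σ y → HalfOpen c τ y → σ ≡ τ
  half-open-unique {c} {σ} {τ} {y} mσ mτ hσ hτ with ev-witness (ev-∧ (positive σ hσ) (positive τ hτ))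
    where
    positive : ∀ σ → HalfOpen c σ y → Ev (λ ε → ∀ {v} → v ∈ σ → 0# < co σ y v + ε * co σ c v)
    positive σ h = ev-∀ {P = λ v ε → 0# < co σ y v + ε * co σ c v} σ (λ {v} v∈ → at v (h v∈))
      where
      at : ∀ v → 0# < co σ y v ⊎ (co σ y v ≡ 0# × 0# < co σ c v) → Ev (λ ε → 0# < co σ y v + ε * co σ c v)
      at v (inj₁ lt) = ev-pos (co σ c v) lt
      at v (inj₂ (z , lt)) = ev-const (λ {ε} ε>0 → subst (0# <_) (sym (trans (cong (_+ ε * co σ c v) z) (+-identityˡ _))) (*-0< ε>0 lt))
  ... | ε , ε>0 , pσ , pτ = cone-ext (facet∈K mσ) (facet∈K mτ) (inside mσ mτ pσ pτ) (inside mτ mσ pτ pσ)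
    where
    inside : ∀ {σ τ} → σ ∈ Fs → τ ∈ Fs → (∀ {v} → v ∈ σ → 0# < co σ y v + ε * co σ c v) → (∀ {v} → v ∈ τ → 0# < co τ y v + ε * co τ c v) → σ ⊑ τ
    inside {σ} {τ} mσ mτ pσ pτ v∈ with proper (facet∈K mσ) (facet∈K mτ) (λ v → co σ y v + ε * co σ c v) (λ v → co τ y v + ε * co τ c v) (λ n → <⇒≤ (pσ n)) (λ n → <⇒≤ (pτ n))
        (λ i → trans (comb-ε (co σ y) (co σ c) ε σ i) (trans (cong₂ (λ a b → a + ε * b) (trans (sym (co-spec mσ y i)) (co-spec mτ y i)) (trans (sym (co-spec mσ c i)) (co-spec mτ c i)))
          (sym (comb-ε (co τ y) (co τ c) ε τ i)))) v∈
    ... | inj₁ (v∈τ , _) = v∈τ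
    ... | inj₂ (_ , z) = contradiction z (0<⇒≢0 (pσ v∈))

-- Shelling a fan by a generic sweep

filter-↭ : {A : Set} {P : A → Set} (P? : ∀ x → Dec (P x)) (xs : List A) → filter P? xs ++ filter (λ x → ¬? (P? x)) xs ↭ xs
filter-↭ P? [] = ↭-refl
filter-↭ P? (x ∷ xs) with P? x
... | yes _ = prep x (filter-↭ P? xs)
... | no _ = ↭-trans (PermP.shift x (filter P? xs) _) (prep x (filter-↭ P? xs))

filter-length-< : {A : Set} {P Q : A → Set} (P? : ∀ x → Dec (P x)) (Q? : ∀ x → Dec (Q x)) {y : A} (xs : List A) →
  (∀ {x} → P x → Q x) → y ∈ xs → Q y → ¬ P y → length (filter P? xs) ℕ.< length (filter Q? xs)
filter-length-< P? Q? (x ∷ xs) sub (here ≡.refl) q np with P? x | Q? x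
... | yes p | _ = contradiction p np
... | no _ | no nq = contradiction q nq
... | no _ | yes _ = ℕ.s≤s (go xs)
  where
  go : ∀ xs → length (filter P? xs) ℕ.≤ length (filter Q? xs)
  go [] = ℕ.z≤n
  go (x ∷ xs) with P? x | Q? x
  ... | yes _ | yes _ = ℕ.s≤s (go xs)
  ... | yes p | no nq = contradiction (sub p) nq
  ... | no _ | yes _ = ℕP.m≤n⇒m≤1+n (go xs)
  ... | no _ | no _ = go xs
filter-length-< P? Q? (x ∷ xs) sub (there m) q np with P? x | Q? x | filter-length-< P? Q? xs sub m q np
... | yes _ | yes _ | ih = ℕ.s≤s ih
... | yes p | no nq | _ = contradiction (sub p) nq
... | no _ | yes _ | ih = ℕP.m<n⇒m<1+n ih
... | no _ | no _ | ih = ih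

-- The facets of a fan with a strictly convex piecewise linear support function (linear function a σ on the cone σ),
-- swept by a generic direction c, form a shelling; sweeping by - c reverses it.
module Sweep (ℱ : FanData) (c : Vectors.Vector (FanData.O ℱ) (FanData.d ℱ)) (generic : FanGeometry.Generic ℱ c) where
  open FanData ℱ
  open Fan fan
  open ≡
  open FieldProperties O
  open Vectors O d
  open Combinations pos
  open FanGeometry ℱ public
  open DecMembership _≟_ using (_∈?_)

  c⁻ : Vector
  c⁻ i = - c i

  c⁻-generic : Generic c⁻
  c⁻-generic {ν} m e = generic m (trans (sym (neg-involutive _)) (trans (cong -_ (trans (sym (sum-neg _ (allFin d)))
    (trans (sum-cong (allFin d) (λ i → neg-distribʳ-* _ _)) e))) -0≡0))

  co-c⁻ : ∀ {σ} → σ ∈ Fs → ∀ {v} → v ∈ σ → co σ c⁻ v ≡ - co σ c v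
  co-c⁻ {σ} m = co-unique m (λ i → trans (cong -_ (co-spec m c i)) (trans (sym (sum-neg _ σ)) (sum-cong σ (λ v → neg-distribˡ-* _ _))))

  -- The half-open cone over σ in direction `c` lacks exactly the faces opposite to the vertices of
  -- `R σ`; for direction `- c` these are the vertices of `S σ`.
  R S : List V → List V
  R σ = filter (λ v → co σ c v <? 0#) σ
  S σ = filter (λ v → ¬? (co σ c v <? 0#)) σ

  ∈R : ∀ {σ v} → v ∈ R σ → v ∈ σ × co σ c v < 0#
  ∈R {σ} = ∈-filter⁻ (λ v → co σ c v <? 0#)

  ∈S : ∀ {σ v} → σ ∈ Fs → v ∈ S σ → v ∈ σ × 0# < co σ c v
  ∈S {σ} mσ m with ∈-filter⁻ (λ v → ¬? (co σ c v <? 0#)) m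
  ... | v∈ , nl = v∈ , ≤∧≢⇒< (≮⇒≥ nl) (λ e → co-generic generic mσ v∈ (sym e))

  -- The sum of the rays in `A` lies in the half-open cone of some τ. Its coordinates there vanish
  -- off `A`, and a vanishing coordinate is allowed only where the direction is positive.
  cover : ∀ {c′} → Generic c′ → ∀ {σ} A → σ ∈ Fs → A ⊑ σ →
    ∃[ τ ] τ ∈ Fs × (∀ {v} → v ∈ τ → v ∉ A → 0# < co τ c′ v) × A ⊑ τ
  cover {c′} gen {σ} A mσ A⊑ = found (half-open-exists gen y)
    where
    ind : V → 𝔽
    ind v with v ∈? A
    ... | yes _ = 1#
    ... | no _ = 0#
    ind≥0 : ∀ v → 0# ≤ ind v
    ind≥0 v with v ∈? A
    ... | yes _ = <⇒≤ 0<1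
    ... | no _ = ≤-refl
    ind-∈ : ∀ {v} → v ∈ A → ind v ≢ 0#
    ind-∈ {v} m with v ∈? A
    ... | yes _ = 0<⇒≢0 0<1
    ... | no v∉ = contradiction m v∉
    ind-∉ : ∀ {v} → v ∉ A → ind v ≡ 0#
    ind-∉ {v} v∉ with v ∈? A
    ... | yes m = contradiction m v∉
    ... | no _ = refl
    y : Vector
    y = comb ind σ
    found : ∃[ τ ] τ ∈ Fs × HalfOpen c′ τ y → ∃[ τ ] τ ∈ Fs × (∀ {v} → v ∈ τ → v ∉ A → 0# < co τ c′ v) × A ⊑ τ
    found (τ , mτ , ho) = τ , mτ , positive , inside
      where
      co≥0 : ∀ {v} → v ∈ τ → 0# ≤ co τ y v
      co≥0 = half-open⇒0≤ {c′} {τ} {y} ho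
      inside : A ⊑ τ
      inside v∈ with proper (facet∈K mσ) (facet∈K mτ) ind (co τ y) (λ {v} _ → ind≥0 v) co≥0 (co-spec mτ y) (A⊑ v∈)
      ... | inj₁ (m , _) = m
      ... | inj₂ (_ , z) = contradiction z (ind-∈ v∈)
      zero-off : ∀ {v} → v ∈ τ → v ∉ A → co τ y v ≡ 0#
      zero-off v∈ v∉ with proper (facet∈K mτ) (facet∈K mσ) (co τ y) ind co≥0 (λ {v} _ → ind≥0 v) (λ i → sym (co-spec mτ y i)) v∈
      ... | inj₁ (_ , e) = trans e (ind-∉ v∉)
      ... | inj₂ (_ , z) = z
      positive : ∀ {v} → v ∈ τ → v ∉ A → 0# < co τ c′ v
      positive v∈ v∉ with ho v∈
      ... | inj₁ lt = contradiction (zero-off v∈ v∉) (0<⇒≢0 lt)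
      ... | inj₂ (_ , lt) = lt

  module Shelling (a : List V → Vector)
      (support-≤ : ∀ {σ τ v} → σ ∈ K → τ ∈ K → v ∈ σ → a τ · pos v ≤ a σ · pos v)
      (support-≡ : ∀ {σ τ v} → σ ∈ K → τ ∈ K → v ∈ σ → a τ · pos v ≡ a σ · pos v → v ∈ τ) where

    -- The functionals `a σ` play the part of the vertices of a dual polytope, on which `c` is a
    -- linear function; the shelling and its reverse are the two directions of this function.
    W : List V → 𝔽
    W σ = a σ · c

    gap : List V → List V → V → 𝔽
    gap σ τ v = a σ · pos v - a τ · pos v

    gap≥0 : ∀ {σ τ v} → σ ∈ Fs → τ ∈ Fs → v ∈ σ → 0# ≤ gap σ τ v
    gap≥0 mσ mτ v∈ = ≤⇒0≤- (support-≤ (facet∈K mσ) (facet∈K mτ) v∈)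

    gap≡0 : ∀ {σ τ v} → σ ∈ Fs → τ ∈ Fs → v ∈ σ → v ∈ τ → gap σ τ v ≡ 0#
    gap≡0 {σ} {τ} {v} mσ mτ v∈ v∈τ = trans (cong (_- a τ · pos v) (≤-antisym (support-≤ (facet∈K mτ) (facet∈K mσ) v∈τ) (support-≤ (facet∈K mσ) (facet∈K mτ) v∈))) (-‿inverseʳ _)

    gap>0 : ∀ {σ τ v} → σ ∈ Fs → τ ∈ Fs → v ∈ σ → v ∉ τ → 0# < gap σ τ v
    gap>0 mσ mτ v∈ v∉ = ≤∧≢⇒< (gap≥0 mσ mτ v∈) (λ e → v∉ (support-≡ (facet∈K mσ) (facet∈K mτ) v∈ (sym (-≡0⇒≡ (sym e)))))

    W-gap : ∀ {σ} τ → σ ∈ Fs → W σ - W τ ≡ sumL (λ v → co σ c v * gap σ τ v) σ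
    W-gap {σ} τ mσ = trans (cong₂ _-_ (expand σ) (expand τ)) (trans (sym (sum-- _ _ σ)) (sum-cong σ (λ v → sym (*-distribˡ-- _ _ _))))
      where
      expand : ∀ τ → W τ ≡ sumL (λ v → co σ c v * (a τ · pos v)) σ
      expand τ = trans (·-cong (a τ) (co-spec mσ c)) (·-comb (a τ) (co σ c) σ)

    missing : ∀ {σ τ} → σ ∈ Fs → τ ∈ Fs → σ ≢ τ → ∃[ v ] v ∈ σ × v ∉ τ
    missing {σ} {τ} mσ mτ ne with All.all? (_∈? τ) σ
    ... | no ¬all = let v , v∈ , v∉ = L∈.find (AllP.¬All⇒Any¬ (_∈? τ) σ ¬all) in v , v∈ , v∉
    ... | yes all = contradiction (cone-ext (facet∈K mσ) (facet∈K mτ) (All.lookup all) τ⊑σ) ne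
      where
      τ⊑σ : τ ⊑ σ
      τ⊑σ v∈ with unique-extend σ (cone-unique (facet∈K mσ)) (All.lookup all)
      ... | [] , p = subst (_ ∈_) (LP.++-identityʳ σ) (∈-resp-↭ (↭-sym p) v∈)
      ... | _ ∷ zs , p = contradiction (trans (facet-length mσ) (sym (facet-length mτ)))
          (λ e → ℕP.m≢1+m+n (length σ) (trans e (trans (sym (↭-length p)) (trans (length-++ σ) (ℕP.+-suc (length σ) (length zs))))))

    -- In `W-gap` the negative coordinates of `c` belong to vertices of `R σ`. These lie in τ, where
    -- the gap is zero, while a vertex of σ outside τ contributes strictly.
    W-decreases : ∀ {σ τ} → σ ∈ Fs → τ ∈ Fs → R σ ⊑ τ → σ ≢ τ → W τ < W σ
    W-decreases {σ} {τ} mσ mτ R⊑ ne with missing mσ mτ ne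
    ... | v , v∈ , v∉ = 0<-⇒< (subst (0# <_) (sym (W-gap τ mσ)) (sum-0< σ v∈ term (strict v∈ v∉)))
      where
      term : ∀ {v} → v ∈ σ → 0# ≤ co σ c v * gap σ τ v
      term {v} v∈ with co σ c v <? 0#
      ... | no nl = *-0≤ (≮⇒≥ nl) (gap≥0 mσ mτ v∈)
      ... | yes lt = ≤-reflexive (sym (trans (cong (co σ c v *_) (gap≡0 mσ mτ v∈ (R⊑ (∈-filter⁺ (λ v → co σ c v <? 0#) v∈ lt)))) (zeroʳ _)))
      strict : ∀ {v} → v ∈ σ → v ∉ τ → 0# < co σ c v * gap σ τ v
      strict {v} v∈ v∉ with co σ c v <? 0#
      ... | yes lt = contradiction (R⊑ (∈-filter⁺ (λ v → co σ c v <? 0#) v∈ lt)) v∉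
      ... | no nl = *-0< (≤∧≢⇒< (≮⇒≥ nl) (λ e → co-generic generic mσ v∈ (sym e))) (gap>0 mσ mτ v∈ v∉)

    W-increases : ∀ {σ τ} → σ ∈ Fs → τ ∈ Fs → S σ ⊑ τ → σ ≢ τ → W σ < W τ
    W-increases {σ} {τ} mσ mτ S⊑ ne with missing mσ mτ ne
    ... | v , v∈ , v∉ = 0<-⇒< (subst (0# <_) flip (sum-0< σ v∈ term (strict v∈ v∉)))
      where
      flip : sumL (λ v → - co σ c v * gap σ τ v) σ ≡ W τ - W σ
      flip = trans (trans (sum-cong σ (λ v → sym (neg-distribˡ-* _ _))) (sum-neg _ σ)) (trans (cong -_ (sym (W-gap τ mσ)))
        (trans (neg-distrib-+ (W σ) (- W τ)) (trans (cong (_+_ (- W σ)) (neg-involutive (W τ))) (+-comm (- W σ) (W τ)))))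
      term : ∀ {v} → v ∈ σ → 0# ≤ - co σ c v * gap σ τ v
      term {v} v∈ with co σ c v <? 0#
      ... | yes lt = *-0≤ (<⇒≤ (neg-0< lt)) (gap≥0 mσ mτ v∈)
      ... | no nl = ≤-reflexive (sym (trans (cong (- co σ c v *_) (gap≡0 mσ mτ v∈ (S⊑ (∈-filter⁺ (λ v → ¬? (co σ c v <? 0#)) v∈ nl)))) (zeroʳ _)))
      strict : ∀ {v} → v ∈ σ → v ∉ τ → 0# < - co σ c v * gap σ τ v
      strict {v} v∈ v∉ with co σ c v <? 0#
      ... | no nl = contradiction (S⊑ (∈-filter⁺ (λ v → ¬? (co σ c v <? 0#)) v∈ nl)) v∉
      ... | yes lt = *-0< (neg-0< lt) (gap>0 mσ mτ v∈ v∉)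

    -- Natural numbers in place of the values of `W`, so that inductions can run along the shelling.
    rank : List V → ℕ
    rank σ = length (filter (λ τ → W τ <? W σ) Fs)

    rank-< : ∀ {σ τ} → τ ∈ Fs → W τ < W σ → rank τ ℕ.< rank σ
    rank-< {σ} {τ} mτ lt = filter-length-< (λ ρ → W ρ <? W τ) (λ ρ → W ρ <? W σ) Fs (λ l → <-trans l lt) mτ lt (<-irrefl refl)

    sphere : ShellableSphere d vs Fs
    sphere = record
      { R = R ; S = S ; ω = rank ; bound = suc (length Fs)
      ; Fs-unique = UP.filter⁺ (λ σ → length σ ℕ.≟ d) K-unique
      ; facet-unique = λ m → cone-unique (facet∈K m)
      ; facet-length = facet-length
      ; facet-vs = λ m → cone-vs (facet∈K m)
      ; R++S = λ {σ} _ → filter-↭ (λ v → co σ c v <? 0#) σ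
      ; ω-bound = λ {σ} _ → ℕ.s≤s (LP.length-filter (λ τ → W τ <? W σ) Fs)
      ; order-R = order-R
      ; order-S = order-S
      ; cover-R = λ A m s → let τ , mτ , p , i = cover generic A m s in τ , mτ , (λ v∈ → in-A A (λ v∉ → <-irrefl refl (<-trans (p (proj₁ (∈R {τ} v∈)) v∉) (proj₂ (∈R {τ} v∈))))) , i
      ; cover-S = λ A m s → let τ , mτ , p , i = cover c⁻-generic A m s in τ , mτ , (λ v∈ → in-A A (λ v∉ → <-irrefl refl (<-trans (subst (0# <_) (co-c⁻ mτ (proj₁ (∈S mτ v∈))) (p (proj₁ (∈S mτ v∈)) v∉)) (neg-<0 (proj₂ (∈S mτ v∈)))))) , i }
      where
      in-A : ∀ A {v} → ¬ (v ∉ A) → v ∈ A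
      in-A A {v} nn with v ∈? A
      ... | yes m = m
      ... | no v∉ = contradiction v∉ nn
      order-R : ∀ {σ τ} → σ ∈ Fs → τ ∈ Fs → R σ ⊑ τ → σ ≡ τ ⊎ rank τ ℕ.< rank σ
      order-R {σ} {τ} mσ mτ s with LP.≡-dec _≟_ σ τ
      ... | yes e = inj₁ e
      ... | no ne = inj₂ (rank-< mτ (W-decreases mσ mτ s ne))
      order-S : ∀ {σ τ} → σ ∈ Fs → τ ∈ Fs → S σ ⊑ τ → σ ≡ τ ⊎ rank σ ℕ.< rank τ
      order-S {σ} {τ} mσ mτ s with LP.≡-dec _≟_ σ τ
      ... | yes e = inj₁ e
      ... | no ne = inj₂ (rank-< mσ (W-increases mσ mτ s ne))

-- Counting lattice points level by level

module ℤSums = RingSums ℤP.+-*-commutativeRing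

ℤ-cancelˡ : ∀ i j k → i ℤ.+ j ≡ i ℤ.+ k → j ≡ k
ℤ-cancelˡ = RingProps.+-cancelˡ (CommutativeRing.ring ℤP.+-*-commutativeRing)

module Sequences where
  open ≡
  open ℤSums
  open import Data.Integer using (_+_)

  -- On generating functions this is division by 1 - t, and `ind e` stands for t^e.
  S : (ℕ → ℤ) → ℕ → ℤ
  S u zero = u 0
  S u (suc m) = S u m + u (suc m)

  S^ : ℕ → (ℕ → ℤ) → ℕ → ℤ
  S^ zero u = u
  S^ (suc n) u = S (S^ n u)

  S-cong : ∀ {u v} m → (∀ l → l ℕ.≤ m → u l ≡ v l) → S u m ≡ S v m
  S-cong zero h = h 0 ℕ.z≤n
  S-cong (suc m) h = cong₂ _+_ (S-cong m (λ l le → h l (ℕP.m≤n⇒m≤1+n le))) (h (suc m) ℕP.≤-refl)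

  S^-cong : ∀ n {u v} m → (∀ l → l ℕ.≤ m → u l ≡ v l) → S^ n u m ≡ S^ n v m
  S^-cong zero m h = h m ℕP.≤-refl
  S^-cong (suc n) m h = S-cong m (λ l le → S^-cong n l (λ l′ le′ → h l′ (ℕP.≤-trans le′ le)))

  S-sum : {J : Set} (f : J → ℕ → ℤ) (js : List J) (m : ℕ) → S (λ l → sumL (λ j → f j l) js) m ≡ sumL (λ j → S (f j) m) js
  S-sum f js zero = refl
  S-sum f js (suc m) = trans (cong (λ t → t + sumL (λ j → f j (suc m)) js) (S-sum f js m)) (sym (sum-+ (λ j → S (f j) m) (λ j → f j (suc m)) js))

  S^-sum : ∀ n {J : Set} (f : J → ℕ → ℤ) (js : List J) (m : ℕ) → S^ n (λ l → sumL (λ j → f j l) js) m ≡ sumL (λ j → S^ n (f j) m) js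
  S^-sum zero f js m = refl
  S^-sum (suc n) f js m = trans (S-cong m (λ l _ → S^-sum n f js l)) (S-sum (λ j → S^ n (f j)) js m)

  S-scale : ∀ c u m → S (λ l → c ℤ.* u l) m ≡ c ℤ.* S u m
  S-scale c u zero = refl
  S-scale c u (suc m) = trans (cong (λ t → t + c ℤ.* u (suc m)) (S-scale c u m)) (sym (ℤP.*-distribˡ-+ c (S u m) (u (suc m))))

  S^-scale : ∀ n c u m → S^ n (λ l → c ℤ.* u l) m ≡ c ℤ.* S^ n u m
  S^-scale zero c u m = refl
  S^-scale (suc n) c u m = trans (S-cong m (λ l _ → S^-scale n c u l)) (S-scale c (S^ n u) m)

  S-injective : ∀ {u v} → (∀ m → S u m ≡ S v m) → ∀ m → u m ≡ v m
  S-injective h zero = h 0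
  S-injective {u} {v} h (suc m) = ℤ-cancelˡ (S u m) _ _ (trans (h (suc m)) (cong (λ t → t + v (suc m)) (sym (h m))))

  S^-injective : ∀ n {u v} → (∀ m → S^ n u m ≡ S^ n v m) → ∀ m → u m ≡ v m
  S^-injective zero h = h
  S^-injective (suc n) h = S^-injective n (S-injective h)

  ind : ℕ → ℕ → ℤ
  ind e m with e ℕ.≟ m
  ... | yes _ = + 1
  ... | no _ = + 0

  ind-≡ : ∀ e → ind e e ≡ + 1
  ind-≡ e with e ℕ.≟ e
  ... | yes _ = refl
  ... | no ne = contradiction refl ne

  ind-≢ : ∀ {e m} → e ≢ m → ind e m ≡ + 0
  ind-≢ {e} {m} ne with e ℕ.≟ m
  ... | yes q = contradiction q ne
  ... | no _ = refl

  S^-ind-below : ∀ n {e m} → m ℕ.< e → S^ n (ind e) m ≡ + 0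
  S^-ind-below zero lt = ind-≢ (λ { refl → ℕP.<-irrefl refl lt })
  S^-ind-below (suc n) {e} {m} lt = trans (S-cong m (λ l le → S^-ind-below n (ℕP.≤-<-trans le lt))) (zeros m)
    where
    zeros : ∀ m → S (λ _ → + 0) m ≡ + 0
    zeros zero = refl
    zeros (suc m) = trans (ℤP.+-identityʳ _) (zeros m)

  S-first : ∀ (u : ℕ → ℤ) e → (∀ l → l ℕ.< e → S u l ≡ + 0) → S u e ≡ u e
  S-first u zero h = refl
  S-first u (suc e) h = trans (cong (λ t → t + u (suc e)) (h e ℕP.≤-refl)) (ℤP.+-identityˡ _)

  -- Pascal's rule for the coefficients of t^e / (1 - t)^(n + 1).
  S^-ind : ∀ n e j → S^ (suc n) (ind e) (e ℕ.+ j) ≡ + ((j ℕ.+ n) C n)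
  S^-ind zero e zero = trans (cong (S (ind e)) (ℕP.+-identityʳ e)) (trans (S-first (ind e) e (λ l lt → S^-ind-below 1 lt)) (ind-≡ e))
  S^-ind zero e (suc j) = trans (cong (S (ind e)) (ℕP.+-suc e j))
    (trans (cong₂ _+_ (S^-ind zero e j) (ind-≢ {e} (λ q → ℕP.m≢1+m+n e q))) refl)
  S^-ind (suc n) e zero = trans (cong (S^ (suc (suc n)) (ind e)) (ℕP.+-identityʳ e))
    (trans (S-first (S^ (suc n) (ind e)) e (λ l lt → S^-ind-below (suc (suc n)) lt))
      (trans (cong (S^ (suc n) (ind e)) (sym (ℕP.+-identityʳ e))) (trans (S^-ind n e zero) (cong +_ (trans (nCn≡1 n) (sym (nCn≡1 (suc n))))))))
  S^-ind (suc n) e (suc j) = trans (cong (S^ (suc (suc n)) (ind e)) (ℕP.+-suc e j))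
    (trans (cong₂ _+_ (S^-ind (suc n) e j) (trans (cong (S^ (suc n) (ind e)) (sym (ℕP.+-suc e j))) (S^-ind n e (suc j))))
      (cong +_ (trans (cong (λ t → (j ℕ.+ suc n) C suc n ℕ.+ t C n) (sym (ℕP.+-suc j n))) (trans (ℕP.+-comm ((j ℕ.+ suc n) C suc n) _) (nCk+nC[k+1]≡[n+1]C[k+1] (j ℕ.+ suc n) n)))))

-- Lists `n` natural numbers with sum `m - e`. The recursion, raising the first entry or fixing it
-- at zero, is that of iterated partial sums, so the length follows without a bijection.
tuples : ℕ → ℕ → ℕ → List (List ℕ)
increment : List ℕ → List ℕ
increment [] = []
increment (a ∷ t) = suc a ∷ t
tuples zero m e with e ℕ.≟ m
... | yes _ = [] ∷ []
... | no _ = []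
tuples (suc n) zero e = map (0 ∷_) (tuples n zero e)
tuples (suc n) (suc m) e = map increment (tuples (suc n) m e) ++ map (0 ∷_) (tuples n (suc m) e)

module Tuples where
  open ≡
  open Sequences

  tuples-length : ∀ n m e → + length (tuples n m e) ≡ S^ n (ind e) m
  tuples-length zero m e with e ℕ.≟ m
  ... | yes _ = refl
  ... | no _ = refl
  tuples-length (suc n) zero e = trans (cong +_ (length-map _ (tuples n zero e))) (tuples-length n zero e)
  tuples-length (suc n) (suc m) e = trans (cong +_ (trans (length-++ (map increment (tuples (suc n) m e)))
      (cong₂ ℕ._+_ (length-map _ (tuples (suc n) m e)) (length-map _ (tuples n (suc m) e)))))
    (cong₂ ℤ._+_ (tuples-length (suc n) m e) (tuples-length n (suc m) e))

  tuples-sound : ∀ n m e {t} → t ∈ tuples n m e → length t ≡ n × e ℕ.+ sumℕ t ≡ m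
  tuples-sound zero m e mem with e ℕ.≟ m | mem
  ... | yes q | here refl = refl , trans (ℕP.+-identityʳ e) q
  tuples-sound (suc n) zero e mem with ∈-map⁻ (0 ∷_) mem
  ... | t , m , refl = let l , s = tuples-sound n zero e m in cong suc l , s
  tuples-sound (suc n) (suc m) e mem with ∈-++⁻ (map increment (tuples (suc n) m e)) mem
  ... | inj₂ mem₂ with ∈-map⁻ (0 ∷_) mem₂
  ...   | t , m′ , refl = let l , s = tuples-sound n (suc m) e m′ in cong suc l , s
  tuples-sound (suc n) (suc m) e mem | inj₁ mem₁ with ∈-map⁻ increment mem₁
  ... | a ∷ t , m′ , refl = let l , s = tuples-sound (suc n) m e m′ in l , trans (ℕP.+-suc e (a ℕ.+ sumℕ t)) (cong suc s)
  ... | [] , m′ , refl = contradiction (proj₁ (tuples-sound (suc n) m e m′)) (λ ())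

  tuples-complete : ∀ n m e t → length t ≡ n → e ℕ.+ sumℕ t ≡ m → t ∈ tuples n m e
  tuples-complete zero m e [] l s with e ℕ.≟ m
  ... | yes _ = here refl
  ... | no ne = contradiction (trans (sym (ℕP.+-identityʳ e)) s) ne
  tuples-complete (suc n) zero e (zero ∷ t) l s = ∈-map⁺ (0 ∷_) (tuples-complete n zero e t (suc-injective l) s)
  tuples-complete (suc n) zero e (suc a ∷ t) l s = contradiction (trans (sym (ℕP.+-suc e (a ℕ.+ sumℕ t))) s) (λ ())
  tuples-complete (suc n) (suc m) e (zero ∷ t) l s = ∈-++⁺ʳ (map increment (tuples (suc n) m e)) (∈-map⁺ (0 ∷_) (tuples-complete n (suc m) e t (suc-injective l) s))
  tuples-complete (suc n) (suc m) e (suc a ∷ t) l s = ∈-++⁺ˡ (∈-map⁺ increment (tuples-complete (suc n) m e (a ∷ t) l (suc-injective (trans (sym (ℕP.+-suc e (a ℕ.+ sumℕ t))) s))))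

  tuples-unique : ∀ n m e → Unique (tuples n m e)
  tuples-unique zero m e with e ℕ.≟ m
  ... | yes _ = [] ∷ []
  ... | no _ = []
  tuples-unique (suc n) zero e = UP.map⁺ LP.∷-injectiveʳ (tuples-unique n zero e)
  tuples-unique (suc n) (suc m) e = UP.++⁺ (UP.map⁺ inj (tuples-unique (suc n) m e)) (UP.map⁺ LP.∷-injectiveʳ (tuples-unique n (suc m) e)) disjoint
    where
    inj : ∀ {s t} → increment s ≡ increment t → s ≡ t
    inj {[]} {[]} _ = refl
    inj {a ∷ s} {b ∷ t} refl = refl
    disjoint : ∀ {t} → ¬ (t ∈ map increment (tuples (suc n) m e) × t ∈ map (0 ∷_) (tuples n (suc m) e))
    disjoint (p , q) with ∈-map⁻ increment p | ∈-map⁻ (0 ∷_) q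
    ... | [] , m₁ , refl | _ , _ , ()
    ... | _ ∷ _ , _ , refl | _ , _ , ()

module _ {A B : Set} where
  unique-map-on : (f : A → B) {xs : List A} → (∀ {x y} → x ∈ xs → y ∈ xs → f x ≡ f y → x ≡ y) → Unique xs → Unique (map f xs)
  unique-map-on f inj [] = []
  unique-map-on f {x ∷ xs} inj (x∉ ∷ u) = AllP.map⁺ (All.tabulate (λ m e → All.lookup x∉ m (inj (here ≡.refl) (there m) e)))
    ∷ unique-map-on f (λ m m′ → inj (there m) (there m′)) u

unique-length : {A : Set} {xs ys : List A} → Unique xs → Unique ys → xs ⊑ ys → ys ⊑ xs → length xs ≡ length ys
unique-length {xs = xs} {ys} u v s t = ℕP.≤-antisym (le u s) (le v t)
  where
  le : ∀ {as bs} → Unique as → as ⊑ bs → length as ℕ.≤ length bs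
  le {as} u s with unique-extend as u s
  ... | zs , p = ≡.subst (length as ℕ.≤_) (≡.trans (≡.sym (length-++ as)) (↭-length p)) (ℕP.m≤m+n (length as) (length zs))

≤⇒∃+ : ∀ {i j} → i ℤ.≤ j → ∃[ n ] i ℤ.+ + n ≡ j
≤⇒∃+ {i} {j} le = ℤ.∣ j ℤ.- i ∣ , ≡.trans (≡.cong (λ t → i ℤ.+ t) (ℤP.0≤i⇒+∣i∣≡i (ℤP.i≤j⇒0≤j-i le))) (eq i j)
  where
  eq : ∀ i j → i ℤ.+ (j ℤ.- i) ≡ j
  eq = solve-∀

-- The lattice points of a half-open unimodular cone with coordinates z and level k are given by K zᵢ ≥ k cᵢ + βᵢ;
-- e k is the height of the lowest one.
module Cell (K′ : ℕ) (w : ℤ) where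
  open ≡
  open import Data.Integer using (_+_; _*_; -_; _-_; _≤_)
  open ℤSums

  K : ℤ
  K = + suc K′

  -- The quotient t / K rounded up.
  ceil : ℤ → ℤ
  ceil t = - ((- t) ℤDM./ℕ suc K′)

  ceil-≥ : ∀ t → t ≤ K * ceil t
  ceil-≥ t = ℤP.≤-trans (ℤP.≤-reflexive (sym (ℤP.neg-involutive t))) (ℤP.≤-trans (ℤP.neg-mono-≤ (ℤDM.[n/ℕd]*d≤n (- t) (suc K′)))
    (ℤP.≤-reflexive (eq ((- t) ℤDM./ℕ suc K′) K)))
    where
    eq : ∀ a b → - (a * b) ≡ b * (- a)
    eq = solve-∀

  ceil-least : ∀ t z → t ≤ K * z → ceil t ≤ z
  ceil-least t z le = ℤP.≤-trans (ℤP.neg-mono-≤ le′) (ℤP.≤-reflexive (ℤP.neg-involutive z))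
    where
    a : ℤ
    a = (- t) ℤDM./ℕ suc K′
    eq : ∀ b z → - (b * z) ≡ (- z) * b
    eq = solve-∀
    lt : (- z) * K ℤ.< ℤ.suc a * K
    lt = ℤP.≤-<-trans (ℤP.≤-trans (ℤP.≤-reflexive (sym (eq K z))) (ℤP.neg-mono-≤ le)) (ℤDM.n<s[n/ℕd]*d (- t) (suc K′))
    le′ : - z ≤ a
    le′ = ℤP.≤-trans (ℤP.i<j⇒i≤pred[j] (ℤP.*-cancelʳ-<-nonNeg {i = - z} {j = ℤ.suc a} K lt)) (ℤP.≤-reflexive (ℤP.pred-suc a))

  ceil-unique : ∀ t z → t ≤ K * z → K * z ≤ t + + K′ → ceil t ≡ z
  ceil-unique t z lo hi = ℤP.≤-antisym (ceil-least t z lo) (ℤP.≤-trans (ℤP.i<j⇒i≤pred[j] (ℤP.*-cancelˡ-<-nonNeg {i = z} {j = ℤ.suc (ceil t)} K lt)) (ℤP.≤-reflexive (ℤP.pred-suc (ceil t))))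
    where
    eq : ∀ o t k → t + k ≡ - o + (t + (o + k))
    eq = solve-∀
    eq₂ : ∀ k c → k * c + k ≡ k * ℤ.suc c
    eq₂ k c = trans (ℤP.+-comm (k * c) k) (sym (ℤP.*-suc k c))
    lt : K * z ℤ.< K * ℤ.suc (ceil t)
    lt = ℤP.≤-<-trans (ℤP.≤-trans hi (ℤP.≤-reflexive (eq (+ 1) t (+ K′)))) (ℤP.<-≤-trans (ℤP.i≤pred[j]⇒i<j ℤP.≤-refl)
      (ℤP.≤-trans (ℤP.+-monoˡ-≤ K (ceil-≥ t)) (ℤP.≤-reflexive (eq₂ K (ceil t)))))

  ceil-≤ : ∀ t → K * ceil t ≤ t + + K′
  ceil-≤ t = ℤP.≤-trans (ℤP.i<j⇒i≤pred[j] lt) (ℤP.≤-reflexive (eq₂ (+ 1) t (+ K′)))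
    where
    a : ℤ
    a = (- t) ℤDM./ℕ suc K′
    eq₁ : ∀ k a → k * (- a) ≡ (- (ℤ.suc a * k)) + k
    eq₁ k a = trans (eq₀ k a) (cong (λ z → - z + k) (sym (ℤP.suc-* a k)))
      where
      eq₀ : ∀ k a → k * (- a) ≡ - (k + a * k) + k
      eq₀ = solve-∀
    eq₂ : ∀ o t k → - o + (- (- t) + (o + k)) ≡ t + k
    eq₂ = solve-∀
    lt : K * ceil t ℤ.< - (- t) + K
    lt = ℤP.≤-<-trans (ℤP.≤-reflexive (eq₁ K a)) (ℤP.+-monoˡ-< K (ℤP.neg-mono-< (ℤDM.n<s[n/ℕd]*d (- t) (suc K′))))

  ceil-+ : ∀ t c → ceil (t + K * c) ≡ ceil t + c
  ceil-+ t c = ceil-unique (t + K * c) (ceil t + c)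
    (ℤP.≤-trans (ℤP.+-monoˡ-≤ (K * c) (ceil-≥ t)) (ℤP.≤-reflexive (sym (ℤP.*-distribˡ-+ K (ceil t) c))))
    (ℤP.≤-trans (ℤP.≤-reflexive (ℤP.*-distribˡ-+ K (ceil t) c)) (ℤP.≤-trans (ℤP.+-monoˡ-≤ (K * c) (ceil-≤ t)) (ℤP.≤-reflexive (eq t (+ K′) (K * c)))))
    where
    eq : ∀ t k x → t + k + x ≡ t + x + k
    eq = solve-∀

  -- For integers `K z ≥ 1 - t` means that `- z` fails to satisfy `K (- z) ≥ t`. Hence the least
  -- such `z` corresponds to the largest failing value, which is `ceil t - 1`. This is the source of
  -- reciprocity.
  ceil-flip : ∀ t → ceil (+ 1 - t) ≡ + 1 - ceil t
  ceil-flip t = ceil-unique (+ 1 - t) (+ 1 - ceil t)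
    (ℤP.≤-trans (ℤP.≤-trans (ℤP.≤-reflexive (eq₁ (+ 1) t (+ K′))) (ℤP.+-monoʳ-≤ K (ℤP.neg-mono-≤ (ceil-≤ t)))) (ℤP.≤-reflexive (eq₂ K (ceil t))))
    (ℤP.≤-trans (ℤP.≤-reflexive (sym (eq₂ K (ceil t)))) (ℤP.≤-trans (ℤP.+-monoʳ-≤ K (ℤP.neg-mono-≤ (ceil-≥ t))) (ℤP.≤-reflexive (eq₃ (+ 1) (+ K′) t))))
    where
    eq₁ : ∀ o t k → o - t ≡ (o + k) + - (t + k)
    eq₁ = solve-∀
    eq₂ : ∀ k c → k + - (k * c) ≡ k * (+ 1 - c)
    eq₂ k c = trans (cong₂ _+_ (sym (ℤP.*-identityʳ k)) (ℤP.neg-distribʳ-* k c)) (sym (ℤP.*-distribˡ-+ k (+ 1) (- c)))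
    eq₃ : ∀ o k t → (o + k) + - t ≡ o - t + k
    eq₃ = solve-∀

  module _ (k : ℤ) where
    start : ℤ × ℤ → ℤ
    start (c , β) = ceil (k * c + β)

    e : List (ℤ × ℤ) → ℤ
    e D = k * w + sumL start D

    Half : List (ℤ × ℤ) → List ℤ → Set
    Half = Pointwise (λ p z → k * proj₁ p + proj₂ p ≤ K * z)

    translate : List (ℤ × ℤ) → List ℕ → List ℤ
    translate = L.zipWith (λ p t → start p + + t)

    translate-half : ∀ D t → length t ≡ length D → Half D (translate D t)
    translate-half [] [] _ = []
    translate-half ((c , β) ∷ D) (t ∷ ts) l = ℤP.≤-trans (ceil-≥ (k * c + β)) (ℤP.*-monoˡ-≤-nonNeg K (ℤP.i≤i+j (start (c , β)) (+ t))) ∷ translate-half D ts (suc-injective l)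

    translate-sum : ∀ D t → length t ≡ length D → k * w + sumL id (translate D t) ≡ e D + + sumℕ t
    translate-sum D t l = trans (cong (λ x → k * w + x) (go D t l)) (sym (ℤP.+-assoc (k * w) (sumL start D) (+ sumℕ t)))
      where
      go : ∀ D t → length t ≡ length D → sumL id (translate D t) ≡ sumL start D + + sumℕ t
      go [] [] _ = refl
      go (p ∷ D) (t ∷ ts) l = trans (cong (λ x → start p + + t + x) (go D ts (suc-injective l))) (eq (start p) (+ t) (sumL start D) (+ sumℕ ts))
        where
        eq : ∀ a b c d → a + b + (c + d) ≡ a + c + (b + d)
        eq = solve-∀

    translate-injective : ∀ D t t′ → length t ≡ length D → length t′ ≡ length D → translate D t ≡ translate D t′ → t ≡ t′
    translate-injective [] [] [] _ _ _ = refl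
    translate-injective (p ∷ D) (t ∷ ts) (t′ ∷ ts′) l l′ q = cong₂ _∷_ (ℤP.+-injective (ℤ-cancelˡ (start p) _ _ (LP.∷-injectiveˡ q)))
      (translate-injective D ts ts′ (suc-injective l) (suc-injective l′) (LP.∷-injectiveʳ q))

    half⇒translate : ∀ {D zs} → Half D zs → ∃[ t ] length t ≡ length D × translate D t ≡ zs
    half⇒translate [] = [] , refl , refl
    half⇒translate {(c , β) ∷ D} {z ∷ zs} (le ∷ h) with half⇒translate h | ≤⇒∃+ (ceil-least (k * c + β) z le)
    ... | t , l , q | n , q′ = n ∷ t , cong suc l , cong₂ _∷_ q′ q

  csum : List (ℤ × ℤ) → ℤ
  csum = sumL proj₁

  -- Reversing the direction closes the open faces and opens the closed ones, so β = 0 and β = 1 are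
  -- interchanged.
  flip : List (ℤ × ℤ) → List (ℤ × ℤ)
  flip = map (λ p → proj₁ p , + 1 - proj₂ p)

  -- Translation by the apex, which has level `K` and height `csum D + K * w`.
  e-shift : ∀ D k → e (k + K) D ≡ e k D + (csum D + K * w)
  e-shift D k = trans (cong (λ x → (k + K) * w + x) (trans (sum-cong D (λ p → trans (cong ceil (eq k K (proj₁ p) (proj₂ p))) (ceil-+ (k * proj₁ p + proj₂ p) (proj₁ p)))) (sum-+ (start k) proj₁ D)))
    (eq′ k K w (sumL (start k) D) (csum D))
    where
    eq : ∀ k K c β → (k + K) * c + β ≡ k * c + β + K * c
    eq = solve-∀
    eq′ : ∀ k K w s c → (k + K) * w + (s + c) ≡ k * w + s + (c + K * w)
    eq′ = solve-∀

  e-flip : ∀ D k → e k (flip D) ≡ + length D - e (- k) D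
  e-flip D k = trans (cong (λ x → k * w + x) (trans (sum-map (start k) (λ p → proj₁ p , + 1 - proj₂ p) D) (go D))) (eq k w (+ length D) (sumL (start (- k)) D))
    where
    eq : ∀ k w l s → k * w + (l - s) ≡ l - ((- k) * w + s)
    eq = solve-∀
    eq₂ : ∀ o k c β → k * c + (o - β) ≡ o - ((- k) * c + β)
    eq₂ = solve-∀
    eq₃ : ∀ o a l s → o - a + (l - s) ≡ o + l - (a + s)
    eq₃ = solve-∀
    go : ∀ D → sumL (λ p → ceil (k * proj₁ p + (+ 1 - proj₂ p))) D ≡ + length D - sumL (start (- k)) D
    go [] = refl
    go (p ∷ D) = trans (cong₂ _+_ (trans (cong ceil (eq₂ (+ 1) k (proj₁ p) (proj₂ p))) (ceil-flip ((- k) * proj₁ p + proj₂ p))) (go D)) (eq₃ (+ 1) (start (- k) p) (+ length D) (sumL (start (- k)) D))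

  -- Discarding the rounding and the non-negative β leaves a linear bound in `k`. It makes the
  -- number of non-negative levels below a given height finite.
  e-lower : ∀ D k → All (λ p → + 0 ≤ proj₂ p) D → k * (csum D + K * w) ≤ K * e k D
  e-lower D k β≥0 = ℤP.≤-trans (ℤP.≤-reflexive (eq k (csum D) K w)) (ℤP.≤-trans (ℤP.+-monoʳ-≤ (K * (k * w)) (go D β≥0)) (ℤP.≤-reflexive (sym (ℤP.*-distribˡ-+ K (k * w) (sumL (start k) D)))))
    where
    eq : ∀ k c K w → k * (c + K * w) ≡ K * (k * w) + k * c
    eq = solve-∀
    go : ∀ D → All (λ p → + 0 ≤ proj₂ p) D → k * csum D ≤ K * sumL (start k) D
    go [] [] = ℤP.≤-reflexive (trans (ℤP.*-zeroʳ k) (sym (ℤP.*-zeroʳ K)))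
    go ((c , β) ∷ D) (b ∷ bs) = ℤP.≤-trans (ℤP.≤-reflexive (ℤP.*-distribˡ-+ k c (csum D))) (ℤP.≤-trans (ℤP.+-mono-≤
      (ℤP.≤-trans (ℤP.≤-trans (ℤP.≤-reflexive (sym (ℤP.+-identityʳ (k * c)))) (ℤP.+-monoʳ-≤ (k * c) b)) (ceil-≥ (k * c + β))) (go D bs)) (ℤP.≤-reflexive (sym (ℤP.*-distribˡ-+ K (start k (c , β)) (sumL (start k) D)))))

module FiniteSums where
  open ≡
  open import Data.Integer using (_+_)
  open ℤSums

  Σ< : ℕ → (ℕ → ℤ) → ℤ
  Σ< zero f = + 0
  Σ< (suc n) f = f 0 + Σ< n (f ∘ suc)

  sum-upTo : ∀ (f : ℕ → ℤ) n → sumL f (upTo n) ≡ Σ< n f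
  sum-upTo f n = go id n
    where
    go : ∀ (g : ℕ → ℕ) n → sumL f (L.applyUpTo g n) ≡ Σ< n (f ∘ g)
    go g zero = refl
    go g (suc n) = cong (λ t → f (g 0) + t) (go (g ∘ suc) n)

  Σ<-cong : ∀ n {f g} → (∀ j → j ℕ.< n → f j ≡ g j) → Σ< n f ≡ Σ< n g
  Σ<-cong zero h = refl
  Σ<-cong (suc n) h = cong₂ _+_ (h 0 (ℕ.s≤s ℕ.z≤n)) (Σ<-cong n (λ j lt → h (suc j) (ℕ.s≤s lt)))

  Σ<-zero : ∀ n {f} → (∀ j → j ℕ.< n → f j ≡ + 0) → Σ< n f ≡ + 0
  Σ<-zero zero h = refl
  Σ<-zero (suc n) h = cong₂ _+_ (h 0 (ℕ.s≤s ℕ.z≤n)) (Σ<-zero n (λ j lt → h (suc j) (ℕ.s≤s lt)))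

  Σ<-+ : ∀ m n f → Σ< (m ℕ.+ n) f ≡ Σ< m f + Σ< n (λ j → f (m ℕ.+ j))
  Σ<-+ zero n f = sym (ℤP.+-identityˡ _)
  Σ<-+ (suc m) n f = trans (cong (λ t → f 0 + t) (Σ<-+ m n (f ∘ suc))) (sym (ℤP.+-assoc (f 0) _ _))

  Σ<-extend : ∀ {B B′} f → B ℕ.≤ B′ → (∀ j → B ℕ.≤ j → f j ≡ + 0) → Σ< B′ f ≡ Σ< B f
  Σ<-extend {B} {B′} f le h = trans (cong (λ n → Σ< n f) (sym (ℕP.m+[n∸m]≡n le))) (trans (Σ<-+ B (B′ ∸ B) f)
    (trans (cong (λ t → Σ< B f + t) (Σ<-zero (B′ ∸ B) (λ j _ → h (B ℕ.+ j) (ℕP.m≤m+n B j)))) (ℤP.+-identityʳ _)))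

  Σ<-last : ∀ n f → Σ< (suc n) f ≡ Σ< n f + f n
  Σ<-last n f = trans (cong (λ k → Σ< k f) (ℕP.+-comm 1 n)) (trans (Σ<-+ n 1 f) (cong (λ t → Σ< n f + t) (trans (ℤP.+-identityʳ _) (cong f (ℕP.+-identityʳ n)))))

  Σ<-reverse : ∀ n f → Σ< n f ≡ Σ< n (λ j → f (n ∸ suc j))
  Σ<-reverse zero f = refl
  Σ<-reverse (suc n) f = trans (Σ<-last n f) (trans (ℤP.+-comm _ (f n)) (cong (λ t → f n + t) (Σ<-reverse n f)))

  χ : ℤ → ℕ → ℤ
  χ z l with z ℤ.≟ + l
  ... | yes _ = + 1
  ... | no _ = + 0

  χ-≢ : ∀ {z l} → z ≢ + l → χ z l ≡ + 0
  χ-≢ {z} {l} ne with z ℤ.≟ + l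
  ... | yes q = contradiction q ne
  ... | no _ = refl

  χ-iff : ∀ {z z′ l l′} → (z ≡ + l → z′ ≡ + l′) → (z′ ≡ + l′ → z ≡ + l) → χ z l ≡ χ z′ l′
  χ-iff {z} {z′} {l} {l′} f g with z ℤ.≟ + l | z′ ℤ.≟ + l′
  ... | yes _ | yes _ = refl
  ... | yes p | no q = contradiction (f p) q
  ... | no p | yes q = contradiction (g q) p
  ... | no _ | no _ = refl

  χ-ind : ∀ e l → χ (+ e) l ≡ Sequences.ind e l
  χ-ind e l with e ℕ.≟ l
  ... | yes refl = refl
  ... | no _ = refl

module _ {A B : Set} where
  unique-concatMap : (f : A → List B) (xs : List A) → Unique xs → (∀ {x} → x ∈ xs → Unique (f x)) →
    (∀ {x y b} → b ∈ f x → b ∈ f y → x ≡ y) → Unique (L.concat (map f xs))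
  unique-concatMap f [] _ _ _ = []
  unique-concatMap f (x ∷ xs) (x∉ ∷ u) us dis = UP.++⁺ (us (here ≡.refl)) (unique-concatMap f xs u (us ∘ there) dis)
    (λ { (p , q) → let ys , b∈ , ys∈ = ∈-concat⁻′ (map f xs) q in let y , y∈ , e = ∈-map⁻ f ys∈ in All.lookup x∉ y∈ (dis p (≡.subst (_ ∈_) e b∈)) })

  length-concatMap : (f : A → List B) (xs : List A) → + length (L.concat (map f xs)) ≡ ℤSums.sumL (λ x → + length (f x)) xs
  length-concatMap f [] = ≡.refl
  length-concatMap f (x ∷ xs) = ≡.trans (≡.cong +_ (length-++ (f x))) (≡.cong (λ t → + length (f x) ℤ.+ t) (length-concatMap f xs))

  ∈-concatMap⁺ : (f : A → List B) {xs : List A} {x : A} {b : B} → x ∈ xs → b ∈ f x → b ∈ L.concat (map f xs)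
  ∈-concatMap⁺ f x∈ b∈ = ∈-concat⁺′ b∈ (∈-map⁺ f x∈)

  ∈-concatMap⁻ : (f : A → List B) (xs : List A) {b : B} → b ∈ L.concat (map f xs) → ∃[ x ] x ∈ xs × b ∈ f x
  ∈-concatMap⁻ f xs m = let ys , b∈ , ys∈ = ∈-concat⁻′ (map f xs) m in let x , x∈ , e = ∈-map⁻ f ys∈ in x , x∈ , ≡.subst (_ ∈_) e b∈

-- Lattice points of height m, located in half-open unimodular cones (two opposite choices, indexed by Bool).
module Counting (d : ℕ) {A X : Set} (Fs : List A) (Fs-unique : Unique Fs)
    (K′ : A → ℕ) (w : A → ℤ) (D⁺ : A → List (ℤ × ℤ)) (N′ : ℕ)
    (D-length : ∀ {σ} → σ ∈ Fs → length (D⁺ σ) ≡ d)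
    (D-N : ∀ {σ} → σ ∈ Fs → Cell.csum (K′ σ) (w σ) (D⁺ σ) ℤ.+ Cell.K (K′ σ) (w σ) ℤ.* w σ ≡ + suc N′)
    (β≥0 : ∀ {σ} → σ ∈ Fs → All (λ p → + 0 ℤ.≤ proj₂ p) (D⁺ σ))
    (β≤1 : ∀ {σ} → σ ∈ Fs → All (λ p → proj₂ p ℤ.≤ + 1) (D⁺ σ))
    (mk : A → ℤ → List ℤ → X) where
  open ≡
  open import Data.Integer using (_+_; _*_; -_; _-_; _≤_; _<_)
  open ℤSums
  open FiniteSums
  open Sequences
  open Tuples

  D : Bool → A → List (ℤ × ℤ)
  D true σ = D⁺ σ
  D false σ = Cell.flip (K′ σ) (w σ) (D⁺ σ)

  e : Bool → A → ℤ → ℤ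
  e s σ k = Cell.e (K′ σ) (w σ) k (D s σ)

  record Located (s : Bool) (m : ℕ) (x : X) (σ : A) (k : ℤ) (zs : List ℤ) : Set where
    field
      facet : σ ∈ Fs
      half : Cell.Half (K′ σ) (w σ) k (D s σ) zs
      height : k * w σ + sumL id zs ≡ + m
      image : mk σ k zs ≡ x

  Ds-length : ∀ s {σ} → σ ∈ Fs → length (D s σ) ≡ d
  Ds-length true m = D-length m
  Ds-length false {σ} m = trans (length-map _ (D⁺ σ)) (D-length m)

  flip-csum : ∀ σ → Cell.csum (K′ σ) (w σ) (D false σ) ≡ Cell.csum (K′ σ) (w σ) (D⁺ σ)
  flip-csum σ = sum-map proj₁ (λ p → proj₁ p , + 1 - proj₂ p) (D⁺ σ)

  lower : ∀ s {σ} → σ ∈ Fs → ∀ k → k * + suc N′ ≤ + suc (K′ σ) * e s σ k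
  lower true {σ} m k = subst (λ n → k * n ≤ + suc (K′ σ) * e true σ k) (D-N m) (Cell.e-lower (K′ σ) (w σ) (D⁺ σ) k (β≥0 m))
  lower false {σ} m k = subst (λ n → k * n ≤ + suc (K′ σ) * e false σ k) (trans (cong (λ c → c + + suc (K′ σ) * w σ) (flip-csum σ)) (D-N m))
    (Cell.e-lower (K′ σ) (w σ) (D false σ) k (AllP.map⁺ (All.map (λ le → ℤP.i≤j⇒0≤j-i le) (β≤1 m))))

  e≥0 : ∀ s {σ} → σ ∈ Fs → ∀ n → e s σ (+ n) ≡ + ℤ.∣ e s σ (+ n) ∣
  e≥0 s {σ} m n = sym (ℤP.0≤i⇒+∣i∣≡i (ℤP.*-cancelˡ-≤-pos (+ 0) (e s σ (+ n)) (+ suc (K′ σ))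
    (ℤP.≤-trans (ℤP.≤-reflexive (ℤP.*-zeroʳ (+ suc (K′ σ)))) (ℤP.≤-trans (ℤP.≤-trans (ℤ.+≤+ ℕ.z≤n) (ℤP.≤-reflexive (ℤP.pos-* n (suc N′)))) (lower s m (+ n))))))

  level-bound : ∀ s {σ} → σ ∈ Fs → ∀ n {l} → e s σ (+ n) ≤ + l → n ℕ.≤ l ℕ.* suc (K′ σ)
  level-bound s {σ} m n {l} le = ℕP.≤-trans (ℕP.≤-trans (ℕP.≤-reflexive (sym (ℕP.*-identityʳ n))) (ℕP.*-monoʳ-≤ n (ℕ.s≤s (ℕ.z≤n {N′}))))
    (ℤP.drop‿+≤+ (ℤP.≤-trans (ℤP.≤-reflexive (ℤP.pos-* n (suc N′))) (ℤP.≤-trans (lower s m (+ n)) (ℤP.≤-trans (ℤP.*-monoˡ-≤-nonNeg (+ suc (K′ σ)) le)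
      (ℤP.≤-reflexive (trans (ℤP.*-comm (+ suc (K′ σ)) (+ l)) (sym (ℤP.pos-* l (suc (K′ σ))))))))))

  e≢ : ∀ s {σ} → σ ∈ Fs → ∀ n {l} → l ℕ.* suc (K′ σ) ℕ.< n → e s σ (+ n) ≢ + l
  e≢ s m n lt q = ℕP.<⇒≱ lt (level-bound s m n (ℤP.≤-reflexive q))

  cell : Bool → ℕ → ℕ → A → ℕ → List (A × ℕ × List ℕ)
  cell s k₀ m σ j = map (λ t → σ , k₀ ℕ.+ j , t) (tuples d m ℤ.∣ e s σ (+ (k₀ ℕ.+ j)) ∣)

  column : Bool → ℕ → ℕ → A → List (A × ℕ × List ℕ)
  column s k₀ m σ = L.concat (map (cell s k₀ m σ) (upTo (suc (m ℕ.* suc (K′ σ)))))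

  triples : Bool → ℕ → ℕ → List (A × ℕ × List ℕ)
  triples s k₀ m = L.concat (map (column s k₀ m) Fs)

  ∈-triples : ∀ s k₀ m {σ k t} → (σ , k , t) ∈ triples s k₀ m → σ ∈ Fs × k₀ ℕ.≤ k × t ∈ tuples d m ℤ.∣ e s σ (+ k) ∣
  ∈-triples s k₀ m mem with ∈-concatMap⁻ (column s k₀ m) Fs mem
  ... | σ , σ∈ , mem₁ with ∈-concatMap⁻ (cell s k₀ m σ) (upTo (suc (m ℕ.* suc (K′ σ)))) mem₁
  ... | j , _ , mem₂ with ∈-map⁻ (λ t → σ , k₀ ℕ.+ j , t) mem₂
  ... | t , t∈ , refl = σ∈ , ℕP.m≤m+n k₀ j , t∈

  triples-complete : ∀ s k₀ m {σ k t} → σ ∈ Fs → k₀ ℕ.≤ k → t ∈ tuples d m ℤ.∣ e s σ (+ k) ∣ → (σ , k , t) ∈ triples s k₀ m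
  triples-complete s k₀ m {σ} {k} {t} σ∈ le t∈ = subst (λ n → (σ , n , t) ∈ triples s k₀ m) k≡ (∈-concatMap⁺ (column s k₀ m) σ∈ (∈-concatMap⁺ (cell s k₀ m σ) (∈-upTo⁺ (ℕ.s≤s bound)) (∈-map⁺ _ (subst (λ n → t ∈ tuples d m ℤ.∣ e s σ (+ n) ∣) (sym k≡) t∈))))
    where
    k≡ : k₀ ℕ.+ (k ∸ k₀) ≡ k
    k≡ = ℕP.m+[n∸m]≡n le
    bound : k ∸ k₀ ℕ.≤ m ℕ.* suc (K′ σ)
    bound = ℕP.≤-trans (ℕP.m∸n≤m k k₀) (level-bound s σ∈ k (ℤP.≤-trans (ℤP.≤-reflexive (e≥0 s σ∈ k)) (ℤ.+≤+ (ℕP.≤-trans (ℕP.m≤m+n _ _) (ℕP.≤-reflexive (proj₂ (tuples-sound d m _ t∈)))))))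

  triples-unique : ∀ s k₀ m → Unique (triples s k₀ m)
  triples-unique s k₀ m = unique-concatMap (column s k₀ m) Fs Fs-unique (λ {σ} _ → unique-concatMap (cell s k₀ m σ) (upTo (suc (m ℕ.* suc (K′ σ)))) (UP.upTo⁺ (suc (m ℕ.* suc (K′ σ))))
      (λ {j} _ → UP.map⁺ (λ { refl → refl }) (tuples-unique d m ℤ.∣ e s σ (+ (k₀ ℕ.+ j)) ∣)) (λ p q → ℕP.+-cancelˡ-≡ k₀ _ _ (trans (sym (level σ p)) (level σ q))))
    (λ p q → trans (sym (owner p)) (owner q))
    where
    level : ∀ σ {j b} → b ∈ cell s k₀ m σ j → proj₁ (proj₂ b) ≡ k₀ ℕ.+ j
    level σ p with ∈-map⁻ _ p
    ... | _ , _ , refl = refl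
    owner : ∀ {σ b} → b ∈ column s k₀ m σ → proj₁ b ≡ σ
    owner {σ} p with ∈-concatMap⁻ (cell s k₀ m σ) (upTo (suc (m ℕ.* suc (K′ σ)))) p
    ... | j , _ , q with ∈-map⁻ _ q
    ... | _ , _ , refl = refl

  -- The number of cells of level ≥ k₀ whose lowest point has height l.
  a : Bool → ℕ → ℕ → ℤ
  a s k₀ l = sumL (λ σ → Σ< (suc (l ℕ.* suc (K′ σ))) (λ j → χ (e s σ (+ (k₀ ℕ.+ j))) l)) Fs

  triples-length : ∀ s k₀ m → + length (triples s k₀ m) ≡ S^ d (a s k₀) m
  triples-length s k₀ m = trans (trans (length-concatMap (column s k₀ m) Fs) (sum-cong-∈ Fs (λ {σ} σ∈ → trans (trans (length-concatMap (cell s k₀ m σ) (upTo (B σ))) (sum-cong (upTo (B σ))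
        (λ j → trans (cong +_ (length-map _ (tuples d m ℤ.∣ e s σ (+ (k₀ ℕ.+ j)) ∣))) (trans (tuples-length d m ℤ.∣ e s σ (+ (k₀ ℕ.+ j)) ∣) (S^-cong d m (λ l _ → trans (sym (χ-ind _ l)) (cong (λ z → χ z l) (sym (e≥0 s σ∈ (k₀ ℕ.+ j))))))))))
      (sym (S^-sum d (λ j → χ (e s σ (+ (k₀ ℕ.+ j)))) (upTo (B σ)) m)))))
    (trans (sym (S^-sum d (λ σ l → sumL (λ j → χ (e s σ (+ (k₀ ℕ.+ j))) l) (upTo (B σ))) Fs m)) (S^-cong d m (λ l le → sum-cong-∈ Fs (λ {σ} σ∈ → trans (sum-upTo (λ j → χ (e s σ (+ (k₀ ℕ.+ j))) l) (B σ))
      (Σ<-extend (λ j → χ (e s σ (+ (k₀ ℕ.+ j))) l) (ℕ.s≤s (ℕP.*-monoˡ-≤ (suc (K′ σ)) le)) (λ j lt → χ-≢ (e≢ s σ∈ (k₀ ℕ.+ j) (ℕP.<-≤-trans lt (ℕP.m≤n+m j k₀)))))))))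
    where
    B : A → ℕ
    B σ = suc (m ℕ.* suc (K′ σ))

  point : Bool → A × ℕ × List ℕ → X
  point s (σ , k , t) = mk σ (+ k) (Cell.translate (K′ σ) (w σ) (+ k) (D s σ) t)

  located : ∀ s k₀ m {b} → b ∈ triples s k₀ m → let σ , k , t = b in Located s m (point s b) σ (+ k) (Cell.translate (K′ σ) (w σ) (+ k) (D s σ) t)
  located s k₀ m {σ , k , t} mem = record
    { facet = σ∈ ; half = Cell.translate-half (K′ σ) (w σ) (+ k) (D s σ) t len
    ; height = trans (Cell.translate-sum (K′ σ) (w σ) (+ k) (D s σ) t len) (trans (cong (λ z → z + + sumℕ t) (e≥0 s σ∈ k)) (cong +_ (proj₂ ts)))
    ; image = refl }
    where
    σ∈ : σ ∈ Fs
    σ∈ = proj₁ (∈-triples s k₀ m mem)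
    ts : length t ≡ d × ℤ.∣ e s σ (+ k) ∣ ℕ.+ sumℕ t ≡ m
    ts = tuples-sound d m _ (proj₂ (proj₂ (∈-triples s k₀ m mem)))
    len : length t ≡ length (D s σ)
    len = trans (proj₁ ts) (sym (Ds-length s σ∈))

  points : Bool → ℕ → ℕ → List X
  points s k₀ m = map (point s) (triples s k₀ m)

  points-complete : ∀ s k₀ m {x σ k zs} → Located s m x σ (+ k) zs → k₀ ℕ.≤ k → x ∈ points s k₀ m
  points-complete s k₀ m {x} {σ} {k} {zs} loc le with Cell.half⇒translate (K′ σ) (w σ) (+ k) (Located.half loc)
  ... | t , len , refl = subst (_∈ points s k₀ m) (Located.image loc) (∈-map⁺ (point s) (triples-complete s k₀ m (Located.facet loc) le
      (tuples-complete d m _ t (trans len (Ds-length s (Located.facet loc))) (ℤP.+-injective (trans (cong (λ z → z + + sumℕ t) (sym (e≥0 s (Located.facet loc) k)))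
        (trans (sym (Cell.translate-sum (K′ σ) (w σ) (+ k) (D s σ) t len)) (Located.height loc)))))))

  points-unique : ∀ s k₀ m → (∀ {x σ k zs σ′ k′ zs′} → Located s m x σ k zs → Located s m x σ′ k′ zs′ → σ ≡ σ′ × k ≡ k′ × zs ≡ zs′) → Unique (points s k₀ m)
  points-unique s k₀ m uniq = unique-map-on (point s) inj (triples-unique s k₀ m)
    where
    inj : ∀ {b b′} → b ∈ triples s k₀ m → b′ ∈ triples s k₀ m → point s b ≡ point s b′ → b ≡ b′
    inj {σ , k , t} {σ′ , k′ , t′} p p′ q with uniq (located s k₀ m p) (subst (λ x → Located s m x σ′ (+ k′) (Cell.translate (K′ σ′) (w σ′) (+ k′) (D s σ′) t′)) (sym q) (located s k₀ m p′))
    ... | refl , refl , tr = cong (λ t → σ , k , t) (Cell.translate-injective (K′ σ) (w σ) (+ k) (D s σ) t t′ (len p) (len p′) tr)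
      where
      len : ∀ {σ k t} → (σ , k , t) ∈ triples s k₀ m → length t ≡ length (D s σ)
      len mem = let σ∈ , _ , t∈ = ∈-triples s k₀ m mem in trans (proj₁ (tuples-sound d m _ t∈)) (sym (Ds-length s σ∈))

  -- Cells of level 0 lie on the boundary of the cone over the polytope. Their lowest heights turn
  -- out to be the sizes of the shelling restrictions, so this is the h-vector.
  H : ℕ → ℤ
  H l = sumL (λ σ → χ (e true σ (+ 0)) l) Fs

  a-boundary : ∀ l → a true 0 l ≡ H l + a true 1 l
  a-boundary l = trans (sum-cong-∈ Fs (λ {σ} σ∈ → cong (λ t → χ (e true σ (+ 0)) l + t) (sym (Σ<-extend {l ℕ.* suc (K′ σ)} (λ j → χ (e true σ (+ suc j)) l) (ℕP.n≤1+n _)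
    (λ j le → χ-≢ (e≢ true σ∈ (suc j) (ℕ.s≤s le))))))) (sum-+ _ _ Fs)

  e-shiftⁿ : ∀ {σ} → σ ∈ Fs → ∀ n k → e true σ (k + + (n ℕ.* suc (K′ σ))) ≡ e true σ k + + (n ℕ.* suc N′)
  e-shiftⁿ {σ} σ∈ zero k = trans (cong (e true σ) (ℤP.+-identityʳ k)) (sym (ℤP.+-identityʳ _))
  e-shiftⁿ {σ} σ∈ (suc n) k = trans (cong (e true σ) (trans (cong (λ z → k + z) (ℤP.pos-+ (suc (K′ σ)) (n ℕ.* suc (K′ σ)))) (eq k (+ suc (K′ σ)) (+ (n ℕ.* suc (K′ σ))))))
    (trans (Cell.e-shift (K′ σ) (w σ) (D⁺ σ) (k + + (n ℕ.* suc (K′ σ)))) (trans (cong₂ _+_ (e-shiftⁿ σ∈ n k) (D-N σ∈))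
      (trans (sym (eq (e true σ k) (+ suc N′) (+ (n ℕ.* suc N′)))) (cong (λ z → e true σ k + z) (sym (ℤP.pos-+ (suc N′) (n ℕ.* suc N′)))))))
    where
    eq : ∀ k a b → k + (a + b) ≡ k + b + a
    eq = solve-∀

  -- The cells of negative level; they are counted by the opposite choice of half-open cones.
  below : A → ℕ → ℤ
  below σ l = Σ< (d ℕ.* suc (K′ σ)) (λ j → χ (e true σ (- + suc j)) l)

  -- Translation by minus `d` times the apex takes cells of non-negative level and height
  -- `l + d * suc N′` to cells of height `l` and level at least `- d K`: those counted by `a`, and
  -- those of negative level.
  a-period : ∀ l → a true 0 (l ℕ.+ d ℕ.* suc N′) ≡ a true 0 l + sumL (λ σ → below σ l) Fs
  a-period l = trans (sum-cong-∈ Fs (λ σ∈ → per σ∈)) (sum-+ _ _ Fs)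
    where
    M : ℕ
    M = l ℕ.+ d ℕ.* suc N′
    per : ∀ {σ} → σ ∈ Fs → Σ< (suc (M ℕ.* suc (K′ σ))) (λ j → χ (e true σ (+ j)) M) ≡ Σ< (suc (l ℕ.* suc (K′ σ))) (λ j → χ (e true σ (+ j)) l) + below σ l
    per {σ} σ∈ = begin
      Σ< (suc (M ℕ.* κ)) f ≡⟨ cong (λ n → Σ< n f) (ℕP.m+[n∸m]≡n DK≤) ⟨
      Σ< (d ℕ.* κ ℕ.+ r) f ≡⟨ Σ<-+ (d ℕ.* κ) r f ⟩
      Σ< (d ℕ.* κ) f + Σ< r (λ j → f (d ℕ.* κ ℕ.+ j)) ≡⟨ cong₂ _+_ first second ⟩
      below σ l + Σ< (suc (l ℕ.* κ)) (λ j → χ (e true σ (+ j)) l) ≡⟨ ℤP.+-comm (below σ l) _ ⟩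
      Σ< (suc (l ℕ.* κ)) (λ j → χ (e true σ (+ j)) l) + below σ l ∎
      where
      open ≡-Reasoning
      κ : ℕ
      κ = suc (K′ σ)
      f : ℕ → ℤ
      f j = χ (e true σ (+ j)) M
      shifted : ∀ k {k′} → k′ ≡ k + + (d ℕ.* κ) → χ (e true σ k′) M ≡ χ (e true σ k) l
      shifted k refl = χ-iff (λ q → ℤ-cancelʳ (trans (sym (e-shiftⁿ σ∈ d k)) q)) (λ q → trans (e-shiftⁿ σ∈ d k) (cong (λ z → z + + (d ℕ.* suc N′)) q))
        where
        ℤ-cancelʳ : ∀ {i j} → i + + (d ℕ.* suc N′) ≡ + j + + (d ℕ.* suc N′) → i ≡ + j
        ℤ-cancelʳ {i} {j} q = ℤ-cancelˡ (+ (d ℕ.* suc N′)) i (+ j) (trans (ℤP.+-comm (+ (d ℕ.* suc N′)) i) (trans q (ℤP.+-comm (+ j) (+ (d ℕ.* suc N′)))))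
      room : suc (l ℕ.* κ) ℕ.+ d ℕ.* κ ℕ.≤ suc (M ℕ.* κ)
      room = ℕ.s≤s (ℕP.≤-trans (ℕP.≤-reflexive (sym (ℕP.*-distribʳ-+ κ l d))) (ℕP.*-monoˡ-≤ κ (ℕP.+-monoʳ-≤ l (ℕP.≤-trans (ℕP.≤-reflexive (sym (ℕP.*-identityʳ d))) (ℕP.*-monoʳ-≤ d (ℕ.s≤s ℕ.z≤n))))))
      DK≤ : d ℕ.* κ ℕ.≤ suc (M ℕ.* κ)
      DK≤ = ℕP.≤-trans (ℕP.m≤n+m (d ℕ.* κ) (suc (l ℕ.* κ))) room
      r : ℕ
      r = suc (M ℕ.* κ) ∸ d ℕ.* κ
      first : Σ< (d ℕ.* κ) f ≡ below σ l
      first = trans (Σ<-reverse (d ℕ.* κ) f) (Σ<-cong (d ℕ.* κ) (λ j lt → shifted (- + suc j) (trans (sym (ℤP.⊖-≥ lt)) (trans (sym (ℤP.m-n≡m⊖n (d ℕ.* κ) (suc j))) (ℤP.+-comm (+ (d ℕ.* κ)) (- + suc j))))))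
      second : Σ< r (λ j → f (d ℕ.* κ ℕ.+ j)) ≡ Σ< (suc (l ℕ.* κ)) (λ j → χ (e true σ (+ j)) l)
      second = trans (Σ<-cong r (λ j _ → shifted (+ j) (cong +_ (ℕP.+-comm (d ℕ.* κ) j)))) (Σ<-extend _ (ℕP.m+n≤o⇒m≤o∸n (suc (l ℕ.* κ)) room) (λ j lt → χ-≢ (e≢ true σ∈ j lt)))

  -- By `e-flip`, level -k and height `l` become level k and height `d - l` for the opposite
  -- direction. By `level-bound` such a height occurs only for k up to `d K`, which is why `d`
  -- periods suffice in `below`.
  a-opposite : ∀ l → l ℕ.≤ d → a false 1 (d ∸ l) ≡ sumL (λ σ → below σ l) Fs
  a-opposite l l≤d = sum-cong-∈ Fs per
    where
    per : ∀ {σ} → σ ∈ Fs → Σ< (suc ((d ∸ l) ℕ.* suc (K′ σ))) (λ j → χ (e false σ (+ suc j)) (d ∸ l)) ≡ below σ l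
    per {σ} σ∈ = trans (Σ<-extend {(d ∸ l) ℕ.* suc (K′ σ)} (λ j → χ (e false σ (+ suc j)) (d ∸ l)) (ℕP.n≤1+n _) vanish) (trans (sym (Σ<-extend {(d ∸ l) ℕ.* suc (K′ σ)} (λ j → χ (e false σ (+ suc j)) (d ∸ l)) (ℕP.*-monoˡ-≤ (suc (K′ σ)) (ℕP.m∸n≤m d l)) vanish))
        (Σ<-cong (d ℕ.* suc (K′ σ)) (λ j _ → χ-iff (λ q → to j q) (λ q → from j q))))
      where
      vanish : ∀ j → (d ∸ l) ℕ.* suc (K′ σ) ℕ.≤ j → χ (e false σ (+ suc j)) (d ∸ l) ≡ + 0
      vanish j le = χ-≢ (e≢ false σ∈ (suc j) (ℕ.s≤s le))
      flipped : ∀ j → e false σ (+ suc j) ≡ + d - e true σ (- + suc j)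
      flipped j = trans (Cell.e-flip (K′ σ) (w σ) (D⁺ σ) (+ suc j)) (cong (λ n → + n - e true σ (- + suc j)) (D-length σ∈))
      d-l : + (d ∸ l) ≡ + d - + l
      d-l = trans (sym (ℤP.⊖-≥ l≤d)) (sym (ℤP.m-n≡m⊖n d l))
      eq : ∀ a b → a - (a - b) ≡ b
      eq = solve-∀
      to : ∀ j → e false σ (+ suc j) ≡ + (d ∸ l) → e true σ (- + suc j) ≡ + l
      to j q = trans (sym (eq (+ d) (e true σ (- + suc j)))) (trans (cong (λ z → + d - z) (trans (sym (flipped j)) (trans q d-l))) (eq (+ d) (+ l)))
      from : ∀ j → e true σ (- + suc j) ≡ + l → e false σ (+ suc j) ≡ + (d ∸ l)
      from j q = trans (flipped j) (trans (cong (λ z → + d - z) q) (sym d-l))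

  -- f counts the lattice points of height m in the cone; counting the interior ones in two ways gives reciprocity.
  module Reciprocity (Inside Interior : ℕ → X → Set) (f : ℕ → ℤ)
      (counts : ∀ m (xs : List X) → Unique xs → (∀ x → x ∈ xs ⇔ Inside m x) → + length xs ≡ f m)
      (locate : ∀ s m x → ∃[ σ ] ∃[ k ] ∃[ zs ] Located s m x σ k zs)
      (located-unique : ∀ s m {x σ k zs σ′ k′ zs′} → Located s m x σ k zs → Located s m x σ′ k′ zs′ → σ ≡ σ′ × k ≡ k′ × zs ≡ zs′)
      (inside⇔ : ∀ {m x σ k zs} → Located true m x σ k zs → Inside m x ⇔ (+ 0 ≤ k))
      (interior⇔ : ∀ {s m x σ k zs} → Located s m x σ k zs → Interior m x ⇔ (+ 1 ≤ k)) where

    at-level : ∀ s k₀ m {x σ k zs} → Located s m x σ k zs → + k₀ ≤ k → x ∈ points s k₀ m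
    at-level s k₀ m {k = + n} loc (ℤ.+≤+ le) = points-complete s k₀ m loc le

    f≡S^a : ∀ m → f m ≡ S^ d (a true 0) m
    f≡S^a m = trans (sym (counts m (points true 0 m) (points-unique true 0 m (located-unique true m)) (λ x → mk⇔ (to x) (from x))))
      (trans (cong +_ (length-map (point true) (triples true 0 m))) (triples-length true 0 m))
      where
      to : ∀ x → x ∈ points true 0 m → Inside m x
      to x mem with ∈-map⁻ (point true) mem
      ... | _ , b∈ , refl = Equivalence.from (inside⇔ (located true 0 m b∈)) (ℤ.+≤+ ℕ.z≤n)
      from : ∀ x → Inside m x → x ∈ points true 0 m
      from x ins with locate true m x
      ... | σ , k , zs , loc = at-level true 0 m loc (Equivalence.to (inside⇔ loc) ins)

    interior-sound : ∀ s m {x} → x ∈ points s 1 m → Interior m x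
    interior-sound s m mem with ∈-map⁻ (point s) mem
    ... | _ , b∈ , refl = Equivalence.from (interior⇔ (located s 1 m b∈)) (ℤ.+≤+ (proj₁ (proj₂ (∈-triples s 1 m b∈))))

    interior-complete : ∀ s m {x} → Interior m x → x ∈ points s 1 m
    interior-complete s m {x} int with locate s m x
    ... | σ , k , zs , loc = at-level s 1 m loc (Equivalence.to (interior⇔ loc) int)

    -- Both choices of half-open cones find each interior point exactly once, in a positive level.
    -- The point counts agree in every height, and `d`-fold partial summation is injective.
    a-interior : ∀ l → a true 1 l ≡ a false 1 l
    a-interior = S^-injective d (λ m → trans (sym (triples-length true 1 m)) (trans (cong +_ (trans (sym (length-map (point true) (triples true 1 m)))
      (trans (unique-length (points-unique true 1 m (located-unique true m)) (points-unique false 1 m (located-unique false m))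
        (λ mem → interior-complete false m (interior-sound true m mem)) (λ mem → interior-complete true m (interior-sound false m mem))) (length-map (point false) (triples false 1 m)))))
      (triples-length false 1 m)))

    reciprocity : ∀ l → l ℕ.≤ d → a true 0 (l ℕ.+ d ℕ.* suc N′) + H (d ∸ l) ≡ a true 0 l + a true 0 (d ∸ l)
    reciprocity l le = trans (cong (λ z → z + H (d ∸ l)) (trans (a-period l) (cong (λ z → a true 0 l + z) (trans (sym (a-opposite l le)) (sym (a-interior (d ∸ l)))))))
      (trans (eq (a true 0 l) (a true 1 (d ∸ l)) (H (d ∸ l))) (cong (λ z → a true 0 l + z) (sym (a-boundary (d ∸ l)))))
      where
      eq : ∀ x y z → x + y + z ≡ x + (z + y)
      eq = solve-∀

-- Fourier-Motzkin elimination and rays leaving a polytope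

module FourierMotzkin (O : OrderedField) where
  open ≡
  open FieldProperties O
  open V using ([]; _∷_)

  argmax : {A : Set} (f : A → 𝔽) (x : A) (xs : List A) → ∃[ y ] y ∈ x ∷ xs × (∀ {z} → z ∈ x ∷ xs → f z ≤ f y)
  argmax f x [] = x , here refl , λ { (here refl) → ≤-refl }
  argmax f x (x′ ∷ xs) with argmax f x′ xs
  ... | y , m , h with f x ≤? f y
  ... | yes le = y , there m , λ { (here refl) → le ; (there n) → h n }
  ... | no nle = x , here refl , λ { (here refl) → ≤-refl ; (there n) → ≤-trans (h n) (<⇒≤ (≰⇒> nle)) }

  -- The affine constraint 0 ≤ c · x + b.
  Con : ℕ → Set
  Con n = Vec 𝔽 n × 𝔽

  ev : ∀ {n} → Con n → Vec 𝔽 n → 𝔽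
  ev ([] , b) [] = b
  ev (c ∷ cs , b) (x ∷ xs) = c * x + ev (cs , b) xs

  _⊕_ : ∀ {n} → Con n → Con n → Con n
  (c , b) ⊕ (c′ , b′) = V.zipWith _+_ c c′ , b + b′

  _⊙_ : ∀ {n} → 𝔽 → Con n → Con n
  r ⊙ (c , b) = V.map (r *_) c , r * b

  ev-⊕ : ∀ {n} (p q : Con n) x → ev (p ⊕ q) x ≡ ev p x + ev q x
  ev-⊕ ([] , b) ([] , b′) [] = refl
  ev-⊕ (c ∷ cs , b) (c′ ∷ cs′ , b′) (x ∷ xs) = trans (cong₂ _+_ (distribʳ x c c′) (ev-⊕ (cs , b) (cs′ , b′) xs)) (interchange _ _ _ _)

  ev-⊙ : ∀ {n} r (p : Con n) x → ev (r ⊙ p) x ≡ r * ev p x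
  ev-⊙ r ([] , b) [] = refl
  ev-⊙ r (c ∷ cs , b) (x ∷ xs) = trans (cong₂ _+_ (*-assoc r c x) (ev-⊙ r (cs , b) xs)) (sym (distribˡ r _ _))

  Sat : ∀ {n} → List (Con n) → Vec 𝔽 n → Set
  Sat cs x = ∀ {c} → c ∈ cs → 0# ≤ ev c x

  head₀ : ∀ {n} → Con (suc n) → 𝔽
  head₀ (c ∷ _ , _) = c

  tail₀ : ∀ {n} → Con (suc n) → Con n
  tail₀ (_ ∷ cs , b) = cs , b

  ev-∷ : ∀ {n} (c : Con (suc n)) x xs → ev c (x ∷ xs) ≡ head₀ c * x + ev (tail₀ c) xs
  ev-∷ (_ ∷ _ , _) x xs = refl

  combine : ∀ {n} → Con (suc n) → Con (suc n) → Con (suc n)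
  combine l u = ((- head₀ u) ⊙ l) ⊕ (head₀ l ⊙ u)

  head-combine : ∀ {n} (l u : Con (suc n)) → head₀ (combine l u) ≡ 0#
  head-combine (l ∷ _ , _) (u ∷ _ , _) = trans (cong₂ _+_ (trans (sym (neg-distribˡ-* u l)) (cong -_ (*-comm u l))) refl) (-‿inverseˡ (l * u))

  tail-combine : ∀ {n} (l u : Con (suc n)) x → ev (tail₀ (combine l u)) x ≡ (- head₀ u) * ev (tail₀ l) x + head₀ l * ev (tail₀ u) x
  tail-combine (l ∷ ls , b) (u ∷ us , b′) x = trans (ev-⊕ ((- u) ⊙ (ls , b)) (l ⊙ (us , b′)) x) (cong₂ _+_ (ev-⊙ (- u) (ls , b) x) (ev-⊙ l (us , b′) x))

  lowers uppers neutrals : ∀ {n} → List (Con (suc n)) → List (Con (suc n))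
  lowers = filter (λ c → 0# <? head₀ c)
  uppers = filter (λ c → head₀ c <? 0#)
  neutrals = filter (λ c → head₀ c ≟ᶠ 0#)

  combinations : ∀ {n} → List (Con (suc n)) → List (Con (suc n))
  combinations cs = neutrals cs ++ L.concat (map (λ l → map (combine l) (uppers cs)) (lowers cs))

  eliminate : ∀ {n} → List (Con (suc n)) → List (Con n)
  eliminate cs = map tail₀ (combinations cs)

  -- Elimination only adds constraints and multiplies them by positive numbers, so it preserves
  -- every property closed under these operations. Applied to satisfaction at a point and to the
  -- existence of a certificate, the same lemma yields consistency and a form of Farkas' lemma.
  record ConvexCone {n} (Q : Con n → Set) : Set where
    field
      closed-⊕ : ∀ {p q} → Q p → Q q → Q (p ⊕ q)
      closed-⊙ : ∀ {r p} → 0# < r → Q p → Q (r ⊙ p)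

  extend₀ : ∀ {n} → Con n → Con (suc n)
  extend₀ (cs , b) = 0# ∷ cs , b

  extend-tail : ∀ {n} (c : Con (suc n)) → head₀ c ≡ 0# → extend₀ (tail₀ c) ≡ c
  extend-tail (_ ∷ _ , _) refl = refl

  eliminate-sound : ∀ {n} {Q : Con (suc n) → Set} → ConvexCone Q → ∀ cs → (∀ {c} → c ∈ cs → Q c) → ∀ {c} → c ∈ eliminate cs → Q (extend₀ c)
  eliminate-sound {Q = Q} cone cs h m with ∈-map⁻ tail₀ m
  ... | c , c∈ , refl with ∈-++⁻ (neutrals cs) c∈
  ... | inj₁ n with ∈-filter⁻ (λ c → head₀ c ≟ᶠ 0#) {xs = cs} n
  ...   | c∈cs , z = subst Q (sym (extend-tail c z)) (h c∈cs)
  eliminate-sound {Q = Q} cone cs h m | c , c∈ , refl | inj₂ k with ∈-concatMap⁻ (λ l → map (combine l) (uppers cs)) (lowers cs) k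
  ... | l , l∈ , k′ with ∈-map⁻ (combine l) k′
  ... | u , u∈ , refl with ∈-filter⁻ (λ c → 0# <? head₀ c) {xs = cs} l∈ | ∈-filter⁻ (λ c → head₀ c <? 0#) {xs = cs} u∈
  ... | l∈cs , l>0 | u∈cs , u<0 = subst Q (sym (extend-tail (combine l u) (head-combine l u)))
        (ConvexCone.closed-⊕ cone (ConvexCone.closed-⊙ cone (neg-0< u<0) (h l∈cs)) (ConvexCone.closed-⊙ cone l>0 (h u∈cs)))

  module _ {n} (cs : List (Con (suc n))) (x : Vec 𝔽 n) (sat : Sat (eliminate cs) x) where
    private
      g : Con (suc n) → 𝔽
      g c = ev (tail₀ c) x

      root : Con (suc n) → 𝔽
      root c with head₀ c ≟ᶠ 0#
      ... | yes _ = 0#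
      ... | no ne = - g c * proj₁ (1/′ ne)

      root-spec : ∀ c → head₀ c ≢ 0# → head₀ c * root c + g c ≡ 0#
      root-spec c ne with head₀ c ≟ᶠ 0#
      ... | yes z = contradiction z ne
      ... | no ne′ = trans (cong (_+ g c) (trans (cong (head₀ c *_) (*-comm (- g c) _)) (trans (sym (*-assoc _ _ _)) (trans (cong (_* - g c) (proj₂ (1/′ ne′))) (*-identityˡ _))))) (-‿inverseˡ (g c))

      above-root : ∀ c → 0# < head₀ c → ∀ {t} → root c ≤ t → 0# ≤ ev c (t ∷ x)
      above-root c pos {t} le = subst (0# ≤_) (sym (ev-∷ c t x)) (≤-trans (≤-reflexive (sym (root-spec c (0<⇒≢0 pos)))) (+-monoˡ-≤ (g c) (*-monoˡ-≤ (<⇒≤ pos) le)))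

      below-root : ∀ c → head₀ c < 0# → ∀ {t} → t ≤ root c → 0# ≤ ev c (t ∷ x)
      below-root c neg {t} le = subst (0# ≤_) (sym (ev-∷ c t x)) (≤-trans (≤-reflexive (sym (root-spec c (λ z → <-irrefl z neg)))) (+-monoˡ-≤ (g c)
        (0≤-⇒≤ (subst (0# ≤_) eq (*-0≤ (<⇒≤ (neg-0< neg)) (≤⇒0≤- le))))))
        where
        eq : - head₀ c * (root c - t) ≡ head₀ c * t - head₀ c * root c
        eq = trans (sym (neg-distribˡ-* (head₀ c) (root c - t))) (trans (cong -_ (*-distribˡ-- (head₀ c) t (root c)))
          (trans (neg-distrib-+ _ _) (trans (cong (_+_ (- (head₀ c * root c))) (neg-involutive _)) (+-comm _ _))))

      neutral : ∀ {c} → c ∈ cs → head₀ c ≡ 0# → ∀ t → 0# ≤ ev c (t ∷ x)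
      neutral {c} c∈ z t = subst (0# ≤_) (sym (trans (ev-∷ c t x) (trans (cong (_+ g c) (trans (cong (_* t) z) (zeroˡ t))) (+-identityˡ (g c)))))
        (sat (∈-map⁺ tail₀ (∈-++⁺ˡ (∈-filter⁺ (λ c → head₀ c ≟ᶠ 0#) c∈ z))))

      ordered : ∀ {l u} → l ∈ lowers cs → u ∈ uppers cs → 0# < head₀ l → head₀ u < 0# → root l ≤ root u
      ordered {l} {u} l∈ u∈ l>0 u<0 = ≮⇒≥ λ lt → ≤⇒≯ combined (strict lt)
        where
        combined : 0# ≤ (- head₀ u) * g l + head₀ l * g u
        combined = subst (0# ≤_) (tail-combine l u x) (sat (∈-map⁺ tail₀ (∈-++⁺ʳ (neutrals cs) (∈-concatMap⁺ (λ l → map (combine l) (uppers cs)) l∈ (∈-map⁺ (combine l) u∈)))))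
        g≡ : ∀ c → head₀ c ≢ 0# → g c ≡ - (head₀ c * root c)
        g≡ c ne = -≡0⇒≡ (trans (cong (_+_ (g c)) (neg-involutive _)) (trans (+-comm (g c) _) (root-spec c ne)))
        strict : root u < root l → (- head₀ u) * g l + head₀ l * g u < 0#
        strict lt = subst (_< 0#) (sym eq) (neg-<0 (*-0< (*-0< (neg-0< u<0) l>0) (<⇒0<- lt)))
          where
          h k m : 𝔽
          h = head₀ l
          k = head₀ u
          m = - k
          eq : m * g l + h * g u ≡ - (m * h * (root l - root u))
          eq = begin
            m * g l + h * g u ≡⟨ cong₂ (λ a b → m * a + h * b) (g≡ l (0<⇒≢0 l>0)) (g≡ u (λ z → <-irrefl z u<0)) ⟩
            m * - (h * root l) + h * - (k * root u) ≡⟨ cong₂ _+_ (sym (neg-distribʳ-* m (h * root l))) (cong (h *_) (neg-distribˡ-* k (root u))) ⟩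
            - (m * (h * root l)) + h * (m * root u) ≡⟨ cong₂ (λ a b → - a + b) (sym (*-assoc m h (root l))) (trans (sym (*-assoc h m (root u))) (cong (_* root u) (*-comm h m))) ⟩
            - (m * h * root l) + m * h * root u ≡⟨ cong (_+_ (- (m * h * root l))) (neg-involutive (m * h * root u)) ⟨
            - (m * h * root l) + - (- (m * h * root u)) ≡⟨ neg-distrib-+ (m * h * root l) (- (m * h * root u)) ⟨
            - (m * h * root l - m * h * root u) ≡⟨ cong -_ (*-distribˡ-- (m * h) (root u) (root l)) ⟨
            - (m * h * (root l - root u)) ∎
            where open ≡-Reasoning

      by-sign : ∀ {t} → (∀ {c} → c ∈ lowers cs → root c ≤ t) → (∀ {c} → c ∈ uppers cs → t ≤ root c) → Sat cs (t ∷ x)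
      by-sign {t} lo up {c} c∈ with <-cmp (head₀ c) 0#
      ... | Tri.tri< lt _ _ = below-root c lt (up (∈-filter⁺ (λ c → head₀ c <? 0#) c∈ lt))
      ... | Tri.tri≈ _ z _ = neutral c∈ z t
      ... | Tri.tri> _ _ gt = above-root c gt (lo (∈-filter⁺ (λ c → 0# <? head₀ c) c∈ gt))

      lower>0 : ∀ {c} → c ∈ lowers cs → 0# < head₀ c
      lower>0 m = proj₂ (∈-filter⁻ (λ c → 0# <? head₀ c) {xs = cs} m)

      upper<0 : ∀ {c} → c ∈ uppers cs → head₀ c < 0#
      upper<0 m = proj₂ (∈-filter⁻ (λ c → head₀ c <? 0#) {xs = cs} m)

      choose : ∀ ls us → ls ⊑ lowers cs → lowers cs ⊑ ls → us ⊑ uppers cs → uppers cs ⊑ us → ∃[ t ] Sat cs (t ∷ x)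
      choose [] [] _ a _ b = 0# , by-sign (λ m → case a m of λ ()) (λ m → case b m of λ ())
      choose [] (u ∷ us) _ a _ b with argmax (λ c → - root c) u us
      ... | u′ , _ , h = root u′ , by-sign (λ m → case a m of λ ()) (λ m → 0≤-⇒≤ (subst (0# ≤_) (trans (+-comm _ _) (cong (_+ - root u′) (neg-involutive _))) (≤⇒0≤- (h (b m)))))
      choose (l ∷ ls) us sub a _ b with argmax root l ls
      ... | l′ , m , h = root l′ , by-sign (λ n → h (a n)) (λ n → ordered (sub m) n (lower>0 (sub m)) (upper<0 n))

    -- The largest root of a lower bound serves as `t`, or the smallest root of an upper bound if
    -- there are no lower bounds. The combined constraints say precisely that every lower root is at
    -- most every upper root.
    eliminate-complete : ∃[ t ] Sat cs (t ∷ x)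
    eliminate-complete = choose (lowers cs) (uppers cs) id id id id

  eliminateAll : ∀ n {k} → List (Con (n ℕ.+ k)) → List (Con k)
  eliminateAll zero cs = cs
  eliminateAll (suc n) cs = eliminateAll n (eliminate cs)

  zeros : ∀ n {k} → Con k → Con (n ℕ.+ k)
  zeros zero c = c
  zeros (suc n) c = extend₀ (zeros n c)

  eliminateAll-complete : ∀ n {k} (cs : List (Con (n ℕ.+ k))) x → Sat (eliminateAll n cs) x → ∃[ y ] Sat cs (y V.++ x)
  eliminateAll-complete zero cs x sat = [] , sat
  eliminateAll-complete (suc n) cs x sat with eliminateAll-complete n (eliminate cs) x sat
  ... | y , sat′ with eliminate-complete cs (y V.++ x) sat′
  ... | t , sat″ = t ∷ y , sat″

  eliminateAll-sound : ∀ n {k} {Q : Con (n ℕ.+ k) → Set} → ConvexCone Q → ∀ cs → (∀ {c} → c ∈ cs → Q c) → ∀ {c} → c ∈ eliminateAll n cs → Q (zeros n c)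
  eliminateAll-sound zero cone cs h m = h m
  eliminateAll-sound (suc n) {Q = Q} cone cs h m = eliminateAll-sound n {Q = λ c → Q (extend₀ c)} record
    { closed-⊕ = λ {p} {q} a b → subst Q (extend-⊕ p q) (ConvexCone.closed-⊕ cone a b)
    ; closed-⊙ = λ {r} {p} lt a → subst Q (extend-⊙ r p) (ConvexCone.closed-⊙ cone lt a) } (eliminate cs) (eliminate-sound cone cs h) m
    where
    extend-⊕ : ∀ {n} (p q : Con n) → extend₀ p ⊕ extend₀ q ≡ extend₀ (p ⊕ q)
    extend-⊕ (p , b) (q , b′) = cong (λ z → z ∷ V.zipWith _+_ p q , b + b′) (+-identityˡ 0#)
    extend-⊙ : ∀ {n} r (p : Con n) → r ⊙ extend₀ p ≡ extend₀ (r ⊙ p)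
    extend-⊙ r (p , b) = cong (λ z → z ∷ V.map (r *_) p , r * b) (zeroʳ r)

module RayExit (O : OrderedField) (d n : ℕ) (P : Fin n → Vectors.Vector O d) where
  open ≡
  open FieldProperties O
  open Vectors O d
  open FourierMotzkin O
  open V using ([]; _∷_)

  fins : List (Fin n)
  fins = allFin n

  record Convex (x : Vector) : Set where
    field
      weight : Fin n → 𝔽
      weight≥0 : ∀ i → 0# ≤ weight i
      weight-sum : sumL weight fins ≡ 1#
      weight-comb : ∀ j → sumL (λ i → weight i * P i j) fins ≡ x j

  -- The affine form Σᵢ (f i) λᵢ + g t + b in the unknowns λ₁ … λₙ and t.
  form : (Fin n → 𝔽) → 𝔽 → 𝔽 → Con (n ℕ.+ 1)
  form f g b = V.tabulate f V.++ (g ∷ []) , b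

  ev-form : ∀ f g b (y : Vec 𝔽 n) t → ev (form f g b) (y V.++ t ∷ []) ≡ sumL (λ i → f i * V.lookup y i) fins + (g * t + b)
  ev-form f g b y t = trans (go f y) (cong (_+ (g * t + b)) (sym (tab (λ i → f i * V.lookup y i) id)))
    where
    s : ∀ {m} → (Fin m → 𝔽) → 𝔽
    s {zero} f = 0#
    s {suc m} f = f F.zero + s (f ∘ F.suc)
    tab : ∀ {m k} (f : Fin k → 𝔽) (h : Fin m → Fin k) → sumL f (L.tabulate h) ≡ s (f ∘ h)
    tab {zero} f h = refl
    tab {suc m} f h = cong (_+_ (f (h F.zero))) (tab f (h ∘ F.suc))
    go : ∀ {m} (f : Fin m → 𝔽) (y : Vec 𝔽 m) → ev (V.tabulate f V.++ (g ∷ []) , b) (y V.++ t ∷ []) ≡ s (λ i → f i * V.lookup y i) + (g * t + b)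
    go {zero} f [] = sym (+-identityˡ _)
    go {suc m} f (x ∷ y) = trans (cong (_+_ (f F.zero * x)) (go (f ∘ F.suc) y)) (sym (+-assoc _ _ _))

  unit : ∀ {m} → Fin m → Fin m → 𝔽
  unit i j with i F.≟ j
  ... | yes _ = 1#
  ... | no _ = 0#

  sum-unit : ∀ {m} i (f : Fin m → 𝔽) → sumL (λ j → unit i j * f j) (allFin m) ≡ f i
  sum-unit {m} i f = trans (sum-single {f = λ j → unit i j * f j} (UP.allFin⁺ m) (∈-allFin i) (λ {j} _ ne → trans (cong (_* f j) (off j ne)) (zeroˡ (f j))))
      (trans (cong (_* f i) on) (*-identityˡ (f i)))
    where
    on : unit i i ≡ 1#
    on with i F.≟ i
    ... | yes _ = refl
    ... | no ne = contradiction refl ne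
    off : ∀ j → j ≢ i → unit i j ≡ 0#
    off j ne with i F.≟ j
    ... | yes e = contradiction (sym e) ne
    ... | no _ = refl

  unit≥0 : ∀ {m} (i j : Fin m) → 0# ≤ unit i j
  unit≥0 i j with i F.≟ j
  ... | yes _ = <⇒≤ 0<1
  ... | no _ = ≤-refl

  square>0 : ∀ {p} → p ≢ 0# → 0# < p * p
  square>0 {p} ne with <-cmp p 0#
  ... | Tri.tri> _ _ gt = *-0< gt gt
  ... | Tri.tri≈ _ e _ = contradiction e ne
  ... | Tri.tri< lt _ _ = subst (0# <_) (trans (sym (neg-distribˡ-* p (- p))) (trans (cong -_ (sym (neg-distribʳ-* p p))) (neg-involutive (p * p)))) (*-0< (neg-0< lt) (neg-0< lt))

  ·-+ : ∀ (a b x : Vector) → (λ i → a i + b i) · x ≡ a · x + b · x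
  ·-+ a b x = trans (sum-cong (allFin d) (λ i → distribʳ (x i) (a i) (b i))) (sum-+ _ _ (allFin d))

  ·-scale : ∀ r (a x : Vector) → (λ i → r * a i) · x ≡ r * (a · x)
  ·-scale r a x = trans (sum-cong (allFin d) (λ i → *-assoc r (a i) (x i))) (sym (sum-*ˡ r _ (allFin d)))

  convex-· : ∀ {x} (c : Convex x) a → a · x ≡ sumL (λ i → Convex.weight c i * (a · P i)) fins
  convex-· {x} c a = trans (·-cong a (λ j → sym (Convex.weight-comb c j))) (Combinations.·-comb P a (Convex.weight c) fins)

  convex-≤ : ∀ {x} → Convex x → ∀ a M → (∀ i → a · P i ≤ M) → a · x ≤ M
  convex-≤ {x} c a M h = 0≤-⇒≤ (subst (0# ≤_) eq (sum-0≤ fins (λ {i} _ → *-0≤ (Convex.weight≥0 c i) (≤⇒0≤- (h i)))))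
    where
    open Convex c
    eq : sumL (λ i → weight i * (M - a · P i)) fins ≡ M - a · x
    eq = trans (sum-cong fins (λ i → *-distribˡ-- (weight i) (a · P i) M)) (trans (sum-- _ _ fins)
      (cong₂ _-_ (trans (sym (sum-*ʳ weight M fins)) (trans (cong (_* M) weight-sum) (*-identityˡ M))) (sym (convex-· c a))))

  record Exit (q y : Vector) : Set where
    field
      time : 𝔽
      time≥0 : 0# ≤ time
      exit : Convex (λ i → q i + time * y i)
      normal : Vector
      normal-y : 0# < normal · y
      supporting : ∀ i → normal · P i ≤ normal · (λ i → q i + time * y i)

  module _ (q y : Vector) (q∈ : Convex q) (y≢0 : ∃[ j ] y j ≢ 0#) where
    constraints : List (Con (n ℕ.+ 1))
    constraints = map (λ i → form (unit i) 0# 0#) fins ++ (map (λ r → form (λ i → P i r) (- y r) (- q r)) (allFin d)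
      ++ (map (λ r → form (λ i → - P i r) (y r) (q r)) (allFin d) ++ (form (λ _ → 1#) 0# (- 1#) ∷ form (λ _ → - 1#) 0# 1# ∷ [])))

    case-constraints : ∀ (Q : Con (n ℕ.+ 1) → Set) → (∀ i → Q (form (unit i) 0# 0#)) → (∀ r → Q (form (λ i → P i r) (- y r) (- q r))) →
      (∀ r → Q (form (λ i → - P i r) (y r) (q r))) → Q (form (λ _ → 1#) 0# (- 1#)) → Q (form (λ _ → - 1#) 0# 1#) → ∀ {c} → c ∈ constraints → Q c
    case-constraints Q a b b′ e e′ m with ∈-++⁻ (map (λ i → form (unit i) 0# 0#) fins) m
    ... | inj₁ m₁ with ∈-map⁻ _ m₁
    ...   | i , _ , refl = a i
    case-constraints Q a b b′ e e′ m | inj₂ m₂ with ∈-++⁻ (map (λ r → form (λ i → P i r) (- y r) (- q r)) (allFin d)) m₂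
    ... | inj₁ m₃ with ∈-map⁻ _ m₃
    ...   | r , _ , refl = b r
    case-constraints Q a b b′ e e′ m | inj₂ m₂ | inj₂ m₄ with ∈-++⁻ (map (λ r → form (λ i → - P i r) (y r) (q r)) (allFin d)) m₄
    ... | inj₁ m₅ with ∈-map⁻ _ m₅
    ...   | r , _ , refl = b′ r
    case-constraints Q a b b′ e e′ m | inj₂ m₂ | inj₂ m₄ | inj₂ (here refl) = e
    case-constraints Q a b b′ e e′ m | inj₂ m₂ | inj₂ m₄ | inj₂ (there (here refl)) = e′

    private
      ∈-unit : ∀ i → form (unit i) 0# 0# ∈ constraints
      ∈-unit i = ∈-++⁺ˡ (∈-map⁺ _ (∈-allFin i))
      ∈-eq⁺ : ∀ r → form (λ i → P i r) (- y r) (- q r) ∈ constraints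
      ∈-eq⁺ r = ∈-++⁺ʳ (map (λ i → form (unit i) 0# 0#) fins) (∈-++⁺ˡ (∈-map⁺ _ (∈-allFin r)))
      ∈-eq⁻ : ∀ r → form (λ i → - P i r) (y r) (q r) ∈ constraints
      ∈-eq⁻ r = ∈-++⁺ʳ (map (λ i → form (unit i) 0# 0#) fins) (∈-++⁺ʳ (map (λ r → form (λ i → P i r) (- y r) (- q r)) (allFin d)) (∈-++⁺ˡ (∈-map⁺ _ (∈-allFin r))))
      ∈-one : ∀ {c} → c ∈ form (λ _ → 1#) 0# (- 1#) ∷ form (λ _ → - 1#) 0# 1# ∷ [] → c ∈ constraints
      ∈-one m = ∈-++⁺ʳ (map (λ i → form (unit i) 0# 0#) fins) (∈-++⁺ʳ (map (λ r → form (λ i → P i r) (- y r) (- q r)) (allFin d)) (∈-++⁺ʳ (map (λ r → form (λ i → - P i r) (y r) (q r)) (allFin d)) m))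

      zero-one : ∀ t b → 0# * t + b ≡ b
      zero-one t b = trans (cong (_+ b) (zeroˡ t)) (+-identityˡ b)

      ev-eq⁺ : ∀ r z t → ev (form (λ i → P i r) (- y r) (- q r)) (z V.++ t ∷ []) ≡ sumL (λ i → V.lookup z i * P i r) fins - (q r + t * y r)
      ev-eq⁺ r z t = trans (ev-form _ _ _ z t) (cong₂ _+_ (sum-cong fins (λ i → *-comm _ _)) (trans (cong (_+ - q r) (trans (sym (neg-distribˡ-* (y r) t)) (cong -_ (*-comm (y r) t)))) (trans (+-comm _ _) (sym (neg-distrib-+ (q r) (t * y r))))))

      ev-eq⁻ : ∀ r z t → ev (form (λ i → - P i r) (y r) (q r)) (z V.++ t ∷ []) ≡ (q r + t * y r) - sumL (λ i → V.lookup z i * P i r) fins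
      ev-eq⁻ r z t = trans (ev-form _ _ _ z t) (trans (cong₂ _+_ (trans (sum-cong fins (λ i → trans (sym (neg-distribˡ-* _ _)) (cong -_ (*-comm _ _)))) (sum-neg _ fins)) (trans (cong (_+ q r) (*-comm (y r) t)) (+-comm _ _))) (+-comm _ _))

      ev-one⁺ : ∀ z t → ev (form (λ _ → 1#) 0# (- 1#)) (z V.++ t ∷ []) ≡ sumL (V.lookup z) fins - 1#
      ev-one⁺ z t = trans (ev-form _ _ _ z t) (cong₂ _+_ (sum-cong fins (λ i → *-identityˡ _)) (zero-one t (- 1#)))

      ev-one⁻ : ∀ z t → ev (form (λ _ → - 1#) 0# 1#) (z V.++ t ∷ []) ≡ 1# - sumL (V.lookup z) fins
      ev-one⁻ z t = trans (ev-form _ _ _ z t) (trans (cong₂ _+_ (trans (sum-cong fins (λ i → trans (sym (neg-distribˡ-* 1# _)) (cong -_ (*-identityˡ _)))) (sum-neg _ fins)) (zero-one t 1#)) (+-comm _ _))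

      ev-unit : ∀ i z t → ev (form (unit i) 0# 0#) (z V.++ t ∷ []) ≡ V.lookup z i
      ev-unit i z t = trans (ev-form _ _ _ z t) (trans (cong₂ _+_ (sum-unit i (V.lookup z)) (zero-one t 0#)) (+-identityʳ _))

    sat⇒convex : ∀ z t → Sat constraints (z V.++ t ∷ []) → Convex (λ i → q i + t * y i)
    sat⇒convex z t sat = record
      { weight = V.lookup z
      ; weight≥0 = λ i → subst (0# ≤_) (ev-unit i z t) (sat (∈-unit i))
      ; weight-sum = ≤-antisym (0≤-⇒≤ (subst (0# ≤_) (ev-one⁻ z t) (sat (∈-one (there (here refl)))))) (0≤-⇒≤ (subst (0# ≤_) (ev-one⁺ z t) (sat (∈-one (here refl)))))
      ; weight-comb = λ r → ≤-antisym (0≤-⇒≤ (subst (0# ≤_) (ev-eq⁻ r z t) (sat (∈-eq⁻ r)))) (0≤-⇒≤ (subst (0# ≤_) (ev-eq⁺ r z t) (sat (∈-eq⁺ r)))) }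

    q-solution : Sat constraints (V.tabulate (Convex.weight q∈) V.++ 0# ∷ [])
    q-solution = case-constraints (λ c → 0# ≤ ev c (z V.++ 0# ∷ []))
        (λ i → subst (0# ≤_) (sym (trans (ev-unit i z 0#) (lookup∘tabulate weight i))) (weight≥0 i))
        (λ r → ≤-reflexive (sym (trans (ev-eq⁺ r z 0#) (trans (cong₂ _-_ (comb r) (q0 r)) (-‿inverseʳ (q r))))))
        (λ r → ≤-reflexive (sym (trans (ev-eq⁻ r z 0#) (trans (cong₂ _-_ (q0 r) (comb r)) (-‿inverseʳ (q r))))))
        (≤-reflexive (sym (trans (ev-one⁺ z 0#) (trans (cong (_- 1#) total) (-‿inverseʳ 1#)))))
        (≤-reflexive (sym (trans (ev-one⁻ z 0#) (trans (cong (λ z → 1# - z) total) (-‿inverseʳ 1#)))))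
      where
      open Convex q∈
      z : Vec 𝔽 n
      z = V.tabulate weight
      q0 : ∀ r → q r + 0# * y r ≡ q r
      q0 r = trans (cong (_+_ (q r)) (zeroˡ (y r))) (+-identityʳ (q r))
      comb : ∀ r → sumL (λ i → V.lookup z i * P i r) fins ≡ q r
      comb r = trans (sum-cong fins (λ i → cong (_* P i r) (lookup∘tabulate weight i))) (weight-comb r)
      total : sumL (V.lookup z) fins ≡ 1#
      total = trans (sum-cong fins (λ i → lookup∘tabulate weight i)) weight-sum

    slope : Con (n ℕ.+ 1) → 𝔽
    slope (c , _) = V.lookup c (n F.↑ʳ F.zero)

    coeff : Con (n ℕ.+ 1) → Fin n → 𝔽
    coeff (c , _) i = V.lookup c (i F.↑ˡ 1)

    -- Farkas certificate: the constraint is a hyperplane a · x + e evaluated on the ray, plus slack.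
    Certified : Con (n ℕ.+ 1) → Set
    Certified c = ∃[ a ] ∃[ e ] (∀ i → a · P i + e ≤ coeff c i) × a · y ≡ - slope c × a · q + e ≡ - proj₂ c

    private
      coeff-form : ∀ f g b i → coeff (form f g b) i ≡ f i
      coeff-form f g b i = trans (VP.lookup-++ˡ (V.tabulate f) (g ∷ []) i) (lookup∘tabulate f i)
      slope-form : ∀ f g b → slope (form f g b) ≡ g
      slope-form f g b = VP.lookup-++ʳ (V.tabulate f) (g ∷ []) F.zero
      0· : ∀ x → (λ _ → 0#) · x ≡ 0#
      0· x = sum-zero (allFin d) (λ i → zeroˡ (x i))
      neg-· : ∀ a x → (λ i → - a i) · x ≡ - (a · x)
      neg-· a x = trans (sum-cong (allFin d) (λ i → sym (neg-distribˡ-* (a i) (x i)))) (sum-neg _ (allFin d))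

    certify : ∀ {c} → c ∈ constraints → Certified c
    certify = case-constraints Certified
      (λ i → (λ _ → 0#) , 0# , (λ j → ≤-trans (≤-reflexive (trans (cong (_+ 0#) (0· (P j))) (+-identityʳ 0#))) (subst (0# ≤_) (sym (coeff-form (unit i) 0# 0# j)) (unit≥0 i j)))
        , trans (0· y) (sym (trans (cong -_ (slope-form (unit i) 0# 0#)) -0≡0)) , trans (trans (+-identityʳ _) (0· q)) (sym -0≡0))
      (λ r → unit r , 0# , (λ j → ≤-reflexive (trans (+-identityʳ _) (trans (sum-unit r (P j)) (sym (coeff-form _ _ 0# j)))))
        , trans (sum-unit r y) (sym (trans (cong -_ (slope-form _ _ 0#)) (neg-involutive (y r)))) , trans (+-identityʳ _) (trans (sum-unit r q) (sym (neg-involutive (q r)))))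
      (λ r → (λ j → - unit r j) , 0# , (λ j → ≤-reflexive (trans (+-identityʳ _) (trans (neg-· (unit r) (P j)) (trans (cong -_ (sum-unit r (P j))) (sym (coeff-form _ _ 0# j))))))
        , trans (neg-· (unit r) y) (cong -_ (trans (sum-unit r y) (sym (slope-form _ _ 0#)))) , trans (+-identityʳ _) (trans (neg-· (unit r) q) (cong -_ (sum-unit r q))))
      ((λ _ → 0#) , 1# , (λ j → ≤-reflexive (trans (cong (_+ 1#) (0· (P j))) (trans (+-identityˡ 1#) (sym (coeff-form _ _ 0# j)))))
        , trans (0· y) (sym (trans (cong -_ (slope-form _ _ 0#)) -0≡0)) , trans (cong (_+ 1#) (0· q)) (trans (+-identityˡ 1#) (sym (neg-involutive 1#))))
      ((λ _ → 0#) , - 1# , (λ j → ≤-reflexive (trans (cong (_+ - 1#) (0· (P j))) (trans (+-identityˡ (- 1#)) (sym (coeff-form _ _ 0# j)))))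
        , trans (0· y) (sym (trans (cong -_ (slope-form _ _ 0#)) -0≡0)) , trans (cong (_+ - 1#) (0· q)) (+-identityˡ (- 1#)))

    certified-cone : ConvexCone Certified
    certified-cone = record
      { closed-⊕ = λ { {c , b} {c′ , b′} (a , e , h , hy , hq) (a′ , e′ , h′ , hy′ , hq′) → (λ i → a i + a′ i) , e + e′
          , (λ i → subst₂ _≤_ (trans (interchange (a · P i) e (a′ · P i) e′) (cong (_+ (e + e′)) (sym (·-+ a a′ (P i))))) (sym (lookup-zipWith _+_ (i F.↑ˡ 1) c c′)) (+-mono-≤ (h i) (h′ i)))
          , trans (·-+ a a′ y) (trans (cong₂ _+_ hy hy′) (trans (sym (neg-distrib-+ _ _)) (cong -_ (sym (lookup-zipWith _+_ (n F.↑ʳ F.zero) c c′)))))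
          , trans (cong (_+ (e + e′)) (·-+ a a′ q)) (trans (sym (interchange (a · q) e (a′ · q) e′)) (trans (cong₂ _+_ hq hq′) (sym (neg-distrib-+ b b′)))) }
      ; closed-⊙ = λ { {r} {c , b} lt (a , e , h , hy , hq) → (λ i → r * a i) , r * e
          , (λ i → subst₂ _≤_ (trans (distribˡ r (a · P i) e) (cong (_+ r * e) (sym (·-scale r a (P i))))) (sym (lookup-map (i F.↑ˡ 1) (r *_) c)) (*-monoˡ-≤ (<⇒≤ lt) (h i)))
          , trans (·-scale r a y) (trans (cong (r *_) hy) (trans (sym (neg-distribʳ-* r _)) (cong -_ (sym (lookup-map (n F.↑ʳ F.zero) (r *_) c)))))
          , trans (cong (_+ r * e) (·-scale r a q)) (trans (sym (distribˡ r (a · q) e)) (trans (cong (r *_) hq) (sym (neg-distribʳ-* r b)))) } }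
      where
      +-mono-≤ : ∀ {p q r s} → p ≤ q → r ≤ s → p + r ≤ q + s
      +-mono-≤ {p} {q} {r} {s} a b = ≤-trans (+-monoˡ-≤ r a) (subst₂ _≤_ (+-comm r q) (+-comm s q) (+-monoˡ-≤ q b))

    bounds : List (Con 1)
    bounds = eliminateAll n constraints

    private
      ev-zeros : ∀ m (c : Con 1) (z : Vec 𝔽 m) x → ev (zeros m c) (z V.++ x) ≡ ev c x
      ev-zeros zero c [] x = refl
      ev-zeros (suc m) c (t ∷ z) x = trans (ev-extend (zeros m c) t (z V.++ x)) (ev-zeros m c z x)
        where
        ev-extend : ∀ {k} (c : Con k) t x → ev (extend₀ c) (t ∷ x) ≡ ev c x
        ev-extend c t x = trans (cong (_+ ev c x) (zeroˡ t)) (+-identityˡ (ev c x))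

      zeros-coeff : ∀ m (c : Con 1) i → V.lookup (proj₁ (zeros m c)) (i F.↑ˡ 1) ≡ 0#
      zeros-coeff (suc m) c F.zero = refl
      zeros-coeff (suc m) c (F.suc i) = zeros-coeff m c i

      zeros-slope : ∀ m (c : Con 1) → V.lookup (proj₁ (zeros m c)) (m F.↑ʳ F.zero) ≡ head₀ c
      zeros-slope zero (_ ∷ [] , _) = refl
      zeros-slope (suc m) c = zeros-slope m c

      zeros-const : ∀ m (c : Con 1) → proj₂ (zeros m c) ≡ proj₂ c
      zeros-const zero c = refl
      zeros-const (suc m) c = zeros-const m c

      ev₁ : ∀ (c : Con 1) t → ev c (t ∷ []) ≡ head₀ c * t + proj₂ c
      ev₁ (_ ∷ [] , _) t = refl

    -- At time 0 the weights of `q` solve the whole system, hence also what is left after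
    -- elimination.
    const≥0 : ∀ {c} → c ∈ bounds → 0# ≤ proj₂ c
    const≥0 {c} m = subst (0# ≤_) (trans (ev-zeros n c _ (0# ∷ [])) (trans (ev₁ c 0#) (trans (cong (_+ proj₂ c) (zeroʳ (head₀ c))) (+-identityˡ (proj₂ c)))))
      (eliminateAll-sound n {Q = λ c → 0# ≤ ev c (V.tabulate (Convex.weight q∈) V.++ 0# ∷ [])} record
        { closed-⊕ = λ {p} {p′} a b → subst (0# ≤_) (sym (ev-⊕ p p′ _)) (+-0≤ a b) ; closed-⊙ = λ {r} {p} lt a → subst (0# ≤_) (sym (ev-⊙ r p _)) (*-0≤ (<⇒≤ lt) a) } constraints q-solution m)

    feasible : ∀ t → 0# ≤ t → (∀ {c} → c ∈ bounds → head₀ c < 0# → 0# ≤ head₀ c * t + proj₂ c) → Convex (λ i → q i + t * y i)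
    feasible t t≥0 h with eliminateAll-complete n constraints (t ∷ []) sat
      where
      sat : Sat bounds (t ∷ [])
      sat {c} m with head₀ c <? 0#
      ... | yes lt = subst (0# ≤_) (sym (ev₁ c t)) (h m lt)
      ... | no nl = subst (0# ≤_) (sym (ev₁ c t)) (+-0≤ (*-0≤ (≮⇒≥ nl) t≥0) (const≥0 m))
    ... | z , sat = sat⇒convex z t sat

    limit : Con 1 → 𝔽
    limit c with head₀ c ≟ᶠ 0#
    ... | yes _ = 0#
    ... | no ne = - proj₂ c * proj₁ (1/′ ne)

    limit-spec : ∀ c → head₀ c ≢ 0# → head₀ c * limit c + proj₂ c ≡ 0#
    limit-spec c ne with head₀ c ≟ᶠ 0#
    ... | yes z = contradiction z ne
    ... | no ne′ = trans (cong (_+ proj₂ c) (trans (cong (head₀ c *_) (*-comm (- proj₂ c) _)) (trans (sym (*-assoc _ _ _)) (trans (cong (_* - proj₂ c) (proj₂ (1/′ ne′))) (*-identityˡ _))))) (-‿inverseˡ (proj₂ c))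

    decreasing : ∀ h {s t} → h < 0# → s ≤ t → h * t ≤ h * s
    decreasing h {s} {t} neg le = 0≤-⇒≤ (subst (0# ≤_) eq (*-0≤ (<⇒≤ (neg-0< neg)) (≤⇒0≤- le)))
      where
      eq : - h * (t - s) ≡ h * s - h * t
      eq = trans (sym (neg-distribˡ-* h (t - s))) (trans (cong -_ (*-distribˡ-- h s t)) (trans (neg-distrib-+ _ _) (trans (cong (_+_ (- (h * t))) (neg-involutive _)) (+-comm _ _))))

    limit≥0 : ∀ {c} → c ∈ bounds → head₀ c < 0# → 0# ≤ limit c
    limit≥0 {c} m lt = ≮⇒≥ (λ l → <-irrefl (sym (limit-spec c (λ z → <-irrefl z lt))) (+-0< (subst (0# <_) (neg*neg) (*-0< (neg-0< lt) (neg-0< l))) (const≥0 m)))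
      where
      neg*neg : - head₀ c * - limit c ≡ head₀ c * limit c
      neg*neg = trans (sym (neg-distribˡ-* (head₀ c) (- limit c))) (trans (cong -_ (sym (neg-distribʳ-* (head₀ c) (limit c)))) (neg-involutive _))

    -- Without an upper bound all times would be feasible. But `y · (q + t y)` grows with slope
    -- `y · y > 0`, while `y ·` is bounded on the polytope.
    unbounded-absurd : (∀ {c} → c ∈ bounds → ¬ (head₀ c < 0#)) → ⊥
    unbounded-absurd none with upper fins
      where
      upper : ∀ is → ∃[ M ] (∀ {i} → i ∈ is → y · P i ≤ M)
      upper [] = 0# , λ ()
      upper (i ∷ is) with upper is
      ... | M , h with M ≤? (y · P i)
      ... | yes le = y · P i , λ { (here refl) → ≤-refl ; (there m) → ≤-trans (h m) le }
      ... | no nle = M , λ { (here refl) → <⇒≤ (≰⇒> nle) ; (there m) → h m }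
    ... | M , h with 1/⁺ y·y>0 | above (M - y · q)
      where
      y·y>0 : 0# < y · y
      y·y>0 = sum-0< (allFin d) (∈-allFin (proj₁ y≢0)) (λ {i} _ → square≥0 (y i)) (square>0 (proj₂ y≢0))
        where
        square≥0 : ∀ p → 0# ≤ p * p
        square≥0 p with p ≟ᶠ 0#
        ... | yes refl = ≤-reflexive (sym (zeroˡ 0#))
        ... | no ne = <⇒≤ (square>0 ne)
    ... | r , r>0 , e | Z , lt , Z>0 = ≤⇒≯ (convex-≤ (feasible (Z * r) (<⇒≤ (*-0< Z>0 r>0)) (λ m l → contradiction l (none m))) y M (λ i → h (∈-allFin i)))
        (0<-⇒< (subst (0# <_) eq (<⇒0<- lt)))
      where
      eq : Z - (M - y · q) ≡ y · (λ i → q i + Z * r * y i) - M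
      eq = trans (cong (_+_ Z) (trans (neg-distrib-+ M (- (y · q))) (cong (_+_ (- M)) (neg-involutive (y · q)))))
        (trans (sym (+-assoc Z (- M) (y · q))) (trans (trans (cong (_+ (y · q)) (+-comm Z (- M))) (+-assoc (- M) Z (y · q))) (trans (+-comm (- M) (Z + y · q)) (cong (_- M) (sym
          (trans (·-ε y q y (Z * r)) (trans (+-comm (y · q) _) (cong (_+ (y · q)) (trans (*-assoc Z r (y · y)) (trans (cong (Z *_) (trans (*-comm r (y · y)) e)) (*-identityʳ Z)))))))))))

    -- The tightest upper bound gives the exit time. No weights are left in it, so its certificate
    -- is an affine function that is at most zero at every generator and zero at the exit point.
    ray-exit : Exit q y
    ray-exit = choose (filter (λ c → head₀ c <? 0#) bounds) id id
      where
      choose : ∀ cs → cs ⊑ filter (λ c → head₀ c <? 0#) bounds → filter (λ c → head₀ c <? 0#) bounds ⊑ cs → Exit q y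
      choose [] _ sub = ⊥-elim (unbounded-absurd (λ m lt → case sub (∈-filter⁺ (λ c → head₀ c <? 0#) m lt) of λ ()))
      choose (c ∷ cs) inc sub with argmax (λ c → - limit c) c cs
      ... | c* , m , min with ∈-filter⁻ (λ c → head₀ c <? 0#) {xs = bounds} (inc m)
      ... | c*∈ , neg with eliminateAll-sound n certified-cone constraints certify c*∈
      ... | a , e , h , hy , hq = record
        { time = limit c* ; time≥0 = limit≥0 c*∈ neg
        ; exit = feasible (limit c*) (limit≥0 c*∈ neg) (λ {c} m lt → ≤-trans (≤-reflexive (sym (limit-spec c (λ z → <-irrefl z lt))))
            (+-monoˡ-≤ (proj₂ c) (decreasing (head₀ c) lt (0≤-⇒≤ (subst (0# ≤_) (trans (+-comm _ _) (cong (_+ - limit c*) (neg-involutive _))) (≤⇒0≤- (min (sub (∈-filter⁺ (λ c → head₀ c <? 0#) m lt)))))))))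
        ; normal = a
        ; normal-y = subst (0# <_) (sym (trans hy (cong -_ (zeros-slope n c*)))) (neg-0< neg)
        ; supporting = λ i → 0≤-⇒≤ (subst (0# ≤_) (shift i) (≤⇒0≤- (h i))) }
        where
        value : a · (λ i → q i + limit c* * y i) + e ≡ 0#
        value = trans (cong (_+ e) (·-ε a q y (limit c*))) (trans (+-assoc _ _ _) (trans (cong (_+_ (a · q)) (+-comm _ e)) (trans (sym (+-assoc _ _ _))
          (trans (cong₂ _+_ (trans hq (cong -_ (zeros-const n c*))) (trans (cong (limit c* *_) (trans hy (cong -_ (zeros-slope n c*)))) (trans (sym (neg-distribʳ-* (limit c*) (head₀ c*))) (cong -_ (*-comm _ _)))))
            (trans (sym (neg-distrib-+ (proj₂ c*) (head₀ c* * limit c*))) (trans (cong -_ (trans (+-comm _ _) (limit-spec c* (λ z → <-irrefl z neg)))) -0≡0))))))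
        shift : ∀ i → coeff (zeros n c*) i - (a · P i + e) ≡ a · (λ i → q i + limit c* * y i) - a · P i
        shift i = trans (cong₂ _-_ (trans (zeros-coeff n c* i) (sym value)) refl) (trans (cong (_+_ (a · x + e)) (trans (neg-distrib-+ (a · P i) e) (+-comm _ _)))
          (trans (sym (+-assoc (a · x + e) (- e) (- (a · P i)))) (cong (_- a · P i) (trans (+-assoc (a · x) e (- e)) (trans (cong (_+_ (a · x)) (-‿inverseʳ e)) (+-identityʳ _))))))
          where
          x : Vector
          x i = q i + limit c* * y i

-- The fan and the support function of a triangulated boundary

-- A triangulation K of the boundary of conv P, seen from the interior point q.
record Triangulated (O : OrderedField) (d n : ℕ) (P : Fin n → Vectors.Vector O d) {V : Set} (vs : List V) (K : List (List V))
                    (pt : V → Vectors.Vector O d) (q : Vectors.Vector O d) : Set where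
  open FieldProperties O using (𝔽; _≤_; _*_; 0#; 1#; sumL)
  open Vectors O d
  open Combinations pt
  open RayExit O d n P using (Convex)

  Boundary : Vector → Set
  Boundary x = Convex x × ∃[ a ] (∃[ j ] a j ≢ 0#) × (∀ i → a · P i ≤ a · x)

  InSimplex : List V → Vector → Set
  InSimplex σ x = ∃[ μ ] (∀ {v} → v ∈ σ → 0# ≤ μ v) × sumL μ σ ≡ 1# × (∀ j → comb μ σ j ≡ x j)

  field
    K-unique : Unique K
    cone-unique : ∀ {σ} → σ ∈ K → Unique σ
    cone-vs : ∀ {σ} → σ ∈ K → σ ⊑ vs
    cone-ext : ∀ {σ τ} → σ ∈ K → τ ∈ K → σ ⊑ τ → τ ⊑ σ → σ ≡ τ
    q-convex : Convex q
    q-interior : ¬ Boundary q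
    affine-independent : ∀ {σ} → σ ∈ K → ∀ c → sumL c σ ≡ 0# → (∀ j → comb c σ j ≡ 0#) → ∀ {v} → v ∈ σ → c v ≡ 0#
    in-boundary : ∀ {σ x} → σ ∈ K → InSimplex σ x → Boundary x
    covers : ∀ {x} → Boundary x → ∃[ σ ] σ ∈ K × InSimplex σ x
    meets : ∀ {σ τ x} → σ ∈ K → τ ∈ K → InSimplex σ x → InSimplex τ x → ∃[ F ] Unique F × F ⊑ σ × F ⊑ τ × InSimplex F x

record PolytopeData : Set₁ where
  constructor polytope-data
  field
    O : OrderedField
    d n : ℕ
    P : Fin n → Vectors.Vector O d
    V : Set
    _≟_ : DecidableEquality V
    vs : List V
    K : List (List V)
    pt : V → Vectors.Vector O d
    q : Vectors.Vector O d
    tri : Triangulated O d n P vs K pt q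
    j₀ : Fin d

module PolytopeFan (𝒫 : PolytopeData) where
  open PolytopeData 𝒫
  open Triangulated tri
  open ≡
  open FieldProperties O
  open Vectors O d
  open RayExit O d n P
  open DecMembership _≟_ using (_∈?_)

  pos : V → Vector
  pos v j = pt v j - q j

  private
    module Pt = Combinations pt

  open Combinations pos

  comb-pos : ∀ μ σ j → comb μ σ j ≡ Pt.comb μ σ j - sumL μ σ * q j
  comb-pos μ σ j = trans (sum-cong σ (λ v → *-distribˡ-- (μ v) (q j) (pt v j))) (trans (sum-- _ _ σ) (cong (λ z → Pt.comb μ σ j - z) (sym (sum-*ʳ μ (q j) σ))))

  -- q + y / s lies on the boundary, so some normal a separates it from q.
  record Gauge (y : Vector) (s : 𝔽) : Set where
    field
      r : 𝔽
      r>0 : 0# < r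
      s*r : s * r ≡ 1#
      boundary : Boundary (λ j → q j + r * y j)
    normal : Vector
    normal = proj₁ (proj₂ boundary)
    supporting : ∀ i → normal · P i ≤ normal · (λ j → q j + r * y j)
    supporting = proj₂ (proj₂ (proj₂ boundary))
    -- If `normal · y ≤ 0`, the same normal would support the polytope at `q`, against `q-interior`.
    normal-y : 0# < normal · y
    normal-y = ≰⇒> (λ le → q-interior (q-convex , normal , proj₁ (proj₂ (proj₂ boundary)) , λ i → ≤-trans (supporting i) (0≤-⇒≤ (subst (0# ≤_) (eq le) (*-0≤ (<⇒≤ r>0) (subst (0# ≤_) (+-identityˡ _) (≤⇒0≤- le)))))))
      where
      eq : normal · y ≤ 0# → r * - (normal · y) ≡ normal · q - normal · (λ j → q j + r * y j)
      eq _ = sym (trans (cong (λ z → normal · q - z) (·-ε normal q y r)) (trans (cong (_+_ (normal · q)) (neg-distrib-+ _ _)) (trans (sym (+-assoc _ _ _))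
        (trans (cong (_+ - (r * (normal · y))) (-‿inverseʳ _)) (trans (+-identityˡ _) (neg-distribʳ-* r (normal · y)))))))

  in-simplex-scaled : ∀ {σ} μ {y : Vector} {s r : 𝔽} → (∀ {v} → v ∈ σ → 0# ≤ μ v) → (∀ j → y j ≡ comb μ σ j) → sumL μ σ ≡ s → 0# ≤ r → s * r ≡ 1# → InSimplex σ (λ j → q j + r * y j)
  in-simplex-scaled {σ} μ {y} {s} {r} μ≥0 e es r≥0 sr = (λ v → r * μ v) , (λ m → *-0≤ r≥0 (μ≥0 m)) , total , coords
    where
    total : sumL (λ v → r * μ v) σ ≡ 1#
    total = trans (sym (sum-*ˡ r μ σ)) (trans (cong (r *_) es) (trans (*-comm r s) sr))
    coords : ∀ j → Pt.comb (λ v → r * μ v) σ j ≡ q j + r * y j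
    coords j = trans (sum-cong σ (λ v → *-assoc r (μ v) (pt v j))) (trans (sym (sum-*ˡ r _ σ)) (sym (trans (cong (λ z → q j + r * z) (trans (e j) (comb-pos μ σ j)))
      (trans (cong (_+_ (q j)) (*-distribˡ-- r (sumL μ σ * q j) (Pt.comb μ σ j))) (trans (cong (λ z → q j + (r * Pt.comb μ σ j - z)) (trans (sym (*-assoc r _ _)) (trans (cong (_* q j) (trans (cong (r *_) es) (trans (*-comm r s) sr))) (*-identityˡ (q j)))))
        (trans (+-comm _ _) (cancel-+ (q j) _)))))))

  gauge : ∀ {σ} → σ ∈ K → ∀ μ {y : Vector} {s : 𝔽} → (∀ {v} → v ∈ σ → 0# ≤ μ v) → (∀ j → y j ≡ comb μ σ j) → sumL μ σ ≡ s → 0# < s → Gauge y s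
  gauge m μ μ≥0 e es s>0 with 1/⁺ s>0
  ... | r , r>0 , sr = record { r = r ; r>0 = r>0 ; s*r = sr ; boundary = in-boundary m (in-simplex-scaled μ μ≥0 e es (<⇒≤ r>0) sr) }

  -- The ray meets the boundary only once.
  gauge-≤ : ∀ {y s s′} → Gauge y s → Gauge y s′ → s ≤ s′
  gauge-≤ {y} {s} {s′} g g′ = ≮⇒≥ λ lt → ≤⇒≯ r′≤r (r-anti lt)
    where
    open Gauge g
    module G′ = Gauge g′
    le : normal · (λ j → q j + G′.r * y j) ≤ normal · (λ j → q j + r * y j)
    le = convex-≤ (proj₁ G′.boundary) normal _ supporting
    r′≤r : G′.r ≤ r
    r′≤r = ≮⇒≥ λ lt → ≤⇒≯ le (0<-⇒< (subst (0# <_) eq (*-0< (<⇒0<- lt) normal-y)))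
      where
      eq : (G′.r - r) * (normal · y) ≡ normal · (λ j → q j + G′.r * y j) - normal · (λ j → q j + r * y j)
      eq = sym (trans (cong₂ _-_ (·-ε normal q y G′.r) (·-ε normal q y r)) (trans (cong (_+_ (normal · q + G′.r * (normal · y))) (neg-distrib-+ _ _))
        (trans (interchange _ _ _ _) (trans (cong (_+ (G′.r * (normal · y) - r * (normal · y))) (-‿inverseʳ _)) (trans (+-identityˡ _)
          (trans (cong (_+_ (G′.r * (normal · y))) (neg-distribˡ-* r _)) (sym (distribʳ _ _ _))))))))
    r-anti : s′ < s → r < G′.r
    r-anti lt = 0<-⇒< (subst (0# <_) eq (*-0< (*-0< r>0 G′.r>0) (<⇒0<- lt)))
      where
      eq : r * G′.r * (s - s′) ≡ G′.r - r
      eq = trans (*-distribˡ-- (r * G′.r) s′ s) (cong₂ _-_ (trans (cong (_* s) (*-comm r G′.r)) (trans (*-assoc G′.r r s) (trans (cong (G′.r *_) (trans (*-comm r s) s*r)) (*-identityʳ _))))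
        (trans (*-assoc r G′.r s′) (trans (cong (r *_) (trans (*-comm G′.r s′) G′.s*r)) (*-identityʳ _))))

  gauge-zero : ∀ {y s} → Gauge y s → ¬ (∀ j → y j ≡ 0#)
  gauge-zero {y} g z = <-irrefl (sym (trans (·-cong normal z) (sum-zero (allFin d) (λ i → zeroʳ (normal i))))) normal-y
    where open Gauge g

  sum-zero⇒comb-zero : ∀ {σ} μ → (∀ {v} → v ∈ σ → 0# ≤ μ v) → sumL μ σ ≡ 0# → ∀ j → comb μ σ j ≡ 0#
  sum-zero⇒comb-zero {σ} μ μ≥0 z j = sum-zero-∈ σ (λ m → trans (cong (_* pos _ j) (sum-≡0 σ μ≥0 z m)) (zeroˡ _))

  Rep : List V → (V → 𝔽) → Vector → Set
  Rep σ μ y = σ ∈ K × (∀ {v} → v ∈ σ → 0# ≤ μ v) × (∀ j → y j ≡ comb μ σ j)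

  private
    sign : ∀ {σ μ y} → Rep σ μ y → (sumL μ σ ≡ 0# × ∀ j → y j ≡ 0#) ⊎ (0# < sumL μ σ × Gauge y (sumL μ σ))
    sign {σ} {μ} (m , μ≥0 , e) with ≤-cases (sum-0≤ σ μ≥0)
    ... | inj₁ lt = inj₂ (lt , gauge m μ μ≥0 e refl lt)
    ... | inj₂ z = inj₁ (sym z , λ j → trans (e j) (sum-zero⇒comb-zero μ μ≥0 (sym z) j))

  -- The coefficient sum is the gauge of `y` for the polytope seen from `q`, a quantity that does
  -- not depend on the cone.
  total-unique : ∀ {σ τ μ ν y} → Rep σ μ y → Rep τ ν y → sumL μ σ ≡ sumL ν τ
  total-unique r r′ with sign r | sign r′
  ... | inj₁ (a , _) | inj₁ (b , _) = trans a (sym b)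
  ... | inj₁ (_ , z) | inj₂ (_ , g) = contradiction z (gauge-zero g)
  ... | inj₂ (_ , g) | inj₁ (_ , z) = contradiction z (gauge-zero g)
  ... | inj₂ (_ , g) | inj₂ (_ , g′) = ≤-antisym (gauge-≤ g g′) (gauge-≤ g′ g)

  -- The barycentric coordinates in σ are those in a face F of σ, extended by zero.
  restrict-to : ∀ {σ F} {x : Vector} μ η → σ ∈ K → Unique F → F ⊑ σ → sumL μ σ ≡ sumL η F → (∀ j → Pt.comb μ σ j ≡ x j) → (∀ j → Pt.comb η F j ≡ x j) →
    ∀ {v} → v ∈ σ → (v ∈ F × μ v ≡ η v) ⊎ (v ∉ F × μ v ≡ 0#)
  restrict-to {σ} {F} {x} μ η m uF F⊑ tot eμ eη {v} v∈ with v ∈? F | -≡0⇒≡ (affine-independent m (λ v → μ v - η̃ v) tot0 comb0 v∈)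
    where
    η̃ : V → 𝔽
    η̃ v with v ∈? F
    ... | yes _ = η v
    ... | no _ = 0#
    η̃-∈ : ∀ {v} → v ∈ F → η̃ v ≡ η v
    η̃-∈ {v} k with v ∈? F
    ... | yes _ = refl
    ... | no v∉ = contradiction k v∉
    η̃-∉ : ∀ {v} → v ∉ F → η̃ v ≡ 0#
    η̃-∉ {v} k with v ∈? F
    ... | yes v∈ = contradiction v∈ k
    ... | no _ = refl
    extended : ∀ (f : V → 𝔽) → sumL (λ v → η̃ v * f v) σ ≡ sumL (λ v → η v * f v) F
    extended f with unique-extend F uF F⊑
    ... | rest , p = trans (sum-↭ _ (↭-sym p)) (trans (sum-++ _ F rest) (trans (cong₂ _+_ (sum-cong-∈ F (λ k → cong (_* f _) (η̃-∈ k))) (sum-zero-∈ rest (λ k → trans (cong (_* f _) (η̃-∉ (λ k′ → disjoint F (unique-resp-↭ (↭-sym p) (cone-unique m)) k′ k))) (zeroˡ _)))) (+-identityʳ _)))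
      where
      disjoint : ∀ as {bs v} → Unique (as ++ bs) → v ∈ as → v ∉ bs
      disjoint (a ∷ as) (a∉ ∷ u) (here refl) k = All.lookup a∉ (∈-++⁺ʳ as k) refl
      disjoint (a ∷ as) (a∉ ∷ u) (there k′) k = disjoint as u k′ k
    tot0 : sumL (λ v → μ v - η̃ v) σ ≡ 0#
    tot0 = trans (sum-- μ η̃ σ) (trans (cong₂ _-_ tot (trans (sum-cong σ (λ v → sym (*-identityʳ (η̃ v)))) (trans (extended (λ _ → 1#)) (sum-cong F (λ v → *-identityʳ (η v)))))) (-‿inverseʳ _))
    comb0 : ∀ j → Pt.comb (λ v → μ v - η̃ v) σ j ≡ 0#
    comb0 j = trans (sum-cong σ (λ v → trans (distribʳ (pt v j) (μ v) (- η̃ v)) (cong (_+_ (μ v * pt v j)) (sym (neg-distribˡ-* (η̃ v) (pt v j)))))) (trans (sum-- _ _ σ)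
      (trans (cong₂ _-_ (eμ j) (trans (extended (λ v → pt v j)) (eη j))) (-‿inverseʳ _)))
  ... | yes k | e = inj₁ (k , e)
  ... | no k | e = inj₂ (k , e)

  -- Both representations have the same coefficient sum. If it is zero, all coefficients vanish;
  -- otherwise division by it yields one boundary point in two simplices, and both sets of
  -- barycentric coordinates restrict to the common face given by `meets`.
  proper : ∀ {σ τ} → σ ∈ K → τ ∈ K → ∀ μ ν → (∀ {v} → v ∈ σ → 0# ≤ μ v) → (∀ {v} → v ∈ τ → 0# ≤ ν v) →
    (∀ i → comb μ σ i ≡ comb ν τ i) → ∀ {v} → v ∈ σ → (v ∈ τ × μ v ≡ ν v) ⊎ (v ∉ τ × μ v ≡ 0#)
  proper {σ} {τ} mσ mτ μ ν μ≥0 ν≥0 e {v} v∈ with ≤-cases (sum-0≤ σ μ≥0)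
  ... | inj₂ z = decide (v ∈? τ)
    where
    μ0 : μ v ≡ 0#
    μ0 = sum-≡0 σ μ≥0 (sym z) v∈
    decide : Dec (v ∈ τ) → (v ∈ τ × μ v ≡ ν v) ⊎ (v ∉ τ × μ v ≡ 0#)
    decide (no k) = inj₂ (k , μ0)
    decide (yes k) = inj₁ (k , trans μ0 (sym (sum-≡0 τ ν≥0 (trans (sym (total-unique {y = comb μ σ} (mσ , μ≥0 , λ _ → refl) (mτ , ν≥0 , e))) (sym z)) k)))
  ... | inj₁ s>0 with 1/⁺ s>0
  ... | r , r>0 , sr = from-face (meets mσ mτ (in-simplex-scaled μ {y = comb μ σ} μ≥0 (λ _ → refl) refl (<⇒≤ r>0) sr) (in-simplex-scaled ν {y = comb μ σ} ν≥0 e tot (<⇒≤ r>0) sr))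
    where
    tot : sumL ν τ ≡ sumL μ σ
    tot = sym (total-unique {y = comb μ σ} (mσ , μ≥0 , λ _ → refl) (mτ , ν≥0 , e))
    scale-cancel : ∀ {a b} → r * a ≡ r * b → a ≡ b
    scale-cancel {a} {b} h = trans (sym (undo a)) (trans (cong (sumL μ σ *_) h) (undo b))
      where
      undo : ∀ a → sumL μ σ * (r * a) ≡ a
      undo a = trans (sym (*-assoc _ r a)) (trans (cong (_* a) sr) (*-identityˡ a))
    from-face : ∃[ F ] Unique F × F ⊑ σ × F ⊑ τ × InSimplex F (λ j → q j + r * comb μ σ j) → (v ∈ τ × μ v ≡ ν v) ⊎ (v ∉ τ × μ v ≡ 0#)
    from-face (F , uF , F⊑σ , F⊑τ , η , η≥0 , η1 , eη) = finish (v ∈? τ) (inσ v∈)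
      where
      Sσ : InSimplex σ (λ j → q j + r * comb μ σ j)
      Sσ = in-simplex-scaled μ {y = comb μ σ} μ≥0 (λ _ → refl) refl (<⇒≤ r>0) sr
      Sτ : InSimplex τ (λ j → q j + r * comb μ σ j)
      Sτ = in-simplex-scaled ν {y = comb μ σ} ν≥0 e tot (<⇒≤ r>0) sr
      inσ : ∀ {v} → v ∈ σ → (v ∈ F × r * μ v ≡ η v) ⊎ (v ∉ F × r * μ v ≡ 0#)
      inσ = restrict-to (λ v → r * μ v) η mσ uF F⊑σ (trans (proj₁ (proj₂ (proj₂ Sσ))) (sym η1)) (proj₂ (proj₂ (proj₂ Sσ))) eη
      inτ : ∀ {v} → v ∈ τ → (v ∈ F × r * ν v ≡ η v) ⊎ (v ∉ F × r * ν v ≡ 0#)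
      inτ = restrict-to (λ v → r * ν v) η mτ uF F⊑τ (trans (proj₁ (proj₂ (proj₂ Sτ))) (sym η1)) (proj₂ (proj₂ (proj₂ Sτ))) eη
      same : v ∈ τ → (v ∈ F × r * μ v ≡ η v) ⊎ (v ∉ F × r * μ v ≡ 0#) → (v ∈ F × r * ν v ≡ η v) ⊎ (v ∉ F × r * ν v ≡ 0#) → μ v ≡ ν v
      same k (inj₁ (_ , a)) (inj₁ (_ , b)) = scale-cancel (trans a (sym b))
      same k (inj₂ (_ , a)) (inj₂ (_ , b)) = scale-cancel (trans a (sym b))
      same k (inj₁ (f , _)) (inj₂ (nf , _)) = contradiction f nf
      same k (inj₂ (nf , _)) (inj₁ (f , _)) = contradiction f nf
      finish : Dec (v ∈ τ) → (v ∈ F × r * μ v ≡ η v) ⊎ (v ∉ F × r * μ v ≡ 0#) → (v ∈ τ × μ v ≡ ν v) ⊎ (v ∉ τ × μ v ≡ 0#)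
      finish (no k) (inj₁ (k′ , _)) = contradiction (F⊑τ k′) k
      finish (no k) (inj₂ (_ , z)) = inj₂ (k , scale-cancel (trans z (sym (zeroʳ r))))
      finish (yes k) c = inj₁ (k , same k c (inτ k))

  Covered : Vector → Set
  Covered y = ∃[ σ ] σ ∈ K × ∃[ μ ] (∀ {v} → v ∈ σ → 0# ≤ μ v) × (∀ i → y i ≡ comb μ σ i)

  -- The ray from `q` along `y` leaves the polytope at a boundary point, and the simplex containing
  -- this point gives the cone.
  complete : ∀ (y : Vector) → Covered y
  complete y = decide (FP.any? (λ j → Dec.¬? (y j ≟ᶠ 0#)))
    where
    nonzero : ∀ (y : Vector) → (∃[ j ] y j ≢ 0#) → Covered y
    nonzero y nz = use (ray-exit q y q-convex nz)
      where
      use : Exit q y → Covered y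
      use ex = scaled (1/⁺ (≤∧≢⇒< time≥0 time≢0)) (covers bd)
        where
        open Exit ex
        normal-nz : ∃[ j ] normal j ≢ 0#
        normal-nz with FP.any? (λ j → Dec.¬? (normal j ≟ᶠ 0#))
        ... | yes w = w
        ... | no none = contradiction normal-y (<-irrefl (sym (sum-zero (allFin d) (λ i → trans (cong (_* y i) (zero-at i)) (zeroˡ (y i))))))
          where
          zero-at : ∀ i → normal i ≡ 0#
          zero-at i with normal i ≟ᶠ 0#
          ... | yes z = z
          ... | no ne = contradiction (i , ne) none
        bd : Boundary (λ i → q i + time * y i)
        bd = exit , normal , normal-nz , supporting
        time≢0 : 0# ≢ time
        time≢0 z = q-interior (q-convex , normal , normal-nz , λ i → subst (normal · P i ≤_) (·-cong normal (λ j → trans (cong (λ t → q j + t * y j) (sym z)) (trans (cong (_+_ (q j)) (zeroˡ (y j))) (+-identityʳ (q j))))) (supporting i))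
        scaled : ∃[ r ] 0# < r × time * r ≡ 1# → ∃[ σ ] σ ∈ K × InSimplex σ (λ i → q i + time * y i) → Covered y
        scaled (r , r>0 , tr) (σ , m , μ , μ≥0 , μ1 , e) = σ , m , (λ v → r * μ v) , (λ k → *-0≤ (<⇒≤ r>0) (μ≥0 k)) , λ i → sym (coords i)
          where
          coords : ∀ i → comb (λ v → r * μ v) σ i ≡ y i
          coords i = trans (sum-cong σ (λ v → *-assoc r (μ v) (pos v i))) (trans (sym (sum-*ˡ r _ σ)) (trans (cong (r *_) (trans (comb-pos μ σ i) (cong₂ _-_ (e i) (trans (cong (_* q i) μ1) (*-identityˡ (q i))))))
            (trans (cong (r *_) (trans (cong (_- q i) (+-comm (q i) _)) (trans (+-assoc _ _ _) (trans (cong (_+_ (time * y i)) (-‿inverseʳ (q i))) (+-identityʳ _)))))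
              (trans (sym (*-assoc r time (y i))) (trans (cong (_* y i) (trans (*-comm r time) tr)) (*-identityˡ (y i)))))))
    decide : Dec (∃[ j ] ¬ (y j ≡ 0#)) → Covered y
    decide (yes nz) = nonzero y nz
    -- Any cone contains the zero vector, and covering (1, ..., 1), which is non-zero because of the
    -- coordinate `j₀`, supplies one.
    decide (no none) = trivial (nonzero (λ _ → 1#) (j₀ , 0<⇒≢0 0<1))
      where
      trivial : Covered (λ _ → 1#) → Covered y
      trivial (σ , m , _) = σ , m , (λ _ → 0#) , (λ _ → ≤-refl) , λ i → trans (zero-at i) (sym (sum-zero σ (λ v → zeroˡ (pos v i))))
        where
        zero-at : ∀ i → y i ≡ 0#
        zero-at i with y i ≟ᶠ 0#
        ... | yes z = z
        ... | no ne = contradiction (i , ne) none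

  fan : Fan O d vs K pos
  fan = record { K-unique = K-unique ; cone-unique = cone-unique ; cone-vs = cone-vs ; cone-ext = cone-ext ; complete = complete ; proper = proper }

  indicator : V → V → 𝔽
  indicator v u with v ≟ u
  ... | yes _ = 1#
  ... | no _ = 0#

  indicator≥0 : ∀ v u → 0# ≤ indicator v u
  indicator≥0 v u with v ≟ u
  ... | yes _ = <⇒≤ 0<1
  ... | no _ = ≤-refl

  indicator-≡ : ∀ v → indicator v v ≡ 1#
  indicator-≡ v with v ≟ v
  ... | yes _ = refl
  ... | no ne = contradiction refl ne

  sum-indicator : ∀ {σ v} → Unique σ → v ∈ σ → ∀ (f : V → 𝔽) → sumL (λ u → indicator v u * f u) σ ≡ f v
  sum-indicator {σ} {v} u m f = trans (sum-single {f = λ u → indicator v u * f u} u m (λ {w} _ ne → trans (cong (_* f w) (off w ne)) (zeroˡ (f w)))) (trans (cong (_* f v) (indicator-≡ v)) (*-identityˡ (f v)))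
    where
    off : ∀ w → w ≢ v → indicator v w ≡ 0#
    off w ne with v ≟ w
    ... | yes e = contradiction (sym e) ne
    ... | no _ = refl

  vertex-boundary : ∀ {σ v} → σ ∈ K → v ∈ σ → Boundary (pt v)
  vertex-boundary {σ} {v} m v∈ = in-boundary m (indicator v , (λ {u} _ → indicator≥0 v u)
    , trans (sum-cong σ (λ u → sym (*-identityʳ _))) (sum-indicator (cone-unique m) v∈ (λ _ → 1#)) , λ j → sum-indicator (cone-unique m) v∈ (λ u → pt u j))

module PolytopeSupport (𝒫 : PolytopeData) where
  open PolytopeData 𝒫
  open Triangulated tri
  open ≡
  open FieldProperties O
  open Vectors O d
  open RayExit O d n P
  open PolytopeFan 𝒫 public
  open Combinations pos
  private
    module Pt = Combinations pt

  -- x ∈ M · conv P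
  Dilated : 𝔽 → Vector → Set
  Dilated M x = ∃[ w ] (∀ i → 0# ≤ w i) × sumL w fins ≡ 1# × (∀ j → M * sumL (λ i → w i * P i j) fins ≡ x j)

  from : 𝔽 → Vector → Vector
  from M x j = x j - M * q j

  -- If the coefficient sum s exceeded `M`, the normal supporting the polytope at
  -- `q + (x - M q) / s` would take at `x` a value above `M` times its maximum on the polytope.
  dilated⇒≤ : ∀ {M x σ μ} → 0# ≤ M → Rep σ μ (from M x) → Dilated M x → sumL μ σ ≤ M
  dilated⇒≤ {M} {x} {σ} {μ} M≥0 (m , μ≥0 , e) (w , w≥0 , w1 , ew) = ≮⇒≥ absurd
    where
    absurd : ¬ (M < sumL μ σ)
    absurd lt = ≤⇒≯ a·x≤ (0<-⇒< (subst (0# <_) eq (*-0< (*-0< (<⇒0<- lt) r>0) normal-y)))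
      where
      s : 𝔽
      s = sumL μ σ
      open Gauge (gauge m μ μ≥0 e refl (≤-<-trans M≥0 lt))
      z : Vector
      z j = sumL (λ i → w i * P i j) fins
      zc : Convex z
      zc = record { weight = w ; weight≥0 = w≥0 ; weight-sum = w1 ; weight-comb = λ _ → refl }
      p : Vector
      p j = q j + r * from M x j
      a·x : normal · x ≡ M * (normal · z)
      a·x = trans (·-cong normal (λ j → sym (ew j))) (trans (sum-cong (allFin d) (λ j → trans (sym (*-assoc _ M _)) (trans (cong (_* z j) (*-comm _ M)) (*-assoc M _ _)))) (sym (sum-*ˡ M _ (allFin d))))
      a·x≤ : normal · x ≤ M * (normal · p)
      a·x≤ = subst (_≤ M * (normal · p)) (sym a·x) (*-monoˡ-≤ M≥0 (convex-≤ zc normal _ supporting))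
      -- (s - M) r (a · y) = a · x - M (a · p) because a · x = M (a · q) + a · y and s r = 1
      eq : (s - M) * r * (normal · from M x) ≡ normal · x - M * (normal · p)
      eq = begin
        (s - M) * r * Y ≡⟨ cong (_* Y) (trans (*-comm (s - M) r) (*-distribˡ-- r M s)) ⟩
        (r * s - r * M) * Y ≡⟨ cong (λ t → (t - r * M) * Y) (trans (*-comm r s) s*r) ⟩
        (1# - r * M) * Y ≡⟨ trans (distribʳ Y 1# (- (r * M))) (cong₂ _+_ (*-identityˡ Y) (sym (neg-distribˡ-* (r * M) Y))) ⟩
        Y - r * M * Y ≡⟨ cong (λ t → t - r * M * Y) Y≡ ⟩
        normal · x - M * (normal · q) - r * M * Y ≡⟨ +-assoc _ _ _ ⟩
        normal · x + (- (M * (normal · q)) + - (r * M * Y)) ≡⟨ cong (_+_ (normal · x)) (sym (neg-distrib-+ _ _)) ⟩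
        normal · x - (M * (normal · q) + r * M * Y) ≡⟨ cong (λ t → normal · x - (M * (normal · q) + t)) (trans (cong (_* Y) (*-comm r M)) (*-assoc M r Y)) ⟩
        normal · x - (M * (normal · q) + M * (r * Y)) ≡⟨ cong (λ t → normal · x - t) (sym (distribˡ M _ _)) ⟩
        normal · x - M * (normal · q + r * Y) ≡⟨ cong (λ t → normal · x - M * t) (sym (·-ε normal q (from M x) r)) ⟩
        normal · x - M * (normal · p) ∎
        where
        open ≡-Reasoning
        Y : 𝔽
        Y = normal · from M x
        Y≡ : Y ≡ normal · x - M * (normal · q)
        Y≡ = trans (sum-cong (allFin d) (λ j → trans (*-distribˡ-- (normal j) (M * q j) (x j)) (cong (λ t → normal j * x j - t) (trans (sym (*-assoc _ M _)) (trans (cong (_* q j) (*-comm _ M)) (*-assoc M _ _))))))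
          (trans (sum-- _ _ (allFin d)) (cong (λ t → normal · x - t) (sym (sum-*ˡ M _ (allFin d)))))

  -- The missing mass `M - s` is given to `q`. The weights of `q` and of the vertices of σ then
  -- spread all mass over the generators.
  ≤⇒dilated : ∀ {M x σ μ} → 0# ≤ M → Rep σ μ (from M x) → sumL μ σ ≤ M → Dilated M x
  ≤⇒dilated {M} {x} {σ} {μ} M≥0 (m , μ≥0 , e) le = by-sign (≤-cases M≥0)
    where
    s : 𝔽
    s = sumL μ σ
    ω : V → Fin n → 𝔽
    ω v with v ∈? σ
      where open DecMembership _≟_ using (_∈?_)
    ... | yes k = Convex.weight (proj₁ (vertex-boundary m k))
    ... | no _ = λ _ → 0#
    ω-spec : ∀ {v} → v ∈ σ → (∀ i → 0# ≤ ω v i) × sumL (ω v) fins ≡ 1# × (∀ j → sumL (λ i → ω v i * P i j) fins ≡ pt v j)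
    ω-spec {v} k with DecMembership._∈?_ _≟_ v σ
    ... | yes k′ = let open Convex (proj₁ (vertex-boundary m k′)) in weight≥0 , weight-sum , weight-comb
    ... | no v∉ = contradiction k v∉
    open Convex q-convex
    U : Fin n → 𝔽
    U i = (M - s) * weight i + sumL (λ v → μ v * ω v i) σ
    U≥0 : ∀ i → 0# ≤ U i
    U≥0 i = +-0≤ (*-0≤ (≤⇒0≤- le) (weight≥0 i)) (sum-0≤ σ (λ k → *-0≤ (μ≥0 k) (proj₁ (ω-spec k) i)))
    mix : ∀ (f : Fin n → 𝔽) (a : 𝔽) (b : V → 𝔽) → sumL (λ i → weight i * f i) fins ≡ a → (∀ {v} → v ∈ σ → sumL (λ i → ω v i * f i) fins ≡ b v) →
      sumL (λ i → U i * f i) fins ≡ (M - s) * a + sumL (λ v → μ v * b v) σ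
    mix f a b ha hb = trans (sum-cong fins (λ i → trans (distribʳ (f i) _ _) (cong₂ _+_ (*-assoc _ _ _) (trans (sum-*ʳ _ (f i) σ) (sum-cong σ (λ v → *-assoc _ _ _))))))
      (trans (sum-+ _ _ fins) (cong₂ _+_ (trans (sym (sum-*ˡ (M - s) _ fins)) (cong ((M - s) *_) ha))
        (trans (sum-swap _ fins σ) (sum-cong-∈ σ (λ {v} k → trans (sym (sum-*ˡ (μ v) _ fins)) (cong (μ v *_) (hb k)))))))
    U-total : sumL U fins ≡ M
    U-total = trans (sum-cong fins (λ i → sym (*-identityʳ (U i)))) (trans (mix (λ _ → 1#) 1# (λ _ → 1#) (trans (sum-cong fins (λ i → *-identityʳ _)) weight-sum) (λ k → trans (sum-cong fins (λ i → *-identityʳ _)) (proj₁ (proj₂ (ω-spec k)))))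
      (trans (cong₂ _+_ (*-identityʳ (M - s)) (sum-cong σ (λ v → *-identityʳ (μ v)))) (cancel-+ s M)))
    U-comb : ∀ j → sumL (λ i → U i * P i j) fins ≡ x j
    U-comb j = trans (mix (λ i → P i j) (q j) (λ v → pt v j) (weight-comb j) (λ k → proj₂ (proj₂ (ω-spec k)) j))
      (trans (cong (_+_ ((M - s) * q j)) (trans (sym (cancel-+ (s * q j) _)) (cong (_+ s * q j) (trans (sym (comb-pos μ σ j)) (sym (e j))))))
        (trans (cong (_+ (x j - M * q j + s * q j)) (trans (*-comm (M - s) (q j)) (*-distribˡ-- (q j) s M)))
          (trans (cong₂ (λ a b → a - b + (x j - M * q j + s * q j)) (*-comm (q j) M) (*-comm (q j) s)) (trans (cong (_+_ (M * q j - s * q j)) (+-comm _ _)) (trans (sym (+-assoc _ (s * q j) _)) (trans (cong (_+ (x j - M * q j)) (cancel-+ (s * q j) (M * q j))) (trans (+-comm _ _) (cancel-+ (M * q j) (x j)))))))))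
    by-sign : 0# < M ⊎ 0# ≡ M → Dilated M x
    by-sign (inj₁ M>0) with 1/⁺ M>0
    ... | r , r>0 , Mr = (λ i → r * U i) , (λ i → *-0≤ (<⇒≤ r>0) (U≥0 i)) , trans (sym (sum-*ˡ r U fins)) (trans (cong (r *_) U-total) (trans (*-comm r M) Mr))
        , λ j → trans (cong (M *_) (trans (sum-cong fins (λ i → *-assoc r _ _)) (sym (sum-*ˡ r _ fins)))) (trans (sym (*-assoc M r _)) (trans (cong (_* sumL (λ i → U i * P i j) fins) Mr) (trans (*-identityˡ _) (U-comb j))))
    -- For `M = 0` the non-negative `U` have sum zero, so `x` is zero and any weights will do.
    by-sign (inj₂ refl) = weight , weight≥0 , weight-sum , λ j → trans (zeroˡ _) (sym (trans (sym (U-comb j)) (sum-zero-∈ fins (λ {i} k → trans (cong (_* P i j) (sum-≡0 fins (λ {i} _ → U≥0 i) U-total k)) (zeroˡ (P i j))))))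

  -- `InQ` stands for a polytope with the given fan as its face fan. Scaled to the value 1 on the
  -- face of σ, the normals `N σ` become the linear pieces of its gauge, which is the strictly
  -- convex support function.
  module Support (InQ : Vector → Set) (N : List V → Vector) (b : List V → 𝔽)
      (N≢0 : ∀ {σ} → σ ∈ K → ∃[ j ] N σ j ≢ 0#)
      (Q-≤ : ∀ {σ x} → σ ∈ K → InQ x → N σ · x ≤ b σ)
      (to-face : ∀ {σ μ y} → Rep σ μ y → ∃[ t ] ∃[ x ] 0# ≤ t × InQ x × N σ · x ≡ b σ × (∀ j → t * x j ≡ y j))
      (from-face : ∀ {σ t x y} → σ ∈ K → 0# ≤ t → InQ x → N σ · x ≡ b σ → (∀ j → t * x j ≡ y j) → ∃[ μ ] Rep σ μ y) where

    ·-scaled : ∀ (a : Vector) {t} {x y : Vector} → (∀ j → t * x j ≡ y j) → a · y ≡ t * (a · x)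
    ·-scaled a {t} {x} e = trans (·-cong a (λ j → sym (e j))) (trans (sum-cong (allFin d) (λ j → trans (sym (*-assoc _ t _)) (trans (cong (_* x j) (*-comm _ t)) (*-assoc t _ _)))) (sym (sum-*ˡ t _ (allFin d))))

    -- The fan is complete, so the vector `N σ` itself is a non-negative multiple of a point of the
    -- polytope. A bound `b σ ≤ 0` would then force `N σ · N σ ≤ 0`.
    b>0 : ∀ {σ} → σ ∈ K → 0# < b σ
    b>0 {σ} m = ≰⇒> (λ le → absurd le (complete (N σ)))
      where
      N·N>0 : 0# < N σ · N σ
      N·N>0 = sum-0< (allFin d) (∈-allFin (proj₁ (N≢0 m))) (λ {i} _ → square≥0 (N σ i)) (square>0 (proj₂ (N≢0 m)))
        where
        square≥0 : ∀ p → 0# ≤ p * p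
        square≥0 p with p ≟ᶠ 0#
        ... | yes refl = ≤-reflexive (sym (zeroˡ 0#))
        ... | no ne = <⇒≤ (square>0 ne)
      absurd : b σ ≤ 0# → ∃[ τ ] τ ∈ K × ∃[ μ ] (∀ {v} → v ∈ τ → 0# ≤ μ v) × (∀ i → N σ i ≡ comb μ τ i) → ⊥
      absurd le (τ , mτ , μ , μ≥0 , e) with to-face {τ} {μ} {N σ} (mτ , μ≥0 , e)
      ... | t , x , t≥0 , x∈ , _ , ex = ≤⇒≯ (subst₂ _≤_ (sym (·-scaled (N σ) ex)) (zeroʳ t) (*-monoˡ-≤ t≥0 (≤-trans (Q-≤ m x∈) le))) N·N>0

    inv : List V → 𝔽
    inv σ with b σ ≟ᶠ 0#
    ... | yes _ = 0#
    ... | no ne = proj₁ (1/′ ne)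

    inv-spec : ∀ {σ} → σ ∈ K → b σ * inv σ ≡ 1#
    inv-spec {σ} m with b σ ≟ᶠ 0#
    ... | yes z = contradiction z (0<⇒≢0 (b>0 m))
    ... | no ne = proj₂ (1/′ ne)

    inv>0 : ∀ {σ} → σ ∈ K → 0# < inv σ
    inv>0 {σ} m = ≰⇒> (λ le → ≤⇒≯ (subst₂ _≤_ (inv-spec m) (zeroʳ (b σ)) (*-monoˡ-≤ (<⇒≤ (b>0 m)) le)) 0<1)

    a : List V → Vector
    a σ j = inv σ * N σ j

    a-· : ∀ σ x → a σ · x ≡ inv σ * (N σ · x)
    a-· σ x = ·-scale (inv σ) (N σ) x

    a-face : ∀ {σ x} → σ ∈ K → N σ · x ≡ b σ → a σ · x ≡ 1#
    a-face {σ} {x} m e = trans (a-· σ x) (trans (cong (inv σ *_) e) (trans (*-comm _ _) (inv-spec m)))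

    a-≤ : ∀ {σ x} → σ ∈ K → InQ x → a σ · x ≤ 1#
    a-≤ {σ} {x} m x∈ = subst₂ _≤_ (sym (a-· σ x)) (trans (*-comm _ _) (inv-spec m)) (*-monoˡ-≤ (<⇒≤ (inv>0 m)) (Q-≤ m x∈))

    ray : ∀ {σ v} → σ ∈ K → v ∈ σ → Rep σ (indicator v) (pos v)
    ray {σ} {v} m v∈ = m , (λ {u} _ → indicator≥0 v u) , λ j → sym (sum-indicator (cone-unique m) v∈ (λ u → pos u j))

    -- The ray `pos v` is a multiple of a point on the face of σ, where `a σ` is 1 and `a τ` is at
    -- most 1.
    support-≤ : ∀ {σ τ v} → σ ∈ K → τ ∈ K → v ∈ σ → a τ · pos v ≤ a σ · pos v
    support-≤ {σ} {τ} {v} mσ mτ v∈ with to-face {σ} {indicator v} {pos v} (ray mσ v∈)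
    ... | t , x , t≥0 , x∈ , fx , ex = subst₂ _≤_ (sym (·-scaled (a τ) ex)) (sym (trans (·-scaled (a σ) ex) (cong (t *_) (a-face mσ fx)))) (*-monoˡ-≤ t≥0 (a-≤ mτ x∈))

    -- The multiple is non-zero, as otherwise `q` would be a boundary point. Equality therefore puts
    -- the point on the face of τ, so the ray lies in the cone of τ, and `proper` makes `v` a vertex
    -- of τ.
    support-≡ : ∀ {σ τ v} → σ ∈ K → τ ∈ K → v ∈ σ → a τ · pos v ≡ a σ · pos v → v ∈ τ
    support-≡ {σ} {τ} {v} mσ mτ v∈ same with to-face {σ} {indicator v} {pos v} (ray mσ v∈)
    ... | t , x , t≥0 , x∈ , fx , ex = conclude (from-face {y = pos v} mτ t≥0 x∈ on-face ex)
      where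
      t≢0 : t ≢ 0#
      t≢0 z = q-interior (subst-boundary (vertex-boundary mσ v∈))
        where
        pt≡q : ∀ j → pt v j ≡ q j
        pt≡q j = -≡0⇒≡ (trans (sym (ex j)) (trans (cong (_* x j) z) (zeroˡ (x j))))
        subst-boundary : Boundary (pt v) → Boundary q
        subst-boundary (c , n , nz , h) = q-convex , n , nz , λ i → subst (n · P i ≤_) (·-cong n pt≡q) (h i)
      aτx : a τ · x ≡ 1#
      aτx with 1/′ t≢0
      ... | r , tr = trans (sym (undo (a τ · x))) (trans (cong (r *_) (trans (sym (·-scaled (a τ) ex)) (trans same (trans (·-scaled (a σ) ex) (cong (t *_) (a-face mσ fx)))))) (undo 1#))
        where
        undo : ∀ p → r * (t * p) ≡ p
        undo p = trans (sym (*-assoc r t p)) (trans (cong (_* p) (trans (*-comm r t) tr)) (*-identityˡ p))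
      on-face : N τ · x ≡ b τ
      on-face = trans (sym (*-identityˡ _)) (trans (cong (_* (N τ · x)) (sym (inv-spec mτ))) (trans (*-assoc (b τ) (inv τ) _) (trans (cong (b τ *_) (trans (sym (a-· τ x)) aτx)) (*-identityʳ (b τ)))))
      conclude : ∃[ ν ] Rep τ ν (pos v) → v ∈ τ
      conclude (ν , _ , ν≥0 , eν) with proper mσ mτ (indicator v) ν (λ {u} _ → indicator≥0 v u) ν≥0 (λ j → trans (sym (proj₂ (proj₂ (ray mσ v∈)) j)) (eν j)) v∈
      ... | inj₁ (k , _) = k
      ... | inj₂ (_ , z) = contradiction (trans (sym (indicator-≡ v)) z) (0<⇒≢0 0<1)

-- Lattice bases and integral coordinates of located points

ℤ-domain : IntegralDomain
ℤ-domain = record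
  { cring = ℤP.+-*-commutativeRing ; zero? = λ z → z ℤ.≟ + 0 ; integral = λ {x} e → ℤP.i*j≡0⇒i≡0∨j≡0 x e ; 1≉0 = λ () }

vec-ext : {A : Set} {n : ℕ} {u v : Vec A n} → (∀ r → V.lookup u r ≡ V.lookup v r) → u ≡ v
vec-ext {u = u} {v} h = ≡.trans (≡.sym (VP.tabulate∘lookup u)) (≡.trans (VP.tabulate-cong h) (VP.tabulate∘lookup v))

module LatticeBases where
  open ≡
  open import Data.Integer using (_+_; _*_; -_)
  open ℤSums
  open Kernel ℤ-domain using (sumF; kernel)

  sumF-suc : ∀ {n} (f : Fin (suc n) → ℤ) → sumF f ≡ f F.zero + sumF (f ∘ F.suc)
  sumF-suc {n} f = cong (λ t → f F.zero + t) (trans (cong (sumL f) (sym (LP.map-tabulate id F.suc))) (sum-map f F.suc (allFin n)))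

  nth : List ℤ → ℕ → ℤ
  nth [] _ = + 0
  nth (c ∷ _) zero = c
  nth (_ ∷ cs) (suc i) = nth cs i

  nth-tabulate : ∀ {n} (y : Fin n → ℤ) j → nth (L.tabulate y) (F.toℕ j) ≡ y j
  nth-tabulate y F.zero = refl
  nth-tabulate y (F.suc j) = nth-tabulate (y ∘ F.suc) j

  lincomb-lookup : ∀ {n} cs (bs : List (Vec ℤ n)) r → length cs ≡ length bs →
    V.lookup (lincombℤ cs bs) r ≡ sumF (λ j → nth cs (F.toℕ j) * V.lookup (L.lookup bs j) r)
  lincomb-lookup [] [] r _ = lookup-replicate r (+ 0)
  lincomb-lookup (c ∷ cs) (b ∷ bs) r l = trans (lookup-zipWith _+_ r (V.map (c *_) b) (lincombℤ cs bs))
    (trans (cong₂ _+_ (lookup-map r (c *_) b) (lincomb-lookup cs bs r (suc-injective l))) (sym (sumF-suc (λ j → nth (c ∷ cs) (F.toℕ j) * V.lookup (L.lookup (b ∷ bs) j) r))))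

  module _ {n} (bs : List (Vec ℤ n)) (basis : IsBasis bs) where
    private
      m : ℕ
      m = length bs

    rank≤ : m ℕ.≤ n
    rank≤ = ℕP.≮⇒≥ λ lt → absurd (kernel (map (λ r j → V.lookup (L.lookup bs j) r) (allFin n)) (subst (ℕ._< m) (sym (trans (length-map _ (allFin n)) (LP.length-tabulate id))) lt))
      where
      absurd : ∃[ y ] (∃[ j ] ¬ (y j ≡ + 0)) × All (λ c → sumF (λ j → y j * c j) ≡ + 0) (map (λ r j → V.lookup (L.lookup bs j) r) (allFin n)) → ⊥
      absurd (y , (j , nz) , ker) = nz (AllP.tabulate⁻ (proj₂ basis (L.tabulate y) (LP.length-tabulate y) (vec-ext zero-at)) j)
        where
        zero-at : ∀ r → V.lookup (lincombℤ (L.tabulate y) bs) r ≡ V.lookup (V.replicate n (+ 0)) r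
        zero-at r = trans (lincomb-lookup (L.tabulate y) bs r (LP.length-tabulate y)) (trans (sum-cong (allFin m) (λ j → cong (_* V.lookup (L.lookup bs j) r) (nth-tabulate y j)))
          (trans (All.lookup (AllP.map⁻ ker) (∈-allFin r)) (sym (lookup-replicate r (+ 0)))))

    rank≥ : n ℕ.≤ m
    rank≥ = ℕP.≮⇒≥ λ lt → absurd (kernel (map (λ j i → nth (cs i) (F.toℕ j)) (allFin m)) (subst (ℕ._< n) (sym (trans (length-map _ (allFin m)) (LP.length-tabulate id))) lt))
      where
      δ : Fin n → Fin n → ℤ
      δ i r with i F.≟ r
      ... | yes _ = + 1
      ... | no _ = + 0
      sum-δ : ∀ (y : Fin n → ℤ) r → sumF (λ i → y i * δ i r) ≡ y r
      sum-δ y r = trans (sum-single {f = λ i → y i * δ i r} (UP.allFin⁺ n) (∈-allFin r) (λ {i} _ ne → trans (cong (y i *_) (off i ne)) (ℤP.*-zeroʳ (y i)))) (trans (cong (y r *_) on) (ℤP.*-identityʳ (y r)))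
        where
        on : δ r r ≡ + 1
        on with r F.≟ r
        ... | yes _ = refl
        ... | no ne = contradiction refl ne
        off : ∀ i → i ≢ r → δ i r ≡ + 0
        off i ne with i F.≟ r
        ... | yes e = contradiction e ne
        ... | no _ = refl
      cs : Fin n → List ℤ
      cs i = proj₁ (proj₁ basis (V.tabulate (δ i)))
      cs-length : ∀ i → length (cs i) ≡ m
      cs-length i = proj₁ (proj₂ (proj₁ basis (V.tabulate (δ i))))
      cs-eq : ∀ i r → sumF (λ j → nth (cs i) (F.toℕ j) * V.lookup (L.lookup bs j) r) ≡ δ i r
      cs-eq i r = trans (sym (lincomb-lookup (cs i) bs r (cs-length i))) (trans (cong (λ u → V.lookup u r) (proj₂ (proj₂ (proj₁ basis (V.tabulate (δ i)))))) (lookup∘tabulate (δ i) r))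
      absurd : ∃[ y ] (∃[ j ] ¬ (y j ≡ + 0)) × All (λ c → sumF (λ i → y i * c i) ≡ + 0) (map (λ j i → nth (cs i) (F.toℕ j)) (allFin m)) → ⊥
      absurd (y , (r , nz) , ker) = nz (begin
        y r ≡⟨ sum-δ y r ⟨
        sumF (λ i → y i * δ i r) ≡⟨ sum-cong (allFin n) (λ i → cong (y i *_) (sym (cs-eq i r))) ⟩
        sumF (λ i → y i * sumF (λ j → nth (cs i) (F.toℕ j) * b j)) ≡⟨ sum-cong (allFin n) (λ i → trans (sum-*ˡ (y i) _ (allFin m)) (sum-cong (allFin m) (λ j → sym (ℤP.*-assoc (y i) _ _)))) ⟩
        sumF (λ i → sumF (λ j → y i * nth (cs i) (F.toℕ j) * b j)) ≡⟨ sum-swap _ (allFin n) (allFin m) ⟩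
        sumF (λ j → sumF (λ i → y i * nth (cs i) (F.toℕ j) * b j)) ≡⟨ sum-zero (allFin m) (λ j → trans (sym (sum-*ʳ _ (b j) (allFin n))) (trans (cong (_* b j) (All.lookup (AllP.map⁻ ker) (∈-allFin j))) (ℤP.*-zeroˡ (b j)))) ⟩
        + 0 ∎)
        where
        open ≡-Reasoning
        b : Fin m → ℤ
        b j = V.lookup (L.lookup bs j) r

    -- `PartOfBasis` adds an unspecified number of vectors; the rank shows that a lifted facet is
    -- completed by exactly one.
    rank : m ≡ n
    rank = ℕP.≤-antisym rank≤ rank≥

  lookup-∷ʳ-inject : ∀ {n} (x : Vec ℤ n) z i → V.lookup (x V.∷ʳ z) (F.inject₁ i) ≡ V.lookup x i
  lookup-∷ʳ-inject (_ V.∷ x) z F.zero = refl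
  lookup-∷ʳ-inject (_ V.∷ x) z (F.suc i) = lookup-∷ʳ-inject x z i

  lookup-∷ʳ-last : ∀ {n} (x : Vec ℤ n) z → V.lookup (x V.∷ʳ z) (F.fromℕ n) ≡ z
  lookup-∷ʳ-last V.[] z = refl
  lookup-∷ʳ-last (_ V.∷ x) z = lookup-∷ʳ-last x z

  init-or-last : ∀ {n} (r : Fin (suc n)) → (∃[ i ] r ≡ F.inject₁ i) ⊎ r ≡ F.fromℕ n
  init-or-last {zero} F.zero = inj₂ refl
  init-or-last {suc n} F.zero = inj₁ (F.zero , refl)
  init-or-last {suc n} (F.suc r) with init-or-last r
  ... | inj₁ (i , refl) = inj₁ (F.suc i , refl)
  ... | inj₂ refl = inj₂ refl

  module Coordinates {d : ℕ} {V : Set} (pt : V → Pt d) (σ : List V) (w : Vec ℤ (suc d)) where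
    hat : V → Fin (suc d) → ℤ
    hat v = V.lookup (lift1 (pt v))

    lin : List ℤ → Fin (suc d) → ℤ
    lin zs r = sumL (λ p → proj₁ p * hat (proj₂ p) r) (L.zip zs σ)

    rep : List ℤ → ℤ → Fin (suc d) → ℤ
    rep zs k r = lin zs r + k * V.lookup w r

    lincomb-rep : ∀ zs k r → length zs ≡ length σ → V.lookup (lincombℤ (zs ++ k ∷ []) (map lift1 (map pt σ) ++ w ∷ [])) r ≡ rep zs k r
    lincomb-rep zs k r l = go zs σ l
      where
      go : ∀ zs σ → length zs ≡ length σ → V.lookup (lincombℤ (zs ++ k ∷ []) (map lift1 (map pt σ) ++ w ∷ [])) r ≡ sumL (λ p → proj₁ p * hat (proj₂ p) r) (L.zip zs σ) + k * V.lookup w r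
      go [] [] _ = trans (lookup-zipWith _+_ r (V.map (k *_) w) (V.replicate (suc d) (+ 0))) (trans (cong₂ _+_ (lookup-map r (k *_) w) (lookup-replicate r (+ 0))) (ℤP.+-comm (k * V.lookup w r) (+ 0)))
      go (z ∷ zs) (v ∷ σ) l = trans (lookup-zipWith _+_ r (V.map (z *_) (lift1 (pt v))) (lincombℤ (zs ++ k ∷ []) (map lift1 (map pt σ) ++ w ∷ [])))
        (trans (cong₂ _+_ (lookup-map r (z *_) (lift1 (pt v))) (go zs σ (suc-injective l))) (sym (ℤP.+-assoc (z * hat v r) _ _)))

  record Coordinatized {d : ℕ} {V : Set} (pt : V → Pt d) (σ : List V) (w : Vec ℤ (suc d)) : Set where
    open Coordinates pt σ w
    field
      coordinates : ∀ (u : Fin (suc d) → ℤ) → ∃[ zs ] ∃[ k ] length zs ≡ length σ × (∀ r → rep zs k r ≡ u r)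
      unique : ∀ {zs k zs′ k′} → length zs ≡ length σ → length zs′ ≡ length σ → (∀ r → rep zs k r ≡ rep zs′ k′ r) → zs ≡ zs′ × k ≡ k′

  unsnoc : ∀ {A : Set} n (xs : List A) → length xs ≡ suc n → ∃[ ys ] ∃[ y ] length ys ≡ n × xs ≡ ys ++ y ∷ []
  unsnoc zero (x ∷ []) _ = [] , x , refl , refl
  unsnoc (suc n) (x ∷ xs) l with unsnoc n xs (suc-injective l)
  ... | ys , y , l′ , refl = x ∷ ys , y , cong suc l′ , refl

  coordinatize : ∀ {d V} (pt : V → Pt d) (σ : List V) → length σ ≡ d → PartOfBasis (map lift1 (map pt σ)) → ∃[ w ] Coordinatized pt σ w
  coordinatize {d} {V} pt σ lσ (ws , basis) = go ws basis (trans (sym (length-++ B)) (rank (B ++ ws) basis))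
    where
    B : List (Vec ℤ (suc d))
    B = map lift1 (map pt σ)
    lB : length B ≡ d
    lB = trans (length-map lift1 (map pt σ)) (trans (length-map pt σ) lσ)
    go : ∀ ws → IsBasis (B ++ ws) → length B ℕ.+ length ws ≡ suc d → ∃[ w ] Coordinatized pt σ w
    go [] _ l = contradiction (trans (sym (trans (ℕP.+-identityʳ _) lB)) l) (λ e → ℕP.1+n≢n (sym e))
    go (w ∷ w′ ∷ ws) _ l = contradiction (trans (cong (ℕ._+ suc (suc (length ws))) (sym lB)) l) (λ e → ℕP.m≢1+m+n d (sym (suc-injective (trans (sym (trans (ℕP.+-suc d _) (cong suc (ℕP.+-suc d (length ws))))) e))))
    go (w ∷ []) basis _ = w , record { coordinates = coords ; unique = uniq }
      where
      open Coordinates pt σ w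
      len : ∀ (zs : List ℤ) k → length zs ≡ length σ → length (zs ++ k ∷ []) ≡ length (B ++ w ∷ [])
      len zs k l = trans (length-++ zs) (trans (cong (ℕ._+ 1) (trans l (trans lσ (sym lB)))) (sym (length-++ B)))
      coords : ∀ u → ∃[ zs ] ∃[ k ] length zs ≡ length σ × (∀ r → rep zs k r ≡ u r)
      coords u with proj₁ basis (V.tabulate u)
      ... | cs , lc , e with unsnoc d cs (trans lc (trans (length-++ B) (trans (cong (ℕ._+ 1) lB) (ℕP.+-comm d 1))))
      ... | zs , k , l , refl = zs , k , trans l (sym lσ) , λ r → trans (sym (lincomb-rep zs k r (trans l (sym lσ)))) (trans (cong (λ t → V.lookup t r) e) (lookup∘tabulate u r))
      minus : List ℤ → List ℤ → List ℤ
      minus = L.zipWith ℤ._-_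
      uniq : ∀ {zs k zs′ k′} → length zs ≡ length σ → length zs′ ≡ length σ → (∀ r → rep zs k r ≡ rep zs′ k′ r) → zs ≡ zs′ × k ≡ k′
      uniq {zs} {k} {zs′} {k′} l l′ e = finish (proj₂ basis (minus zs zs′ ++ (k ℤ.- k′) ∷ []) (len (minus zs zs′) (k ℤ.- k′) lm) (vec-ext zero-at))
        where
        lm : length (minus zs zs′) ≡ length σ
        lm = trans (LP.length-zipWith ℤ._-_ zs zs′) (trans (cong₂ ℕ._⊓_ l l′) (ℕP.⊓-idem _))
        part : List ℤ → List V → Fin (suc d) → ℤ
        part zs σ r = sumL (λ p → proj₁ p * hat (proj₂ p) r) (L.zip zs σ)
        sum-minus : ∀ zs zs′ σ r → length zs ≡ length σ → length zs′ ≡ length σ → part (minus zs zs′) σ r ≡ part zs σ r ℤ.- part zs′ σ r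
        sum-minus [] [] [] r _ _ = refl
        sum-minus (a ∷ zs) (b ∷ zs′) (v ∷ σ) r l l′ = trans (cong (λ t → (a ℤ.- b) * hat v r + t) (sum-minus zs zs′ σ r (suc-injective l) (suc-injective l′))) (eq a b (hat v r) (part zs σ r) (part zs′ σ r))
          where
          eq : ∀ a b h s t → (a ℤ.- b) * h + (s ℤ.- t) ≡ a * h + s ℤ.- (b * h + t)
          eq = solve-∀
        zero-at : ∀ r → V.lookup (lincombℤ (minus zs zs′ ++ (k ℤ.- k′) ∷ []) (B ++ w ∷ [])) r ≡ V.lookup (V.replicate (suc d) (+ 0)) r
        zero-at r = trans (lincomb-rep (minus zs zs′) (k ℤ.- k′) r lm) (trans (cong (λ t → t + (k ℤ.- k′) * V.lookup w r) (sum-minus zs zs′ σ r l l′))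
          (trans (eq (lin zs r) (lin zs′ r) k k′ (V.lookup w r)) (trans (ℤP.i≡j⇒i-j≡0 {i = rep zs k r} {j = rep zs′ k′ r} (e r)) (sym (lookup-replicate r (+ 0))))))
          where
          eq : ∀ s t k k′ h → s ℤ.- t + (k ℤ.- k′) * h ≡ s + k * h ℤ.- (t + k′ * h)
          eq = solve-∀
        finish : All (_≡ + 0) (minus zs zs′ ++ (k ℤ.- k′) ∷ []) → zs ≡ zs′ × k ≡ k′
        finish all with AllP.++⁻ʳ (minus zs zs′) all
        ... | kz ∷ [] = same zs zs′ (trans l (sym l′)) (AllP.++⁻ˡ (minus zs zs′) all) , ℤP.i-j≡0⇒i≡j k k′ kz
          where
          same : ∀ zs zs′ → length zs ≡ length zs′ → All (_≡ + 0) (minus zs zs′) → zs ≡ zs′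
          same [] [] _ _ = refl
          same (a ∷ zs) (b ∷ zs′) l (z ∷ az) = cong₂ _∷_ (ℤP.i-j≡0⇒i≡j a b z) (same zs zs′ (suc-injective l) az)

  -- The completing vector is determined only up to sign and the facet; its sign is chosen to give
  -- the apex a positive coefficient.
  negate-w : ∀ {d V} {pt : V → Pt d} {σ w} → Coordinatized pt σ w → Coordinatized pt σ (V.map -_ w)
  negate-w {pt = pt} {σ} {w} C = record
    { coordinates = λ u → let zs , k , l , e = coordinates u in zs , - k , l , λ r → trans (neg zs k r) (e r)
    ; unique = λ {zs} {k} {zs′} {k′} l l′ e → let a , b = unique {zs} { - k} {zs′} { - k′} l l′ (λ r → trans (sym (neg′ zs k r)) (trans (e r) (neg′ zs′ k′ r))) in a , ℤP.neg-injective b }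
    where
    open Coordinatized C
    module C⁻ = Coordinates pt σ (V.map -_ w)
    open Coordinates pt σ w
    eq : ∀ s k h → s + (- k) * (- h) ≡ s + k * h
    eq = solve-∀
    eq′ : ∀ s k h → s + k * (- h) ≡ s + (- k) * h
    eq′ = solve-∀
    neg : ∀ zs k r → C⁻.rep zs (- k) r ≡ rep zs k r
    neg zs k r = trans (cong (λ t → lin zs r + (- k) * t) (lookup-map r -_ w)) (eq (lin zs r) k (V.lookup w r))
    neg′ : ∀ zs k r → C⁻.rep zs k r ≡ rep zs (- k) r
    neg′ zs k r = trans (cong (λ t → lin zs r + k * t) (lookup-map r -_ w)) (eq′ (lin zs r) k (V.lookup w r))

-- Integer coordinates as functions on the vertices; w completes the lifted vertices of σ to a lattice basis and q̂ is the lift of the apex.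
module FacetCoordinates {d : ℕ} {V : Set} (_≟_ : DecidableEquality V) (pt : V → Pt d) (q̂ : Fin (suc d) → ℤ) where
  open ≡
  open import Data.Integer using (_+_; _*_; -_; _-_)
  open ℤSums
  open LatticeBases

  hat : V → Fin (suc d) → ℤ
  hat v = V.lookup (lift1 (pt v))

  at : List V → List ℤ → V → ℤ
  at [] _ _ = + 0
  at (_ ∷ _) [] _ = + 0
  at (u ∷ σ) (z ∷ zs) v with v ≟ u
  ... | yes _ = z
  ... | no _ = at σ zs v

  map-at : ∀ σ zs → Unique σ → length zs ≡ length σ → map (at σ zs) σ ≡ zs
  map-at [] [] _ _ = refl
  map-at (u ∷ σ) (z ∷ zs) (u∉ ∷ uq) l = cong₂ _∷_ first (trans (LP.map-cong-local (All.tabulate rest)) (map-at σ zs uq (suc-injective l)))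
    where
    first : at (u ∷ σ) (z ∷ zs) u ≡ z
    first with u ≟ u
    ... | yes _ = refl
    ... | no ne = contradiction refl ne
    rest : ∀ {v} → v ∈ σ → at (u ∷ σ) (z ∷ zs) v ≡ at σ zs v
    rest {v} m with v ≟ u
    ... | yes refl = contradiction refl (All.lookup u∉ m)
    ... | no _ = refl

  map-injective-∈ : ∀ {f g : V → ℤ} σ → map f σ ≡ map g σ → ∀ {v} → v ∈ σ → f v ≡ g v
  map-injective-∈ (u ∷ σ) e (here refl) = LP.∷-injectiveˡ e
  map-injective-∈ (u ∷ σ) e (there m) = map-injective-∈ σ (LP.∷-injectiveʳ e) m

  rep : List V → Vec ℤ (suc d) → (V → ℤ) → ℤ → Fin (suc d) → ℤ
  rep σ w f k r = sumL (λ v → f v * hat v r) σ + k * V.lookup w r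

  rep-map : ∀ σ w f k r → Coordinates.rep pt σ w (map f σ) k r ≡ rep σ w f k r
  rep-map σ w f k r = cong (λ t → t + k * V.lookup w r) (go σ)
    where
    go : ∀ σ → sumL (λ p → proj₁ p * hat (proj₂ p) r) (L.zip (map f σ) σ) ≡ sumL (λ v → f v * hat v r) σ
    go [] = refl
    go (v ∷ σ) = cong (λ t → f v * hat v r + t) (go σ)

  rep-last : ∀ σ w f k → rep σ w f k (F.fromℕ d) ≡ k * V.lookup w (F.fromℕ d) + sumL id (map f σ)
  rep-last σ w f k = trans (ℤP.+-comm _ (k * V.lookup w (F.fromℕ d))) (cong (λ t → k * V.lookup w (F.fromℕ d) + t)
    (trans (sum-cong σ (λ v → trans (cong (f v *_) (lookup-∷ʳ-last (pt v) (+ 1))) (ℤP.*-identityʳ (f v)))) (sym (sum-map id f σ))))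

  -- `suc κ` is the lattice distance of the apex from the hyperplane spanned by the lifted facet,
  -- which is also the index of the cone spanned by facet and apex; `cs` are the other coordinates
  -- of the apex.
  record FacetBasis (σ : List V) (w : Vec ℤ (suc d)) (κ : ℕ) (cs : V → ℤ) : Set where
    field
      coordinates : ∀ (u : Fin (suc d) → ℤ) → ∃[ f ] ∃[ k ] (∀ r → rep σ w f k r ≡ u r)
      unique : ∀ {f k f′ k′} → (∀ r → rep σ w f k r ≡ rep σ w f′ k′ r) → (∀ {v} → v ∈ σ → f v ≡ f′ v) × k ≡ k′
      apex : ∀ r → rep σ w cs (+ suc κ) r ≡ q̂ r

    -- Subtracting `k` times the apex from `suc κ` times `u` removes the completing vector and
    -- leaves a combination of the lifted facet.
    eliminate : ∀ {f k} {u : Fin (suc d) → ℤ} → (∀ r → rep σ w f k r ≡ u r) → ∀ r → sumL (λ v → (+ suc κ * f v - k * cs v) * hat v r) σ ≡ + suc κ * u r - k * q̂ r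
    eliminate {f} {k} {u} e r = trans (sum-cong σ (λ v → eq (+ suc κ) k (f v) (cs v) (hat v r))) (trans (sum-+ (λ v → + suc κ * (f v * hat v r)) (λ v → (- k) * (cs v * hat v r)) σ)
      (trans (cong₂ _+_ (sym (sum-*ˡ (+ suc κ) (λ v → f v * hat v r) σ)) (sym (sum-*ˡ (- k) (λ v → cs v * hat v r) σ)))
        (trans (eq′ (+ suc κ) k (sumL (λ v → f v * hat v r) σ) (sumL (λ v → cs v * hat v r) σ) (V.lookup w r)) (cong₂ (λ s t → + suc κ * s - k * t) (e r) (apex r)))))
      where
      eq : ∀ K k f c h → (K * f - k * c) * h ≡ K * (f * h) + (- k) * (c * h)
      eq = solve-∀
      eq′ : ∀ K k a b w → K * a + (- k) * b ≡ K * (a + k * w) - k * (b + K * w)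
      eq′ = solve-∀

  facet-basis : ∀ {σ} → Unique σ → length σ ≡ d → PartOfBasis (map lift1 (map pt σ)) → (∀ w cs → (∀ r → rep σ w cs (+ 0) r ≡ q̂ r) → ⊥) →
    ∃[ w ] ∃[ κ ] ∃[ cs ] FacetBasis σ w κ cs
  facet-basis {σ} uσ lσ part off = orient (coordinatize pt σ lσ part)
    where
    coords : ∀ {w} → Coordinatized pt σ w → ∀ u → ∃[ f ] ∃[ k ] (∀ r → rep σ w f k r ≡ u r)
    coords {w} c u with Coordinatized.coordinates c u
    ... | zs , k , l , e = at σ zs , k , λ r → trans (sym (rep-map σ w (at σ zs) k r)) (trans (cong (λ t → Coordinates.rep pt σ w t k r) (map-at σ zs uσ l)) (e r))
    uniq : ∀ {w} → Coordinatized pt σ w → ∀ {f k f′ k′} → (∀ r → rep σ w f k r ≡ rep σ w f′ k′ r) → (∀ {v} → v ∈ σ → f v ≡ f′ v) × k ≡ k′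
    uniq {w} c {f} {k} {f′} {k′} e with Coordinatized.unique c {map f σ} {k} {map f′ σ} {k′} (length-map f σ) (length-map f′ σ) (λ r → trans (rep-map σ w f k r) (trans (e r) (sym (rep-map σ w f′ k′ r))))
    ... | same , k≡ = map-injective-∈ σ same , k≡
    orient : ∃[ w ] Coordinatized pt σ w → ∃[ w ] ∃[ κ ] ∃[ cs ] FacetBasis σ w κ cs
    orient (w , c) with coords c q̂
    ... | cs , + zero , e = ⊥-elim (off w cs e)
    ... | cs , + suc κ , e = w , κ , cs , record { coordinates = coords c ; unique = uniq c ; apex = e }
    ... | cs , -[1+ κ ] , e = V.map -_ w , κ , cs , record { coordinates = coords (negate-w c) ; unique = uniq (negate-w c) ; apex = λ r → trans (cong (λ t → sumL (λ v → cs v * hat v r) σ + t) (trans (cong (+ suc κ *_) (lookup-map r -_ w)) (trans (sym (ℤP.neg-distribʳ-* (+ suc κ) (V.lookup w r))) (ℤP.neg-distribˡ-* (+ suc κ) (V.lookup w r))))) (e r) }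

record ℤ-Embedding (O : OrderedField) : Set where
  open OrderedField O
  field
    ι : ℤ → 𝔽
    ι-+ : ∀ i j → ι (i ℤ.+ j) ≡ ι i + ι j
    ι-* : ∀ i j → ι (i ℤ.* j) ≡ ι i * ι j
    ι-pos : ∀ n → 0# < ι (+ suc n)

  embed : {d : ℕ} → Pt d → Fin d → 𝔽
  embed x j = ι (V.lookup x j)

module EmbeddingProperties (O : OrderedField) (E : ℤ-Embedding O) where
  open ≡
  open FieldProperties O
  open ℤ-Embedding E public

  ι-0 : ι (+ 0) ≡ 0#
  ι-0 = trans (sym (cancel (ι (+ 0)))) (trans (cong (_- ι (+ 0)) (sym (ι-+ (+ 0) (+ 0)))) (-‿inverseʳ (ι (+ 0))))
    where
    cancel : ∀ p → p + p - p ≡ p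
    cancel p = trans (+-assoc p p (- p)) (trans (cong (_+_ p) (-‿inverseʳ p)) (+-identityʳ p))

  ι-- : ∀ i j → ι (i ℤ.- j) ≡ ι i - ι j
  ι-- i j = trans (sym (+-identityʳ _)) (trans (cong (_+_ (ι (i ℤ.- j))) (sym (-‿inverseʳ (ι j)))) (trans (sym (+-assoc _ _ _)) (cong (_- ι j) (trans (sym (ι-+ (i ℤ.- j) j)) (cong ι (eq i j))))))
    where
    eq : ∀ i j → i ℤ.- j ℤ.+ j ≡ i
    eq = solve-∀

  ι-sum : ∀ {I : Set} (f : I → ℤ) xs → ι (ℤSums.sumL f xs) ≡ sumL (ι ∘ f) xs
  ι-sum f [] = ι-0
  ι-sum f (x ∷ xs) = trans (ι-+ (f x) _) (cong (_+_ (ι (f x))) (ι-sum f xs))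

  ι-0< : ∀ {z} → + 0 ℤ.< z → 0# < ι z
  ι-0< (ℤ.+<+ {n = suc n} _) = ι-pos n

  ι-<0 : ∀ {z} → z ℤ.< + 0 → ι z < 0#
  ι-<0 { -[1+ n ]} _ = subst (_< 0#) (sym (trans (ι-- (+ 0) (+ suc n)) (trans (cong (_- ι (+ suc n)) ι-0) (+-identityˡ (- ι (+ suc n)))))) (neg-<0 (ι-pos n))
  ι-<0 {+ n} (ℤ.+<+ ())

  ι-reflects-0< : ∀ {z} → 0# < ι z → + 0 ℤ.< z
  ι-reflects-0< {z} lt with ℤP.<-cmp z (+ 0)
  ... | Tri.tri> _ _ gt = gt
  ... | Tri.tri≈ _ refl _ = contradiction lt (<-irrefl (sym ι-0))
  ... | Tri.tri< l _ _ = contradiction (<-trans lt (ι-<0 l)) (<-irrefl refl)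

  ι-reflects-0≤ : ∀ {z} → 0# ≤ ι z → + 0 ℤ.≤ z
  ι-reflects-0≤ le = ℤP.≮⇒≥ (λ l → ≤⇒≯ le (ι-<0 l))

  ι-0≤ : ∀ {z} → + 0 ℤ.≤ z → 0# ≤ ι z
  ι-0≤ le = ≮⇒≥ (λ l → ℤP.≤⇒≯ le (reflect l))
    where
    reflect : ∀ {z} → ι z < 0# → z ℤ.< + 0
    reflect {z} l with ℤP.<-cmp z (+ 0)
    ... | Tri.tri< q _ _ = q
    ... | Tri.tri≈ _ refl _ = contradiction l (<-irrefl ι-0)
    ... | Tri.tri> _ _ g = contradiction (<-trans l (ι-0< g)) (<-irrefl refl)

  ι-reflects-0 : ∀ {z} → ι z ≡ 0# → z ≡ + 0
  ι-reflects-0 {z} e with ℤP.<-cmp z (+ 0)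
  ... | Tri.tri< q _ _ = contradiction (ι-<0 q) (<-irrefl e)
  ... | Tri.tri≈ _ q _ = q
  ... | Tri.tri> _ _ g = contradiction (ι-0< g) (<-irrefl (sym e))

ℤ-<⇒+1≤ : ∀ {i j} → + 0 ℤ.< j ℤ.- i → i ℤ.+ + 1 ℤ.≤ j
ℤ-<⇒+1≤ {i} {j} lt = ℤP.≤-trans (ℤP.≤-reflexive (ℤP.+-comm i (+ 1))) (ℤP.i<j⇒suc[i]≤j (≡.subst₂ ℤ._<_ (ℤP.+-identityˡ i) (eq i j) (ℤP.+-monoˡ-< i lt)))
  where
  eq : ∀ i j → j ℤ.- i ℤ.+ i ≡ j
  eq = solve-∀

ℤ-+1≤⇒< : ∀ {i j} → i ℤ.+ + 1 ℤ.≤ j → + 0 ℤ.< j ℤ.- i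
ℤ-+1≤⇒< {i} {j} le = ≡.subst (ℤ._< j ℤ.- i) (ℤP.+-inverseʳ i) (ℤP.+-monoˡ-< (ℤ.- i) {i} {j} (ℤP.suc[i]≤j⇒i<j {i} {j} (ℤP.≤-trans (ℤP.≤-reflexive (ℤP.+-comm (+ 1) i)) le)))

sum-ind : {A : Set} (g : A → ℕ) (l : ℕ) (xs : List A) → ℤSums.sumL (λ x → Sequences.ind (g x) l) xs ≡ + length (filter (λ x → g x ℕ.≟ l) xs)
sum-ind g l [] = ≡.refl
sum-ind g l (x ∷ xs) = split (g x ℕ.≟ l)
  where
  split : Dec (g x ≡ l) → Sequences.ind (g x) l ℤ.+ ℤSums.sumL (λ x → Sequences.ind (g x) l) xs ≡ + length (filter (λ x → g x ℕ.≟ l) (x ∷ xs))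
  split (yes e) = ≡.trans (≡.cong₂ ℤ._+_ (≡.trans (≡.cong (λ t → Sequences.ind t l) e) (Sequences.ind-≡ l)) (sum-ind g l xs)) (≡.cong (λ t → + length t) (≡.sym (LP.filter-accept (λ x → g x ℕ.≟ l) {x = x} {xs = xs} e)))
  split (no ne) = ≡.trans (≡.cong₂ ℤ._+_ (Sequences.ind-≢ ne) (sum-ind g l xs)) (≡.trans (ℤP.+-identityˡ _) (≡.cong (λ t → + length t) (≡.sym (LP.filter-reject (λ x → g x ℕ.≟ l) {x = x} {xs = xs} ne))))

record LatticePolytope : Set₁ where
  constructor lattice-polytope
  field
    polytope : PolytopeData
  open PolytopeData polytope public
  field
    E : ℤ-Embedding O
    p̂ : V → Pt d
    pt-p̂ : ∀ {σ} → σ ∈ K → ∀ {v} → v ∈ σ → ∀ j → pt v j ≡ ℤ-Embedding.embed E (p̂ v) j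
    N′ : ℕ
    q̂ : Pt d
    q-q̂ : ∀ j → OrderedField._*_ O (ℤ-Embedding.ι E (+ suc N′)) (q j) ≡ ℤ-Embedding.embed E q̂ j
    unimodular : ∀ {σ} → σ ∈ K → PartOfBasis (map lift1 (map p̂ σ))

module LatticeFan (ℒ : LatticePolytope) where
  open LatticePolytope ℒ
  open ≡
  open FieldProperties O
  open EmbeddingProperties O E
  open Vectors O d
  open PolytopeSupport polytope

  -- The vector (q, 1) multiplied by the common denominator `suc N′`.
  apex⁺ : Fin (suc d) → ℤ
  apex⁺ = V.lookup (q̂ V.∷ʳ + suc N′)

  at-height : ℕ → Pt d → Fin (suc d) → ℤ
  at-height m x = V.lookup (x V.∷ʳ + m)

  open FacetCoordinates _≟_ p̂ apex⁺
  open LatticeBases using (lookup-∷ʳ-inject; lookup-∷ʳ-last; init-or-last; module Coordinates)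
  open Triangulated tri

  module Directed (c : Vector) (generic : FanGeometry.Generic (fan-data O d V _≟_ vs K pos fan) c) where
    open Sweep (fan-data O d V _≟_ vs K pos fan) c generic
    open Combinations pos
    open DecMembership (LP.≡-dec _≟_) using (_∈?_)

    Lifted : List V → (V → ℤ) → (Fin (suc d) → ℤ) → Set
    Lifted σ z u = sumL (ι ∘ z) σ ≡ ι (u (F.fromℕ d)) × (∀ j → comb (ι ∘ z) σ j ≡ ι (u (F.inject₁ j)) - ι (u (F.fromℕ d)) * q j)

    comb-lattice : ∀ {σ} → σ ∈ K → ∀ z u → (∀ r → ℤSums.sumL (λ v → z v ℤ.* hat v r) σ ≡ u r) → Lifted σ z u
    comb-lattice {σ} m z u e = total , λ j → trans (comb-pos (ι ∘ z) σ j) (cong₂ _-_ (coord j) (cong (_* q j) total))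
      where
      total : sumL (ι ∘ z) σ ≡ ι (u (F.fromℕ d))
      total = trans (sym (ι-sum z σ)) (cong ι (trans (ℤSums.sum-cong σ (λ v → sym (trans (cong (z v ℤ.*_) (lookup-∷ʳ-last (p̂ v) (+ 1))) (ℤP.*-identityʳ (z v))))) (e (F.fromℕ d))))
      coord : ∀ j → sumL (λ v → ι (z v) * pt v j) σ ≡ ι (u (F.inject₁ j))
      coord j = trans (sum-cong-∈ σ (λ {v} k → trans (cong (ι (z v) *_) (trans (pt-p̂ m k j) (cong ι (sym (lookup-∷ʳ-inject (p̂ v) (+ 1) j))))) (sym (ι-* (z v) (hat v (F.inject₁ j))))))
        (trans (sym (ι-sum (λ v → z v ℤ.* hat v (F.inject₁ j)) σ)) (cong ι (e (F.inject₁ j))))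

    -- An apex in the span of the lifted facet would give a combination of the rays `pos v` that is
    -- zero although its coefficients sum to `suc N′`, against their independence.
    off-apex : ∀ {σ} → σ ∈ Fs → ∀ w cs → (∀ r → rep σ w cs (+ 0) r ≡ apex⁺ r) → ⊥
    off-apex {σ} m w cs e = <-irrefl (sym (trans (cong ι (sym (lookup-∷ʳ-last q̂ (+ suc N′)))) (trans (sym (proj₁ cl)) (sum-zero-∈ σ (λ k → lin-indep (facet∈K m) (ι ∘ cs) zero-at k))))) (ι-pos N′)
      where
      cl : Lifted σ cs apex⁺
      cl = comb-lattice (facet∈K m) cs (apex⁺) (λ r → trans (sym (ℤP.+-identityʳ (ℤSums.sumL (λ v → cs v ℤ.* hat v r) σ))) (e r))
      zero-at : ∀ j → comb (ι ∘ cs) σ j ≡ 0#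
      zero-at j = trans (proj₂ cl j) (trans (cong₂ _-_ (cong ι (lookup-∷ʳ-inject q̂ (+ suc N′) j)) (trans (cong (λ t → ι t * q j) (lookup-∷ʳ-last q̂ (+ suc N′))) (q-q̂ j))) (-‿inverseʳ (embed q̂ j)))

    basis-of : ∀ {σ} → σ ∈ Fs → ∃[ w ] ∃[ κ ] ∃[ cs ] FacetBasis σ w κ cs
    basis-of m = facet-basis (cone-unique (facet∈K m)) (facet-length m) (unimodular (facet∈K m)) (off-apex m)

    -- Deciding membership makes the chosen basis a function of σ alone, as the counting of cells
    -- requires; the values off `Fs` are defaults.
    chosen : List V → Vec ℤ (suc d) × ℕ × (V → ℤ)
    chosen σ with σ ∈? Fs
    ... | yes m = let w , κ , cs , _ = basis-of m in w , κ , cs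
    ... | no _ = V.replicate (suc d) (+ 0) , 0 , λ _ → + 0

    W : List V → Vec ℤ (suc d)
    W σ = proj₁ (chosen σ)
    κ : List V → ℕ
    κ σ = proj₁ (proj₂ (chosen σ))
    cs : List V → V → ℤ
    cs σ = proj₂ (proj₂ (chosen σ))

    basis : ∀ {σ} → σ ∈ Fs → FacetBasis σ (W σ) (κ σ) (cs σ)
    basis {σ} m with σ ∈? Fs
    ... | yes m′ = proj₂ (proj₂ (proj₂ (basis-of m′)))
    ... | no σ∉ = contradiction m σ∉

    κι : List V → 𝔽
    κι σ = ι (+ suc (κ σ))

    seen : ℕ → Pt d → Vector
    seen m x = from (ι (+ m)) (embed x)

    Rep⁺ : ℕ → Pt d → List V → (V → ℤ) → ℤ → Set
    Rep⁺ m x σ f k = ∀ r → rep σ (W σ) f k r ≡ at-height m x r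

    gap : List V → (V → ℤ) → ℤ → V → ℤ
    gap σ f k v = + suc (κ σ) ℤ.* f v ℤ.- k ℤ.* cs σ v

    private
      sub-cancel : ∀ a b e → a - b - (e - b) ≡ a - e
      sub-cancel a b e = trans (cong (_+_ (a - b)) (neg-distrib-+ e (- b))) (trans (interchange a (- b) (- e) (- - b)) (trans (cong (_+_ (a - e)) (-‿inverseʳ (- b))) (+-identityʳ (a - e))))

      shift : ∀ κ k X Q M N q → N * q ≡ Q → κ * X - k * Q - (κ * M - k * N) * q ≡ κ * (X - M * q)
      shift κ k X Q M N q refl = trans (cong (λ t → κ * X - k * (N * q) - t) (trans (*-comm (κ * M - k * N) q) (trans (*-distribˡ-- q (k * N) (κ * M)) (cong₂ _-_ (trans (*-comm q (κ * M)) (*-assoc κ M q)) (trans (*-comm q (k * N)) (*-assoc k N q))))))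
        (trans (sub-cancel (κ * X) (k * (N * q)) (κ * (M * q))) (sym (*-distribˡ-- κ (M * q) X)))

    module _ {m x σ f k} (σ∈ : σ ∈ Fs) (r : Rep⁺ m x σ f k) where
      private
        u : Fin (suc d) → ℤ
        u i = + suc (κ σ) ℤ.* at-height m x i ℤ.- k ℤ.* apex⁺ i
        cl : Lifted σ (gap σ f k) u
        cl = comb-lattice (facet∈K σ∈) (gap σ f k) u (FacetBasis.eliminate (basis σ∈) {f} {k} {at-height m x} r)
        ι-u : ∀ i {a b} → at-height m x i ≡ a → apex⁺ i ≡ b → ι (u i) ≡ κι σ * ι a - ι k * ι b
        ι-u i refl refl = trans (ι-- (+ suc (κ σ) ℤ.* at-height m x i) (k ℤ.* apex⁺ i)) (cong₂ _-_ (ι-* (+ suc (κ σ)) (at-height m x i)) (ι-* k (apex⁺ i)))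
        u-last : ι (u (F.fromℕ d)) ≡ κι σ * ι (+ m) - ι k * ι (+ suc N′)
        u-last = ι-u (F.fromℕ d) (lookup-∷ʳ-last x (+ m)) (lookup-∷ʳ-last q̂ (+ suc N′))

      -- Compares the two coordinate systems of a lattice point: that of the cone seen from `q` and
      -- that of the lattice basis. It turns sign conditions into integer inequalities.
      co-lattice : ∀ {v} → v ∈ σ → κι σ * co σ (seen m x) v ≡ ι (gap σ f k v)
      co-lattice = coord-unique (facet∈K σ∈) {λ v → κι σ * co σ (seen m x) v} {ι ∘ gap σ f k} (λ j → trans (sum-cong σ (λ v → *-assoc (κι σ) (co σ (seen m x) v) (pos v j)))
        (trans (sym (sum-*ˡ (κι σ) (λ v → co σ (seen m x) v * pos v j) σ)) (trans (cong (κι σ *_) (sym (co-spec σ∈ (seen m x) j))) (sym (trans (proj₂ cl j)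
          (trans (cong₂ (λ s t → s - t * q j) (ι-u (F.inject₁ j) (lookup-∷ʳ-inject x (+ m) j) (lookup-∷ʳ-inject q̂ (+ suc N′) j)) u-last)
            (shift (κι σ) (ι k) (embed x j) (embed q̂ j) (ι (+ m)) (ι (+ suc N′)) (q j) (q-q̂ j))))))))

      total-lattice : κι σ * (ι (+ m) - sumL (co σ (seen m x)) σ) ≡ ι (k ℤ.* + suc N′)
      total-lattice = trans (*-distribˡ-- (κι σ) (sumL (co σ (seen m x)) σ) (ι (+ m))) (trans (cong (λ t → κι σ * ι (+ m) - t) (trans (sum-*ˡ (κι σ) (co σ (seen m x)) σ) (trans (sum-cong-∈ σ co-lattice) (trans (proj₁ cl) u-last))))
        (trans (cong (_+_ (κι σ * ι (+ m))) (trans (neg-distrib-+ _ _) (cong (_+_ (- (κι σ * ι (+ m)))) (neg-involutive _)))) (trans (sym (+-assoc _ _ _)) (trans (cong (_+ ι k * ι (+ suc N′)) (-‿inverseʳ (κι σ * ι (+ m)))) (trans (+-identityˡ _) (sym (ι-* k (+ suc N′))))))))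

    pos-factor : ∀ {p q} → 0# < p → 0# < p * q → 0# < q
    pos-factor {p} {q} p>0 pq = ≰⇒> (λ le → ≤⇒≯ (subst (p * q ≤_) (zeroʳ p) (*-monoˡ-≤ (<⇒≤ p>0) le)) pq)

    nonneg-factor : ∀ {p q} → 0# < p → 0# ≤ p * q → 0# ≤ q
    nonneg-factor {p} {q} p>0 pq = ≮⇒≥ (λ lt → ≤⇒≯ pq (subst (p * q <_) (zeroʳ p) (*-monoˡ-< p>0 lt)))

    -- 1 where the half-open cone needs a strict inequality, which for integers is a shift by one.
    β : List V → V → ℤ
    β σ v with co σ c v <? 0#
    ... | yes _ = + 1
    ... | no _ = + 0

    dir : Bool → Vector
    dir true = c
    dir false = c⁻

    dir-generic : ∀ s → Generic (dir s)
    dir-generic true = generic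
    dir-generic false = c⁻-generic

    β′ : Bool → List V → V → ℤ
    β′ true σ v = β σ v
    β′ false σ v = + 1 ℤ.- β σ v

    β-spec : ∀ s {σ v} → σ ∈ Fs → v ∈ σ → (co σ (dir s) v < 0# × β′ s σ v ≡ + 1) ⊎ (0# < co σ (dir s) v × β′ s σ v ≡ + 0)
    β-spec true {σ} {v} m v∈ with co σ c v <? 0#
    ... | yes lt = inj₁ (lt , refl)
    ... | no ¬lt = inj₂ (≤∧≢⇒< (≮⇒≥ ¬lt) (λ e → co-generic generic m v∈ (sym e)) , refl)
    β-spec false {σ} {v} m v∈ with co σ c v <? 0#
    ... | yes lt = inj₂ (subst (0# <_) (sym (co-c⁻ m v∈)) (neg-0< lt) , refl)
    ... | no ¬lt = inj₁ (subst (_< 0#) (sym (co-c⁻ m v∈)) (neg-<0 (≤∧≢⇒< (≮⇒≥ ¬lt) (λ e → co-generic generic m v∈ (sym e)))) , refl)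

    β≤1′ : ∀ σ v → β σ v ℤ.≤ + 1
    β≤1′ σ v with co σ c v <? 0#
    ... | yes _ = ℤP.≤-refl
    ... | no _ = ℤ.+≤+ ℕ.z≤n

    β≥0′ : ∀ σ v → + 0 ℤ.≤ β σ v
    β≥0′ σ v with co σ c v <? 0#
    ... | yes _ = ℤ.+≤+ ℕ.z≤n
    ... | no _ = ℤP.≤-refl

    private
      β≤1-of : ∀ {b : ℤ} {A B : Set} → (A × b ≡ + 1) ⊎ (B × b ≡ + 0) → b ℤ.≤ + 1
      β≤1-of (inj₁ (_ , e)) = ℤP.≤-reflexive e
      β≤1-of (inj₂ (_ , e)) = ℤP.≤-trans (ℤP.≤-reflexive e) (ℤ.+≤+ ℕ.z≤n)

      -- Here s = K z and t = k c for one coordinate.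
      half-to : ∀ {κ y y′ : 𝔽} {s t b : ℤ} → 0# < κ → κ * y ≡ ι (s ℤ.- t) → (y′ < 0# × b ≡ + 1) ⊎ (0# < y′ × b ≡ + 0) → 0# < y ⊎ (y ≡ 0# × 0# < y′) → t ℤ.+ b ℤ.≤ s
      half-to {s = s} {t} κ>0 e spec (inj₁ lt) = ℤP.≤-trans (ℤP.+-monoʳ-≤ t (β≤1-of spec)) (ℤ-<⇒+1≤ {t} {s} (ι-reflects-0< (subst (0# <_) e (*-0< κ>0 lt))))
      half-to κ>0 e (inj₁ (lt , _)) (inj₂ (_ , gt)) = contradiction (<-trans lt gt) (<-irrefl refl)
      half-to {κ} {s = s} {t} κ>0 e (inj₂ (_ , b0)) (inj₂ (z , _)) = ℤP.≤-reflexive (trans (cong (λ b → t ℤ.+ b) b0) (trans (ℤP.+-identityʳ t) (sym (ℤP.i-j≡0⇒i≡j s t (ι-reflects-0 {s ℤ.- t} (trans (sym e) (trans (cong (κ *_) z) (zeroʳ κ))))))))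

      half-from : ∀ {κ y y′ : 𝔽} {s t b : ℤ} → 0# < κ → κ * y ≡ ι (s ℤ.- t) → (y′ < 0# × b ≡ + 1) ⊎ (0# < y′ × b ≡ + 0) → t ℤ.+ b ℤ.≤ s → 0# < y ⊎ (y ≡ 0# × 0# < y′)
      half-from {s = s} {t} κ>0 e (inj₁ (_ , b1)) le = inj₁ (pos-factor κ>0 (subst (0# <_) (sym e) (ι-0< (ℤ-+1≤⇒< {t} {s} (subst (λ b → t ℤ.+ b ℤ.≤ s) b1 le)))))
      half-from {s = s} {t} κ>0 e (inj₂ (gt , b0)) le with ≤-cases (nonneg-factor κ>0 (subst (0# ≤_) (sym e) (ι-0≤ (ℤP.i≤j⇒0≤j-i {t} {s} (subst (ℤ._≤ s) (ℤP.+-identityʳ t) (subst (λ b → t ℤ.+ b ℤ.≤ s) b0 le))))))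
      ... | inj₁ lt = inj₁ lt
      ... | inj₂ z = inj₂ (sym z , gt)

    Half-at : Bool → List V → (V → ℤ) → ℤ → V → Set
    Half-at s σ f k v = k ℤ.* cs σ v ℤ.+ β′ s σ v ℤ.≤ + suc (κ σ) ℤ.* f v

    half-open⇒half : ∀ s {m x σ f k} → σ ∈ Fs → Rep⁺ m x σ f k → HalfOpen (dir s) σ (seen m x) → ∀ {v} → v ∈ σ → Half-at s σ f k v
    half-open⇒half s {m} {x} {σ} {f} {k} σ∈ r ho {v} v∈ = half-to {κι σ} {co σ (seen m x) v} {co σ (dir s) v} {+ suc (κ σ) ℤ.* f v} {k ℤ.* cs σ v} {β′ s σ v} (ι-pos (κ σ)) (co-lattice {m} {x} {σ} {f} {k} σ∈ r v∈) (β-spec s σ∈ v∈) (ho v∈)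

    half⇒half-open : ∀ s {m x σ f k} → σ ∈ Fs → Rep⁺ m x σ f k → (∀ {v} → v ∈ σ → Half-at s σ f k v) → HalfOpen (dir s) σ (seen m x)
    half⇒half-open s {m} {x} {σ} {f} {k} σ∈ r h {v} v∈ = half-from {κι σ} {co σ (seen m x) v} {co σ (dir s) v} {+ suc (κ σ) ℤ.* f v} {k ℤ.* cs σ v} {β′ s σ v} (ι-pos (κ σ)) (co-lattice {m} {x} {σ} {f} {k} σ∈ r v∈) (β-spec s σ∈ v∈) (h v∈)

    D⁺ : List V → List (ℤ × ℤ)
    D⁺ σ = map (λ v → cs σ v , β σ v) σ

    top : List V → ℤ
    top σ = V.lookup (W σ) (F.fromℕ d)

    mk : List V → ℤ → List ℤ → Pt d
    mk σ k zs = V.tabulate (λ i → Coordinates.rep p̂ σ (W σ) zs k (F.inject₁ i))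

    Fs-unique : Unique Fs
    Fs-unique = UP.filter⁺ (λ σ → length σ ℕ.≟ d) K-unique

    D-length : ∀ {σ} → σ ∈ Fs → length (D⁺ σ) ≡ d
    D-length {σ} m = trans (length-map (λ v → cs σ v , β σ v) σ) (facet-length m)

    D-N : ∀ {σ} → σ ∈ Fs → Cell.csum (κ σ) (top σ) (D⁺ σ) ℤ.+ Cell.K (κ σ) (top σ) ℤ.* top σ ≡ + suc N′
    D-N {σ} m = trans (cong (λ t → t ℤ.+ + suc (κ σ) ℤ.* top σ) (trans (ℤSums.sum-map proj₁ (λ v → cs σ v , β σ v) σ) (sym (ℤSums.sum-map id (cs σ) σ))))
      (trans (ℤP.+-comm (ℤSums.sumL id (map (cs σ) σ)) (+ suc (κ σ) ℤ.* top σ)) (trans (sym (rep-last σ (W σ) (cs σ) (+ suc (κ σ)))) (trans (FacetBasis.apex (basis m) (F.fromℕ d)) (lookup-∷ʳ-last q̂ (+ suc N′)))))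

    β≥0 : ∀ {σ} → σ ∈ Fs → All (λ p → + 0 ℤ.≤ proj₂ p) (D⁺ σ)
    β≥0 {σ} m = AllP.map⁺ (All.tabulate (λ {v} _ → β≥0′ σ v))

    β≤1 : ∀ {σ} → σ ∈ Fs → All (λ p → proj₂ p ℤ.≤ + 1) (D⁺ σ)
    β≤1 {σ} m = AllP.map⁺ (All.tabulate (λ {v} _ → β≤1′ σ v))

    open Counting d Fs Fs-unique κ top D⁺ N′ D-length D-N β≥0 β≤1 mk using (Located; D; H; module Reciprocity) renaming (a to cells)

    D-map : ∀ s σ → D s σ ≡ map (λ v → cs σ v , β′ s σ v) σ
    D-map true σ = refl
    D-map false σ = sym (LP.map-∘ σ)

    private
      pointwise⁺ : ∀ {A B : Set} {R : A → B → Set} {g : V → A} {f : V → B} σ → (∀ {v} → v ∈ σ → R (g v) (f v)) → Pointwise R (map g σ) (map f σ)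
      pointwise⁺ [] h = []
      pointwise⁺ (v ∷ σ) h = h (here refl) ∷ pointwise⁺ σ (λ k → h (there k))

      pointwise⁻ : ∀ {A B : Set} {R : A → B → Set} {g : V → A} {f : V → B} σ → Pointwise R (map g σ) (map f σ) → ∀ {v} → v ∈ σ → R (g v) (f v)
      pointwise⁻ (v ∷ σ) (r ∷ _) (here refl) = r
      pointwise⁻ (v ∷ σ) (_ ∷ rs) (there k) = pointwise⁻ σ rs k

    LevelRel : ℤ → List V → ℤ × ℤ → ℤ → Set
    LevelRel k σ p z = k ℤ.* proj₁ p ℤ.+ proj₂ p ℤ.≤ + suc (κ σ) ℤ.* z

    -- The geometric counterpart of `Located`: existence and uniqueness of half-open cones apply to
    -- this form, the counting to the other.
    record Position (s : Bool) (m : ℕ) (x : Pt d) (σ : List V) (k : ℤ) (zs : List ℤ) : Set where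
      field
        σ∈ : σ ∈ Fs
        f : V → ℤ
        zs≡ : zs ≡ map f σ
        coords : Rep⁺ m x σ f k
        half-open : HalfOpen (dir s) σ (seen m x)

    position⇒located : ∀ {s m x σ k zs} → Position s m x σ k zs → Located s m x σ k zs
    position⇒located {s} {m} {x} {σ} {k} p = record
      { facet = σ∈
      ; half = subst₂ (Pointwise (LevelRel k σ)) (sym (D-map s σ)) (sym zs≡) (pointwise⁺ {R = LevelRel k σ} {g = λ v → cs σ v , β′ s σ v} {f = f} σ (half-open⇒half s {m} {x} {σ} {f} {k} σ∈ coords half-open))
      ; height = trans (cong (λ t → k ℤ.* top σ ℤ.+ ℤSums.sumL id t) zs≡) (trans (sym (rep-last σ (W σ) f k)) (trans (coords (F.fromℕ d)) (lookup-∷ʳ-last x (+ m))))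
      ; image = trans (cong (mk σ k) zs≡) (vec-ext (λ i → trans (lookup∘tabulate (λ i → Coordinates.rep p̂ σ (W σ) (map f σ) k (F.inject₁ i)) i) (trans (rep-map σ (W σ) f k (F.inject₁ i)) (trans (coords (F.inject₁ i)) (lookup-∷ʳ-inject x (+ m) i))))) }
      where open Position p

    located⇒position : ∀ {s m x σ k zs} → Located s m x σ k zs → Position s m x σ k zs
    located⇒position {s} {m} {x} {σ} {k} {zs} l = record { σ∈ = facet ; f = f ; zs≡ = sym zs≡ ; coords = coords
        ; half-open = half⇒half-open s {m} {x} {σ} {f} {k} facet coords (pointwise⁻ {R = LevelRel k σ} {g = λ v → cs σ v , β′ s σ v} {f = f} σ (subst₂ (Pointwise (LevelRel k σ)) (D-map s σ) (sym zs≡) half)) }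
      where
      open Located l
      f : V → ℤ
      f = at σ zs
      zs≡ : map f σ ≡ zs
      zs≡ = map-at σ zs (cone-unique (facet∈K facet)) (trans (sym (Pointwise-length half)) (trans (cong length (D-map s σ)) (length-map (λ v → cs σ v , β′ s σ v) σ)))
      coords : Rep⁺ m x σ f k
      coords r = at-row (init-or-last r)
       where
       at-row : ∀ {r} → (∃[ i ] r ≡ F.inject₁ i) ⊎ r ≡ F.fromℕ d → rep σ (W σ) f k r ≡ at-height m x r
       at-row (inj₂ refl) = trans (rep-last σ (W σ) f k) (trans (cong (λ t → k ℤ.* top σ ℤ.+ ℤSums.sumL id t) zs≡) (trans height (sym (lookup-∷ʳ-last x (+ m)))))
       at-row (inj₁ (i , refl)) = trans (sym (rep-map σ (W σ) f k (F.inject₁ i))) (trans (cong (λ t → Coordinates.rep p̂ σ (W σ) t k (F.inject₁ i)) zs≡)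
        (trans (sym (lookup∘tabulate (λ i → Coordinates.rep p̂ σ (W σ) zs k (F.inject₁ i)) i)) (trans (cong (λ t → V.lookup t i) image) (sym (lookup-∷ʳ-inject x (+ m) i)))))

    locate : ∀ s m x → ∃[ σ ] ∃[ k ] ∃[ zs ] Located s m x σ k zs
    locate s m x = use (half-open-exists (dir-generic s) (seen m x))
      where
      use : ∃[ σ ] σ ∈ Fs × HalfOpen (dir s) σ (seen m x) → ∃[ σ ] ∃[ k ] ∃[ zs ] Located s m x σ k zs
      use (σ , σ∈ , ho) = let f , k , e = FacetBasis.coordinates (basis σ∈) (at-height m x) in
        σ , k , map f σ , position⇒located {s} (record { σ∈ = σ∈ ; f = f ; zs≡ = refl ; coords = e ; half-open = ho })

    located-unique : ∀ s m {x σ k zs σ′ k′ zs′} → Located s m x σ k zs → Located s m x σ′ k′ zs′ → σ ≡ σ′ × k ≡ k′ × zs ≡ zs′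
    located-unique s m {x} {σ} {k} {zs} {σ′} {k′} {zs′} l l′ = same (located⇒position {s} l) (located⇒position {s} l′)
      where
      same : Position s m x σ k zs → Position s m x σ′ k′ zs′ → σ ≡ σ′ × k ≡ k′ × zs ≡ zs′
      same p p′ with half-open-unique {dir s} {σ} {σ′} {seen m x} (Position.σ∈ p) (Position.σ∈ p′) (Position.half-open p) (Position.half-open p′)
      ... | refl with FacetBasis.unique (basis (Position.σ∈ p)) {Position.f p} {k} {Position.f p′} {k′} (λ r → trans (Position.coords p r) (sym (Position.coords p′ r)))
      ...   | f≡ , k≡ = refl , k≡ , trans (Position.zs≡ p) (trans (LP.map-cong-local (All.tabulate f≡)) (sym (Position.zs≡ p′)))

    -- The level k is a positive multiple of the distance ι m - Σ co of x from the boundary of mP.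
    module LevelOf {s m x σ k zs} (l : Located s m x σ k zs) where
      open Position (located⇒position {s} l)
      rep-seen : Rep σ (co σ (seen m x)) (seen m x)
      rep-seen = facet∈K σ∈ , half-open⇒0≤ {dir s} {σ} {seen m x} half-open , co-spec σ∈ (seen m x)
      distance : 𝔽
      distance = ι (+ m) - sumL (co σ (seen m x)) σ
      total : κι σ * distance ≡ ι (k ℤ.* + suc N′)
      total = total-lattice {m} {x} {σ} {f} {k} σ∈ coords
      0≤k : 0# ≤ distance → + 0 ℤ.≤ k
      0≤k le = ℤP.*-cancelʳ-≤-pos (+ 0) k (+ suc N′) (ι-reflects-0≤ {k ℤ.* + suc N′} (subst (0# ≤_) total (*-0≤ (<⇒≤ (ι-pos (κ σ))) le)))
      0<k : 0# < distance → + 0 ℤ.< k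
      0<k lt = ℤP.*-cancelʳ-<-nonNeg {+ 0} {k} (+ suc N′) (ι-reflects-0< {k ℤ.* + suc N′} (subst (0# <_) total (*-0< (ι-pos (κ σ)) lt)))
      0≤distance : + 0 ℤ.≤ k → 0# ≤ distance
      0≤distance le = nonneg-factor (ι-pos (κ σ)) (subst (0# ≤_) (sym total) (ι-0≤ (ℤP.*-monoʳ-≤-nonNeg (+ suc N′) {+ 0} {k} le)))
      0<distance : + 0 ℤ.< k → 0# < distance
      0<distance lt = pos-factor (ι-pos (κ σ)) (subst (0# <_) (sym total) (ι-0< (ℤP.*-monoʳ-<-pos (+ suc N′) {+ 0} {k} lt)))

    -- `Interior` does not refer to the direction, so it is a common description of the points of
    -- positive level for both choices.
    Inside Interior : ℕ → Pt d → Set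
    Inside m x = Dilated (ι (+ m)) (embed x)
    Interior m x = ∃[ σ ] ∃[ μ ] Rep σ μ (seen m x) × sumL μ σ < ι (+ m)

    inside⇔ : ∀ {m x σ k zs} → Located true m x σ k zs → Inside m x ⇔ (+ 0 ℤ.≤ k)
    inside⇔ {m} {x} {σ} l = mk⇔ (λ dil → 0≤k (≤⇒0≤- (dilated⇒≤ {ι (+ m)} {embed x} {σ} {co σ (seen m x)} (ι-0≤ (ℤ.+≤+ ℕ.z≤n)) rep-seen dil)))
        (λ le → ≤⇒dilated {ι (+ m)} {embed x} {σ} {co σ (seen m x)} (ι-0≤ (ℤ.+≤+ ℕ.z≤n)) rep-seen (0≤-⇒≤ (0≤distance le)))
      where open LevelOf {true} l

    interior⇔ : ∀ {s m x σ k zs} → Located s m x σ k zs → Interior m x ⇔ (+ 1 ℤ.≤ k)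
    interior⇔ {s} {m} {x} {σ} {k} l = mk⇔ to (λ le → σ , co σ (seen m x) , rep-seen , 0<-⇒< (0<distance (ℤP.suc[i]≤j⇒i<j {+ 0} {k} le)))
      where
      open LevelOf {s} l
      to : Interior m x → + 1 ℤ.≤ k
      to (τ , μ , r , lt) = ℤP.i<j⇒suc[i]≤j {+ 0} {k} (0<k (<⇒0<- (subst (_< ι (+ m)) (total-unique {τ} {σ} {μ} {co σ (seen m x)} {seen m x} r rep-seen) lt)))

    open FiniteSums using (χ; χ-ind)

    R-count : ∀ σ → ℤSums.sumL (β σ) σ ≡ + length (R σ)
    R-count σ = go σ
      where
      go : ∀ τ → ℤSums.sumL (β σ) τ ≡ + length (filter (λ v → co σ c v <? 0#) τ)
      go [] = refl
      go (v ∷ τ) with co σ c v <? 0#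
      ... | yes _ = cong (λ t → + 1 ℤ.+ t) (go τ)
      ... | no _ = trans (ℤP.+-identityˡ _) (go τ)

    -- At level 0 the lowest admissible coordinates are the β themselves, so the height counts the
    -- open faces.
    level-zero : ∀ {σ} → Cell.e (κ σ) (top σ) (+ 0) (D⁺ σ) ≡ + length (R σ)
    level-zero {σ} = trans (ℤP.+-identityˡ (ℤSums.sumL (Cell.start (κ σ) (top σ) (+ 0)) (D⁺ σ))) (trans (ℤSums.sum-map (Cell.start (κ σ) (top σ) (+ 0)) (λ v → cs σ v , β σ v) σ)
      (trans (ℤSums.sum-cong σ (λ v → trans (cong (Cell.ceil (κ σ) (top σ)) (ℤP.+-identityˡ (β σ v))) (ceil-β v))) (R-count σ)))
      where
      ceil-β : ∀ v → Cell.ceil (κ σ) (top σ) (β σ v) ≡ β σ v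
      ceil-β v with co σ c v <? 0#
      ... | yes _ = Cell.ceil-unique (κ σ) (top σ) (+ 1) (+ 1) (ℤP.≤-trans (ℤ.+≤+ (ℕ.s≤s ℕ.z≤n)) (ℤP.≤-reflexive (sym (ℤP.*-identityʳ (+ suc (κ σ)))))) (ℤP.≤-reflexive (ℤP.*-identityʳ (+ suc (κ σ))))
      ... | no _ = Cell.ceil-unique (κ σ) (top σ) (+ 0) (+ 0) (ℤP.≤-reflexive (sym (ℤP.*-zeroʳ (+ suc (κ σ))))) (ℤP.≤-trans (ℤP.≤-reflexive (ℤP.*-zeroʳ (+ suc (κ σ)))) (ℤ.+≤+ ℕ.z≤n))

    H≡ : ∀ l → H l ≡ + length (filter (λ σ → length (R σ) ℕ.≟ l) Fs)
    H≡ l = trans (ℤSums.sum-cong Fs (λ σ → trans (cong (λ t → χ t l) (level-zero {σ})) (χ-ind (length (R σ)) l))) (sum-ind (length ∘ R) l Fs)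

    module Ehrhart (f : ℕ → ℤ) (counts : ∀ m (xs : List (Pt d)) → Unique xs → (∀ x → x ∈ xs ⇔ Inside m x) → + length xs ≡ f m) where
      private
        module Rec = Reciprocity Inside Interior f counts locate located-unique inside⇔ interior⇔

      a : ℕ → ℤ
      a = cells true 0

      f≡S^a : ∀ m → f m ≡ Sequences.S^ d a m
      f≡S^a = Rec.f≡S^a

      reciprocity : ∀ l → l ℕ.≤ d → a (l ℕ.+ d ℕ.* suc N′) ℤ.+ + length (filter (λ σ → length (R σ) ℕ.≟ (d ∸ l)) Fs) ≡ a l ℤ.+ a (d ∸ l)
      reciprocity l le = trans (cong (λ t → a (l ℕ.+ d ℕ.* suc N′) ℤ.+ t) (sym (H≡ (d ∸ l)))) (Rec.reciprocity l le)

-- From reciprocity to the inequalities for δ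

module DeltaVector (d : ℕ) (δ a : ℕ → ℤ) (h : ℕ → ℕ) (N′ : ℕ)
    (ehrhart : ∀ m → sumTo d (λ i → δ i ℤ.* + ((m ℕ.+ d ∸ i) C d)) ≡ Sequences.S^ d a m)
    (reciprocity : ∀ l → l ℕ.≤ d → a (l ℕ.+ d ℕ.* suc N′) ℤ.+ + h (d ∸ l) ≡ a l ℤ.+ a (d ∸ l)) where
  open ≡
  open import Data.Integer using (_+_; _*_; -_; _-_; _≤_)
  open ℤSums
  open Sequences
  open FiniteSums

  S^-suc : ∀ n (u : ℕ → ℤ) m → S^ (suc n) u m ≡ S^ n (S u) m
  S^-suc zero u m = refl
  S^-suc (suc n) u m = S-cong m (λ l _ → S^-suc n u l)

  sumTo≡ : ∀ n f → sumTo n f ≡ Σ< (suc n) f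
  sumTo≡ n f = trans (go f (upTo (suc n))) (sum-upTo f (suc n))
    where
    go : ∀ f xs → L.foldr _+_ (+ 0) (map f xs) ≡ sumL f xs
    go f [] = refl
    go f (x ∷ xs) = cong (λ t → f x + t) (go f xs)

  -- δ continued by zero beyond `d`.
  δ̃ : ℕ → ℤ
  δ̃ l = sumL (λ i → δ i * ind i l) (upTo (suc d))

  δ̃-≤ : ∀ {l} → l ℕ.≤ d → δ̃ l ≡ δ l
  δ̃-≤ {l} le = trans (sum-single {f = λ i → δ i * ind i l} (UP.upTo⁺ (suc d)) (∈-upTo⁺ (ℕ.s≤s le)) (λ {i} _ ne → trans (cong (δ i *_) (ind-≢ ne)) (ℤP.*-zeroʳ (δ i)))) (trans (cong (δ l *_) (ind-≡ l)) (ℤP.*-identityʳ (δ l)))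

  δ̃-> : ∀ {l} → d ℕ.< l → δ̃ l ≡ + 0
  δ̃-> {l} lt = sum-zero-∈ (upTo (suc d)) (λ {i} m → trans (cong (δ i *_) (ind-≢ (λ e → ℕP.<⇒≱ (subst (ℕ._< suc d) e (∈-upTo⁻ m)) lt))) (ℤP.*-zeroʳ (δ i)))

  binomial-ind : ∀ {i} m → i ℕ.≤ d → + ((m ℕ.+ d ∸ i) C d) ≡ S^ (suc d) (ind i) m
  binomial-ind {i} m i≤d with i ℕ.≤? m
  ... | yes i≤m = trans (cong (λ t → + (t C d)) (ℕP.+-∸-comm d i≤m)) (trans (sym (S^-ind d i (m ∸ i))) (cong (S^ (suc d) (ind i)) (ℕP.m+[n∸m]≡n i≤m)))
  ... | no i≰m = trans (cong +_ (k>n⇒nCk≡0 (ℕP.+-cancelʳ-< i (m ℕ.+ d ∸ i) d (subst (ℕ._< d ℕ.+ i) (sym (ℕP.m∸n+n≡m (ℕP.≤-trans i≤d (ℕP.m≤n+m d m)))) (subst (ℕ._< d ℕ.+ i) (ℕP.+-comm d m) (ℕP.+-monoʳ-< d (ℕP.≰⇒> i≰m))))))) (sym (S^-ind-below (suc d) (ℕP.≰⇒> i≰m)))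

  -- The Ehrhart series is δ(t) / (1 - t)^(d + 1) and also a(t) / (1 - t)^d, and `d`-fold partial
  -- summation can be undone.
  a≡ : ∀ m → a m ≡ S δ̃ m
  a≡ = S^-injective d (λ m → trans (sym (ehrhart m)) (trans (sumTo≡ d (λ i → δ i * + ((m ℕ.+ d ∸ i) C d))) (trans (sym (sum-upTo (λ i → δ i * + ((m ℕ.+ d ∸ i) C d)) (suc d)))
    (trans (sum-cong-∈ (upTo (suc d)) (λ {i} k → trans (cong (δ i *_) (binomial-ind m (ℕP.≤-pred (∈-upTo⁻ k)))) (sym (S^-scale (suc d) (δ i) (ind i) m))))
      (trans (sym (S^-sum (suc d) (λ i l → δ i * ind i l) (upTo (suc d)) m)) (S^-suc d δ̃ m))))))

  a-suc : ∀ {m} → suc m ℕ.≤ d → a (suc m) ≡ a m + δ (suc m)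
  a-suc {m} le = trans (a≡ (suc m)) (cong₂ _+_ (sym (a≡ m)) (δ̃-≤ le))

  a-above : ∀ j → a (d ℕ.+ j) ≡ a d
  a-above zero = cong a (ℕP.+-identityʳ d)
  a-above (suc j) = trans (cong a (ℕP.+-suc d j)) (trans (a≡ (suc (d ℕ.+ j))) (trans (cong₂ _+_ (sym (a≡ (d ℕ.+ j))) (δ̃-> (ℕ.s≤s (ℕP.m≤m+n d j)))) (trans (ℤP.+-identityʳ _) (a-above j))))

  -- In `reciprocity` at `d - k` the shifted index is at least `d`, where `a` has become constant.
  symmetry : ∀ {k} → k ℕ.≤ d → a d + + h k ≡ a (d ∸ k) + a k
  symmetry {k} le = trans (cong₂ (λ s t → s + + h t) (sym (trans (cong a (trans (cong (d ∸ k ℕ.+_) (ℕP.*-suc d N′)) (trans (sym (ℕP.+-assoc (d ∸ k) d (d ℕ.* N′))) (trans (cong (ℕ._+ d ℕ.* N′) (ℕP.+-comm (d ∸ k) d)) (ℕP.+-assoc d (d ∸ k) (d ℕ.* N′)))))) (a-above (d ∸ k ℕ.+ d ℕ.* N′)))) (sym (ℕP.m∸[m∸n]≡n le)))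
    (trans (reciprocity (d ∸ k) (ℕP.m∸n≤m d k)) (cong (λ t → a (d ∸ k) + a t) (ℕP.m∸[m∸n]≡n le)))

  descend : ∀ {i} → suc i ℕ.≤ d → a (d ∸ i) ≡ a (d ∸ suc i) + δ (d ∸ i)
  descend {i} le = trans (cong a e) (trans (a-suc (ℕP.≤-trans (ℕP.≤-reflexive (sym e)) (ℕP.m∸n≤m d i))) (cong (λ t → a (d ∸ suc i) + δ t) (sym e)))
    where
    e : d ∸ i ≡ suc (d ∸ suc i)
    e = ℕP.+-∸-assoc 1 le

  -- The relations `symmetry` for `i` and for `suc i`, subtracted from each other.
  difference : ∀ {i} → suc i ℕ.≤ d → δ (suc i) + + h i ≡ δ (d ∸ i) + + h (suc i)
  difference {i} le = ℤ-cancelˡ (a d + a i + a (d ∸ suc i)) _ _ (trans (eq₁ (a d) (a i) (a (d ∸ suc i)) (δ (suc i)) (+ h i))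
    (trans (cong₂ (λ s t → s + t + a (d ∸ suc i)) (trans (symmetry (ℕP.≤-trans (ℕP.n≤1+n i) le)) (cong (λ t → t + a i) (descend le))) (sym (a-suc le)))
      (trans (eq₂ (a (d ∸ suc i)) (δ (d ∸ i)) (a i) (a (suc i))) (trans (cong (λ t → t + (a (d ∸ suc i) + (δ (d ∸ i) + a i))) (sym (symmetry le))) (eq₃ (a d) (+ h (suc i)) (a (d ∸ suc i)) (δ (d ∸ i)) (a i))))))
    where
    eq₁ : ∀ v x y e h → v + x + y + (e + h) ≡ v + h + (x + e) + y
    eq₁ = solve-∀
    eq₂ : ∀ y e x z → y + e + x + z + y ≡ y + z + (y + (e + x))
    eq₂ = solve-∀
    eq₃ : ∀ v h y e x → v + h + (y + (e + x)) ≡ v + x + y + (e + h)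
    eq₃ = solve-∀

  tail : ∀ {i} → suc i ℕ.≤ d → a (d ∸ suc i) + Σ< (suc i) (λ j → δ (d ∸ j)) ≡ a d
  tail {zero} le = trans (cong (λ t → a (d ∸ 1) + t) (ℤP.+-identityʳ (δ d))) (sym (descend le))
  tail {suc i} le = trans (cong (λ t → a (d ∸ suc (suc i)) + t) (trans (Σ<-last (suc i) (λ j → δ (d ∸ j))) (ℤP.+-comm (Σ< (suc i) (λ j → δ (d ∸ j))) (δ (d ∸ suc i)))))
    (trans (sym (ℤP.+-assoc (a (d ∸ suc (suc i))) (δ (d ∸ suc i)) (Σ< (suc i) (λ j → δ (d ∸ j))))) (trans (cong (λ t → t + Σ< (suc i) (λ j → δ (d ∸ j))) (sym (descend le))) (tail (ℕP.≤-trans (ℕP.n≤1+n (suc i)) le))))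

  head : ∀ {i} → i ℕ.≤ d → Σ< (suc i) δ ≡ a i
  head {zero} le = trans (ℤP.+-identityʳ (δ 0)) (sym (trans (a≡ 0) (δ̃-≤ le)))
  head {suc i} le = trans (Σ<-last (suc i) δ) (trans (cong (λ t → t + δ (suc i)) (head (ℕP.≤-trans (ℕP.n≤1+n i) le))) (sym (a-suc le)))

  inequalities : h 0 ≡ 1 → ∀ i → suc i ℕ.≤ d → h i ℕ.≤ h (suc i) → h (suc i) ℕ.≤ (h 1 ℕ.+ i) C suc i →
    (δ (d ∸ i) ≤ δ (suc i)) × (sumTo (suc i) δ ≤ sumTo i (λ j → δ (d ∸ j)) + binomℤ (δ 1 - δ d + + suc i) (suc i))
  inequalities h0 i le inc upper = first , second
    where
    first : δ (d ∸ i) ≤ δ (suc i)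
    first = ℤP.0≤i-j⇒j≤i (ℤP.≤-trans (ℤP.i≤j⇒0≤j-i (ℤ.+≤+ inc)) (ℤP.≤-reflexive (trans (sym (eq (δ (d ∸ i)) (+ h (suc i)) (+ h i))) (trans (cong (λ t → t - + h i - δ (d ∸ i)) (sym (difference le))) (eq′ (δ (suc i)) (+ h i) (δ (d ∸ i)))))))
      where
      eq : ∀ e x y → e + x - y - e ≡ x - y
      eq = solve-∀
      eq′ : ∀ e y g → e + y - y - g ≡ e - g
      eq′ = solve-∀
    -- By `difference` at 0 and `h 0 ≡ 1`, the number `δ 1 - δ d + 1` is `h 1`; the binomial thus
    -- counts monomials in `h 1` variables.
    degree : δ 1 - δ d + + suc i ≡ + (h 1 ℕ.+ i)
    degree = trans (eq (δ 1) (δ d) (+ 1) (+ i)) (trans (cong (λ t → t - δ d + + i) (trans (cong (λ t → δ 1 + + t) (sym h0)) (difference {0} (ℕP.≤-trans (ℕ.s≤s ℕ.z≤n) le)))) (eq′ (δ d) (+ h 1) (+ i)))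
      where
      eq : ∀ x y o j → x - y + (o + j) ≡ x + o - y + j
      eq = solve-∀
      eq′ : ∀ y x j → y + x - y + j ≡ x + j
      eq′ = solve-∀
    -- The initial sum is `a (suc i)` and the final one is `a d - a (d ∸ suc i)`; by `symmetry` they
    -- differ by `h (suc i)`.
    split : sumTo (suc i) δ ≡ sumTo i (λ j → δ (d ∸ j)) + + h (suc i)
    split = ℤ-cancelˡ (a (d ∸ suc i)) _ _ (trans (cong (λ t → a (d ∸ suc i) + t) (trans (sumTo≡ (suc i) δ) (head le))) (trans (sym (symmetry le))
      (trans (cong (λ t → t + + h (suc i)) (trans (sym (tail le)) (cong (λ t → a (d ∸ suc i) + t) (sym (sumTo≡ i (λ j → δ (d ∸ j))))))) (ℤP.+-assoc (a (d ∸ suc i)) (sumTo i (λ j → δ (d ∸ j))) (+ h (suc i))))))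
    second : sumTo (suc i) δ ≤ sumTo i (λ j → δ (d ∸ j)) + binomℤ (δ 1 - δ d + + suc i) (suc i)
    second = ℤP.≤-trans (ℤP.≤-reflexive split) (ℤP.+-monoʳ-≤ (sumTo i (λ j → δ (d ∸ j))) (ℤP.≤-trans (ℤ.+≤+ upper) (ℤP.≤-reflexive (sym (cong (λ t → binomℤ t (suc i)) degree)))))

-- Rational convex hulls and the given triangulation

ℚ-field : OrderedField
ℚ-field = record
  { 𝔽 = ℚ ; _+_ = ℚ._+_ ; _*_ = ℚ._*_ ; -_ = ℚ.-_ ; 0# = 0ℚ ; 1# = 1ℚ
  ; isCommutativeRing = ℚP.+-*-isCommutativeRing
  ; _<_ = ℚ._<_ ; _≤_ = ℚ._≤_ ; <-cmp = ℚP.<-cmp ; <-trans = ℚP.<-trans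
  ; ≤⇒≯ = λ le lt → ℚP.<-irrefl ≡.refl (ℚP.<-≤-trans lt le) ; ≮⇒≥ = ℚP.≮⇒≥
  ; +-monoˡ-< = λ r lt → ℚP.+-monoˡ-< r lt
  ; *-0< = λ {p} {q} p>0 q>0 → ℚP.positive⁻¹ (p ℚ.* q) {{ℚP.pos*pos⇒pos p {{ℚ.positive p>0}} q {{ℚ.positive q>0}}}}
  ; 0<1 = ℚP.positive⁻¹ 1ℚ
  ; 1/′ = λ {p} p≢0 → (ℚ.1/ p) {{ℚ.≢-nonZero p≢0}} , ℚP.*-inverseʳ p {{ℚ.≢-nonZero p≢0}} }

module ℤinℚ where
  open ≡

  of : ℤ → ℚ
  of z = z ℚ./ 1

  of-ᵘ : ∀ z → ℚ.toℚᵘ (of z) ℚᵘ.≃ ℚᵘ.mkℚᵘ z 0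
  of-ᵘ z = ℚP.toℚᵘ-fromℚᵘ (ℚᵘ.mkℚᵘ z 0)

  of-+ : ∀ i j → of (i ℤ.+ j) ≡ of i ℚ.+ of j
  of-+ i j = ℚP.toℚᵘ-injective (ℚᵘP.≃-trans (of-ᵘ (i ℤ.+ j)) (ℚᵘP.≃-trans (ℚᵘ.*≡* (eq i j (+ 1))) (ℚᵘP.≃-sym (ℚᵘP.≃-trans (ℚP.toℚᵘ-homo-+ (of i) (of j)) (ℚᵘP.+-cong (of-ᵘ i) (of-ᵘ j))))))
    where
    eq : ∀ i j o → (i ℤ.+ j) ℤ.* (o ℤ.* o) ≡ (i ℤ.* o ℤ.+ j ℤ.* o) ℤ.* o
    eq = solve-∀

  of-* : ∀ i j → of (i ℤ.* j) ≡ of i ℚ.* of j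
  of-* i j = ℚP.toℚᵘ-injective (ℚᵘP.≃-trans (of-ᵘ (i ℤ.* j)) (ℚᵘP.≃-sym (ℚᵘP.≃-trans (ℚP.toℚᵘ-homo-* (of i) (of j)) (ℚᵘP.*-cong (of-ᵘ i) (of-ᵘ j)))))

  of-pos : ∀ n → 0ℚ ℚ.< of (+ suc n)
  of-pos n = ℚP.toℚᵘ-cancel-< (ℚᵘP.<-respʳ-≃ (ℚᵘP.≃-sym (of-ᵘ (+ suc n))) (ℚᵘP.positive⁻¹ (ℚᵘ.mkℚᵘ (+ suc n) 0)))

  of-den : ∀ p → of (ℚ.denominator p) ℚ.* p ≡ of (ℚ.numerator p)
  of-den p@record{} = ℚP.toℚᵘ-injective (ℚᵘP.≃-trans (ℚP.toℚᵘ-homo-* (of (ℚ.denominator p)) p) (ℚᵘP.≃-trans (ℚᵘP.*-cong (of-ᵘ (ℚ.denominator p)) (ℚᵘP.≃-refl {ℚ.toℚᵘ p}))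
    (ℚᵘP.≃-trans (ℚᵘ.*≡* (eq (ℚ.denominator p) (ℚ.numerator p) (+ 1))) (ℚᵘP.≃-sym (of-ᵘ (ℚ.numerator p))))))
    where
    eq : ∀ a n o → (a ℤ.* n) ℤ.* o ≡ n ℤ.* (o ℤ.* a)
    eq = solve-∀

  clear : ∀ {d} (q : QPt d) → ∃[ N ] ∃[ q̂ ] (∀ j → of (+ suc N) ℚ.* V.lookup q j ≡ of (V.lookup {n = d} q̂ j))
  clear V.[] = 0 , V.[] , λ ()
  clear (p V.∷ q) with clear q
  -- One less than the product of the new denominator and `suc N`.
  ... | N , q̂ , e = N ℕ.+ ℚ.denominator-1 p ℕ.* suc N , (+ suc N ℤ.* ℚ.numerator p) V.∷ V.map (ℚ.denominator p ℤ.*_) q̂ , λ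
    { F.zero → trans (cong (λ t → t ℚ.* p) (split (ℚ.denominator p) (+ suc N))) (trans (cong (λ t → t ℚ.* p) (ℚP.*-comm (of (ℚ.denominator p)) (of (+ suc N)))) (trans (ℚP.*-assoc (of (+ suc N)) (of (ℚ.denominator p)) p) (trans (cong (of (+ suc N) ℚ.*_) (of-den p)) (sym (of-* (+ suc N) (ℚ.numerator p))))))
    ; (F.suc j) → trans (cong (λ t → t ℚ.* V.lookup q j) (split (ℚ.denominator p) (+ suc N))) (trans (ℚP.*-assoc (of (ℚ.denominator p)) (of (+ suc N)) (V.lookup q j)) (trans (cong (of (ℚ.denominator p) ℚ.*_) (e j)) (trans (sym (of-* (ℚ.denominator p) (V.lookup q̂ j))) (cong of (sym (lookup-map j (ℚ.denominator p ℤ.*_) q̂)))))) }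
    where
    split : ∀ a b → of (a ℤ.* b) ≡ of a ℚ.* of b
    split = of-*

ℤ⊂ℚ : ℤ-Embedding ℚ-field
ℤ⊂ℚ = record { ι = ℤinℚ.of ; ι-+ = ℤinℚ.of-+ ; ι-* = ℤinℚ.of-* ; ι-pos = ℤinℚ.of-pos }

module Gather (O : OrderedField) where
  open ≡
  open FieldProperties O

  -- In `InConv` points may repeat and come in any order, so the coefficients at equal points are
  -- added up. Quantifying over all φ yields the total weight and every coordinate from one
  -- statement.
  gather : {I X : Set} (_≟_ : DecidableEquality I) (G : I → X) (is : List I) → Unique is → (ps : List (𝔽 × X)) → All (λ p → proj₂ p ∈ map G is) ps →
    Σ (I → 𝔽) λ w → (All (λ p → 0# ≤ proj₁ p) ps → ∀ i → 0# ≤ w i) × (∀ (φ : X → 𝔽) → sumL (λ p → proj₁ p * φ (proj₂ p)) ps ≡ sumL (λ i → w i * φ (G i)) is)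
  gather {I} _≟_ G is u [] [] = (λ _ → 0#) , (λ _ _ → ≤-refl) , λ φ → sym (sum-zero is (λ i → zeroˡ (φ (G i))))
  gather {I} _≟_ G is u ((c , x) ∷ ps) (m ∷ ms) with ∈-map⁻ G m | gather _≟_ G is u ps ms
  ... | i₀ , i₀∈ , refl | w , w≥0 , e = (λ i → bump i + w i) , (λ { (c≥0 ∷ nn) i → +-0≤ (bump≥0 c≥0 i) (w≥0 nn i) }) , λ φ →
      trans (cong (_+_ (c * φ (G i₀))) (e φ)) (sym (trans (sum-cong is (λ i → distribʳ (φ (G i)) (bump i) (w i))) (trans (sum-+ (λ i → bump i * φ (G i)) (λ i → w i * φ (G i)) is)
        (cong (_+ sumL (λ i → w i * φ (G i)) is) (trans (sum-single {f = λ i → bump i * φ (G i)} u i₀∈ (λ {i} _ ne → trans (cong (_* φ (G i)) (bump-≢ ne)) (zeroˡ (φ (G i))))) (cong (_* φ (G i₀)) bump-≡))))))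
    where
    bump : I → 𝔽
    bump i with i ≟ i₀
    ... | yes _ = c
    ... | no _ = 0#
    bump≥0 : 0# ≤ c → ∀ i → 0# ≤ bump i
    bump≥0 c≥0 i with i ≟ i₀
    ... | yes _ = c≥0
    ... | no _ = ≤-refl
    bump-≡ : bump i₀ ≡ c
    bump-≡ with i₀ ≟ i₀
    ... | yes _ = refl
    ... | no ne = contradiction refl ne
    bump-≢ : ∀ {i} → i ≢ i₀ → bump i ≡ 0#
    bump-≢ {i} ne with i ≟ i₀
    ... | yes q = contradiction q ne
    ... | no _ = refl

module ConvexHulls where
  open ≡
  open FieldProperties ℚ-field using (sumL; sum-cong; sum-map)
  open Gather ℚ-field

  pairs : {X : Set} → (X → ℚ) → List (ℚ × X) → ℚ
  pairs φ = sumL (λ p → proj₁ p ℚ.* φ (proj₂ p))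

  lookup-lincomb : ∀ {d} cs (vs : List (QPt d)) → ∀ j → V.lookup (lincomb cs vs) j ≡ pairs (λ v → V.lookup v j) (L.zip cs vs)
  lookup-lincomb [] vs j = lookup-replicate j 0ℚ
  lookup-lincomb (c ∷ cs) [] j = lookup-replicate j 0ℚ
  lookup-lincomb (c ∷ cs) (v ∷ vs) j = trans (lookup-zipWith ℚ._+_ j (c ·ᵥ v) (lincomb cs vs)) (cong₂ ℚ._+_ (lookup-map j (c ℚ.*_) v) (lookup-lincomb cs vs j))

  sumQ-pairs : ∀ {X : Set} cs (vs : List X) → length cs ≡ length vs → sumQ cs ≡ pairs (λ _ → 1ℚ) (L.zip cs vs)
  sumQ-pairs [] [] _ = refl
  sumQ-pairs (c ∷ cs) (v ∷ vs) l = cong₂ ℚ._+_ (sym (ℚP.*-identityʳ c)) (sumQ-pairs cs vs (suc-injective l))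

  zip-∈ : ∀ {X : Set} {S : List X} cs vs → All (_∈ S) vs → All (λ p → proj₂ p ∈ S) (L.zip {A = ℚ} cs vs)
  zip-∈ [] vs _ = []
  zip-∈ (c ∷ cs) [] _ = []
  zip-∈ (c ∷ cs) (v ∷ vs) (m ∷ ms) = m ∷ zip-∈ cs vs ms

  zip-≥0 : ∀ {X : Set} cs (vs : List X) → All (0ℚ ℚ.≤_) cs → All (λ p → 0ℚ ℚ.≤ proj₁ p) (L.zip cs vs)
  zip-≥0 [] vs _ = []
  zip-≥0 (c ∷ cs) [] _ = []
  zip-≥0 (c ∷ cs) (v ∷ vs) (m ∷ ms) = m ∷ zip-≥0 cs vs ms

  pairs-map : ∀ {I X : Set} (w : I → ℚ) (G : I → X) φ is → pairs φ (L.zip (map w is) (map G is)) ≡ sumL (λ i → w i ℚ.* φ (G i)) is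
  pairs-map w G φ [] = refl
  pairs-map w G φ (i ∷ is) = cong (ℚ._+_ (w i ℚ.* φ (G i))) (pairs-map w G φ is)

  sumQ-map : ∀ {I : Set} (w : I → ℚ) is → sumQ (map w is) ≡ sumL w is
  sumQ-map w [] = refl
  sumQ-map w (i ∷ is) = cong (ℚ._+_ (w i)) (sumQ-map w is)

  dot-· : ∀ {d} (a x : QPt d) → dot a x ≡ sumL (λ j → V.lookup a j ℚ.* V.lookup x j) (allFin d)
  dot-· V.[] V.[] = refl
  dot-· {suc d} (a V.∷ as) (x V.∷ xs) = cong (ℚ._+_ (a ℚ.* x)) (trans (dot-· as xs) (trans (sym (sum-map (λ j → V.lookup (a V.∷ as) j ℚ.* V.lookup (x V.∷ xs) j) F.suc (allFin d))) (cong (sumL (λ j → V.lookup (a V.∷ as) j ℚ.* V.lookup (x V.∷ xs) j)) (LP.map-tabulate id F.suc))))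

  Weights : {I : Set} {d : ℕ} → (I → QPt d) → List I → QPt d → Set
  Weights {I} G is x = Σ (I → ℚ) λ w → (∀ {i : I} → i ∈ is → 0ℚ ℚ.≤ w i) × sumL w is ≡ 1ℚ × (∀ j → sumL (λ i → w i ℚ.* V.lookup (G i) j) is ≡ V.lookup x j)

  conv⇒weights : ∀ {I : Set} {d} (_≟_ : DecidableEquality I) (G : I → QPt d) is {x} → Unique is → InConv (map G is) x → Weights G is x
  conv⇒weights _≟_ G is {x} u (cs , vs , l , ms , cs≥0 , s , e) with gather _≟_ G is u (L.zip cs vs) (zip-∈ cs vs ms)
  ... | w , w≥0 , same = w , (λ {i} _ → w≥0 (zip-≥0 cs vs cs≥0) i)
      , trans (sum-cong is (λ i → sym (ℚP.*-identityʳ (w i)))) (trans (sym (same (λ _ → 1ℚ))) (trans (sym (sumQ-pairs cs vs l)) s))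
      , λ j → trans (sym (same (λ v → V.lookup v j))) (trans (sym (lookup-lincomb cs vs j)) (cong (λ t → V.lookup t j) e))

  weights⇒conv : ∀ {I : Set} {d} (G : I → QPt d) is {x} → Weights G is x → InConv (map G is) x
  weights⇒conv G is {x} (w , w≥0 , s , e) = map w is , map G is , trans (length-map w is) (sym (length-map G is)) , All.tabulate id
    , AllP.map⁺ (All.tabulate w≥0) , trans (sumQ-map w is) s , vec-ext (λ j → trans (lookup-lincomb (map w is) (map G is) j) (trans (pairs-map w G (λ v → V.lookup v j) is) (e j)))

  conv-⊑ : ∀ {d} {S S′ : List (QPt d)} {x} → S ⊑ S′ → InConv S x → InConv S′ x
  conv-⊑ sub (cs , vs , l , ms , rest) = cs , vs , l , All.map sub ms , rest

-- Serves twice: for vertices up to equality, and for simplices up to having the same vertices.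
Representatives : {A : Set} → (A → A → Set) → List A → Set
Representatives _≈_ xs = ∃[ ys ] ys ⊑ xs × (∀ {x} → x ∈ xs → ∃[ y ] y ∈ ys × x ≈ y) × Unique ys × (∀ {x y} → x ∈ ys → y ∈ ys → x ≈ y → x ≡ y)

representatives : {A : Set} {_≈_ : A → A → Set} (_≈?_ : ∀ x y → Dec (x ≈ y)) → (∀ {x} → x ≈ x) → (∀ {x y} → x ≈ y → y ≈ x) → ∀ xs → Representatives _≈_ xs
representatives _≈?_ rfl sm [] = [] , (λ ()) , (λ ()) , [] , λ ()
representatives {A} {_≈_} _≈?_ rfl sm (x ∷ xs) with representatives _≈?_ rfl sm xs
... | ys , sub , cov , uq , sep with Any.any? (x ≈?_) ys
...   | yes m = ys , there ∘ sub , (λ { (here ≡.refl) → L∈.find m ; (there k) → cov k }) , uq , sep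
...   | no none = x ∷ ys , (λ { (here ≡.refl) → here ≡.refl ; (there k) → there (sub k) })
      , (λ { (here ≡.refl) → x , here ≡.refl , rfl ; (there k) → let y , y∈ , e = cov k in y , there y∈ , e })
      , All.tabulate (λ k e → none (L∈.lose k (≡.subst (x ≈_) e rfl))) ∷ uq
      , λ { (here ≡.refl) (here ≡.refl) _ → ≡.refl ; (here ≡.refl) (there k) e → contradiction (L∈.lose k e) none ; (there k) (here ≡.refl) e → contradiction (L∈.lose k (sm e)) none ; (there k) (there k′) e → sep k k′ e }

module Hulls {d : ℕ} where
  open ≡
  open ConvexHulls
  open FieldProperties ℚ-field using (sumL; sum-cong; sum-*ˡ; *-distribˡ--)
  open Vectors ℚ-field d

  hull : (S : List (QPt d)) → Fin (length S) → Fin d → ℚ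
  hull S i = V.lookup (L.lookup S i)

  map-lookup : ∀ {A : Set} (S : List A) → map (L.lookup S) (allFin (length S)) ≡ S
  map-lookup S = trans (LP.map-tabulate id (L.lookup S)) (LP.tabulate-lookup S)

  conv⇒convex : ∀ {S x} → InConv S x → RayExit.Convex ℚ-field d (length S) (hull S) (V.lookup x)
  conv⇒convex {S} {x} c = unpack (conv⇒weights F._≟_ (L.lookup S) (allFin (length S)) {x} (UP.allFin⁺ (length S)) (subst (λ t → InConv t x) (sym (map-lookup S)) c))
    where
    unpack : Weights (L.lookup S) (allFin (length S)) x → RayExit.Convex ℚ-field d (length S) (hull S) (V.lookup x)
    unpack (w , w≥0 , s , e) = record { weight = w ; weight≥0 = λ i → w≥0 (∈-allFin i) ; weight-sum = s ; weight-comb = e }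

  convex⇒conv : ∀ {S x} → RayExit.Convex ℚ-field d (length S) (hull S) x → InConv S (V.tabulate x)
  convex⇒conv {S} {x} c = subst (λ t → InConv t (V.tabulate x)) (map-lookup S) (weights⇒conv (L.lookup S) (allFin (length S)) {V.tabulate x}
      (weight , (λ {i} _ → weight≥0 i) , weight-sum , λ j → trans (weight-comb j) (sym (lookup∘tabulate x j))))
    where open RayExit.Convex c

  dot-fn : ∀ (a x : QPt d) {a′ x′ : Fin d → ℚ} → (∀ j → V.lookup a j ≡ a′ j) → (∀ j → V.lookup x j ≡ x′ j) → dot a x ≡ a′ · x′
  dot-fn a x ea ex = trans (dot-· a x) (sum-cong (allFin d) (λ j → cong₂ ℚ._*_ (ea j) (ex j)))

  nonzero : ∀ (a : QPt d) → ¬ (a ≡ 0Q) → ∃[ j ] V.lookup a j ≢ 0ℚ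
  nonzero a ne with FP.any? (λ j → ¬? (V.lookup a j ℚ.≟ 0ℚ))
  ... | yes w = w
  ... | no none = contradiction (vec-ext (λ j → trans (zero-at j) (sym (lookup-replicate j 0ℚ)))) ne
    where
    zero-at : ∀ j → V.lookup a j ≡ 0ℚ
    zero-at j with V.lookup a j ℚ.≟ 0ℚ
    ... | yes z = z
    ... | no nz = contradiction (j , nz) none

  pairs-mapʳ : ∀ {X Y : Set} (φ : Y → ℚ) (g : X → Y) cs vs → pairs φ (L.zip cs (map g vs)) ≡ pairs (φ ∘ g) (L.zip cs vs)
  pairs-mapʳ φ g [] vs = refl
  pairs-mapʳ φ g (c ∷ cs) [] = refl
  pairs-mapʳ φ g (c ∷ cs) (v ∷ vs) = cong (ℚ._+_ (c ℚ.* φ (g v))) (pairs-mapʳ φ g cs vs)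

  lookup-toQ : ∀ (v : Pt d) j → V.lookup (toQ v) j ≡ ℤinℚ.of (V.lookup v j)
  lookup-toQ v j = lookup-map j (λ z → z ℚ./ 1) v

  -- A repeated point gives an affine relation with coefficients 1 and -1.
  affine-unique : ∀ (σ : List (Pt d)) → AffInd (map toQ σ) → Unique σ
  affine-unique [] _ = []
  affine-unique (p ∷ σ) aff = All.tabulate (λ {r} m e → distinct (subst (_∈ σ) (sym e) m)) ∷ affine-unique σ rest
    where
    rest : AffInd (map toQ σ)
    rest cs l s e with aff (0ℚ ∷ cs) (cong suc l) (trans (ℚP.+-identityˡ (sumQ cs)) s)
      (trans (vec-ext (λ j → trans (lookup-zipWith ℚ._+_ j (0ℚ ·ᵥ toQ p) (lincomb cs (map toQ σ))) (trans (cong (λ t → t ℚ.+ V.lookup (lincomb cs (map toQ σ)) j) (trans (lookup-map j (0ℚ ℚ.*_) (toQ p)) (ℚP.*-zeroˡ (V.lookup (toQ p) j)))) (ℚP.+-identityˡ _)))) e)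
    ... | _ ∷ az = az
    minus : ∀ {τ : List (Pt d)} → p ∈ τ → ∃[ cs ] length cs ≡ length (map toQ τ) × sumQ cs ≡ ℚ.- 1ℚ × (∀ j → V.lookup (lincomb cs (map toQ τ)) j ≡ ℚ.- 1ℚ ℚ.* V.lookup (toQ p) j)
    minus {_ ∷ τ} (here refl) = (ℚ.- 1ℚ) ∷ map (λ _ → 0ℚ) τ , cong suc (trans (length-map (λ _ → 0ℚ) τ) (sym (length-map toQ τ))) , trans (cong (ℚ._+_ (ℚ.- 1ℚ)) (zeros τ)) (ℚP.+-identityʳ (ℚ.- 1ℚ))
        , λ j → trans (lookup-zipWith ℚ._+_ j ((ℚ.- 1ℚ) ·ᵥ toQ p) (lincomb (map (λ _ → 0ℚ) τ) (map toQ τ))) (trans (cong₂ ℚ._+_ (lookup-map j ((ℚ.- 1ℚ) ℚ.*_) (toQ p)) (zeros′ τ j)) (ℚP.+-identityʳ _))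
      where
      zeros : ∀ (τ : List (Pt d)) → sumQ (map (λ _ → 0ℚ) τ) ≡ 0ℚ
      zeros [] = refl
      zeros (_ ∷ τ) = trans (ℚP.+-identityˡ _) (zeros τ)
      zeros′ : ∀ (τ : List (Pt d)) j → V.lookup (lincomb (map (λ _ → 0ℚ) τ) (map toQ τ)) j ≡ 0ℚ
      zeros′ [] j = lookup-replicate j 0ℚ
      zeros′ (u ∷ τ) j = trans (lookup-zipWith ℚ._+_ j (0ℚ ·ᵥ toQ u) (lincomb (map (λ _ → 0ℚ) τ) (map toQ τ))) (trans (cong₂ ℚ._+_ (trans (lookup-map j (0ℚ ℚ.*_) (toQ u)) (ℚP.*-zeroˡ (V.lookup (toQ u) j))) (zeros′ τ j)) refl)
    minus {u ∷ τ} (there m) with minus m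
    ... | cs , l , s , e = 0ℚ ∷ cs , cong suc l , trans (ℚP.+-identityˡ (sumQ cs)) s
        , λ j → trans (lookup-zipWith ℚ._+_ j (0ℚ ·ᵥ toQ u) (lincomb cs (map toQ τ))) (trans (cong₂ ℚ._+_ (trans (lookup-map j (0ℚ ℚ.*_) (toQ u)) (ℚP.*-zeroˡ (V.lookup (toQ u) j))) (e j)) (ℚP.+-identityˡ _))
    distinct : p ∈ σ → ⊥
    distinct m with minus m
    ... | cs , l , s , e with aff (1ℚ ∷ cs) (cong suc l) (trans (cong (ℚ._+_ 1ℚ) s) refl)
      (vec-ext (λ j → trans (lookup-zipWith ℚ._+_ j (1ℚ ·ᵥ toQ p) (lincomb cs (map toQ σ))) (trans (cong₂ ℚ._+_ (lookup-map j (1ℚ ℚ.*_) (toQ p)) (e j)) (trans (sym (ℚP.*-distribʳ-+ (V.lookup (toQ p) j) 1ℚ (ℚ.- 1ℚ))) (trans (ℚP.*-zeroˡ (V.lookup (toQ p) j)) (sym (lookup-replicate j 0ℚ)))))))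
    ...   | () ∷ _

-- The simplices of T as lists of vertex indices; the index zero is reserved for an extra vertex, and T may list a simplex several times.
module Indexed {d : ℕ} (P : LPoly d) (T : List (Simplex d)) (triangulation : LatticeTriangulationOfBoundary P T) (regular : Regular P T) where
  open ≡
  open ConvexHulls
  open Hulls {d}
  open FieldProperties ℚ-field using (sumL; sum-cong; sum-*ˡ; *-distribˡ--)
  open Vectors ℚ-field d
  open ℤ-Embedding ℤ⊂ℚ using (embed)

  private
    points-of : Representatives _≡_ (L.concat T)
    points-of = representatives (VP.≡-dec ℤ._≟_) refl sym (L.concat T)

  points : List (Pt d)
  points = proj₁ points-of

  ∈-points : ∀ {p σ} → σ ∈ T → p ∈ σ → p ∈ points
  ∈-points m k with proj₁ (proj₂ (proj₂ points-of)) (∈-concat⁺′ k m)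
  ... | _ , y∈ , refl = y∈

  Vertex : Set
  Vertex = Fin (suc (length points))

  vs : List Vertex
  vs = map F.suc (allFin (length points))

  place : Vertex → Pt d
  place F.zero = V.replicate d (+ 0)
  place (F.suc i) = L.lookup points i

  index : Pt d → Vertex
  index p with Any.any? (VP.≡-dec ℤ._≟_ p) points
  ... | yes m = F.suc (Any.index m)
  ... | no _ = F.zero

  place-index : ∀ {p} → p ∈ points → place (index p) ≡ p
  place-index {p} k with Any.any? (VP.≡-dec ℤ._≟_ p) points
  ... | yes m = sym (AnyP.lookup-index m)
  ... | no p∉ = contradiction k p∉

  index-∈ : ∀ {p} → p ∈ points → index p ∈ vs
  index-∈ {p} k with Any.any? (VP.≡-dec ℤ._≟_ p) points
  ... | yes m = ∈-map⁺ F.suc (∈-allFin (Any.index m))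
  ... | no p∉ = contradiction k p∉

  index-injective : ∀ {p p′} → p ∈ points → p′ ∈ points → index p ≡ index p′ → p ≡ p′
  index-injective k k′ e = trans (sym (place-index k)) (trans (cong place e) (place-index k′))

  place-map : ∀ (F : List (Pt d)) → (∀ {p} → p ∈ F → p ∈ points) → map place (map index F) ≡ F
  place-map F sub = trans (sym (LP.map-∘ F)) (trans (LP.map-cong-local (All.tabulate (λ k → place-index (sub k)))) (LP.map-id F))

  _≈?_ : ∀ (σ τ : List Vertex) → Dec (All (_∈ τ) σ × All (_∈ σ) τ)
  σ ≈? τ = All.all? (λ v → DecMembership._∈?_ F._≟_ v τ) σ Dec.×-dec All.all? (λ v → DecMembership._∈?_ F._≟_ v σ) τ

  -- The empty simplex may occur in `T`; it is dropped because it is not a face in the sense of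
  -- `IsFace`, so regularity and unimodularity do not speak about it.
  nonempty? : ∀ (σ : Simplex d) → Dec (¬ (σ ≡ []))
  nonempty? [] = no (λ ne → ne refl)
  nonempty? (_ ∷ _) = yes (λ ())

  private
    K-of : Representatives (λ σ τ → All (_∈ τ) σ × All (_∈ σ) τ) (map (map index) (filter nonempty? T))
    K-of = representatives _≈?_ (λ {x} → All.tabulate id , All.tabulate id) (λ e → proj₂ e , proj₁ e) (map (map index) (filter nonempty? T))

  K : List (List Vertex)
  K = proj₁ K-of

  origin : ∀ {σ} → σ ∈ K → ∃[ σ̂ ] σ̂ ∈ T × ¬ (σ̂ ≡ []) × σ ≡ map index σ̂
  origin m with ∈-map⁻ (map index) (proj₁ (proj₂ K-of) m)
  ... | σ̂ , k , e = σ̂ , proj₁ (∈-filter⁻ nonempty? {xs = T} k) , proj₂ (∈-filter⁻ nonempty? {xs = T} k) , e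

  placed : ∀ {σ} → σ ∈ K → map place σ ∈ T × ¬ (map place σ ≡ [])
  placed m with origin m
  ... | σ̂ , k , ne , refl = subst (λ t → t ∈ T × ¬ (t ≡ [])) (sym (place-map σ̂ (∈-points k))) (k , ne)

  vertex-∈ : ∀ {σ v} → σ ∈ K → v ∈ σ → v ∈ vs × index (place v) ≡ v
  vertex-∈ m k with origin m
  ... | σ̂ , σ̂∈ , _ , refl with ∈-map⁻ index k
  ...   | p , p∈ , refl = index-∈ (∈-points σ̂∈ p∈) , cong index (place-index (∈-points σ̂∈ p∈))

  cone-unique : ∀ {σ} → σ ∈ K → Unique σ
  cone-unique m with origin m
  ... | σ̂ , k , _ , refl = unique-map-on index (λ a b → index-injective (∈-points k a) (∈-points k b)) (affine-unique σ̂ (All.lookup (proj₁ triangulation) k))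

  pt : Vertex → Vector
  pt v = embed (place v)

  q : QPt d
  q = proj₁ regular

  Pˢ : Fin (length (QV P)) → Vector
  Pˢ = hull (QV P)

  Boundary′ : Vector → Set
  Boundary′ x = RayExit.Convex ℚ-field d (length (QV P)) Pˢ x × ∃[ a ] (∃[ j ] a j ≢ 0ℚ) × (∀ i → a · Pˢ i ℚ.≤ a · x)

  InSimplex′ : List Vertex → Vector → Set
  InSimplex′ σ x = ∃[ μ ] (∀ {v} → v ∈ σ → 0ℚ ℚ.≤ μ v) × sumL μ σ ≡ 1ℚ × (∀ j → Combinations.comb pt μ σ j ≡ x j)

  boundary⇒ : ∀ {x} → x ∈∂ P → Boundary′ (V.lookup x)
  boundary⇒ {x} (c , a , nz , le) = conv⇒convex c , V.lookup a , nonzero a nz , λ i → subst₂ ℚ._≤_ (dot-fn a (L.lookup (QV P) i) (λ _ → refl) (λ _ → refl)) (dot-fn a x (λ _ → refl) (λ _ → refl)) (All.lookup le (∈-lookup i))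

  ⇒boundary : ∀ {x} → Boundary′ x → V.tabulate x ∈∂ P
  ⇒boundary {x} (c , a , (j , nz) , le) = convex⇒conv c , V.tabulate a , (λ z → nz (trans (sym (lookup∘tabulate a j)) (trans (cong (λ t → V.lookup t j) z) (lookup-replicate j 0ℚ))))
    , subst (All (λ v → dot (V.tabulate a) v ℚ.≤ dot (V.tabulate a) (V.tabulate x))) (map-lookup (QV P)) (AllP.map⁺ (All.tabulate (λ {i} _ → subst₂ ℚ._≤_ (sym (dot-fn (V.tabulate a) (L.lookup (QV P) i) (lookup∘tabulate a) (λ _ → refl))) (sym (dot-fn (V.tabulate a) (V.tabulate x) (lookup∘tabulate a) (lookup∘tabulate x))) (le i))))

  simplex⇒ : ∀ {σ x} → Unique σ → InConv (map toQ (map place σ)) x → InSimplex′ σ (V.lookup x)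
  simplex⇒ {σ} {x} u c = unpack (conv⇒weights F._≟_ (toQ ∘ place) σ {x} u (subst (λ t → InConv t x) (sym (LP.map-∘ σ)) c))
    where
    unpack : Weights (toQ ∘ place) σ x → InSimplex′ σ (V.lookup x)
    unpack (w , w≥0 , s , e) = w , w≥0 , s , λ j → trans (sum-cong σ (λ v → cong (w v ℚ.*_) (sym (lookup-toQ (place v) j)))) (e j)

  ⇒simplex : ∀ {σ x} → InSimplex′ σ x → InConv (map toQ (map place σ)) (V.tabulate x)
  ⇒simplex {σ} {x} (w , w≥0 , s , e) = subst (λ t → InConv t (V.tabulate x)) (LP.map-∘ σ) (weights⇒conv (toQ ∘ place) σ {V.tabulate x}
    (w , w≥0 , s , λ j → trans (sum-cong σ (λ v → cong (w v ℚ.*_) (lookup-toQ (place v) j))) (trans (e j) (sym (lookup∘tabulate x j)))))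

  untabulate : ∀ {A : Vector → Set} (x : Vector) → (∀ {y z : Vector} → (∀ j → y j ≡ z j) → A y → A z) → A (V.lookup (V.tabulate x)) → A x
  untabulate x resp = resp (lookup∘tabulate x)

  boundary-resp : ∀ {y z : Vector} → (∀ j → y j ≡ z j) → Boundary′ y → Boundary′ z
  boundary-resp e (c , a , nz , le) = record { weight = weight ; weight≥0 = weight≥0 ; weight-sum = weight-sum ; weight-comb = λ j → trans (weight-comb j) (e j) } , a , nz , λ i → subst (a · Pˢ i ℚ.≤_) (·-cong a e) (le i)
    where open RayExit.Convex c

  simplex-resp : ∀ {σ} {y z : Vector} → (∀ j → y j ≡ z j) → InSimplex′ σ y → InSimplex′ σ z
  simplex-resp e (w , w≥0 , s , eq) = w , w≥0 , s , λ j → trans (eq j) (e j)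

  triangulated : Triangulated ℚ-field d (length (QV P)) Pˢ vs K pt (V.lookup q)
  triangulated = record
    { K-unique = proj₁ (proj₂ (proj₂ (proj₂ K-of))) ; cone-unique = cone-unique ; cone-vs = λ m k → proj₁ (vertex-∈ m k)
    ; cone-ext = λ m m′ s t → proj₂ (proj₂ (proj₂ (proj₂ K-of))) m m′ (All.tabulate s , All.tabulate t)
    ; q-convex = conv⇒convex (proj₁ (proj₂ regular))
    ; q-interior = λ b → proj₁ (proj₂ (proj₂ regular)) (subst (_∈∂ P) (VP.tabulate∘lookup q) (⇒boundary b))
    ; affine-independent = independent ; in-boundary = in-boundary ; covers = covers ; meets = meets }
    where
    independent : ∀ {σ} → σ ∈ K → ∀ c → sumL c σ ≡ 0ℚ → (∀ j → Combinations.comb pt c σ j ≡ 0ℚ) → ∀ {v} → v ∈ σ → c v ≡ 0ℚ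
    independent {σ} m c s e k = All.lookup (AllP.map⁻ (All.lookup (proj₁ triangulation) (proj₁ (placed m)) (map c σ) (trans (length-map c σ) (sym (trans (length-map toQ (map place σ)) (length-map place σ))))
      (trans (sumQ-map c σ) s) (vec-ext (λ j → trans (lookup-lincomb (map c σ) (map toQ (map place σ)) j) (trans (cong (λ t → pairs (λ v → V.lookup v j) (L.zip (map c σ) t)) (sym (LP.map-∘ σ)))
        (trans (pairs-map c (toQ ∘ place) (λ v → V.lookup v j) σ) (trans (sum-cong σ (λ v → cong (c v ℚ.*_) (lookup-toQ (place v) j))) (trans (e j) (sym (lookup-replicate j 0ℚ)))))))))) k
    in-boundary : ∀ {σ x} → σ ∈ K → InSimplex′ σ x → Boundary′ x
    in-boundary {σ} {x} m s = untabulate {Boundary′} x boundary-resp (boundary⇒ (All.lookup (proj₁ (proj₂ triangulation)) (proj₁ (placed m)) (V.tabulate x) (⇒simplex {σ} {x} s)))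
    covers : ∀ {x} → Boundary′ x → ∃[ σ ] σ ∈ K × InSimplex′ σ x
    covers {x} b with proj₁ (proj₂ (proj₂ triangulation)) (V.tabulate x) (⇒boundary b)
    -- The empty simplex contains no point, since an empty sum of coefficients cannot be 1.
    ... | [] , k , (_ ∷ _ , _ ∷ _ , _ , () ∷ _ , _)
    ... | [] , k , ([] , [] , _ , _ , _ , () , _)
    ... | σ̂@(_ ∷ _) , k , c with proj₁ (proj₂ (proj₂ K-of)) (∈-map⁺ (map index) (∈-filter⁺ nonempty? k (λ ())))
    ...   | τ , τ∈ , fwd , bwd = τ , τ∈ , untabulate {InSimplex′ τ} x (simplex-resp {τ}) (simplex⇒ {τ} (cone-unique τ∈) (conv-⊑ sub c))
      where
      sub : map toQ σ̂ ⊑ map toQ (map place τ)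
      sub z with ∈-map⁻ toQ z
      ... | p , p∈ , refl = ∈-map⁺ toQ (subst (_∈ map place τ) (place-index (∈-points k p∈)) (∈-map⁺ place (All.lookup fwd (∈-map⁺ index p∈))))
    meets : ∀ {σ τ x} → σ ∈ K → τ ∈ K → InSimplex′ σ x → InSimplex′ τ x → ∃[ F ] Unique F × F ⊑ σ × F ⊑ τ × InSimplex′ F x
    meets {σ} {τ} {x} m m′ s s′ with proj₂ (proj₂ (proj₂ triangulation)) (map place σ) (map place τ) (proj₁ (placed m)) (proj₁ (placed m′)) (V.tabulate x) (⇒simplex {σ} {x} s) (⇒simplex {τ} {x} s′)
    ... | F , F⊆ , F∈ , c = map index F , uF , back m (SL.lookup F⊆) , back m′ (All.lookup F∈)
        , untabulate {InSimplex′ (map index F)} x (simplex-resp {map index F}) (simplex⇒ {map index F} uF (subst (λ t → InConv (map toQ t) (V.tabulate x)) (sym (place-map F F-points)) c))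
      where
      F-points : ∀ {p} → p ∈ F → p ∈ points
      F-points k = ∈-points (proj₁ (placed m)) (SL.lookup F⊆ k)
      uF : Unique (map index F)
      uF = unique-map-on index (λ a b → index-injective (F-points a) (F-points b)) (unique-⊆ F⊆ (affine-unique (map place σ) (All.lookup (proj₁ triangulation) (proj₁ (placed m)))))
        where
        unique-⊆ : ∀ {as bs : List (Pt d)} → as ⊆ bs → Unique bs → Unique as
        unique-⊆ [] [] = []
        unique-⊆ (_ ∷ʳ s) (_ ∷ u) = unique-⊆ s u
        unique-⊆ (refl ∷ s) (b∉ ∷ u) = All.tabulate (λ k → All.lookup b∉ (SL.lookup s k)) ∷ unique-⊆ s u
      back : ∀ {ρ} → ρ ∈ K → (∀ {p} → p ∈ F → p ∈ map place ρ) → map index F ⊑ ρ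
      back n sub k with ∈-map⁻ index k
      ... | p , p∈ , refl with ∈-map⁻ place (sub p∈)
      ...   | v , v∈ , refl = subst (_∈ _) (sym (proj₂ (vertex-∈ n v∈))) v∈

-- The initial facet and the conclusion

singleton-length : {A : Set} {xs : List A} {x : A} → Unique xs → x ∈ xs → (∀ {y} → y ∈ xs → y ≡ x) → length xs ≡ 1
singleton-length {xs = _ ∷ []} _ _ _ = ≡.refl
singleton-length {xs = _ ∷ _ ∷ _} (y∉ ∷ _) _ same = contradiction (≡.trans (same (here ≡.refl)) (≡.sym (same (there (here ≡.refl))))) (All.lookup y∉ (here ≡.refl))

module InitialFacet {d : ℕ} {V : Set} {vs : List V} {Fs : List (List V)} (Δ : ShellableSphere d vs Fs) where
  open ≡
  open ShellableSphere Δ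

  ⊑[]⇒length : ∀ {xs : List V} → xs ⊑ [] → length xs ≡ 0
  ⊑[]⇒length {[]} _ = refl
  ⊑[]⇒length {x ∷ xs} s = contradiction (s (here refl)) (λ ())

  length⇒⊑ : ∀ {xs ys : List V} → length xs ≡ 0 → xs ⊑ ys
  length⇒⊑ {[]} _ ()

  -- Some facet covers the empty face. Two different facets with empty restriction would each have
  -- to precede the other.
  h-zero : ∀ {σ} → σ ∈ Fs → h 0 ≡ 1
  h-zero σ∈ with cover-R [] σ∈ (λ ())
  ... | τ , τ∈ , R⊑ , _ = singleton-length (UP.filter⁺ (λ σ → length (R σ) ℕ.≟ 0) Fs-unique) (∈-filter⁺ (λ σ → length (R σ) ℕ.≟ 0) τ∈ (⊑[]⇒length R⊑)) same
    where
    same : ∀ {σ} → σ ∈ level 0 → σ ≡ τ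
    same m with ∈-filter⁻ (λ σ → length (R σ) ℕ.≟ 0) {xs = Fs} m
    ... | σ∈ , e with order-R σ∈ τ∈ (length⇒⊑ e) | order-R τ∈ σ∈ (length⇒⊑ (⊑[]⇒length R⊑))
    ...   | inj₁ e′ | _ = e′
    ...   | inj₂ _ | inj₁ e′ = sym e′
    ...   | inj₂ lt | inj₂ gt = contradiction (ℕP.<-trans lt gt) (ℕP.<-irrefl refl)

record Numbers (d N′ : ℕ) (f : ℕ → ℤ) : Set where
  constructor numbers-of
  field
    h : ℕ → ℕ
    a : ℕ → ℤ
    ehrhart : ∀ m → f m ≡ Sequences.S^ d a m
    reciprocity : ∀ l → l ℕ.≤ d → a (l ℕ.+ d ℕ.* suc N′) ℤ.+ + h (d ∸ l) ≡ a l ℤ.+ a (d ∸ l)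
    h0 : h 0 ≡ 1
    increasing : ∀ i → i ℕ.+ suc i ℕ.≤ d → h i ℕ.≤ h (suc i)
    upper : ∀ i → suc i ℕ.≤ d → h (suc i) ℕ.≤ (h 1 ℕ.+ i) C suc i

module SphereNumbers (O : OrderedField) (E : ℤ-Embedding O) (d′ n v : ℕ) (P : Fin n → Vectors.Vector O (suc d′)) (K : List (List (Fin (suc v))))
    (pt : Fin (suc v) → Vectors.Vector O (suc d′)) (q : Vectors.Vector O (suc d′))
    (tri : Triangulated O (suc d′) n P (map F.suc (allFin v)) K pt q)
    (p̂ : Fin (suc v) → Pt (suc d′)) (pt-p̂ : ∀ {σ} → σ ∈ K → ∀ {v} → v ∈ σ → ∀ j → pt v j ≡ ℤ-Embedding.embed E (p̂ v) j)
    (N′ : ℕ) (q̂ : Pt (suc d′)) (q-q̂ : ∀ j → OrderedField._*_ O (ℤ-Embedding.ι E (+ suc N′)) (q j) ≡ ℤ-Embedding.embed E q̂ j)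
    (unimodular : ∀ {σ} → σ ∈ K → PartOfBasis (map lift1 (map p̂ σ)))
    (InQ : Vectors.Vector O (suc d′) → Set) (N : List (Fin (suc v)) → Vectors.Vector O (suc d′)) (b : List (Fin (suc v)) → OrderedField.𝔽 O)
    (N≢0 : ∀ {σ} → σ ∈ K → ∃[ j ] N σ j ≢ OrderedField.0# O)
    (Q-≤ : ∀ {σ x} → σ ∈ K → InQ x → OrderedField._≤_ O (Vectors._·_ O (suc d′) (N σ) x) (b σ))
    (to-face : ∀ {σ μ y} → PolytopeFan.Rep (polytope-data O (suc d′) n P (Fin (suc v)) F._≟_ (map F.suc (allFin v)) K pt q tri F.zero) σ μ y →
      ∃[ t ] ∃[ x ] OrderedField._≤_ O (OrderedField.0# O) t × InQ x × Vectors._·_ O (suc d′) (N σ) x ≡ b σ × (∀ j → OrderedField._*_ O t (x j) ≡ y j))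
    (from-face : ∀ {σ t x y} → σ ∈ K → OrderedField._≤_ O (OrderedField.0# O) t → InQ x → Vectors._·_ O (suc d′) (N σ) x ≡ b σ → (∀ j → OrderedField._*_ O t (x j) ≡ y j) →
      ∃[ μ ] PolytopeFan.Rep (polytope-data O (suc d′) n P (Fin (suc v)) F._≟_ (map F.suc (allFin v)) K pt q tri F.zero) σ μ y)
    (f : ℕ → ℤ) (counts : ∀ m (xs : List (Pt (suc d′))) → Unique xs →
      (∀ x → x ∈ xs ⇔ PolytopeSupport.Dilated (polytope-data O (suc d′) n P (Fin (suc v)) F._≟_ (map F.suc (allFin v)) K pt q tri F.zero) (ℤ-Embedding.ι E (+ m)) (ℤ-Embedding.embed E x)) → + length xs ≡ f m) where
  open ≡

  vs : List (Fin (suc v))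
  vs = map F.suc (allFin v)

  polytope : PolytopeData
  polytope = polytope-data O (suc d′) n P (Fin (suc v)) F._≟_ vs K pt q tri F.zero

  open PolytopeSupport polytope using (pos; fan; module Support)
  open Support InQ N b N≢0 Q-≤ to-face from-face using (a; support-≤; support-≡)
  open FanGeometry (fan-data O (suc d′) (Fin (suc v)) F._≟_ vs K pos fan) using (Fs; Generic; normals; faces; generic-exists; half-open-exists)

  c : Vectors.Vector O (suc d′)
  c = proj₁ (generic-exists (normals faces))

  generic : Generic c
  generic {ν} = proj₂ (generic-exists (normals faces)) {ν}

  lattice : LatticePolytope
  lattice = lattice-polytope polytope E p̂ pt-p̂ N′ q̂ q-q̂ unimodular

  open LatticeFan lattice using (module Directed)
  module Lattice = Directed.Ehrhart c generic f counts

  Δ : ShellableSphere (suc d′) vs Fs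
  Δ = Sweep.Shelling.sphere (fan-data O (suc d′) (Fin (suc v)) F._≟_ vs K pos fan) c generic a support-≤ support-≡

  open ShellableSphere Δ using (h)

  -- One variable for each row and vertex: row zero is the row `ρ` of the linear form and column
  -- zero belongs to the auxiliary vertex `z`.
  coefficients : GenericDomain (Fin (suc (suc d′)) × Fin (suc v))
  coefficients = reindex (λ p → F.combine (proj₁ p) (proj₂ p)) (λ {i} {j} e → let e₁ , e₂ = FP.combine-injective (proj₁ i) (proj₂ i) (proj₁ j) (proj₂ j) e in cong₂ _,_ e₁ e₂) 𝔽₂[ suc (suc d′) ℕ.* suc v ]

  rows : List (Fin (suc (suc d′)))
  rows = map F.suc (allFin (suc d′))

  zero∉suc : ∀ {n} (is : List (Fin n)) → F.zero ∉ map F.suc is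
  zero∉suc is m with ∈-map⁻ F.suc m
  ... | _ , _ , ()

  stanley-reisner : StanleyReisnerData
  stanley-reisner = stanley-reisner-data (Fin (suc (suc d′))) (Fin (suc v)) F._≟_ coefficients rows (UP.map⁺ FP.suc-injective (UP.allFin⁺ (suc d′))) F.zero (zero∉suc (allFin (suc d′))) F.zero vs
    (AllP.¬Any⇒All¬ vs (zero∉suc (allFin v)) ∷ UP.map⁺ FP.suc-injective (UP.allFin⁺ v)) d′ (trans (length-map F.suc (allFin (suc d′))) (LP.length-tabulate id)) Fs Δ

  open StanleyReisner stanley-reisner using (h-increasing; h-upper)

  h0 : h 0 ≡ 1
  h0 = let σ , σ∈ , _ = half-open-exists generic (λ _ → OrderedField.0# O) in InitialFacet.h-zero Δ {σ} σ∈

  numbers : Numbers (suc d′) N′ f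
  numbers = numbers-of h Lattice.a Lattice.f≡S^a Lattice.reciprocity h0 increasing upper
    where
    increasing : ∀ i → i ℕ.+ suc i ℕ.≤ suc d′ → h i ℕ.≤ h (suc i)
    increasing i le = let o , e = ℕP.m≤n⇒∃[o]m+o≡n le in h-increasing {i} {o} (trans (cong (i ℕ.+_) (ℕP.+-suc i o)) (trans (sym (ℕP.+-assoc i (suc i) o)) e))
    upper : ∀ i → suc i ℕ.≤ suc d′ → h (suc i) ℕ.≤ (h 1 ℕ.+ i) C suc i
    upper i le = let o , e = ℕP.m≤n⇒∃[o]m+o≡n le in h-upper {i} {o} e

module Faces {d : ℕ} (P : LPoly d) (T : List (Simplex d)) (triangulation : LatticeTriangulationOfBoundary P T) (regular : Regular P T) where
  open ≡
  open ConvexHulls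
  open Hulls {d}
  open Indexed P T triangulation regular
  open FieldProperties ℚ-field using (sumL; sum-cong; sum-*ˡ)
  open Vectors ℚ-field d
  open Gather ℚ-field

  pos : Vertex → Vector
  pos v j = pt v j ℚ.- V.lookup q j

  Rep : List Vertex → (Vertex → ℚ) → Vector → Set
  Rep σ μ y = σ ∈ K × (∀ {v} → v ∈ σ → 0ℚ ℚ.≤ μ v) × (∀ j → y j ≡ Combinations.comb pos μ σ j)

  generators : List (Fin (length (QV P)))
  generators = allFin (length (QV P))

  Dilated : ℚ → Vector → Set
  Dilated M x = Σ (Fin (length (QV P)) → ℚ) λ w → (∀ i → 0ℚ ℚ.≤ w i) × sumL w generators ≡ 1ℚ × (∀ j → M ℚ.* sumL (λ i → w i ℚ.* Pˢ i j) generators ≡ x j)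

  Qv : List (QPt d)
  Qv = proj₁ (proj₂ (proj₂ (proj₂ regular)))

  cut : ∀ {σ} → σ ∈ K → ∃[ a ] ∃[ b ] FaceOfQ Qv a b × (∀ y → InConeT q (map place σ) y ⇔ InConeQ Qv a b y)
  cut {σ} m = proj₁ (proj₂ (proj₂ (proj₂ (proj₂ regular)))) (map place σ) (proj₂ (placed m) , map place σ , proj₁ (placed m) , SL.⊆-refl)

  -- Regularity gives a face for each proof of membership; deciding membership makes the normal a
  -- function of σ, with zero as the default.
  normal : List Vertex → QPt d × ℚ
  normal σ with DecMembership._∈?_ (LP.≡-dec F._≟_) σ K
  ... | yes m = proj₁ (cut m) , proj₁ (proj₂ (cut m))
  ... | no _ = 0Q , 0ℚ

  normal-spec : ∀ {σ} → σ ∈ K → FaceOfQ Qv (proj₁ (normal σ)) (proj₂ (normal σ)) × (∀ y → InConeT q (map place σ) y ⇔ InConeQ Qv (proj₁ (normal σ)) (proj₂ (normal σ)) y)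
  normal-spec {σ} m with DecMembership._∈?_ (LP.≡-dec F._≟_) σ K
  ... | yes m′ = proj₂ (proj₂ (cut m′))
  ... | no σ∉ = contradiction m σ∉

  InQ : Vector → Set
  InQ x = InConv Qv (V.tabulate x)

  N : List Vertex → Vector
  N σ = V.lookup (proj₁ (normal σ))

  b : List Vertex → ℚ
  b σ = proj₂ (normal σ)

  N≢0 : ∀ {σ} → σ ∈ K → ∃[ j ] N σ j ≢ 0ℚ
  N≢0 {σ} m = nonzero (proj₁ (normal σ)) (proj₁ (proj₁ (normal-spec m)))

  dot-N : ∀ σ (x : Vector) → dot (proj₁ (normal σ)) (V.tabulate x) ≡ N σ · x
  dot-N σ x = dot-fn (proj₁ (normal σ)) (V.tabulate x) (λ _ → refl) (lookup∘tabulate x)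

  Q-≤ : ∀ {σ x} → σ ∈ K → InQ x → N σ · x ℚ.≤ b σ
  Q-≤ {σ} {x} m c = subst (ℚ._≤ b σ) (·-cong (N σ) (lookup∘tabulate x)) (RayExit.convex-≤ ℚ-field d (length Qv) (hull Qv) (conv⇒convex c) (N σ) (b σ)
    (λ i → subst (ℚ._≤ b σ) (dot-fn (proj₁ (normal σ)) (L.lookup Qv i) (λ _ → refl) (λ _ → refl)) (All.lookup (proj₁ (proj₂ (proj₁ (normal-spec m)))) (∈-lookup i))))

  shifted : Pt d → QPt d
  shifted v = toQ v -ᵥ q

  lookup-shifted : ∀ v j → V.lookup (shifted (place v)) j ≡ pos v j
  lookup-shifted v j = trans (lookup-zipWith ℚ._-_ j (toQ (place v)) q) (cong (λ t → t ℚ.- V.lookup q j) (lookup-toQ (place v) j))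

  cone-comb : ∀ μ σ j → V.lookup (lincomb μ (map shifted (map place σ))) j ≡ pairs (λ v → pos v j) (L.zip μ σ)
  cone-comb μ σ j = trans (lookup-lincomb μ (map shifted (map place σ)) j) (trans (cong (λ t → pairs (λ v → V.lookup v j) (L.zip μ t)) (sym (LP.map-∘ σ)))
    (trans (pairs-mapʳ (λ v → V.lookup v j) (shifted ∘ place) μ σ) (sum-cong (L.zip μ σ) (λ p → cong (proj₁ p ℚ.*_) (lookup-shifted (proj₂ p) j)))))

  to-face : ∀ {σ μ y} → Rep σ μ y → ∃[ t ] ∃[ x ] 0ℚ ℚ.≤ t × InQ x × N σ · x ≡ b σ × (∀ j → t ℚ.* x j ≡ y j)
  to-face {σ} {μ} {y} (m , μ≥0 , e) = unpack (Equivalence.to (proj₂ (normal-spec m) (V.tabulate y)) in-cone)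
    where
    in-cone : InConeT q (map place σ) (V.tabulate y)
    in-cone = map μ σ , trans (length-map μ σ) (sym (length-map place σ)) , AllP.map⁺ (All.tabulate μ≥0)
      , vec-ext (λ j → trans (cone-comb (map μ σ) σ j) (trans (cong (λ t → pairs (λ v → pos v j) (L.zip (map μ σ) t)) (sym (LP.map-id σ))) (trans (pairs-map μ id (λ v → pos v j) σ) (trans (sym (e j)) (sym (lookup∘tabulate y j))))))
    unpack : InConeQ Qv (proj₁ (normal σ)) (b σ) (V.tabulate y) → ∃[ t ] ∃[ x ] 0ℚ ℚ.≤ t × InQ x × N σ · x ≡ b σ × (∀ j → t ℚ.* x j ≡ y j)
    unpack (t , x , t≥0 , x∈ , on , ex) = t , V.lookup x , t≥0 , subst (InConv Qv) (sym (VP.tabulate∘lookup x)) x∈ , trans (sym (dot-fn (proj₁ (normal σ)) x (λ _ → refl) (λ _ → refl))) on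
      , λ j → trans (sym (lookup-map j (t ℚ.*_) x)) (trans (cong (λ u → V.lookup u j) ex) (lookup∘tabulate y j))

  from-face : ∀ {σ t x y} → σ ∈ K → 0ℚ ℚ.≤ t → InQ x → N σ · x ≡ b σ → (∀ j → t ℚ.* x j ≡ y j) → ∃[ μ ] Rep σ μ y
  from-face {σ} {t} {x} {y} m t≥0 x∈ on ex = unpack (Equivalence.from (proj₂ (normal-spec m) (V.tabulate y))
      (t , V.tabulate x , t≥0 , x∈ , trans (dot-N σ x) on , vec-ext (λ j → trans (lookup-map j (t ℚ.*_) (V.tabulate x)) (trans (cong (t ℚ.*_) (lookup∘tabulate x j)) (trans (ex j) (sym (lookup∘tabulate y j)))))))
    where
    unpack : InConeT q (map place σ) (V.tabulate y) → ∃[ μ ] Rep σ μ y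
    unpack (μ , l , μ≥0 , e) with gather F._≟_ id σ (cone-unique m) (L.zip μ σ) (zip-∈ μ σ (All.tabulate (∈-map⁺ id)))
    ... | w , w≥0 , same = w , m , (λ {v} _ → w≥0 (zip-≥0 μ σ μ≥0) v) , λ j → trans (sym (lookup∘tabulate y j)) (trans (cong (λ u → V.lookup u j) (sym e)) (trans (cone-comb μ σ j) (same (λ v → pos v j))))

  scale : ℕ → ℚ
  scale m = ℤinℚ.of (+ m)

  lookup-scaled : ∀ m (v : Pt d) j → V.lookup (toQ (scaleℤ m v)) j ≡ scale m ℚ.* V.lookup (toQ v) j
  lookup-scaled m v j = trans (lookup-toQ (scaleℤ m v) j) (trans (cong ℤinℚ.of (lookup-map j ((+ m) ℤ.*_) v)) (trans (ℤinℚ.of-* (+ m) (V.lookup v j)) (cong (scale m ℚ.*_) (sym (lookup-toQ v j)))))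

  scaled-points : ∀ m → map (λ i → scale m ·ᵥ L.lookup (QV P) i) generators ≡ map (λ v → toQ (scaleℤ m v)) P
  scaled-points m = trans (LP.map-∘ generators) (trans (cong (map (scale m ·ᵥ_)) (map-lookup (QV P))) (trans (sym (LP.map-∘ P))
    (LP.map-cong (λ v → vec-ext (λ j → trans (lookup-map j (scale m ℚ.*_) (toQ v)) (sym (lookup-scaled m v j)))) P)))

  factor : ∀ m (w : Fin (length (QV P)) → ℚ) j → sumL (λ i → w i ℚ.* V.lookup (scale m ·ᵥ L.lookup (QV P) i) j) generators ≡ scale m ℚ.* sumL (λ i → w i ℚ.* Pˢ i j) generators
  factor m w j = trans (sum-cong generators (λ i → trans (cong (w i ℚ.*_) (lookup-map j (scale m ℚ.*_) (L.lookup (QV P) i))) (trans (sym (ℚP.*-assoc (w i) (scale m) (Pˢ i j)))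
    (trans (cong (λ t → t ℚ.* Pˢ i j) (ℚP.*-comm (w i) (scale m))) (ℚP.*-assoc (scale m) (w i) (Pˢ i j)))))) (sym (sum-*ˡ (scale m) (λ i → w i ℚ.* Pˢ i j) generators))

  multiple : ℕ → Fin (length (QV P)) → QPt d
  multiple m i = scale m ·ᵥ L.lookup (QV P) i

  Multiples : ℕ → QPt d → Set
  Multiples m y = Weights (multiple m) generators y

  module _ (m : ℕ) (y : QPt d) {x : Vector} (ey : ∀ j → V.lookup y j ≡ x j) where
    dilated⇒weights : Dilated (scale m) x → Multiples m y
    dilated⇒weights (w , w≥0 , s , e) = w , (λ {i} _ → w≥0 i) , s , λ j → trans (factor m w j) (trans (e j) (sym (ey j)))

    weights⇒dilated : Multiples m y → Dilated (scale m) x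
    weights⇒dilated (w , w≥0 , s , e) = w , (λ i → w≥0 (∈-allFin i)) , s , λ j → trans (sym (factor m w j)) (trans (e j) (ey j))

    dilated⇒conv : Dilated (scale m) x → InConv (map (λ v → toQ (scaleℤ m v)) P) y
    dilated⇒conv dil = subst (λ t → InConv t y) (scaled-points m) (weights⇒conv (multiple m) generators {y} (dilated⇒weights dil))

    conv⇒dilated : InConv (map (λ v → toQ (scaleℤ m v)) P) y → Dilated (scale m) x
    conv⇒dilated c = weights⇒dilated (conv⇒weights F._≟_ (multiple m) generators {y} (UP.allFin⁺ (length (QV P))) (subst (λ t → InConv t y) (sym (scaled-points m)) c))

theorem2p20 : (d : ℕ) (P : LPoly d) → FullDim P → (δ : ℕ → ℤ) → IsDeltaVector P δ →
    (T : List (Simplex d)) → LatticeTriangulationOfBoundary P T → Regular P T → Unimodular T →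
    (i : ℕ) → suc i ℕ.≤ d / 2 →
      (δ (d ∸ i) ℤ.≤ δ (suc i))
      × (sumTo (suc i) δ ℤ.≤ sumTo i (λ j → δ (d ∸ j)) ℤ.+ binomℤ (δ 1 ℤ.- δ d ℤ.+ + (suc i)) (suc i))
-- In dimension 0 no `i` satisfies `suc i ≤ d / 2`.
theorem2p20 (suc d′) P _ δ isδ T triangulation regular unimodular i le = DeltaVector.inequalities (suc d′) δ a h (proj₁ (ℤinℚ.clear q)) ehrhart reciprocity h0 i (ℕP.≤-trans (ℕP.m≤n+m (suc i) i) 2i+1≤d) (increasing i 2i+1≤d) (upper i (ℕP.≤-trans (ℕP.m≤n+m (suc i) i) 2i+1≤d))
  where
  open Indexed P T triangulation regular
  open Faces P T triangulation regular
  open Hulls using (lookup-toQ)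

  2i+2≤d : suc i ℕ.* 2 ℕ.≤ suc d′
  2i+2≤d = ℕP.≤-trans (ℕP.*-monoˡ-≤ 2 le) (ℕDM.m/n*n≤m (suc d′) 2)

  2i+1≤d : i ℕ.+ suc i ℕ.≤ suc d′
  2i+1≤d = ℕP.≤-trans (ℕP.n≤1+n (i ℕ.+ suc i)) (ℕP.≤-trans (ℕP.≤-reflexive (≡.trans (≡.cong (suc i ℕ.+_) (≡.sym (ℕP.+-identityʳ (suc i)))) (ℕP.*-comm 2 (suc i)))) 2i+2≤d)

  f : ℕ → ℤ
  f m = sumTo (suc d′) (λ i → δ i ℤ.* + ((m ℕ.+ suc d′ ∸ i) C suc d′))

  counts : ∀ m (xs : List (Pt (suc d′))) → Unique xs → (∀ x → x ∈ xs ⇔ Dilated (ℤinℚ.of (+ m)) (ℤ-Embedding.embed ℤ⊂ℚ x)) → + length xs ≡ f m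
  counts m xs u iff = isδ m xs u (λ x → mk⇔ (λ k → dilated⇒conv m (toQ x) (lookup-toQ x) (Equivalence.to (iff x) k)) (λ k → Equivalence.from (iff x) (conv⇒dilated m (toQ x) (lookup-toQ x) k)))

  numbers : Numbers (suc d′) (proj₁ (ℤinℚ.clear q)) f
  numbers = SphereNumbers.numbers ℚ-field ℤ⊂ℚ d′ (length (QV P)) (length points) Pˢ K pt (V.lookup q) triangulated place (λ _ _ _ → ≡.refl)
    (proj₁ (ℤinℚ.clear q)) (proj₁ (proj₂ (ℤinℚ.clear q))) (proj₂ (proj₂ (ℤinℚ.clear q)))
    (λ {σ} m → unimodular (map place σ) (proj₂ (placed m) , map place σ , proj₁ (placed m) , SL.⊆-refl))
    InQ N b N≢0 (λ {σ} {x} → Q-≤ {σ} {x}) (λ {σ} {μ} {y} → to-face {σ} {μ} {y}) (λ {σ} {t} {x} {y} → from-face {σ} {t} {x} {y}) f counts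

  open Numbers numbers
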